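{- Let $\mathfrak{R}=\mathbb{C}[a,b,c,d,e,f]^H$ be the invariant ring of the group $H\subset GL(6,\mathbb{C})$ given in the context. Then the six polynomials $$\mathscr{W}^2_{(\mathscr{E}_8,\mathscr{Q}_8)},\quad \mathscr{W}^2_{(\mathscr{E}_8,\mathscr{K}_8)},\quad \mathscr{W}_{(\mathscr{E}_8\oplus\mathscr{E}_8,\ \mathscr{Q}_8\oplus\mathscr{K}_8)},\quad \mathscr{W}_{(\mathscr{E}_8\oplus\mathscr{E}_8,\ \mathscr{K}_{16})},\quad \mathscr{W}_{(\mathscr{D}_{16},\ \mathscr{Q}_8\oplus\mathscr{Q}_8)},\quad \mathscr{W}_{(\mathscr{D}_{16},\ \mathscr{Q}_8\oplus\mathscr{K}_8)}$$ form a basis of the $\mathbb{C}$-vector space of homogeneous elements of degree 16 of $\mathfrak{R}$.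
   Context: **The group.** Let $i=\sqrt{ -1}$ and $z=e^{2\pi i/8}$. The group $H=\langle X,P_1,P_2,E_1,E_2,zI_6\rangle\subset GL(6,\mathbb{C})$ is generated by the following matrices (rows and columns indexed in order by the variables $a,b,c,d,e,f$): $$X=\frac{z^3+z}{4}\begin{pmatrix}1&2&1&1&2&1\\1&0&-1&1&0&-1\\1&-2&1&1&-2&1\\1&2&1&-1&-2&-1\\1&0&-1&-1&0&1\\1&-2&1&-1&2&-1\end{pmatrix},$$ $$P_1=\begin{pmatrix}1&0&0&0&0&0\\0&0&0&0&1&0\\0&0&1&0&0&0\\0&0&0&1&0&0\\0&1&0&0&0&0\\0&0&0&0&0&1\end{pmatrix},\qquad P_2=z^2\begin{pmatrix}1&0&0&0&0&0\\0&0&0&0&1&0\\0&0&1&0&0&0\\0&0&0&0&0&1\\0&1&0&0&0&0\\0&0&0&1&0&0\end{pmatrix},$$ $$E_1=\mathrm{diag}(1,z,-1,z^2,-z^3,-z^2),\qquad E_2=\mathrm{diag}(1,z,-1,1,z,-1),$$ and $zI_6$, where $I_6$ is the identity matrix. A matrix $A=(A_{ij})\in GL(6,\mathbb{C})$ acts on a polynomial $f(x_1,\dots,x_6)$, where $(x_1,\dots,x_6)=(a,b,c,d,e,f)$, by $A\cdot f(x_1,\dots,x_6)=f\left(\sum_j A_{1j}x_j,\dots,\sum_j A_{6j}x_j\right)$. The invariant ring $\mathbb{C}[a,b,c,d,e,f]^H$ consists of the polynomials fixed by every element of $H$, graded by total degree. **Symmetrized weight enumerators.** A linear code of length $n$ over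 $\mathbb{F}_2=\mathbb{Z}/2\mathbb{Z}$ (resp. $\mathbb{Z}_4=\mathbb{Z}/4\mathbb{Z}$) is an additive subgroup of $\mathbb{F}_2^n$ (resp. $\mathbb{Z}_4^n$); the rows of a generator matrix generate it as an additive group. Let $R=\mathbb{F}_2\times\mathbb{Z}_4$ and let $\bar R$ be the quotient of $R$ by the relation $r\sim s\Leftrightarrow r=s$ or $r=-s$. It has six classes, with representatives $(0,0),(0,1),(0,2),(1,0),(1,1),(1,2)$, to which the variables $a,b,c,d,e,f$ are attached in this order (so $(0,3)\sim(0,1)$ gets $b$ and $(1,3)\sim(1,1)$ gets $e$). Denote by $x_{\bar r}$ the variable attached to the class $\bar r$. For linear codes $\mathscr{C}_1\subset\mathbb{F}_2^n$ and $\mathscr{C}_2\subset\mathbb{Z}_4^n$, $$\mathscr{W}_{(\mathscr{C}_1,\mathscr{C}_2)}=\sum_{u\in\mathscr{C}_1,\,v\in\mathscr{C}_2}\ \prod_{\bar r\in\bar R}x_{\bar r}^{\,n_{\bar r}(u,v)},$$ where $n_{\bar r}(u,v)$ is the number of coordinates $j\in\{1,\dots,n\}$ with $\overline{(u_j,v_j)}=\bar r$. $\mathscr{W}^2_{(\mathscr{C}_1,\mathscr{C}_2)}$ denotes the square of the polynomial $\mathscr{W}_{(\mathscr{C}_1,\mathscr{C}_2)}$. **The codes.** For codes $\mathscr{C},\mathscr{C}'$ of length 8, $\mathscr{C}\oplus\mathscr{C}'$ is the code of length 16 consisting of all concatenations $(u,u')$ with $u\in\mathscr{C}$ (coordinates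 1–8) and $u'\in\mathscr{C}'$ (coordinates 9–16). $\mathscr{E}_8\subset\mathbb{F}_2^8$ and $\mathscr{Q}_8,\mathscr{K}_8\subset\mathbb{Z}_4^8$ are the linear codes with generator matrices $$\mathscr{E}_8:\begin{pmatrix}1&1&1&1&0&0&0&0\\0&0&1&1&1&1&0&0\\0&0&0&0&1&1&1&1\\1&0&1&0&1&0&1&0\end{pmatrix},\quad \mathscr{Q}_8:\begin{pmatrix}0&0&1&1&0&2&1&3\\0&0&0&2&1&3&1&1\\1&1&0&2&0&0&1&3\\0&2&0&2&0&2&0&2\\0&0&0&0&0&0&2&2\end{pmatrix},$$ $$\mathscr{K}_8:\begin{pmatrix}1&1&1&1&1&1&1&1\\0&2&0&0&0&0&0&2\\0&0&2&0&0&0&0&2\\0&0&0&2&0&0&0&2\\0&0&0&0&2&0&0&2\\0&0&0&0&0&2&0&2\\0&0&0&0&0&0&2&2\end{pmatrix}.$$ $\mathscr{D}_{16}\subset\mathbb{F}_2^{16}$ is the linear code generated by the eight rows $$1111000000000000,\ 0011110000000000,\ 0000111100000000,\ 0000001111000000,$$ $$0000000011110000,\ 0000000000111100,\ 0000000000001111,\ 1010101010101010.$$ $\mathscr{K}_{16}\subset\mathbb{Z}_4^{16}$ is the linear code generated by the all-ones vector $(1,1,\dots,1)$ and the vectors $2\epsilon_j+2\epsilon_{16}$ for $j=2,3,\dots,15$, where $\epsilon_j$ is the $j$-th standard unit vector. -}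

module Defs where

import Algebra.Definitions.RawSemiring
import Algebra.Definitions.RawMonoid
import Algebra.Properties.AbelianGroup
import Algebra.Properties.CommutativeSemigroup
import Algebra.Properties.Group
import Algebra.Properties.Monoid.Mult
import Algebra.Properties.Semiring.Exp
import Algebra.Properties.Semiring.Sum
open import Algebra.Bundles using (CommutativeRing; AbelianGroup; RawSemiring)
open import Data.Bool.Base using (if_then_else_)
open import Data.Fin.Base as Fin using (Fin; zero; suc; toℕ)
open import Data.Fin.Patterns using (0F; 1F; 2F)
import Data.Fin.Properties as Fin
open import Data.Integer.Base as ℤ using (ℤ; +_; -[1+_]; 0ℤ; 1ℤ; -1ℤ)
import Data.Integer.Properties as ℤ
open import Data.List.Base as List using (List; []; _∷_)
open import Data.List.Membership.Propositional using () renaming (_∈_ to _∈ˡ_)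
open import Data.List.Relation.Unary.Any using (here; there)
open import Data.Nat.Base as ℕ using (ℕ; zero; suc; NonZero)
import Data.Nat.Properties as ℕ
open import Data.Nat.DivMod using (_mod_; _%_; m%n<n; m<n⇒m%n≡m; m%n%n≡m%n; n%n≡0; m*n%n≡0; m≡m%n+[m/n]*n; %-distribˡ-+)
open import Data.Nat.Tactic.RingSolver as ℕ-Ring using ()
import Data.Product.Properties as Prod
open import Data.Product using (∃; ∃₂; _×_; _,_)
open import Data.Sum using (_⊎_; inj₁; inj₂)
open import Data.Rational.Base as ℚ using (ℚ; mkℚ; 0ℚ; 1ℚ; ½; ∣_∣; _/_)
import Data.Rational.Properties as ℚ
import Data.Rational.Unnormalised.Base as ℚᵘ
import Data.Rational.Unnormalised.Properties as ℚᵘ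
open import Data.Vec.Base as Vec using (Vec; []; _∷_; lookup; replicate; zipWith; _[_]≔_)
import Data.Vec.Properties as Vec
open import Data.Vec.Properties using (≡-dec)
open import Data.Vec.Functional using (Vector)
open import Level using (0ℓ; _⊔_)
open import Relation.Binary.PropositionalEquality as ≡
open import Relation.Nullary.Decidable using (Dec; yes; no; does; dec⇒maybe; map′; _×-dec_; _⊎-dec_)
open import Relation.Unary using (Pred; _∈_; Decidable)
open import Tactic.RingSolver using (solve-∀)
open import Tactic.RingSolver.Core.AlmostCommutativeRing using (AlmostCommutativeRing; fromCommutativeRing)

module Polynomials {a ℓ} (R : CommutativeRing a ℓ) (n : ℕ) where
  open CommutativeRing R

  -- A polynomial is a formal sum of terms coefficient · x^exponent.  Exponents
  -- may repeat and coefficients may vanish, hence the equality _≈ᴾ_.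
  Polynomial : Set a
  Polynomial = List (Carrier × Vec ℕ n)

  coefficient : Polynomial → Vec ℕ n → Carrier
  coefficient []            e = 0#
  coefficient ((c , d) ∷ p) e = (if does (≡-dec ℕ._≟_ d e) then c else 0#) + coefficient p e

  infix 4 _≈ᴾ_
  _≈ᴾ_ : Polynomial → Polynomial → Set ℓ
  p ≈ᴾ q = ∀ e → coefficient p e ≈ coefficient q e

  constant : Carrier → Polynomial
  constant c = (c , replicate n 0) ∷ []

  var : Fin n → Polynomial
  var i = (1# , replicate n 0 [ i ]≔ 1) ∷ []

  infixl 6 _+ᴾ_
  infixl 7 _*ᴾ_

  _+ᴾ_ _*ᴾ_ : Polynomial → Polynomial → Polynomial
  _+ᴾ_ = List._++_
  _*ᴾ_ = List.cartesianProductWith λ (c , d) (c′ , d′) → c * c′ , zipWith ℕ._+_ d d′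

  rawSemiring : RawSemiring a ℓ
  rawSemiring = record { _≈_ = _≈ᴾ_ ; _+_ = _+ᴾ_ ; _*_ = _*ᴾ_ ; 0# = [] ; 1# = constant 1# }

  private module P = Algebra.Definitions.RawSemiring rawSemiring

  substitute : Vector Polynomial n → Polynomial → Polynomial
  substitute q []            = []
  substitute q ((c , d) ∷ p) = constant c *ᴾ P.product (λ i → q i P.^ lookup d i) +ᴾ substitute q p

  Homogeneous : ℕ → Pred Polynomial ℓ
  Homogeneous k p = ∀ e → Vec.sum e ≢ k → coefficient p e ≈ 0#

  combination : ∀ {k} → Vector Carrier k → Vector Polynomial k → Polynomial
  combination c p = P.sum λ i → constant (c i) *ᴾ p i

  record IsBasis {k v} (V : Pred Polynomial v) (p : Vector Polynomial k) : Set (a ⊔ ℓ ⊔ v) where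
    field
      inside      : ∀ i → p i ∈ V
      independent : ∀ c → combination c p ≈ᴾ [] → ∀ i → c i ≈ 0#
      spanning    : ∀ q → q ∈ V → ∃ λ c → q ≈ᴾ combination c p

module Matrices {a ℓ} (R : CommutativeRing a ℓ) (n : ℕ) where
  open CommutativeRing R
  open Algebra.Properties.Semiring.Sum semiring using (sum)
  open Polynomials R n using (Polynomial; _≈ᴾ_; constant; var; substitute; combination)

  Matrix : Set a
  Matrix = Fin n → Fin n → Carrier

  infix 4 _≈ᴹ_
  _≈ᴹ_ : Matrix → Matrix → Set ℓ
  A ≈ᴹ B = ∀ i j → A i j ≈ B i j

  diagonal : Vector Carrier n → Matrix
  diagonal d i j = if does (i Fin.≟ j) then d i else 0#

  I : Matrix
  I = diagonal λ _ → 1#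

  infixl 7 _*ᴹ_ _·ᴹ_
  _*ᴹ_ : Matrix → Matrix → Matrix
  (A *ᴹ B) i j = sum λ k → A i k * B k j

  _·ᴹ_ : Carrier → Matrix → Matrix
  (c ·ᴹ A) i j = c * A i j

  -- The subgroup of GL(n, R) generated by the (invertible) matrices in S.
  data ⟨_⟩ᴹ {s} (S : Pred Matrix s) : Pred Matrix (a ⊔ ℓ ⊔ s) where
    generator : ∀ {A} → A ∈ S → A ∈ ⟨ S ⟩ᴹ
    identity  : I ∈ ⟨ S ⟩ᴹ
    product   : ∀ {A B} → A ∈ ⟨ S ⟩ᴹ → B ∈ ⟨ S ⟩ᴹ → A *ᴹ B ∈ ⟨ S ⟩ᴹ
    inverse   : ∀ {A B} → A ∈ ⟨ S ⟩ᴹ → A *ᴹ B ≈ᴹ I → B *ᴹ A ≈ᴹ I → B ∈ ⟨ S ⟩ᴹ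
    respects  : ∀ {A B} → A ≈ᴹ B → A ∈ ⟨ S ⟩ᴹ → B ∈ ⟨ S ⟩ᴹ

  infixr 7 _•_
  _•_ : Matrix → Polynomial → Polynomial
  A • p = substitute (λ i → combination (A i) var) p

  InvariantRing : ∀ {g} → Pred Matrix g → Pred Polynomial (a ⊔ ℓ ⊔ g)
  InvariantRing G p = ∀ A → A ∈ G → A • p ≈ᴾ p

module _ (m : ℕ) .{{_ : NonZero m}} where

  ℤmod-abelianGroup : AbelianGroup 0ℓ 0ℓ
  ℤmod-abelianGroup = record
    { Carrier = Fin m
    ; _≈_ = _≡_
    ; _∙_ = _⊕_
    ; ε = 0 mod m
    ; _⁻¹ = neg
    ; isAbelianGroup = record
      { isGroup = record
        { isMonoid = record
          { isSemigroup = record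
            { isMagma = ≡.isMagma _⊕_
            ; assoc = assoc
            }
          ; identity = identityˡ , λ x → trans (comm x (0 mod m)) (identityˡ x)
          }
        ; inverse = inverseˡ , λ x → trans (comm x (neg x)) (inverseˡ x)
        ; ⁻¹-cong = cong neg
        }
      ; comm = comm
      }
    }
    where
    _⊕_ : Fin m → Fin m → Fin m
    x ⊕ y = (toℕ x ℕ.+ toℕ y) mod m

    neg : Fin m → Fin m
    neg x = (m ℕ.∸ toℕ x) mod m

    toℕ-mod : ∀ k → toℕ (k mod m) ≡ k % m
    toℕ-mod k = Fin.toℕ-fromℕ< (m%n<n k m)

    mod-cong : ∀ {k l} → k % m ≡ l % m → k mod m ≡ l mod m
    mod-cong {k} {l} e = Fin.toℕ-injective (trans (toℕ-mod k) (trans e (sym (toℕ-mod l))))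

    mod-toℕ : ∀ x → toℕ x mod m ≡ x
    mod-toℕ x = Fin.toℕ-injective (trans (toℕ-mod (toℕ x)) (m<n⇒m%n≡m (Fin.toℕ<n x)))

    %-+ˡ : ∀ k l → (k % m ℕ.+ l) % m ≡ (k ℕ.+ l) % m
    %-+ˡ k l = trans (%-distribˡ-+ (k % m) l m)
      (trans (cong (λ t → (t ℕ.+ l % m) % m) (m%n%n≡m%n k m)) (sym (%-distribˡ-+ k l m)))

    ⊕-modˡ : ∀ k y → (k mod m) ⊕ y ≡ (k ℕ.+ toℕ y) mod m
    ⊕-modˡ k y = mod-cong (trans (cong (λ t → (t ℕ.+ toℕ y) % m) (toℕ-mod k)) (%-+ˡ k (toℕ y)))

    comm : ∀ x y → x ⊕ y ≡ y ⊕ x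
    comm x y = cong (_mod m) (ℕ.+-comm (toℕ x) (toℕ y))

    assoc : ∀ x y u → (x ⊕ y) ⊕ u ≡ x ⊕ (y ⊕ u)
    assoc x y u = begin
      (x ⊕ y) ⊕ u                          ≡⟨ ⊕-modˡ (toℕ x ℕ.+ toℕ y) u ⟩
      (toℕ x ℕ.+ toℕ y ℕ.+ toℕ u) mod m    ≡⟨ cong (_mod m) (trans (ℕ.+-assoc (toℕ x) _ _) (ℕ.+-comm (toℕ x) _)) ⟩
      (toℕ y ℕ.+ toℕ u ℕ.+ toℕ x) mod m    ≡⟨ ⊕-modˡ (toℕ y ℕ.+ toℕ u) x ⟨
      (y ⊕ u) ⊕ x                          ≡⟨ comm (y ⊕ u) x ⟩
      x ⊕ (y ⊕ u)                          ∎
      where open ≡-Reasoning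

    identityˡ : ∀ x → (0 mod m) ⊕ x ≡ x
    identityˡ x = trans (⊕-modˡ 0 x) (mod-toℕ x)

    inverseˡ : ∀ x → neg x ⊕ x ≡ 0 mod m
    inverseˡ x = trans (⊕-modˡ (m ℕ.∸ toℕ x) x)
      (mod-cong (trans (cong (_% m) (ℕ.m∸n+n≡m (ℕ.<⇒≤ (Fin.toℕ<n x)))) (trans (n%n≡0 m) (sym (m<n⇒m%n≡m (ℕ.>-nonZero⁻¹ m))))))

  Word : ℕ → Set
  Word n = Vec (Fin m) n

  Word-abelianGroup : ℕ → AbelianGroup 0ℓ 0ℓ
  Word-abelianGroup n = record
    { Carrier = Word n
    ; _≈_ = _≡_
    ; _∙_ = zipWith _∙_
    ; ε = replicate n ε
    ; _⁻¹ = Vec.map _⁻¹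
    ; isAbelianGroup = record
      { isGroup = record
        { isMonoid = record
          { isSemigroup = record
            { isMagma = ≡.isMagma (zipWith _∙_)
            ; assoc = Vec.zipWith-assoc assoc
            }
          ; identity = Vec.zipWith-identityˡ identityˡ , Vec.zipWith-identityʳ identityʳ
          }
        ; inverse = Vec.zipWith-inverseˡ inverseˡ , Vec.zipWith-inverseʳ inverseʳ
        ; ⁻¹-cong = cong (Vec.map _⁻¹)
        }
      ; comm = Vec.zipWith-comm comm
      }
    }
    where open AbelianGroup ℤmod-abelianGroup

  -- A subgroup of the finite group of words.  Membership is decidable for every
  -- code given by generators, and is needed to sum over the elements of a code.
  record LinearCode (n : ℕ) : Set₁ where
    open AbelianGroup (Word-abelianGroup n)
    field
      Member    : Pred (Word n) 0ℓ
      ε-closed  : ε ∈ Member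
      ∙-closed  : ∀ {u v} → u ∈ Member → v ∈ Member → u ∙ v ∈ Member
      ⁻¹-closed : ∀ {u} → u ∈ Member → u ⁻¹ ∈ Member
      member?   : Decidable Member

module _ {m : ℕ} .{{_ : NonZero m}} where

  words : ∀ n → List (Word m n)
  words zero    = [] ∷ []
  words (suc n) = List.cartesianProductWith _∷_ (List.allFin m) (words n)

  codewords : ∀ {n} → LinearCode m n → List (Word m n)
  codewords {n} C = List.filter (LinearCode.member? C) (words n)

  private
    module _ where
      open AbelianGroup (ℤmod-abelianGroup m)
      open Algebra.Definitions.RawMonoid rawMonoid using () renaming (_×_ to _×ᶻ_)

      toℕ-× : ∀ k x → toℕ (k ×ᶻ x) ≡ (k ℕ.* toℕ x) % m
      toℕ-× zero    x = Fin.toℕ-fromℕ< (m%n<n 0 m)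
      toℕ-× (suc k) x = ≡.trans (Fin.toℕ-fromℕ< (m%n<n (toℕ x ℕ.+ toℕ (k ×ᶻ x)) m))
        (≡.trans (cong (λ t → (toℕ x ℕ.+ t) % m) (toℕ-× k x)) (lemma (toℕ x) (k ℕ.* toℕ x)))
        where
        lemma : ∀ a b → (a ℕ.+ b % m) % m ≡ (a ℕ.+ b) % m
        lemma a b = ≡.trans (%-distribˡ-+ a (b % m) m)
          (≡.trans (cong (λ t → (a % m ℕ.+ t) % m) (m%n%n≡m%n b m)) (≡.sym (%-distribˡ-+ a b m)))

      m×x≡0 : ∀ x → m ×ᶻ x ≡ ε
      m×x≡0 x = Fin.toℕ-injective (≡.trans (toℕ-× m x)
        (≡.trans (cong (_% m) (ℕ.*-comm m (toℕ x))) (≡.trans (m*n%n≡0 (toℕ x) m)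
          (≡.sym (≡.trans (Fin.toℕ-fromℕ< (m%n<n 0 m)) (m<n⇒m%n≡m (ℕ.>-nonZero⁻¹ m)))))))

  module _ {n : ℕ} where
    open AbelianGroup (Word-abelianGroup m n)
    open Algebra.Definitions.RawMonoid rawMonoid using () renaming (_×_ to _×ʷ_)
    private
      module Group = Algebra.Properties.Group group
      module Abelian = Algebra.Properties.AbelianGroup (Word-abelianGroup m n)
      module Mult = Algebra.Properties.Monoid.Mult monoid
      module Semigroup = Algebra.Properties.CommutativeSemigroup commutativeSemigroup

    -- The additive subgroup generated by the rows.
    data Span (rows : List (Word m n)) : Pred (Word m n) 0ℓ where
      row   : ∀ {u} → u ∈ˡ rows → u ∈ Span rows
      null  : ε ∈ Span rows
      plus  : ∀ {u v} → u ∈ Span rows → v ∈ Span rows → u ∙ v ∈ Span rows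
      minus : ∀ {u} → u ∈ Span rows → u ⁻¹ ∈ Span rows

    private
      multiple : ∀ {rows u} k → u ∈ Span rows → k ×ʷ u ∈ Span rows
      multiple zero    p = null
      multiple (suc k) p = plus p (multiple k p)

      weaken : ∀ {rows u w} → u ∈ Span rows → u ∈ Span (w ∷ rows)
      weaken (row i)    = row (there i)
      weaken null       = null
      weaken (plus p q) = plus (weaken p) (weaken q)
      weaken (minus p)  = minus (weaken p)

      m×u≡ε : ∀ u → m ×ʷ u ≡ ε
      m×u≡ε u = pointwise m u (m×-all u)
        where
        open Algebra.Definitions.RawMonoid (AbelianGroup.rawMonoid (ℤmod-abelianGroup m)) using () renaming (_×_ to _×ᶻ_)
        m×-all : ∀ {l} (v : Word m l) → Vec.map (m ×ᶻ_) v ≡ replicate l (0 mod m)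
        m×-all []      = ≡.refl
        m×-all (x ∷ v) = cong₂ _∷_ (m×x≡0 x) (m×-all v)
        map-× : ∀ k (v : Word m n) → k ×ʷ v ≡ Vec.map (k ×ᶻ_) v
        map-× zero    v = ≡.sym (Vec.map-const v (0 mod m))
        map-× (suc k) v = ≡.trans (cong (v ∙_) (map-× k v)) (zip-map v)
          where
          zip-map : ∀ {l} (v : Word m l) → zipWith (AbelianGroup._∙_ (ℤmod-abelianGroup m)) v (Vec.map (k ×ᶻ_) v) ≡ Vec.map (suc k ×ᶻ_) v
          zip-map []      = ≡.refl
          zip-map (x ∷ v) = cong (_ ∷_) (zip-map v)
        pointwise : ∀ k v → Vec.map (k ×ᶻ_) v ≡ ε → k ×ʷ v ≡ ε
        pointwise k v e = ≡.trans (map-× k v) e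

      reduce : ∀ k u → k ×ʷ u ≡ (k % m) ×ʷ u
      reduce k u = begin
        k ×ʷ u                                        ≡⟨ cong (_×ʷ u) (m≡m%n+[m/n]*n k m) ⟩
        (k % m ℕ.+ (k ℕ./ m) ℕ.* m) ×ʷ u              ≡⟨ Mult.×-homo-+ u (k % m) ((k ℕ./ m) ℕ.* m) ⟩
        ((k % m) ×ʷ u) ∙ (((k ℕ./ m) ℕ.* m) ×ʷ u)     ≡⟨ cong ((k % m) ×ʷ u ∙_) (Mult.×-assocˡ u (k ℕ./ m) m) ⟨
        ((k % m) ×ʷ u) ∙ ((k ℕ./ m) ×ʷ (m ×ʷ u))      ≡⟨ cong (λ t → (k % m) ×ʷ u ∙ (k ℕ./ m) ×ʷ t) (m×u≡ε u) ⟩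
        ((k % m) ×ʷ u) ∙ ((k ℕ./ m) ×ʷ ε)             ≡⟨ cong ((k % m) ×ʷ u ∙_) (×-ε (k ℕ./ m)) ⟩
        ((k % m) ×ʷ u) ∙ ε                            ≡⟨ identityʳ _ ⟩
        (k % m) ×ʷ u                                  ∎
        where
        open ≡-Reasoning
        ×-ε : ∀ k → k ×ʷ ε ≡ ε
        ×-ε zero    = ≡.refl
        ×-ε (suc k) = ≡.trans (identityˡ (k ×ʷ ε)) (×-ε k)

      negative : ∀ u → u ⁻¹ ≡ ℕ.pred m ×ʷ u
      negative u = ≡.sym (Group.inverseʳ-unique u (ℕ.pred m ×ʷ u) (≡.trans (cong (_×ʷ u) (ℕ.suc-pred m)) (m×u≡ε u)))

      decompose : ∀ {g rows u} → u ∈ Span (g ∷ rows) → ∃₂ λ k w → w ∈ Span rows × u ≡ (k ×ʷ g) ∙ w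
      decompose {g} (row (here ≡.refl)) = 1 , ε , null , ≡.sym (≡.trans (identityʳ _) (Mult.×-homo-1 g))
      decompose (row {u} (there i))     = 0 , u , row i , ≡.sym (identityˡ u)
      decompose null                    = 0 , ε , null , ≡.sym (identityˡ ε)
      decompose {g} (plus p q) with decompose p | decompose q
      ... | k , w , w∈ , ≡.refl | l , v , v∈ , ≡.refl = k ℕ.+ l , w ∙ v , plus w∈ v∈ ,
        ≡.trans (Semigroup.interchange (k ×ʷ g) w (l ×ʷ g) v) (cong (_∙ (w ∙ v)) (≡.sym (Mult.×-homo-+ g k l)))
      decompose {g} (minus p) with decompose p
      ... | k , w , w∈ , ≡.refl = ℕ.pred m ℕ.* k , w ⁻¹ , minus w∈ ,
        ≡.trans (≡.sym (Abelian.⁻¹-∙-comm (k ×ʷ g) w))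
          (cong (_∙ w ⁻¹) (≡.trans (negative (k ×ʷ g)) (Mult.×-assocˡ g (ℕ.pred m) k)))

      span? : ∀ rows → Decidable (Span rows)
      span? []         u = map′ (λ { ≡.refl → null }) trivial (≡-dec Fin._≟_ u ε)
        where
        trivial : ∀ {v} → v ∈ Span [] → v ≡ ε
        trivial null       = ≡.refl
        trivial (plus p q) = ≡.trans (cong₂ _∙_ (trivial p) (trivial q)) (identityˡ ε)
        trivial (minus p)  = ≡.trans (cong _⁻¹ (trivial p)) Group.ε⁻¹≈ε
      span? (g ∷ rows) u = map′ to from (Fin.any? λ k → span? rows ((toℕ k ×ʷ g) ⁻¹ ∙ u))
        where
        to : (∃ λ (k : Fin m) → (toℕ k ×ʷ g) ⁻¹ ∙ u ∈ Span rows) → u ∈ Span (g ∷ rows)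
        to (k , p) = subst (_∈ Span (g ∷ rows)) (Group.\\-leftDividesˡ (toℕ k ×ʷ g) u)
          (plus (multiple (toℕ k) (row (here ≡.refl))) (weaken p))
        from : u ∈ Span (g ∷ rows) → ∃ λ (k : Fin m) → (toℕ k ×ʷ g) ⁻¹ ∙ u ∈ Span rows
        from p with decompose p
        ... | k , w , w∈ , ≡.refl = k mod m , subst (_∈ Span rows) (≡.sym (≡.trans
          (cong (λ t → t ⁻¹ ∙ (k ×ʷ g ∙ w)) (≡.trans (cong (_×ʷ g) (Fin.toℕ-fromℕ< (m%n<n k m))) (≡.sym (reduce k g))))
          (Group.\\-leftDividesʳ (k ×ʷ g) w))) w∈

    generatedBy : List (Vec ℕ n) → LinearCode m n
    generatedBy rows = record
      { Member    = Span (List.map (Vec.map (_mod m)) rows)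
      ; ε-closed  = null
      ; ∙-closed  = plus
      ; ⁻¹-closed = minus
      ; member?   = span? (List.map (Vec.map (_mod m)) rows)
      }

  module _ {k l : ℕ} (C : LinearCode m k) (D : LinearCode m l) where
    private
      module C = LinearCode C
      module D = LinearCode D

      Concatenation : Pred (Word m (k ℕ.+ l)) 0ℓ
      Concatenation w = ∃₂ λ u v → u ∈ C.Member × v ∈ D.Member × w ≡ u Vec.++ v

    infixr 5 _⊕_
    _⊕_ : LinearCode m (k ℕ.+ l)
    _⊕_ = record
      { Member    = Concatenation
      ; ε-closed  = _ , _ , C.ε-closed , D.ε-closed , replicate-++ k
      ; ∙-closed  = λ { (u , v , u∈ , v∈ , refl) (u′ , v′ , u′∈ , v′∈ , refl) →
                      _ , _ , C.∙-closed u∈ u′∈ , D.∙-closed v∈ v′∈ , Vec.zipWith-++ _ u v u′ v′ }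
      ; ⁻¹-closed = λ { (u , v , u∈ , v∈ , refl) →
                      _ , _ , C.⁻¹-closed u∈ , D.⁻¹-closed v∈ , Vec.map-++ _ u v }
      ; member?   = decide
      }
      where
      replicate-++ : ∀ k {x : Fin m} → replicate (k ℕ.+ l) x ≡ replicate k x Vec.++ replicate l x
      replicate-++ zero    = refl
      replicate-++ (suc k) = cong (_ ∷_) (replicate-++ k)

      decide : Decidable Concatenation
      decide w with Vec.splitAt k w
      ... | u , v , refl = map′
        (λ (u∈ , v∈) → u , v , u∈ , v∈ , refl)
        (λ { (u′ , v′ , u′∈ , v′∈ , e) →
             subst (_∈ C.Member) (sym (Vec.++-injectiveˡ u u′ e)) u′∈
           , subst (_∈ D.Member) (sym (Vec.++-injectiveʳ u u′ e)) v′∈ })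
        (C.member? u ×-dec D.member? v)

private
  ℚ-ring : AlmostCommutativeRing 0ℓ 0ℓ
  ℚ-ring = fromCommutativeRing ℚ.+-*-commutativeRing (λ q → dec⇒maybe (0ℚ ℚ.≟ q))

  flip-minus : ∀ a b → ℚ.- (a ℚ.- b) ≡ b ℚ.- a
  flip-minus = solve-∀ ℚ-ring

  telescope : ∀ a b c → a ℚ.- c ≡ (a ℚ.- b) ℚ.+ (b ℚ.- c)
  telescope = solve-∀ ℚ-ring

  plus-minus : ∀ a b → a ≡ (a ℚ.- b) ℚ.+ b
  plus-minus = solve-∀ ℚ-ring

  minus-plus : ∀ x y u v → (x ℚ.+ u) ℚ.- (y ℚ.+ v) ≡ (x ℚ.- y) ℚ.+ (u ℚ.- v)
  minus-plus = solve-∀ ℚ-ring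

  minus-neg : ∀ a b → ℚ.- (a ℚ.- b) ≡ (ℚ.- a) ℚ.- (ℚ.- b)
  minus-neg = solve-∀ ℚ-ring

  minus-times : ∀ x y u v → x ℚ.* u ℚ.- y ℚ.* v ≡ x ℚ.* (u ℚ.- v) ℚ.+ v ℚ.* (x ℚ.- y)
  minus-times = solve-∀ ℚ-ring

private
  ι : ℕ → ℚ
  ι n = + n / 1

  module _ where
    open ℚᵘ.≤-Reasoning

    toℚᵘ-/ : ∀ i d .{{_ : NonZero d}} → ℚ.toℚᵘ (i / d) ℚᵘ.≃ i ℚᵘ./ d
    toℚᵘ-/ i (suc d) = ℚ.toℚᵘ-fromℚᵘ (ℚᵘ.mkℚᵘ i d)

    ι-+ : ∀ a b → ι (a ℕ.+ b) ≡ ι a ℚ.+ ι b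
    ι-+ a b = ℚ.toℚᵘ-injective (begin-equality
      ℚ.toℚᵘ (ι (a ℕ.+ b))                ≃⟨ toℚᵘ-/ (+ (a ℕ.+ b)) 1 ⟩
      (+ (a ℕ.+ b)) ℚᵘ./ 1                ≃⟨ ℚᵘ.*≡* (cong (ℤ._* 1ℤ) (sym (cong₂ ℤ._+_ (ℤ.*-identityʳ (+ a)) (ℤ.*-identityʳ (+ b))))) ⟩
      ((+ a) ℚᵘ./ 1) ℚᵘ.+ ((+ b) ℚᵘ./ 1)      ≃⟨ ℚᵘ.+-cong (toℚᵘ-/ (+ a) 1) (toℚᵘ-/ (+ b) 1) ⟨
      ℚ.toℚᵘ (ι a) ℚᵘ.+ ℚ.toℚᵘ (ι b)      ≃⟨ ℚ.toℚᵘ-homo-+ (ι a) (ι b) ⟨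
      ℚ.toℚᵘ (ι a ℚ.+ ι b)                ∎)

    ι-* : ∀ a b → ι (a ℕ.* b) ≡ ι a ℚ.* ι b
    ι-* a b = ℚ.toℚᵘ-injective (begin-equality
      ℚ.toℚᵘ (ι (a ℕ.* b))                ≃⟨ toℚᵘ-/ (+ (a ℕ.* b)) 1 ⟩
      (+ (a ℕ.* b)) ℚᵘ./ 1                ≃⟨ ℚᵘ.*≡* (cong (ℤ._* 1ℤ) (ℤ.pos-* a b)) ⟩
      ((+ a) ℚᵘ./ 1) ℚᵘ.* ((+ b) ℚᵘ./ 1)      ≃⟨ ℚᵘ.*-cong (toℚᵘ-/ (+ a) 1) (toℚᵘ-/ (+ b) 1) ⟨
      ℚ.toℚᵘ (ι a) ℚᵘ.* ℚ.toℚᵘ (ι b)      ≃⟨ ℚ.toℚᵘ-homo-* (ι a) (ι b) ⟨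
      ℚ.toℚᵘ (ι a ℚ.* ι b)                ∎)

    ratio : ∀ p q .{{_ : NonZero q}} → (+ p / q) ℚ.* ι q ≡ ι p
    ratio p q@(suc _) = ℚ.toℚᵘ-injective (begin-equality
      ℚ.toℚᵘ ((+ p / q) ℚ.* ι q)           ≃⟨ ℚ.toℚᵘ-homo-* (+ p / q) (ι q) ⟩
      ℚ.toℚᵘ (+ p / q) ℚᵘ.* ℚ.toℚᵘ (ι q)   ≃⟨ ℚᵘ.*-cong (toℚᵘ-/ (+ p) q) (toℚᵘ-/ (+ q) 1) ⟩
      ((+ p) ℚᵘ./ q) ℚᵘ.* ((+ q) ℚᵘ./ 1)       ≃⟨ ℚᵘ.*≡* (ℤ.*-assoc (+ p) (+ q) 1ℤ) ⟩
      (+ p) ℚᵘ./ 1                         ≃⟨ toℚᵘ-/ (+ p) 1 ⟨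
      ℚ.toℚᵘ (ι p)                         ∎)

    archimedean : ∀ ε → 0ℚ ℚ.< ε → ∃ λ N → 1ℚ ℚ.< ι N ℚ.* ε
    archimedean ε@(mkℚ (+ suc a) d _) ε>0 = suc (suc d) , ℚ.toℚᵘ-cancel-< (begin-strict
      ℚᵘ.1ℚᵘ                               <⟨ ℚᵘ.*<* (ℤ.+<+ 1<) ⟩
      ((+ suc (suc d)) ℚᵘ./ 1) ℚᵘ.* ℚᵘ.mkℚᵘ (+ suc a) d ≃⟨ ℚᵘ.*-congʳ {ℚᵘ.mkℚᵘ (+ suc a) d} (toℚᵘ-/ (+ suc (suc d)) 1) ⟨
      ℚ.toℚᵘ (ι (suc (suc d))) ℚᵘ.* ℚ.toℚᵘ ε ≃⟨ ℚ.toℚᵘ-homo-* (ι (suc (suc d))) ε ⟨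
      ℚ.toℚᵘ (ι (suc (suc d)) ℚ.* ε)       ∎)
      where
      1< : 1 ℕ.* (1 ℕ.* suc d) ℕ.< suc (suc d) ℕ.* suc a ℕ.* 1
      1< = subst₂ ℕ._<_ (sym (trans (ℕ.*-identityˡ _) (ℕ.*-identityˡ _))) (sym (ℕ.*-identityʳ _))
             (ℕ.<-≤-trans (ℕ.n<1+n (suc d)) (ℕ.m≤m*n (suc (suc d)) (suc a)))
    archimedean (mkℚ (+ zero) d _) (ℚ.*<* (ℤ.+<+ ()))
    archimedean (mkℚ -[1+ a ] d _) (ℚ.*<* ())

  0≤ι : ∀ n → 0ℚ ℚ.≤ ι n
  0≤ι zero    = ℚ.≤-refl
  0≤ι (suc n) = subst (0ℚ ℚ.≤_) (sym (ι-+ 1 n)) (ℚ.+-mono-≤ (ℚ.nonNegative⁻¹ 1ℚ) (0≤ι n))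

  ι-mono : ∀ {m n} → m ℕ.≤ n → ι m ℚ.≤ ι n
  ι-mono {m} {n} m≤n = subst₂ ℚ._≤_ (ℚ.+-identityʳ (ι m)) (trans (sym (ι-+ m (n ℕ.∸ m))) (cong ι (ℕ.m+[n∸m]≡n m≤n)))
    (ℚ.+-monoʳ-≤ (ι m) (0≤ι (n ℕ.∸ m)))

Seq : Set
Seq = ℕ → ℚ

-- x_m - y_n → 0 as m, n → ∞.  In particular x ∼ x says that x is a Cauchy
-- sequence, and for Cauchy sequences x ∼ y says that x_n - y_n → 0.
infix 4 _∼_
_∼_ : Seq → Seq → Set
x ∼ y = ∀ ε → 0ℚ ℚ.< ε → ∃ λ N → ∀ m n → N ℕ.≤ m → N ℕ.≤ n → ∣ x m ℚ.- y n ∣ ℚ.< ε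

private
  open ℚ.≤-Reasoning

  half : ∀ {ε} → 0ℚ ℚ.< ε → 0ℚ ℚ.< ½ ℚ.* ε
  half {ε} ε>0 = ℚ.*-monoʳ-<-pos ½ ε>0

  halves : ∀ ε → ½ ℚ.* ε ℚ.+ ½ ℚ.* ε ≡ ε
  halves ε = trans (sym (ℚ.*-distribʳ-+ ε ½ ½)) (ℚ.*-identityˡ ε)

  ∣sum∣< : ∀ {a b c ε} → a ≡ b ℚ.+ c → ∣ b ∣ ℚ.< ½ ℚ.* ε → ∣ c ∣ ℚ.< ½ ℚ.* ε → ∣ a ∣ ℚ.< ε
  ∣sum∣< {a} {b} {c} {ε} a≡b+c b< c< = begin-strict
    ∣ a ∣                  ≡⟨ cong ∣_∣ a≡b+c ⟩
    ∣ b ℚ.+ c ∣            ≤⟨ ℚ.∣p+q∣≤∣p∣+∣q∣ b c ⟩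
    ∣ b ∣ ℚ.+ ∣ c ∣        <⟨ ℚ.+-mono-< b< c< ⟩
    ½ ℚ.* ε ℚ.+ ½ ℚ.* ε    ≡⟨ halves ε ⟩
    ε                      ∎

  ∼-sym : ∀ {x y} → x ∼ y → y ∼ x
  ∼-sym {x} {y} p ε ε>0 with p ε ε>0
  ... | N , f = N , λ m n N≤m N≤n → subst (ℚ._< ε) (flip-∣-∣ (x n) (y m)) (f n m N≤n N≤m)
    where
    flip-∣-∣ : ∀ a b → ∣ a ℚ.- b ∣ ≡ ∣ b ℚ.- a ∣
    flip-∣-∣ a b = trans (sym (ℚ.∣-p∣≡∣p∣ (a ℚ.- b)))
      (cong ∣_∣ (flip-minus a b))

  ∼-trans : ∀ {x y z} → x ∼ y → y ∼ z → x ∼ z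
  ∼-trans {x} {y} {z} p q ε ε>0 with p (½ ℚ.* ε) (half ε>0) | q (½ ℚ.* ε) (half ε>0)
  ... | M , f | N , g = M ℕ.⊔ N , λ m n l k →
    ∣sum∣< (telescope (x m) (y (M ℕ.⊔ N)) (z n))
      (f m (M ℕ.⊔ N) (ℕ.m⊔n≤o⇒m≤o M N l) (ℕ.m≤m⊔n M N))
      (g (M ℕ.⊔ N) n (ℕ.m≤n⊔m M N) (ℕ.m⊔n≤o⇒n≤o M N k))

  ∼-respʳ-≗ : ∀ {x y z} → x ∼ y → y ≗ z → x ∼ z
  ∼-respʳ-≗ {x} p e ε ε>0 with p ε ε>0
  ... | N , f = N , λ m n l k → subst (λ t → ∣ x m ℚ.- t ∣ ℚ.< ε) (e n) (f m n l k)

  abstract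
    const-∼ : ∀ q → (λ _ → q) ∼ (λ _ → q)
    const-∼ q ε ε>0 = 0 , λ _ _ _ _ → subst (λ t → ∣ t ∣ ℚ.< ε) (sym (ℚ.+-inverseʳ q)) ε>0

  abstract
    +-∼ : ∀ {x y u v} → x ∼ y → u ∼ v → (λ n → x n ℚ.+ u n) ∼ (λ n → y n ℚ.+ v n)
    +-∼ {x} {y} {u} {v} p q ε ε>0 with p (½ ℚ.* ε) (half ε>0) | q (½ ℚ.* ε) (half ε>0)
    ... | M , f | N , g = M ℕ.⊔ N , λ m n l k →
      ∣sum∣< (minus-plus (x m) (y n) (u m) (v n))
        (f m n (ℕ.m⊔n≤o⇒m≤o M N l) (ℕ.m⊔n≤o⇒m≤o M N k))
        (g m n (ℕ.m⊔n≤o⇒n≤o M N l) (ℕ.m⊔n≤o⇒n≤o M N k))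

  abstract
    neg-∼ : ∀ {x y} → x ∼ y → (λ n → ℚ.- x n) ∼ (λ n → ℚ.- y n)
    neg-∼ {x} {y} p ε ε>0 with p ε ε>0
    ... | N , f = N , λ m n l k → subst (ℚ._< ε) (lemma (x m) (y n)) (f m n l k)
      where
      lemma : ∀ a b → ∣ a ℚ.- b ∣ ≡ ∣ ℚ.- a ℚ.- ℚ.- b ∣
      lemma a b = trans (sym (ℚ.∣-p∣≡∣p∣ (a ℚ.- b)))
        (cong ∣_∣ (minus-neg a b))

  bounded : ∀ {x y} → x ∼ y → ∃ λ B → 0ℚ ℚ.< B × ∃ λ N → ∀ n → N ℕ.≤ n → ∣ x n ∣ ℚ.≤ B
  bounded {x} {y} p with p 1ℚ (ℚ.positive⁻¹ 1ℚ)
  ... | N , f = 1ℚ ℚ.+ ∣ y N ∣ , B>0 , N , λ n k → begin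
      ∣ x n ∣                               ≡⟨ cong ∣_∣ (plus-minus (x n) (y N)) ⟩
      ∣ (x n ℚ.- y N) ℚ.+ y N ∣             ≤⟨ ℚ.∣p+q∣≤∣p∣+∣q∣ (x n ℚ.- y N) (y N) ⟩
      ∣ x n ℚ.- y N ∣ ℚ.+ ∣ y N ∣           ≤⟨ ℚ.+-monoˡ-≤ ∣ y N ∣ (ℚ.<⇒≤ (f n N k ℕ.≤-refl)) ⟩
      1ℚ ℚ.+ ∣ y N ∣                        ∎
    where
    B>0 : 0ℚ ℚ.< 1ℚ ℚ.+ ∣ y N ∣
    B>0 = begin-strict
      0ℚ              <⟨ ℚ.positive⁻¹ 1ℚ ⟩
      1ℚ              ≡⟨ ℚ.+-identityʳ 1ℚ ⟨
      1ℚ ℚ.+ 0ℚ       ≤⟨ ℚ.+-monoʳ-≤ 1ℚ (ℚ.0≤∣p∣ (y N)) ⟩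
      1ℚ ℚ.+ ∣ y N ∣  ∎

  shrink : ∀ B ε → 0ℚ ℚ.< B → 0ℚ ℚ.< ε → ∃ λ δ → 0ℚ ℚ.< δ × B ℚ.* δ ≡ ε
  shrink B ε B>0 ε>0 = 1/B ℚ.* ε , δ>0 , Bδ≡ε
    where
    instance
      posB : ℚ.Positive B
      posB = ℚ.positive B>0
      nzB : ℚ.NonZero B
      nzB = ℚ.pos⇒nonZero B
    1/B : ℚ
    1/B = ℚ.1/ B
    instance
      pos1/B : ℚ.Positive 1/B
      pos1/B = ℚ.1/pos⇒pos B
    δ>0 : 0ℚ ℚ.< 1/B ℚ.* ε
    δ>0 = begin-strict
      0ℚ            ≡⟨ ℚ.*-zeroʳ 1/B ⟨
      1/B ℚ.* 0ℚ    <⟨ ℚ.*-monoʳ-<-pos 1/B ε>0 ⟩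
      1/B ℚ.* ε     ∎
    Bδ≡ε : B ℚ.* (1/B ℚ.* ε) ≡ ε
    Bδ≡ε = trans (sym (ℚ.*-assoc B 1/B ε)) (trans (cong (ℚ._* ε) (ℚ.*-inverseʳ B)) (ℚ.*-identityˡ ε))

  ∣a*b∣< : ∀ {a b B δ ε} → 0ℚ ℚ.< B → B ℚ.* δ ≡ ε → ∣ a ∣ ℚ.≤ B → ∣ b ∣ ℚ.< δ → ∣ a ℚ.* b ∣ ℚ.< ε
  ∣a*b∣< {a} {b} {B} {δ} {ε} B>0 e a≤ b< = begin-strict
    ∣ a ℚ.* b ∣      ≡⟨ ℚ.∣p*q∣≡∣p∣*∣q∣ a b ⟩
    ∣ a ∣ ℚ.* ∣ b ∣  ≤⟨ ℚ.*-monoʳ-≤-nonNeg ∣ b ∣ {{ℚ.∣-∣-nonNeg b}} a≤ ⟩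
    B ℚ.* ∣ b ∣      <⟨ ℚ.*-monoʳ-<-pos B {{ℚ.positive B>0}} b< ⟩
    B ℚ.* δ          ≡⟨ e ⟩
    ε                ∎

  Eventually : (ℕ → Set) → Set
  Eventually P = ∃ λ N → ∀ n → N ℕ.≤ n → P n

  Eventually₂ : (ℕ → ℕ → Set) → Set
  Eventually₂ P = ∃ λ N → ∀ m n → N ℕ.≤ m → N ℕ.≤ n → P m n

  combine : ∀ {P Q : ℕ → Set} {S T U : ℕ → ℕ → Set} →
            Eventually P → Eventually Q → Eventually₂ S → Eventually₂ T →
            (∀ m n → P m → Q n → S m n → T m n → U m n) → Eventually₂ U
  combine (M , p) (N , q) (K , s) (L , t) f =
    (M ℕ.⊔ N) ℕ.⊔ (K ℕ.⊔ L) , λ m n a b →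
      f m n (p m (ℕ.m⊔n≤o⇒m≤o M N (ℕ.m⊔n≤o⇒m≤o (M ℕ.⊔ N) (K ℕ.⊔ L) a)))
            (q n (ℕ.m⊔n≤o⇒n≤o M N (ℕ.m⊔n≤o⇒m≤o (M ℕ.⊔ N) (K ℕ.⊔ L) b)))
            (s m n (ℕ.m⊔n≤o⇒m≤o K L (ℕ.m⊔n≤o⇒n≤o (M ℕ.⊔ N) (K ℕ.⊔ L) a))
                   (ℕ.m⊔n≤o⇒m≤o K L (ℕ.m⊔n≤o⇒n≤o (M ℕ.⊔ N) (K ℕ.⊔ L) b)))
            (t m n (ℕ.m⊔n≤o⇒n≤o K L (ℕ.m⊔n≤o⇒n≤o (M ℕ.⊔ N) (K ℕ.⊔ L) a))
                   (ℕ.m⊔n≤o⇒n≤o K L (ℕ.m⊔n≤o⇒n≤o (M ℕ.⊔ N) (K ℕ.⊔ L) b)))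

  abstract
    *-∼ : ∀ {x y u v} → x ∼ y → u ∼ v → (λ n → x n ℚ.* u n) ∼ (λ n → y n ℚ.* v n)
    *-∼ {x} {y} {u} {v} p q ε ε>0 = step (bounded {x} {y} p) (bounded (∼-sym {u} {v} q))
      where
      step : (∃ λ A → 0ℚ ℚ.< A × Eventually λ m → ∣ x m ∣ ℚ.≤ A) →
             (∃ λ B → 0ℚ ℚ.< B × Eventually λ n → ∣ v n ∣ ℚ.≤ B) →
             Eventually₂ λ m n → ∣ x m ℚ.* u m ℚ.- y n ℚ.* v n ∣ ℚ.< ε
      step (A , A>0 , f) (B , B>0 , g) =
        let δ , δ>0 , Aδ≡½ε = shrink A (½ ℚ.* ε) A>0 (half ε>0)
            η , η>0 , Bη≡½ε = shrink B (½ ℚ.* ε) B>0 (half ε>0)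
        in combine f g (q δ δ>0) (p η η>0) λ m n x≤A v≤B u-v<δ x-y<η →
             ∣sum∣< (minus-times (x m) (y n) (u m) (v n))
               (∣a*b∣< A>0 Aδ≡½ε x≤A u-v<δ) (∣a*b∣< B>0 Bη≡½ε v≤B x-y<η)

record ℝ : Set where
  constructor real
  field
    seq    : Seq
    cauchy : seq ∼ seq
open ℝ public

infix 4 _≈ℝ_
record _≈ℝ_ (x y : ℝ) : Set where
  constructor close
  field
    seq-∼ : seq x ∼ seq y
open _≈ℝ_ public

fromℚ : ℚ → ℝ
fromℚ q = real (λ _ → q) (const-∼ q)

infixl 6 _+ℝ_
infixl 7 _*ℝ_
infix 8 -ℝ_

_+ℝ_ _*ℝ_ : ℝ → ℝ → ℝ
x +ℝ y = real (λ n → seq x n ℚ.+ seq y n) (+-∼ {seq x} {seq x} {seq y} {seq y} (cauchy x) (cauchy y))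
x *ℝ y = real (λ n → seq x n ℚ.* seq y n) (*-∼ {seq x} {seq x} {seq y} {seq y} (cauchy x) (cauchy y))

-ℝ_ : ℝ → ℝ
-ℝ x = real (λ n → ℚ.- seq x n) (neg-∼ {seq x} {seq x} (cauchy x))

≗⇒≈ : ∀ x y → seq x ≗ seq y → x ≈ℝ y
≗⇒≈ x y e = close (∼-respʳ-≗ {seq x} (cauchy x) e)

private
  0ℝ 1ℝ : ℝ
  0ℝ = fromℚ 0ℚ
  1ℝ = fromℚ 1ℚ

  ≈ℝ-sym : ∀ {x y} → x ≈ℝ y → y ≈ℝ x
  ≈ℝ-sym {x} {y} p = close (∼-sym {seq x} {seq y} (seq-∼ p))

  ≈ℝ-trans : ∀ {x y z} → x ≈ℝ y → y ≈ℝ z → x ≈ℝ z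
  ≈ℝ-trans {x} {y} {z} p q = close (∼-trans {seq x} {seq y} {seq z} (seq-∼ p) (seq-∼ q))

  +ℝ-cong : ∀ {x y u v} → x ≈ℝ y → u ≈ℝ v → x +ℝ u ≈ℝ y +ℝ v
  +ℝ-cong {x} {y} {u} {v} p q = close (+-∼ {seq x} {seq y} {seq u} {seq v} (seq-∼ p) (seq-∼ q))

  *ℝ-cong : ∀ {x y u v} → x ≈ℝ y → u ≈ℝ v → x *ℝ u ≈ℝ y *ℝ v
  *ℝ-cong {x} {y} {u} {v} p q = close (*-∼ {seq x} {seq y} {seq u} {seq v} (seq-∼ p) (seq-∼ q))

  -ℝ-cong : ∀ {x y} → x ≈ℝ y → -ℝ x ≈ℝ -ℝ y
  -ℝ-cong {x} {y} p = close (neg-∼ {seq x} {seq y} (seq-∼ p))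

  +ℝ-assoc : ∀ x y z → x +ℝ y +ℝ z ≈ℝ x +ℝ (y +ℝ z)
  +ℝ-assoc x y z = ≗⇒≈ _ _ λ n → ℚ.+-assoc (seq x n) (seq y n) (seq z n)

  +ℝ-comm : ∀ x y → x +ℝ y ≈ℝ y +ℝ x
  +ℝ-comm x y = ≗⇒≈ _ _ λ n → ℚ.+-comm (seq x n) (seq y n)

  +ℝ-identityˡ : ∀ x → 0ℝ +ℝ x ≈ℝ x
  +ℝ-identityˡ x = ≗⇒≈ _ _ λ n → ℚ.+-identityˡ (seq x n)

  +ℝ-identityʳ : ∀ x → x +ℝ 0ℝ ≈ℝ x
  +ℝ-identityʳ x = ≗⇒≈ _ _ λ n → ℚ.+-identityʳ (seq x n)

  +ℝ-inverseˡ : ∀ x → -ℝ x +ℝ x ≈ℝ 0ℝ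
  +ℝ-inverseˡ x = ≗⇒≈ _ _ λ n → ℚ.+-inverseˡ (seq x n)

  +ℝ-inverseʳ : ∀ x → x +ℝ -ℝ x ≈ℝ 0ℝ
  +ℝ-inverseʳ x = ≗⇒≈ _ _ λ n → ℚ.+-inverseʳ (seq x n)

  *ℝ-assoc : ∀ x y z → x *ℝ y *ℝ z ≈ℝ x *ℝ (y *ℝ z)
  *ℝ-assoc x y z = ≗⇒≈ _ _ λ n → ℚ.*-assoc (seq x n) (seq y n) (seq z n)

  *ℝ-comm : ∀ x y → x *ℝ y ≈ℝ y *ℝ x
  *ℝ-comm x y = ≗⇒≈ _ _ λ n → ℚ.*-comm (seq x n) (seq y n)

  *ℝ-identityˡ : ∀ x → 1ℝ *ℝ x ≈ℝ x
  *ℝ-identityˡ x = ≗⇒≈ _ _ λ n → ℚ.*-identityˡ (seq x n)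

  *ℝ-identityʳ : ∀ x → x *ℝ 1ℝ ≈ℝ x
  *ℝ-identityʳ x = ≗⇒≈ _ _ λ n → ℚ.*-identityʳ (seq x n)

  *ℝ-distribˡ : ∀ x y z → x *ℝ (y +ℝ z) ≈ℝ x *ℝ y +ℝ x *ℝ z
  *ℝ-distribˡ x y z = ≗⇒≈ _ _ λ n → ℚ.*-distribˡ-+ (seq x n) (seq y n) (seq z n)

  *ℝ-distribʳ : ∀ x y z → (y +ℝ z) *ℝ x ≈ℝ y *ℝ x +ℝ z *ℝ x
  *ℝ-distribʳ x y z = ≗⇒≈ _ _ λ n → ℚ.*-distribʳ-+ (seq x n) (seq y n) (seq z n)

ℝ-commutativeRing : CommutativeRing 0ℓ 0ℓ
ℝ-commutativeRing = record
  { Carrier = ℝ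
  ; _≈_ = _≈ℝ_
  ; _+_ = _+ℝ_
  ; _*_ = _*ℝ_
  ; -_ = -ℝ_
  ; 0# = 0ℝ
  ; 1# = 1ℝ
  ; isCommutativeRing = record
    { isRing = record
      { +-isAbelianGroup = record
        { isGroup = record
          { isMonoid = record
            { isSemigroup = record
              { isMagma = record
                { isEquivalence = record { refl = λ {x} → close (cauchy x) ; sym = ≈ℝ-sym ; trans = ≈ℝ-trans }
                ; ∙-cong = +ℝ-cong
                }
              ; assoc = +ℝ-assoc
              }
            ; identity = +ℝ-identityˡ , +ℝ-identityʳ
            }
          ; inverse = +ℝ-inverseˡ , +ℝ-inverseʳ
          ; ⁻¹-cong = -ℝ-cong
          }
        ; comm = +ℝ-comm
        }
      ; *-cong = *ℝ-cong
      ; *-assoc = *ℝ-assoc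
      ; *-identity = *ℝ-identityˡ , *ℝ-identityʳ
      ; distrib = *ℝ-distribˡ , *ℝ-distribʳ
      }
    ; *-comm = *ℝ-comm
    }
  }

-- The continued-fraction convergents of √2: 1, 3/2, 7/5, 17/12, …
num den : ℕ → ℕ
num zero    = 1
num (suc n) = num n ℕ.+ 2 ℕ.* den n
den zero    = 1
den (suc n) = num n ℕ.+ den n

private
  den≤num : ∀ n → den n ℕ.≤ num n
  den≤num zero    = ℕ.≤-refl
  den≤num (suc n) = ℕ.+-monoʳ-≤ (num n) (ℕ.m≤m+n (den n) (den n ℕ.+ 0))

  n<den : ∀ n → n ℕ.< den n
  n<den zero    = ℕ.z<s
  n<den (suc n) = ℕ.≤-trans (ℕ.+-mono-≤ (ℕ.≤-trans (ℕ.≤-trans (ℕ.s≤s ℕ.z≤n) (n<den n)) (den≤num n)) (n<den n)) ℕ.≤-refl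

den-nonZero : ∀ n → NonZero (den n)
den-nonZero n = ℕ.>-nonZero (ℕ.≤-<-trans ℕ.z≤n (n<den n))

convergent : Seq
convergent n = (+ num n / den n) {{den-nonZero n}}

private
  2ℚ : ℚ
  2ℚ = + 2 / 1

  pell : ∀ n → (num n ℕ.* num n ≡ 2 ℕ.* (den n ℕ.* den n) ℕ.+ 1)
             ⊎ (num n ℕ.* num n ℕ.+ 1 ≡ 2 ℕ.* (den n ℕ.* den n))
  pell zero = inj₂ refl
  pell (suc n) with pell n
  ... | inj₁ e = inj₂ (step (num n) (den n) e)
    where
    left : ∀ p q → (p ℕ.+ 2 ℕ.* q) ℕ.* (p ℕ.+ 2 ℕ.* q) ℕ.+ 1 ≡ p ℕ.* p ℕ.+ (4 ℕ.* (p ℕ.* q) ℕ.+ 2 ℕ.* (q ℕ.* q) ℕ.+ (2 ℕ.* (q ℕ.* q) ℕ.+ 1))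
    left = ℕ-Ring.solve-∀
    right : ∀ p q → p ℕ.* p ℕ.+ (4 ℕ.* (p ℕ.* q) ℕ.+ 2 ℕ.* (q ℕ.* q) ℕ.+ p ℕ.* p) ≡ 2 ℕ.* ((p ℕ.+ q) ℕ.* (p ℕ.+ q))
    right = ℕ-Ring.solve-∀
    step : ∀ p q → p ℕ.* p ≡ 2 ℕ.* (q ℕ.* q) ℕ.+ 1 → (p ℕ.+ 2 ℕ.* q) ℕ.* (p ℕ.+ 2 ℕ.* q) ℕ.+ 1 ≡ 2 ℕ.* ((p ℕ.+ q) ℕ.* (p ℕ.+ q))
    step p q e = trans (left p q) (trans (cong (λ t → p ℕ.* p ℕ.+ (4 ℕ.* (p ℕ.* q) ℕ.+ 2 ℕ.* (q ℕ.* q) ℕ.+ t)) (sym e)) (right p q))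
  ... | inj₂ e = inj₁ (step (num n) (den n) e)
    where
    left : ∀ p q → (p ℕ.+ 2 ℕ.* q) ℕ.* (p ℕ.+ 2 ℕ.* q) ≡ p ℕ.* p ℕ.+ (4 ℕ.* (p ℕ.* q) ℕ.+ 2 ℕ.* (q ℕ.* q) ℕ.+ 2 ℕ.* (q ℕ.* q))
    left = ℕ-Ring.solve-∀
    right : ∀ p q → p ℕ.* p ℕ.+ (4 ℕ.* (p ℕ.* q) ℕ.+ 2 ℕ.* (q ℕ.* q) ℕ.+ (p ℕ.* p ℕ.+ 1)) ≡ 2 ℕ.* ((p ℕ.+ q) ℕ.* (p ℕ.+ q)) ℕ.+ 1
    right = ℕ-Ring.solve-∀
    step : ∀ p q → p ℕ.* p ℕ.+ 1 ≡ 2 ℕ.* (q ℕ.* q) → (p ℕ.+ 2 ℕ.* q) ℕ.* (p ℕ.+ 2 ℕ.* q) ≡ 2 ℕ.* ((p ℕ.+ q) ℕ.* (p ℕ.+ q)) ℕ.+ 1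
    step p q e = trans (left p q) (trans (cong (λ t → p ℕ.* p ℕ.+ (4 ℕ.* (p ℕ.* q) ℕ.+ 2 ℕ.* (q ℕ.* q) ℕ.+ t)) (sym e)) (right p q))

  clear-den : ∀ r t q → (r ℚ.* r ℚ.- t) ℚ.* (q ℚ.* q) ≡ (r ℚ.* q) ℚ.* (r ℚ.* q) ℚ.- t ℚ.* (q ℚ.* q)
  clear-den = solve-∀ ℚ-ring

  minus-self-+ : ∀ a b → (a ℚ.+ b) ℚ.- a ≡ b
  minus-self-+ = solve-∀ ℚ-ring

  minus-+-self : ∀ a b → a ℚ.- (a ℚ.+ b) ≡ ℚ.- b
  minus-+-self = solve-∀ ℚ-ring

  square-defect : ∀ p q .{{_ : NonZero q}} →
    (p ℕ.* p ≡ 2 ℕ.* (q ℕ.* q) ℕ.+ 1) ⊎ (p ℕ.* p ℕ.+ 1 ≡ 2 ℕ.* (q ℕ.* q)) →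
    ∣ (+ p / q) ℚ.* (+ p / q) ℚ.- 2ℚ ∣ ℚ.* ι (q ℕ.* q) ≡ 1ℚ
  square-defect p q h = begin-equality
    ∣ r ℚ.* r ℚ.- 2ℚ ∣ ℚ.* ι (q ℕ.* q)                   ≡⟨ cong (∣ r ℚ.* r ℚ.- 2ℚ ∣ ℚ.*_) (ℚ.0≤p⇒∣p∣≡p (0≤ι (q ℕ.* q))) ⟨
    ∣ r ℚ.* r ℚ.- 2ℚ ∣ ℚ.* ∣ ι (q ℕ.* q) ∣               ≡⟨ ℚ.∣p*q∣≡∣p∣*∣q∣ (r ℚ.* r ℚ.- 2ℚ) (ι (q ℕ.* q)) ⟨
    ∣ (r ℚ.* r ℚ.- 2ℚ) ℚ.* ι (q ℕ.* q) ∣                 ≡⟨ cong (λ t → ∣ (r ℚ.* r ℚ.- 2ℚ) ℚ.* t ∣) (ι-* q q) ⟩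
    ∣ (r ℚ.* r ℚ.- 2ℚ) ℚ.* (ι q ℚ.* ι q) ∣               ≡⟨ cong ∣_∣ (clear-den r 2ℚ (ι q)) ⟩
    ∣ (r ℚ.* ι q) ℚ.* (r ℚ.* ι q) ℚ.- 2ℚ ℚ.* (ι q ℚ.* ι q) ∣ ≡⟨ cong₂ (λ s t → ∣ s ℚ.- t ∣) (cong₂ ℚ._*_ (ratio p q) (ratio p q)) (cong (2ℚ ℚ.*_) (sym (ι-* q q))) ⟩
    ∣ ι p ℚ.* ι p ℚ.- 2ℚ ℚ.* ι (q ℕ.* q) ∣               ≡⟨ cong₂ (λ s t → ∣ s ℚ.- t ∣) (ι-* p p) (ι-* 2 (q ℕ.* q)) ⟨
    ∣ ι (p ℕ.* p) ℚ.- ι (2 ℕ.* (q ℕ.* q)) ∣              ≡⟨ unit h ⟩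
    1ℚ                                                   ∎
    where
    r : ℚ
    r = + p / q
    unit : ∀ {a b} → (a ≡ b ℕ.+ 1) ⊎ (a ℕ.+ 1 ≡ b) → ∣ ι a ℚ.- ι b ∣ ≡ 1ℚ
    unit {a} {b} (inj₁ refl) = trans (cong (λ t → ∣ t ℚ.- ι b ∣) (ι-+ b 1)) (cong ∣_∣ (minus-self-+ (ι b) 1ℚ))
    unit {a} {b} (inj₂ refl) = trans (cong (λ t → ∣ ι a ℚ.- t ∣) (ι-+ a 1)) (cong ∣_∣ (minus-+-self (ι a) 1ℚ))

  convergent²→2 : ∀ ε → 0ℚ ℚ.< ε → Eventually λ n → ∣ convergent n ℚ.* convergent n ℚ.- 2ℚ ∣ ℚ.< ε
  convergent²→2 ε ε>0 = let N , 1<Nε = archimedean ε ε>0 in N , λ n N≤n →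
    let Q   = den n ℕ.* den n
        N≤Q = ℕ.≤-trans (ℕ.≤-trans N≤n (ℕ.<⇒≤ (n<den n))) (ℕ.m≤m*n (den n) (den n) {{den-nonZero n}})
    in ℚ.*-cancelʳ-<-nonNeg (ι Q) {{ℚ.nonNegative (0≤ι Q)}} (begin-strict
      ∣ convergent n ℚ.* convergent n ℚ.- 2ℚ ∣ ℚ.* ι Q   ≡⟨ square-defect (num n) (den n) {{den-nonZero n}} (pell n) ⟩
      1ℚ                                                 <⟨ 1<Nε ⟩
      ι N ℚ.* ε                                          ≤⟨ ℚ.*-monoʳ-≤-nonNeg ε {{ℚ.nonNegative (ℚ.<⇒≤ ε>0)}} (ι-mono N≤Q) ⟩
      ι Q ℚ.* ε                                          ≡⟨ ℚ.*-comm (ι Q) ε ⟩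
      ε ℚ.* ι Q                                          ∎)

  1≤convergent : ∀ n → 1ℚ ℚ.≤ convergent n
  1≤convergent n = ℚ.*-cancelʳ-≤-pos (ι (den n)) {{ℚ.positive 0<den}} (begin
    1ℚ ℚ.* ι (den n)            ≡⟨ ℚ.*-identityˡ (ι (den n)) ⟩
    ι (den n)                   ≤⟨ ι-mono (den≤num n) ⟩
    ι (num n)                   ≡⟨ ratio (num n) (den n) {{den-nonZero n}} ⟨
    convergent n ℚ.* ι (den n)  ∎)
    where
    0<den : 0ℚ ℚ.< ι (den n)
    0<den = ℚ.<-≤-trans (ℚ.positive⁻¹ 1ℚ) (ι-mono (ℕ.≤-trans (ℕ.s≤s ℕ.z≤n) (n<den n)))

  difference-of-squares : ∀ a b → (a ℚ.- b) ℚ.* (a ℚ.+ b) ≡ a ℚ.* a ℚ.- b ℚ.* b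
  difference-of-squares = solve-∀ ℚ-ring

  split-at : ∀ s t u → s ℚ.- t ≡ (s ℚ.- u) ℚ.+ (ℚ.- (t ℚ.- u))
  split-at = solve-∀ ℚ-ring

  abstract
    convergent-cauchy : convergent ∼ convergent
    convergent-cauchy ε ε>0 = let N , f = convergent²→2 (½ ℚ.* ε) (half ε>0) in N , λ m n N≤m N≤n → begin-strict
      ∣ c m ℚ.- c n ∣                              ≡⟨ ℚ.*-identityʳ ∣ c m ℚ.- c n ∣ ⟨
      ∣ c m ℚ.- c n ∣ ℚ.* 1ℚ                       ≤⟨ ℚ.*-monoˡ-≤-nonNeg ∣ c m ℚ.- c n ∣ {{ℚ.∣-∣-nonNeg (c m ℚ.- c n)}} (1≤∣sum∣ m n) ⟩
      ∣ c m ℚ.- c n ∣ ℚ.* ∣ c m ℚ.+ c n ∣          ≡⟨ ℚ.∣p*q∣≡∣p∣*∣q∣ (c m ℚ.- c n) (c m ℚ.+ c n) ⟨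
      ∣ (c m ℚ.- c n) ℚ.* (c m ℚ.+ c n) ∣          <⟨ ∣sum∣< (trans (difference-of-squares (c m) (c n)) (split-at (c m ℚ.* c m) (c n ℚ.* c n) 2ℚ))
                                                        (f m N≤m) (subst (ℚ._< ½ ℚ.* ε) (sym (ℚ.∣-p∣≡∣p∣ (c n ℚ.* c n ℚ.- 2ℚ))) (f n N≤n)) ⟩
      ε                                            ∎
      where
      c : Seq
      c = convergent
      1≤∣sum∣ : ∀ m n → 1ℚ ℚ.≤ ∣ c m ℚ.+ c n ∣
      1≤∣sum∣ m n = subst (1ℚ ℚ.≤_) (sym (ℚ.0≤p⇒∣p∣≡p (ℚ.≤-trans (ℚ.nonNegative⁻¹ 1ℚ) 1≤sum))) 1≤sum
        where
        1≤sum : 1ℚ ℚ.≤ c m ℚ.+ c n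
        1≤sum = ℚ.+-mono-≤ (1≤convergent m) (ℚ.≤-trans (ℚ.nonNegative⁻¹ 1ℚ) (1≤convergent n))

√2 : ℝ
√2 = real convergent convergent-cauchy

√2*√2≈2 : √2 *ℝ √2 ≈ℝ fromℚ (+ 2 / 1)
√2*√2≈2 = close λ ε ε>0 → let N , f = convergent²→2 ε ε>0 in N , λ m n N≤m _ → f m N≤m

√2≥1 : ∀ n → 1ℚ ℚ.≤ seq √2 n
√2≥1 = 1≤convergent

record ℂ : Set where
  constructor _+i_
  field
    re im : ℝ
open ℂ public

infix 4 _≈ℂ_
record _≈ℂ_ (w z : ℂ) : Set where
  constructor _,_
  field
    re-≈ : re w ≈ℝ re z
    im-≈ : im w ≈ℝ im z
open _≈ℂ_ public

infixl 6 _+ℂ_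
infixl 7 _*ℂ_
infix 8 -ℂ_

_+ℂ_ _*ℂ_ : ℂ → ℂ → ℂ
(a +i b) +ℂ (c +i d) = (a +ℝ c) +i (b +ℝ d)
(a +i b) *ℂ (c +i d) = (a *ℝ c +ℝ -ℝ (b *ℝ d)) +i (a *ℝ d +ℝ b *ℝ c)

-ℂ_ : ℂ → ℂ
-ℂ (a +i b) = (-ℝ a) +i (-ℝ b)

ℚ→ℂ : ℚ → ℂ
ℚ→ℂ q = fromℚ q +i fromℚ 0ℚ

0ℂ 1ℂ : ℂ
0ℂ = ℚ→ℂ 0ℚ
1ℂ = ℚ→ℂ 1ℚ

private
  module R = CommutativeRing ℝ-commutativeRing

  *ℂ-cong : ∀ {w z u v} → w ≈ℂ z → u ≈ℂ v → w *ℂ u ≈ℂ z *ℂ v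
  *ℂ-cong (p , p′) (q , q′) =
    R.+-cong (R.*-cong p q) (R.-‿cong (R.*-cong p′ q′)) , R.+-cong (R.*-cong p q′) (R.*-cong p′ q)

  *ℂ-assoc : ∀ w z u → w *ℂ z *ℂ u ≈ℂ w *ℂ (z *ℂ u)
  *ℂ-assoc (a +i b) (c +i d) (e +i f) =
      ≗⇒≈ _ _ (λ n → re-part (seq a n) (seq b n) (seq c n) (seq d n) (seq e n) (seq f n))
    , ≗⇒≈ _ _ (λ n → im-part (seq a n) (seq b n) (seq c n) (seq d n) (seq e n) (seq f n))
    where
    re-part : ∀ a b c d e f → (a ℚ.* c ℚ.+ ℚ.- (b ℚ.* d)) ℚ.* e ℚ.+ ℚ.- ((a ℚ.* d ℚ.+ b ℚ.* c) ℚ.* f)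
                            ≡ a ℚ.* (c ℚ.* e ℚ.+ ℚ.- (d ℚ.* f)) ℚ.+ ℚ.- (b ℚ.* (c ℚ.* f ℚ.+ d ℚ.* e))
    re-part = solve-∀ ℚ-ring
    im-part : ∀ a b c d e f → (a ℚ.* c ℚ.+ ℚ.- (b ℚ.* d)) ℚ.* f ℚ.+ (a ℚ.* d ℚ.+ b ℚ.* c) ℚ.* e
                            ≡ a ℚ.* (c ℚ.* f ℚ.+ d ℚ.* e) ℚ.+ b ℚ.* (c ℚ.* e ℚ.+ ℚ.- (d ℚ.* f))
    im-part = solve-∀ ℚ-ring

  *ℂ-comm : ∀ w z → w *ℂ z ≈ℂ z *ℂ w
  *ℂ-comm (a +i b) (c +i d) =
      R.+-cong (R.*-comm a c) (R.-‿cong (R.*-comm b d))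
    , R.trans (R.+-cong (R.*-comm a d) (R.*-comm b c)) (R.+-comm (d *ℝ a) (c *ℝ b))

  *ℂ-identityˡ : ∀ w → ℚ→ℂ 1ℚ *ℂ w ≈ℂ w
  *ℂ-identityˡ (a +i b) =
      ≗⇒≈ _ _ (λ n → re-part (seq a n) (seq b n))
    , ≗⇒≈ _ _ (λ n → im-part (seq a n) (seq b n))
    where
    re-part : ∀ a b → 1ℚ ℚ.* a ℚ.+ ℚ.- (0ℚ ℚ.* b) ≡ a
    re-part = solve-∀ ℚ-ring
    im-part : ∀ a b → 1ℚ ℚ.* b ℚ.+ 0ℚ ℚ.* a ≡ b
    im-part = solve-∀ ℚ-ring

  *ℂ-distribˡ : ∀ w z u → w *ℂ (z +ℂ u) ≈ℂ w *ℂ z +ℂ w *ℂ u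
  *ℂ-distribˡ (a +i b) (c +i d) (e +i f) =
      ≗⇒≈ _ _ (λ n → re-part (seq a n) (seq b n) (seq c n) (seq d n) (seq e n) (seq f n))
    , ≗⇒≈ _ _ (λ n → im-part (seq a n) (seq b n) (seq c n) (seq d n) (seq e n) (seq f n))
    where
    re-part : ∀ a b c d e f → a ℚ.* (c ℚ.+ e) ℚ.+ ℚ.- (b ℚ.* (d ℚ.+ f))
                            ≡ (a ℚ.* c ℚ.+ ℚ.- (b ℚ.* d)) ℚ.+ (a ℚ.* e ℚ.+ ℚ.- (b ℚ.* f))
    re-part = solve-∀ ℚ-ring
    im-part : ∀ a b c d e f → a ℚ.* (d ℚ.+ f) ℚ.+ b ℚ.* (c ℚ.+ e)
                            ≡ (a ℚ.* d ℚ.+ b ℚ.* c) ℚ.+ (a ℚ.* f ℚ.+ b ℚ.* e)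
    im-part = solve-∀ ℚ-ring

  ≈ℂ-trans : ∀ {w z u} → w ≈ℂ z → z ≈ℂ u → w ≈ℂ u
  ≈ℂ-trans (p , p′) (q , q′) = R.trans p q , R.trans p′ q′

  +ℂ-cong : ∀ {w z u v} → w ≈ℂ z → u ≈ℂ v → w +ℂ u ≈ℂ z +ℂ v
  +ℂ-cong (p , p′) (q , q′) = R.+-cong p q , R.+-cong p′ q′

  *ℂ-identityʳ : ∀ w → w *ℂ ℚ→ℂ 1ℚ ≈ℂ w
  *ℂ-identityʳ w = ≈ℂ-trans (*ℂ-comm w (ℚ→ℂ 1ℚ)) (*ℂ-identityˡ w)

  *ℂ-distribʳ : ∀ w z u → (z +ℂ u) *ℂ w ≈ℂ z *ℂ w +ℂ u *ℂ w
  *ℂ-distribʳ w z u = ≈ℂ-trans (*ℂ-comm (z +ℂ u) w)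
    (≈ℂ-trans (*ℂ-distribˡ w z u) (+ℂ-cong (*ℂ-comm w z) (*ℂ-comm w u)))

ℂ-commutativeRing : CommutativeRing 0ℓ 0ℓ
ℂ-commutativeRing = record
  { Carrier = ℂ
  ; _≈_ = _≈ℂ_
  ; _+_ = _+ℂ_
  ; _*_ = _*ℂ_
  ; -_ = -ℂ_
  ; 0# = 0ℂ
  ; 1# = 1ℂ
  ; isCommutativeRing = record
    { isRing = record
      { +-isAbelianGroup = record
        { isGroup = record
          { isMonoid = record
            { isSemigroup = record
              { isMagma = record
                { isEquivalence = record
                  { refl  = R.refl , R.refl
                  ; sym   = λ (p , p′) → R.sym p , R.sym p′
                  ; trans = ≈ℂ-trans
                  }
                ; ∙-cong = +ℂ-cong
                }
              ; assoc = λ (a +i b) (c +i d) (e +i f) → R.+-assoc a c e , R.+-assoc b d f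
              }
            ; identity = (λ (a +i b) → R.+-identityˡ a , R.+-identityˡ b)
                       , (λ (a +i b) → R.+-identityʳ a , R.+-identityʳ b)
            }
          ; inverse = (λ (a +i b) → R.-‿inverseˡ a , R.-‿inverseˡ b)
                    , (λ (a +i b) → R.-‿inverseʳ a , R.-‿inverseʳ b)
          ; ⁻¹-cong = λ (p , p′) → R.-‿cong p , R.-‿cong p′
          }
        ; comm = λ (a +i b) (c +i d) → R.+-comm a c , R.+-comm b d
        }
      ; *-cong = *ℂ-cong
      ; *-assoc = *ℂ-assoc
      ; *-identity = *ℂ-identityˡ , *ℂ-identityʳ
      ; distrib = *ℂ-distribˡ , *ℂ-distribʳ
      }
    ; *-comm = *ℂ-comm
    }
  }

-- z = e^{2πi/8} = cos (π/4) + i sin (π/4), and cos (π/4) = sin (π/4) = √2/2.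
z : ℂ
z = (fromℚ ½ *ℝ √2) +i (fromℚ ½ *ℝ √2)

open Polynomials ℂ-commutativeRing 6 public
open Matrices ℂ-commutativeRing 6 public

private
  open Algebra.Properties.Semiring.Exp (CommutativeRing.semiring ℂ-commutativeRing) using (_^_)

  2ℤ -2ℤ : ℤ
  2ℤ  = + 2
  -2ℤ = ℤ.- 2ℤ

fromIntegers : Vec (Vec ℤ 6) 6 → Matrix
fromIntegers rows i j = ℚ→ℂ (lookup (lookup rows i) j / 1)

X P₁ P₂ E₁ E₂ : Matrix

X = (z ^ 3 +ℂ z) *ℂ ℚ→ℂ (+ 1 / 4) ·ᴹ fromIntegers
  ( (1ℤ ∷ 2ℤ ∷ 1ℤ ∷ 1ℤ ∷ 2ℤ ∷ 1ℤ ∷ [])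
  ∷ (1ℤ ∷ 0ℤ ∷ -1ℤ ∷ 1ℤ ∷ 0ℤ ∷ -1ℤ ∷ [])
  ∷ (1ℤ ∷ -2ℤ ∷ 1ℤ ∷ 1ℤ ∷ -2ℤ ∷ 1ℤ ∷ [])
  ∷ (1ℤ ∷ 2ℤ ∷ 1ℤ ∷ -1ℤ ∷ -2ℤ ∷ -1ℤ ∷ [])
  ∷ (1ℤ ∷ 0ℤ ∷ -1ℤ ∷ -1ℤ ∷ 0ℤ ∷ 1ℤ ∷ [])
  ∷ (1ℤ ∷ -2ℤ ∷ 1ℤ ∷ -1ℤ ∷ 2ℤ ∷ -1ℤ ∷ [])
  ∷ [])

P₁ = fromIntegers
  ( (1ℤ ∷ 0ℤ ∷ 0ℤ ∷ 0ℤ ∷ 0ℤ ∷ 0ℤ ∷ [])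
  ∷ (0ℤ ∷ 0ℤ ∷ 0ℤ ∷ 0ℤ ∷ 1ℤ ∷ 0ℤ ∷ [])
  ∷ (0ℤ ∷ 0ℤ ∷ 1ℤ ∷ 0ℤ ∷ 0ℤ ∷ 0ℤ ∷ [])
  ∷ (0ℤ ∷ 0ℤ ∷ 0ℤ ∷ 1ℤ ∷ 0ℤ ∷ 0ℤ ∷ [])
  ∷ (0ℤ ∷ 1ℤ ∷ 0ℤ ∷ 0ℤ ∷ 0ℤ ∷ 0ℤ ∷ [])
  ∷ (0ℤ ∷ 0ℤ ∷ 0ℤ ∷ 0ℤ ∷ 0ℤ ∷ 1ℤ ∷ [])
  ∷ [])

P₂ = z ^ 2 ·ᴹ fromIntegers
  ( (1ℤ ∷ 0ℤ ∷ 0ℤ ∷ 0ℤ ∷ 0ℤ ∷ 0ℤ ∷ [])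
  ∷ (0ℤ ∷ 0ℤ ∷ 0ℤ ∷ 0ℤ ∷ 1ℤ ∷ 0ℤ ∷ [])
  ∷ (0ℤ ∷ 0ℤ ∷ 1ℤ ∷ 0ℤ ∷ 0ℤ ∷ 0ℤ ∷ [])
  ∷ (0ℤ ∷ 0ℤ ∷ 0ℤ ∷ 0ℤ ∷ 0ℤ ∷ 1ℤ ∷ [])
  ∷ (0ℤ ∷ 1ℤ ∷ 0ℤ ∷ 0ℤ ∷ 0ℤ ∷ 0ℤ ∷ [])
  ∷ (0ℤ ∷ 0ℤ ∷ 0ℤ ∷ 1ℤ ∷ 0ℤ ∷ 0ℤ ∷ [])
  ∷ [])

E₁ = diagonal (lookup (1ℂ ∷ z ∷ -ℂ 1ℂ ∷ z ^ 2 ∷ -ℂ (z ^ 3) ∷ -ℂ (z ^ 2) ∷ []))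

E₂ = diagonal (lookup (1ℂ ∷ z ∷ -ℂ 1ℂ ∷ 1ℂ ∷ z ∷ -ℂ 1ℂ ∷ []))

data Generators : Pred Matrix 0ℓ where
  X∈  : X ∈ Generators
  P₁∈ : P₁ ∈ Generators
  P₂∈ : P₂ ∈ Generators
  E₁∈ : E₁ ∈ Generators
  E₂∈ : E₂ ∈ Generators
  zI∈ : z ·ᴹ I ∈ Generators

H : Pred Matrix 0ℓ
H = ⟨ Generators ⟩ᴹ

-- r ~ s means that r and s are equal in the quotient of 𝔽₂ × ℤ₄ by r = ± s.
infix 4 _~_
_~_ : Fin 2 × Fin 4 → Fin 2 × Fin 4 → Set
(r , s) ~ (r′ , s′) = (r , s) ≡ (r′ , s′) ⊎ (r , s) ≡ (F₂._⁻¹ r′ , Z₄._⁻¹ s′)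
  where
  module F₂ = AbelianGroup (ℤmod-abelianGroup 2)
  module Z₄ = AbelianGroup (ℤmod-abelianGroup 4)

_~?_ : ∀ r s → Dec (r ~ s)
r ~? s = Prod.≡-dec Fin._≟_ Fin._≟_ r s ⊎-dec Prod.≡-dec Fin._≟_ Fin._≟_ r _

-- In the order of the six variables.
representatives : Vec (Fin 2 × Fin 4) 6
representatives = (0F , 0F) ∷ (0F , 1F) ∷ (0F , 2F) ∷ (1F , 0F) ∷ (1F , 1F) ∷ (1F , 2F) ∷ []

exponents : ∀ {n} → Word 2 n → Word 4 n → Vec ℕ 6
exponents u v = Vec.map (λ r → Vec.count (_~? r) (Vec.zip u v)) representatives

weightEnumerator : ∀ {n} → LinearCode 2 n → LinearCode 4 n → Polynomial
weightEnumerator C D = List.cartesianProductWith (λ u v → 1ℂ , exponents u v) (codewords C) (codewords D)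

infix 9 _²
_² : Polynomial → Polynomial
p ² = p *ᴾ p

E₈ : LinearCode 2 8
E₈ = generatedBy
  ( (1 ∷ 1 ∷ 1 ∷ 1 ∷ 0 ∷ 0 ∷ 0 ∷ 0 ∷ [])
  ∷ (0 ∷ 0 ∷ 1 ∷ 1 ∷ 1 ∷ 1 ∷ 0 ∷ 0 ∷ [])
  ∷ (0 ∷ 0 ∷ 0 ∷ 0 ∷ 1 ∷ 1 ∷ 1 ∷ 1 ∷ [])
  ∷ (1 ∷ 0 ∷ 1 ∷ 0 ∷ 1 ∷ 0 ∷ 1 ∷ 0 ∷ [])
  ∷ [])

Q₈ : LinearCode 4 8
Q₈ = generatedBy
  ( (0 ∷ 0 ∷ 1 ∷ 1 ∷ 0 ∷ 2 ∷ 1 ∷ 3 ∷ [])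
  ∷ (0 ∷ 0 ∷ 0 ∷ 2 ∷ 1 ∷ 3 ∷ 1 ∷ 1 ∷ [])
  ∷ (1 ∷ 1 ∷ 0 ∷ 2 ∷ 0 ∷ 0 ∷ 1 ∷ 3 ∷ [])
  ∷ (0 ∷ 2 ∷ 0 ∷ 2 ∷ 0 ∷ 2 ∷ 0 ∷ 2 ∷ [])
  ∷ (0 ∷ 0 ∷ 0 ∷ 0 ∷ 0 ∷ 0 ∷ 2 ∷ 2 ∷ [])
  ∷ [])

K₈ : LinearCode 4 8
K₈ = generatedBy
  ( (1 ∷ 1 ∷ 1 ∷ 1 ∷ 1 ∷ 1 ∷ 1 ∷ 1 ∷ [])
  ∷ (0 ∷ 2 ∷ 0 ∷ 0 ∷ 0 ∷ 0 ∷ 0 ∷ 2 ∷ [])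
  ∷ (0 ∷ 0 ∷ 2 ∷ 0 ∷ 0 ∷ 0 ∷ 0 ∷ 2 ∷ [])
  ∷ (0 ∷ 0 ∷ 0 ∷ 2 ∷ 0 ∷ 0 ∷ 0 ∷ 2 ∷ [])
  ∷ (0 ∷ 0 ∷ 0 ∷ 0 ∷ 2 ∷ 0 ∷ 0 ∷ 2 ∷ [])
  ∷ (0 ∷ 0 ∷ 0 ∷ 0 ∷ 0 ∷ 2 ∷ 0 ∷ 2 ∷ [])
  ∷ (0 ∷ 0 ∷ 0 ∷ 0 ∷ 0 ∷ 0 ∷ 2 ∷ 2 ∷ [])
  ∷ [])

D₁₆ : LinearCode 2 16
D₁₆ = generatedBy
  ( (1 ∷ 1 ∷ 1 ∷ 1 ∷ 0 ∷ 0 ∷ 0 ∷ 0 ∷ 0 ∷ 0 ∷ 0 ∷ 0 ∷ 0 ∷ 0 ∷ 0 ∷ 0 ∷ [])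
  ∷ (0 ∷ 0 ∷ 1 ∷ 1 ∷ 1 ∷ 1 ∷ 0 ∷ 0 ∷ 0 ∷ 0 ∷ 0 ∷ 0 ∷ 0 ∷ 0 ∷ 0 ∷ 0 ∷ [])
  ∷ (0 ∷ 0 ∷ 0 ∷ 0 ∷ 1 ∷ 1 ∷ 1 ∷ 1 ∷ 0 ∷ 0 ∷ 0 ∷ 0 ∷ 0 ∷ 0 ∷ 0 ∷ 0 ∷ [])
  ∷ (0 ∷ 0 ∷ 0 ∷ 0 ∷ 0 ∷ 0 ∷ 1 ∷ 1 ∷ 1 ∷ 1 ∷ 0 ∷ 0 ∷ 0 ∷ 0 ∷ 0 ∷ 0 ∷ [])
  ∷ (0 ∷ 0 ∷ 0 ∷ 0 ∷ 0 ∷ 0 ∷ 0 ∷ 0 ∷ 1 ∷ 1 ∷ 1 ∷ 1 ∷ 0 ∷ 0 ∷ 0 ∷ 0 ∷ [])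
  ∷ (0 ∷ 0 ∷ 0 ∷ 0 ∷ 0 ∷ 0 ∷ 0 ∷ 0 ∷ 0 ∷ 0 ∷ 1 ∷ 1 ∷ 1 ∷ 1 ∷ 0 ∷ 0 ∷ [])
  ∷ (0 ∷ 0 ∷ 0 ∷ 0 ∷ 0 ∷ 0 ∷ 0 ∷ 0 ∷ 0 ∷ 0 ∷ 0 ∷ 0 ∷ 1 ∷ 1 ∷ 1 ∷ 1 ∷ [])
  ∷ (1 ∷ 0 ∷ 1 ∷ 0 ∷ 1 ∷ 0 ∷ 1 ∷ 0 ∷ 1 ∷ 0 ∷ 1 ∷ 0 ∷ 1 ∷ 0 ∷ 1 ∷ 0 ∷ [])
  ∷ [])

-- Positions count from 0, so the last fourteen rows are 2ε_i + 2ε₁₆, i = 2, …, 15.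
K₁₆ : LinearCode 4 16
K₁₆ = generatedBy (replicate 16 1 ∷ List.tabulate λ (j : Fin 14) → replicate 16 0 [ suc (Fin.inject₁ j) ]≔ 2 [ Fin.fromℕ 15 ]≔ 2)

{-# OPTIONS --safe #-}
-- In the coordinates (s, p, t, q, B, E) = (a + c, d + f, a - c, d - f, 2b, 2e) the group H
-- permutes the planes (s, p), (t, q), (B, E), acting on each by the symmetries of the weight
-- enumerator of ℰ₈.  With f = X⁴ + Y⁴ and g = X² Y² on each plane, H permutes the pairings
-- f f′ + 12 g g′ of the planes up to sign.  The indicator functions of the codes are sums of
-- products over pairs of coordinates, which expresses the six weight enumerators as quadratic
-- forms in the pairings: they are invariant.  Conversely, invariance under the monomial
-- elements of H leaves 16 orbits of exponents, and invariance under X, evaluated at a few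
-- points, gives linear equations for the coefficients at the orbits; an explicit integral
-- certificate shows that the solutions are spanned by the six enumerators, which are
-- independent.
module Submission where

open import Algebra.Bundles using (CommutativeRing; RawMonoid; AbelianGroup)
import Algebra.Definitions.RawMonoid
import Algebra.Definitions.RawSemiring
import Algebra.Properties.AbelianGroup
import Algebra.Properties.CommutativeMonoid.Sum
import Algebra.Properties.CommutativeSemigroup
import Algebra.Properties.CommutativeSemiring.Exp
import Algebra.Properties.Group
import Algebra.Properties.Monoid.Mult
import Algebra.Properties.Ring
import Algebra.Properties.Semiring.Exp
import Algebra.Properties.Semiring.Mult
import Algebra.Properties.Semiring.Sum
import Algebra.Solver.Ring
import Algebra.Solver.Ring.AlmostCommutativeRing as ACR
open import Data.Bool.Base using (Bool; true; false; if_then_else_)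
open import Data.Fin.Base as Fin using (Fin; zero; suc)
open import Data.Fin.Patterns using (0F; 1F; 2F; 3F; 4F; 5F)
import Data.Fin.Properties as Fin
open import Data.Integer.Base as ℤ using (ℤ; +_; -[1+_]; 0ℤ; 1ℤ; -1ℤ)
import Data.Integer.Base
import Data.Integer.Properties as ℤ
import Data.Integer.Tactic.RingSolver as ℤ-Ring
open import Data.List.Base as List using (List; []; _∷_)
import Data.List.Membership.DecPropositional
open import Data.List.Membership.Propositional using () renaming (_∉_ to _∉ˡ_; _∈_ to _∈ˡ_)
import Data.List.Membership.Propositional.Properties as List
import Data.List.Properties as List
open import Data.List.Relation.Unary.All as All using (All; []; _∷_)
import Data.List.Relation.Unary.All.Properties as All
open import Data.List.Relation.Unary.AllPairs using ([]; _∷_)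
open import Data.List.Relation.Unary.Any as Any using (here; there; Any)
open import Data.List.Relation.Unary.Unique.DecPropositional using (unique?)
open import Data.List.Relation.Unary.Unique.DecPropositional.Properties using (deduplicate-!)
open import Data.List.Relation.Unary.Unique.Propositional using (Unique)
import Data.Maybe.Base as Maybe
open import Data.Nat.Base as ℕ using (ℕ; zero; suc; NonZero)
open import Data.Nat.DivMod using (_%_; m≡m%n+[m/n]*n; _mod_)
import Data.Nat.Properties as ℕ
open import Data.Product using (_×_; _,_; proj₁; proj₂; Σ; ∃)
open import Data.Rational.Base as ℚ using (ℚ; 0ℚ; 1ℚ; ½; _/_)
import Data.Rational.Properties as ℚ
import Data.Rational.Unnormalised.Base as ℚᵘ
import Data.Rational.Unnormalised.Properties as ℚᵘ
open import Data.Sum using (_⊎_; inj₁; inj₂)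
open import Data.Vec.Base as Vec using (Vec; []; _∷_; lookup; replicate; zipWith; _[_]≔_)
open import Data.Vec.Functional using (Vector)
import Data.Vec.Properties as Vec
import Data.Vec.Relation.Unary.All as VecAll
open import Function.Base using (_∘_; id)
open import Level using (_⊔_)
open import Relation.Binary.Definitions using (DecidableEquality)
open import Relation.Binary.PropositionalEquality as ≡ using (_≡_; _≢_; cong; cong₂; subst)
import Relation.Binary.Reasoning.Setoid
open import Relation.Nullary.Decidable using (Dec; yes; no; does; dec⇒maybe; dec-true; dec-false; True; toWitness; _×-dec_; map′; from-yes; _⊎-dec_; isYes)
open import Relation.Nullary.Negation using (contradiction; ¬_)
open import Relation.Unary using (Pred; Decidable; _∩_)
import Defs

-- Equality in ℂ is equality of limits of Cauchy sequences and cannot be decided by evaluation.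
-- Every computation therefore takes place in ℤ, or with fractions in z whose denominators are
-- powers of 2, and is carried to an arbitrary commutative ring with ζ⁴ = -1 and reciprocals of the
-- positive integers; ℂ is substituted only at the end. The signs have one source: `E₁` and `E₂`
-- exchange the first two planes and reverse the pairings of the third plane with them. This breaks
-- the symmetry between the planes and explains the signs in the quadratic forms. There are 16 orbit
-- coefficients and 6 enumerators, so 10 independent equations are needed, and ten points supply
-- them. The other obstacle is size: membership in a code is decided by a search over all
-- combinations of generators, and there are 4¹⁶ quaternary words of length 16. Codes are therefore
-- tested through parity checks and explicit decoding, and `K₁₆` is treated through the two halves
-- of its words.

-- Integers, a ring solver and finite sums in a commutative ring

module RingBasics where

  module Integers {a ℓ} (R : CommutativeRing a ℓ) where
    open CommutativeRing R hiding (zero)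
    open Algebra.Properties.Ring ring using (-0#≈0#; -‿distribˡ-*; -‿distribʳ-*; -‿involutive)
    open Algebra.Properties.AbelianGroup +-abelianGroup using (⁻¹-∙-comm)
    open Algebra.Properties.Semiring.Mult semiring using (×-homo-+; ×1-homo-*) renaming (_×_ to _×ʳ_)
    open Relation.Binary.Reasoning.Setoid setoid
    private
      module + = Algebra.Properties.CommutativeSemigroup +-commutativeSemigroup

    fromℤ : ℤ → Carrier
    fromℤ (+ n)    = n ×ʳ 1#
    fromℤ -[1+ n ] = - (suc n ×ʳ 1#)

    private
      fromℤ-⊖ : ∀ m n → fromℤ (m ℤ.⊖ n) ≈ m ×ʳ 1# + - (n ×ʳ 1#)
      fromℤ-⊖ m zero = sym (trans (+-congˡ -0#≈0#) (+-identityʳ _))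
      fromℤ-⊖ zero (suc n) = sym (+-identityˡ _)
      fromℤ-⊖ (suc m) (suc n) = begin
        fromℤ (suc m ℤ.⊖ suc n)                    ≡⟨ cong fromℤ (ℤ.[1+m]⊖[1+n]≡m⊖n m n) ⟩
        fromℤ (m ℤ.⊖ n)                            ≈⟨ fromℤ-⊖ m n ⟩
        m ×ʳ 1# + - (n ×ʳ 1#)                      ≈⟨ +-identityˡ _ ⟨
        0# + (m ×ʳ 1# + - (n ×ʳ 1#))               ≈⟨ +-congʳ (-‿inverseʳ 1#) ⟨
        (1# + - 1#) + (m ×ʳ 1# + - (n ×ʳ 1#))      ≈⟨ +.interchange _ _ _ _ ⟩
        (1# + m ×ʳ 1#) + (- 1# + - (n ×ʳ 1#))      ≈⟨ +-congˡ (⁻¹-∙-comm _ _) ⟩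
        suc m ×ʳ 1# + - (suc n ×ʳ 1#)              ∎

    fromℤ-neg : ∀ k → fromℤ (ℤ.- k) ≈ - fromℤ k
    fromℤ-neg (+ zero)  = sym -0#≈0#
    fromℤ-neg (+ suc n) = refl
    fromℤ-neg -[1+ n ]  = sym (-‿involutive _)

    fromℤ-+ : ∀ k l → fromℤ (k ℤ.+ l) ≈ fromℤ k + fromℤ l
    fromℤ-+ (+ m)    (+ n)    = ×-homo-+ 1# m n
    fromℤ-+ (+ m)    -[1+ n ] = fromℤ-⊖ m (suc n)
    fromℤ-+ -[1+ m ] (+ n)    = trans (fromℤ-⊖ n (suc m)) (+-comm _ _)
    fromℤ-+ -[1+ m ] -[1+ n ] = trans
      (-‿cong (trans (reflexive (cong (λ t → suc t ×ʳ 1#) (≡.sym (+-suc′ m n)))) (×-homo-+ 1# (suc m) (suc n))))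
      (sym (⁻¹-∙-comm _ _))
      where
      +-suc′ : ∀ m n → m ℕ.+ suc n ≡ suc (m ℕ.+ n)
      +-suc′ zero    n = ≡.refl
      +-suc′ (suc m) n = cong suc (+-suc′ m n)

    private
      fromℤ-*⁺ : ∀ m l → fromℤ (+ m ℤ.* l) ≈ fromℤ (+ m) * fromℤ l
      fromℤ-*⁺ m (+ n)    = trans (reflexive (cong fromℤ (≡.sym (ℤ.pos-* m n)))) (×1-homo-* m n)
      fromℤ-*⁺ m -[1+ n ] = begin
        fromℤ (+ m ℤ.* ℤ.- + suc n)     ≡⟨ cong fromℤ (ℤ.neg-distribʳ-* (+ m) (+ suc n)) ⟨
        fromℤ (ℤ.- (+ m ℤ.* + suc n))   ≈⟨ fromℤ-neg (+ m ℤ.* + suc n) ⟩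
        - fromℤ (+ m ℤ.* + suc n)       ≈⟨ -‿cong (fromℤ-*⁺ m (+ suc n)) ⟩
        - (m ×ʳ 1# * suc n ×ʳ 1#)       ≈⟨ -‿distribʳ-* _ _ ⟩
        m ×ʳ 1# * - (suc n ×ʳ 1#)       ∎

    fromℤ-* : ∀ k l → fromℤ (k ℤ.* l) ≈ fromℤ k * fromℤ l
    fromℤ-* (+ m)    l = fromℤ-*⁺ m l
    fromℤ-* -[1+ m ] l = begin
      fromℤ (ℤ.- + suc m ℤ.* l)         ≡⟨ cong fromℤ (ℤ.neg-distribˡ-* (+ suc m) l) ⟨
      fromℤ (ℤ.- (+ suc m ℤ.* l))       ≈⟨ fromℤ-neg (+ suc m ℤ.* l) ⟩
      - fromℤ (+ suc m ℤ.* l)           ≈⟨ -‿cong (fromℤ-*⁺ (suc m) l) ⟩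
      - (suc m ×ʳ 1# * fromℤ l)         ≈⟨ -‿distribˡ-* _ _ ⟩
      - (suc m ×ʳ 1#) * fromℤ l         ∎

    fromℤ-1 : fromℤ (+ 1) ≈ 1#
    fromℤ-1 = +-identityʳ 1#

    private
      -- The solver reduces coefficients in ℤ, where equality is decidable, so that identities with
      -- numerals become provable in any commutative ring, ℂ included.
      homomorphism : ℤ.+-*-rawRing ACR.-Raw-AlmostCommutative⟶ ACR.fromCommutativeRing R
      homomorphism = record
        { ⟦_⟧ = fromℤ ; +-homo = fromℤ-+ ; *-homo = fromℤ-* ; -‿homo = fromℤ-neg ; 0-homo = refl ; 1-homo = fromℤ-1 }

      fromℤ-equal? : ∀ k l → Maybe.Maybe (fromℤ k ≈ fromℤ l)
      fromℤ-equal? k l = Maybe.map (reflexive ∘ cong fromℤ) (dec⇒maybe (k ℤ.≟ l))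

    open Algebra.Solver.Ring ℤ.+-*-rawRing (ACR.fromCommutativeRing R) homomorphism fromℤ-equal?
      public using (solve; _:+_; _:*_; :-_; _:-_; _:^_; con; _:=_) renaming (Polynomial to Term)

  module _ {a ℓ} (R : CommutativeRing a ℓ) where
    open CommutativeRing R hiding (zero)

    -- Together with `HasReciprocals`, the properties of ℂ and z on which the general argument
    -- rests. Over an abstract ring, type checking never meets a Cauchy sequence.
    FourthPowerIs-1 IsHalf : Carrier → Set ℓ
    FourthPowerIs-1 x = x * x * (x * x) ≈ - 1#
    IsHalf x          = x + x ≈ 1#

    HasReciprocals : Set (a ⊔ ℓ)
    HasReciprocals = ∀ n → ∃ λ x → x * Integers.fromℤ R (+ suc n) ≈ 1#

  module Summation {a ℓ} (R : CommutativeRing a ℓ) where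
    open CommutativeRing R hiding (zero)
    open Relation.Binary.Reasoning.Setoid setoid
    private
      module + = Algebra.Properties.CommutativeSemigroup +-commutativeSemigroup

    infixr 8 [_]·_
    [_]·_ : Bool → Carrier → Carrier
    [ b ]· x = if b then x else 0#

    module _ {t} {A : Set t} where

      ∑ : List A → (A → Carrier) → Carrier
      ∑ []       f = 0#
      ∑ (x ∷ xs) f = f x + ∑ xs f

      ∑-cong∈ : ∀ xs {f g : A → Carrier} → (∀ x → x ∈ˡ xs → f x ≈ g x) → ∑ xs f ≈ ∑ xs g
      ∑-cong∈ []       h = refl
      ∑-cong∈ (x ∷ xs) h = +-cong (h x (here ≡.refl)) (∑-cong∈ xs λ y i → h y (there i))

      ∑-cong : ∀ xs {f g : A → Carrier} → (∀ x → f x ≈ g x) → ∑ xs f ≈ ∑ xs g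
      ∑-cong xs h = ∑-cong∈ xs λ x _ → h x

      ∑-zero : ∀ xs → ∑ xs (λ _ → 0#) ≈ 0#
      ∑-zero []       = refl
      ∑-zero (x ∷ xs) = trans (+-identityˡ _) (∑-zero xs)

      ∑-++ : ∀ xs ys {f : A → Carrier} → ∑ (xs List.++ ys) f ≈ ∑ xs f + ∑ ys f
      ∑-++ []       ys = sym (+-identityˡ _)
      ∑-++ (x ∷ xs) ys = trans (+-congˡ (∑-++ xs ys)) (sym (+-assoc _ _ _))

      ∑-+ : ∀ xs (f g : A → Carrier) → ∑ xs (λ x → f x + g x) ≈ ∑ xs f + ∑ xs g
      ∑-+ []       f g = sym (+-identityˡ _)
      ∑-+ (x ∷ xs) f g = trans (+-congˡ (∑-+ xs f g)) (+.interchange _ _ _ _)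

      ∑-*ˡ : ∀ xs c (f : A → Carrier) → ∑ xs (λ x → c * f x) ≈ c * ∑ xs f
      ∑-*ˡ []       c f = sym (zeroʳ c)
      ∑-*ˡ (x ∷ xs) c f = trans (+-congˡ (∑-*ˡ xs c f)) (sym (distribˡ _ _ _))

      ∑-*ʳ : ∀ xs c (f : A → Carrier) → ∑ xs (λ x → f x * c) ≈ ∑ xs f * c
      ∑-*ʳ xs c f = trans (∑-cong xs λ x → *-comm (f x) c) (trans (∑-*ˡ xs c f) (*-comm _ _))

      ∑-filter : ∀ {p} {P : Pred A p} (P? : Decidable P) xs (f : A → Carrier) →
                 ∑ (List.filter P? xs) f ≈ ∑ xs (λ x → [ does (P? x) ]· f x)
      ∑-filter P? []       f = refl
      ∑-filter P? (x ∷ xs) f with does (P? x)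
      ... | true  = +-congˡ (∑-filter P? xs f)
      ... | false = trans (∑-filter P? xs f) (sym (+-identityˡ _))

      module _ (_≟_ : DecidableEquality A) where

        ∑-indicator-∉ : ∀ {xs y} → y ∉ˡ xs → (f : A → Carrier) → ∑ xs (λ x → [ does (y ≟ x) ]· f x) ≈ 0#
        ∑-indicator-∉ {[]}     y∉ f = refl
        ∑-indicator-∉ {x ∷ xs} {y} y∉ f = trans
          (+-cong (reflexive (cong ([_]· f x) (dec-false (y ≟ x) (y∉ ∘ here)))) (∑-indicator-∉ (y∉ ∘ there) f))
          (+-identityˡ _)

        ∑-indicator : ∀ {xs y} → Unique xs → y ∈ˡ xs → (f : A → Carrier) → ∑ xs (λ x → [ does (y ≟ x) ]· f x) ≈ f y
        ∑-indicator {x ∷ xs} {y} (x∉ ∷ _) (here ≡.refl) f = trans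
          (+-cong (reflexive (cong ([_]· f x) (dec-true (y ≟ y) ≡.refl)))
                  (∑-indicator-∉ (λ i → All.lookup x∉ i ≡.refl) f))
          (+-identityʳ _)
        ∑-indicator {x ∷ xs} {y} (x∉ ∷ u) (there i) f = trans
          (+-cong (reflexive (cong ([_]· f x) (dec-false (y ≟ x) λ { ≡.refl → All.lookup x∉ i ≡.refl })))
                  (∑-indicator u i f))
          (+-identityˡ _)

    ∑-map : ∀ {s t} {A : Set s} {B : Set t} (g : A → B) xs (f : B → Carrier) → ∑ (List.map g xs) f ≡ ∑ xs (f ∘ g)
    ∑-map g []       f = ≡.refl
    ∑-map g (x ∷ xs) f = cong (λ t → f (g x) + t) (∑-map g xs f)

    ∑-swap : ∀ {s t} {A : Set s} {B : Set t} xs ys (f : A → B → Carrier) →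
             ∑ xs (λ x → ∑ ys (f x)) ≈ ∑ ys (λ y → ∑ xs λ x → f x y)
    ∑-swap []       ys f = sym (∑-zero ys)
    ∑-swap (x ∷ xs) ys f = trans (+-congˡ (∑-swap xs ys f)) (sym (∑-+ ys (f x) _))

    ∑-cartesian : ∀ {s t u} {A : Set s} {B : Set t} {C : Set u} (g : A → B → C) xs ys (f : C → Carrier) →
                  ∑ (List.cartesianProductWith g xs ys) f ≈ ∑ xs (λ x → ∑ ys λ y → f (g x y))
    ∑-cartesian g []       ys f = refl
    ∑-cartesian g (x ∷ xs) ys f = trans (∑-++ (List.map (g x) ys) _)
      (+-cong (reflexive (∑-map (g x) ys f)) (∑-cartesian g xs ys f))

-- The ring of polynomials, studied through linear functionals

module PolynomialRings where

  open RingBasics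

  module PolynomialAlgebra {a ℓ} (R : CommutativeRing a ℓ) (n : ℕ) where
    open CommutativeRing R hiding (zero)
    open Defs.Polynomials R n
    open Summation R
    open Algebra.Properties.Ring ring using (-‿distribˡ-*; -0#≈0#)
    open Algebra.Properties.Semiring.Sum semiring using (sum)
    private
      module * = Algebra.Properties.CommutativeSemigroup *-commutativeSemigroup
      module ≈ = Relation.Binary.Reasoning.Setoid setoid

    _≟ᵉ_ : DecidableEquality (Vec ℕ n)
    _≟ᵉ_ = Vec.≡-dec ℕ._≟_

    -- The linear functional sending x^d to f d.  Two polynomials are equal
    -- precisely when all of these functionals agree on them.
    ⟪_⟫ : (Vec ℕ n → Carrier) → Polynomial → Carrier
    ⟪ f ⟫ p = ∑ p λ (c , d) → c * f d

    private
      does-sym : ∀ d e → does (d ≟ᵉ e) ≡ does (e ≟ᵉ d)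
      does-sym d e with d ≟ᵉ e
      ... | yes ≡.refl = ≡.sym (dec-true (d ≟ᵉ d) ≡.refl)
      ... | no d≢e     = ≡.sym (dec-false (e ≟ᵉ d) (d≢e ∘ ≡.sym))

      scale-indicator : ∀ b c x → ([ b ]· c) * x ≈ [ b ]· (c * x)
      scale-indicator true  c x = refl
      scale-indicator false c x = zeroˡ x

    -- Each term is spread over `D` by an indicator that hits its exponent exactly once, because `D`
    -- has no repetitions. The right side depends on `p` only through its coefficients.
    expand : ∀ {D} → Unique D → ∀ p → (∀ t → t ∈ˡ p → proj₂ t ∈ˡ D) → ∀ f →
             ⟪ f ⟫ p ≈ ∑ D (λ e → coefficient p e * f e)
    expand {D} u []            h f = sym (trans (∑-cong D λ e → zeroˡ (f e)) (∑-zero D))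
    expand {D} u ((c , d) ∷ p) h f = begin
      c * f d + ⟪ f ⟫ p                                          ≈⟨ +-cong (∑-indicator _≟ᵉ_ u (h _ (here ≡.refl)) (λ e → c * f e)) (sym (expand u p (λ t i → h t (there i)) f)) ⟨
      ∑ D (λ e → [ does (d ≟ᵉ e) ]· (c * f e)) + ∑ D (λ e → coefficient p e * f e)
                                                                 ≈⟨ ∑-+ D _ _ ⟨
      ∑ D (λ e → [ does (d ≟ᵉ e) ]· (c * f e) + coefficient p e * f e)
                                                                 ≈⟨ ∑-cong D (λ e → trans (+-congʳ (sym (scale-indicator (does (d ≟ᵉ e)) c (f e)))) (sym (distribʳ _ _ _))) ⟩
      ∑ D (λ e → coefficient ((c , d) ∷ p) e * f e)              ∎
      where open ≈

    -- Both sides are expanded over one duplicate-free list of the exponents of `p` and `q`, where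
    -- equality of coefficients applies entry by entry.
    ⟪⟫-cong : ∀ {p q} → p ≈ᴾ q → ∀ f → ⟪ f ⟫ p ≈ ⟪ f ⟫ q
    ⟪⟫-cong {p} {q} p≈q f = trans (expand unique p (λ t i → List.∈-deduplicate⁺ _≟ᵉ_ (List.∈-++⁺ˡ (List.∈-map⁺ proj₂ i))) f)
      (trans (∑-cong D λ e → *-congʳ (p≈q e))
        (sym (expand unique q (λ t i → List.∈-deduplicate⁺ _≟ᵉ_ (List.∈-++⁺ʳ (List.map proj₂ p) (List.∈-map⁺ proj₂ i))) f)))
      where
      D : List (Vec ℕ n)
      D = List.deduplicate _≟ᵉ_ (List.map proj₂ p List.++ List.map proj₂ q)
      unique : Unique D
      unique = deduplicate-! _≟ᵉ_ (List.map proj₂ p List.++ List.map proj₂ q)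

    δ : Vec ℕ n → Vec ℕ n → Carrier
    δ e d = [ does (d ≟ᵉ e) ]· 1#

    coefficient-δ : ∀ p e → coefficient p e ≈ ⟪ δ e ⟫ p
    coefficient-δ []            e = refl
    coefficient-δ ((c , d) ∷ p) e = +-cong (lemma (does (d ≟ᵉ e))) (coefficient-δ p e)
      where
      lemma : ∀ b → [ b ]· c ≈ c * [ b ]· 1#
      lemma true  = sym (*-identityʳ c)
      lemma false = sym (zeroʳ c)

    -- As a record, unlike _≈ᴾ_, this lets p and q be inferred from p ≋ q.
    infix 4 _≋_
    record _≋_ (p q : Polynomial) : Set (a ⊔ ℓ) where
      constructor ext
      field functional : ∀ f → ⟪ f ⟫ p ≈ ⟪ f ⟫ q
    open _≋_ public

    ≋⇒≈ᴾ : ∀ {p q} → p ≋ q → p ≈ᴾ q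
    ≋⇒≈ᴾ {p} {q} h e = trans (coefficient-δ p e) (trans (functional h (δ e)) (sym (coefficient-δ q e)))

    ≈ᴾ⇒≋ : ∀ {p q} → p ≈ᴾ q → p ≋ q
    ≈ᴾ⇒≋ {p} {q} h = ext (⟪⟫-cong {p} {q} h)

    -- `D` may omit exponents whose terms occur in `p` but cancel: `p` is first replaced by the
    -- polynomial that lists its coefficients on `D`.
    expand-support : ∀ {D} → Unique D → ∀ p → (∀ e → e ∉ˡ D → coefficient p e ≈ 0#) → ∀ f →
                     ⟪ f ⟫ p ≈ ∑ D (λ e → coefficient p e * f e)
    expand-support {D} u p h f = trans (⟪⟫-cong {p} {List.map (λ e → coefficient p e , e) D} agree f) (reflexive (∑-map _ D _))
      where
      open Data.List.Membership.DecPropositional _≟ᵉ_ using (_∈?_)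
      listed : ∀ D e → coefficient (List.map (λ e → coefficient p e , e) D) e ≈ ∑ D (λ d → [ does (e ≟ᵉ d) ]· coefficient p d)
      listed []      e = refl
      listed (d ∷ D) e = +-cong (reflexive (cong ([_]· coefficient p d) (does-sym d e))) (listed D e)
      agree : p ≈ᴾ List.map (λ e → coefficient p e , e) D
      agree e with e ∈? D
      ... | yes e∈D = sym (trans (listed D e) (∑-indicator _≟ᵉ_ u e∈D (coefficient p)))
      ... | no  e∉D = trans (h e e∉D) (sym (trans (listed D e) (∑-indicator-∉ _≟ᵉ_ e∉D (coefficient p))))

    ⟪⟫-vanish : ∀ p f → (∀ d → coefficient p d * f d ≈ 0#) → ⟪ f ⟫ p ≈ 0#
    ⟪⟫-vanish p f h = trans (expand (deduplicate-! _≟ᵉ_ (List.map proj₂ p)) p (λ t i → List.∈-deduplicate⁺ _≟ᵉ_ (List.∈-map⁺ proj₂ i)) f)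
      (trans (∑-cong (List.deduplicate _≟ᵉ_ (List.map proj₂ p)) h) (∑-zero (List.deduplicate _≟ᵉ_ (List.map proj₂ p))))

    module _ {f g : Vec ℕ n → Carrier} where
      ⟪⟫-congᶠ : (∀ d → f d ≈ g d) → ∀ p → ⟪ f ⟫ p ≈ ⟪ g ⟫ p
      ⟪⟫-congᶠ h p = ∑-cong p λ (c , d) → *-congˡ (h d)

    ⟪⟫-+ᴾ : ∀ f p q → ⟪ f ⟫ (p +ᴾ q) ≈ ⟪ f ⟫ p + ⟪ f ⟫ q
    ⟪⟫-+ᴾ f p q = ∑-++ p q

    -- A product corresponds to an iterated functional. Commutativity, associativity and
    -- compatibility with substitution then come down to rearranging finite sums.
    ⟪⟫-*ᴾ : ∀ f p q → ⟪ f ⟫ (p *ᴾ q) ≈ ⟪ (λ d → ⟪ (λ d′ → f (zipWith ℕ._+_ d d′)) ⟫ q) ⟫ p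
    ⟪⟫-*ᴾ f p q = trans (∑-cartesian _ p q _) (∑-cong p λ (c , d) →
      trans (∑-cong q λ (c′ , d′) → *-assoc c c′ _) (∑-*ˡ q c _))

    ⟪⟫-*ˡ : ∀ c f p → ⟪ (λ d → c * f d) ⟫ p ≈ c * ⟪ f ⟫ p
    ⟪⟫-*ˡ c f p = trans (∑-cong p λ (c′ , d) → *.x∙yz≈y∙xz c′ c (f d)) (∑-*ˡ p c _)

    ⟪⟫-swap : ∀ (g : Vec ℕ n → Vec ℕ n → Carrier) p q →
              ⟪ (λ d → ⟪ g d ⟫ q) ⟫ p ≈ ⟪ (λ d′ → ⟪ (λ d → g d d′) ⟫ p) ⟫ q
    ⟪⟫-swap g p q = begin
      ∑ p (λ (c , d) → c * ⟪ g d ⟫ q)                         ≈⟨ ∑-cong p (λ (c , d) → ∑-*ˡ q c _) ⟨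
      ∑ p (λ (c , d) → ∑ q λ (c′ , d′) → c * (c′ * g d d′))   ≈⟨ ∑-swap p q _ ⟩
      ∑ q (λ (c′ , d′) → ∑ p λ (c , d) → c * (c′ * g d d′))   ≈⟨ ∑-cong q (λ (c′ , d′) → ⟪⟫-*ˡ c′ (λ d → g d d′) p) ⟩
      ∑ q (λ (c′ , d′) → c′ * ⟪ (λ d → g d d′) ⟫ p)           ∎
      where open ≈

    ⟪⟫-monomial : ∀ f c d → ⟪ f ⟫ ((c , d) ∷ []) ≈ c * f d
    ⟪⟫-monomial f c d = +-identityʳ _

    -ᴾ_ : Polynomial → Polynomial
    -ᴾ_ = List.map λ (c , d) → - c , d

    ⟪⟫-neg : ∀ f p → ⟪ f ⟫ (-ᴾ p) ≈ - ⟪ f ⟫ p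
    ⟪⟫-neg f []            = sym -0#≈0#
    ⟪⟫-neg f ((c , d) ∷ p) = trans (+-cong (sym (-‿distribˡ-* c (f d))) (⟪⟫-neg f p)) (⁻¹-∙-comm _ _)
      where open import Algebra.Properties.AbelianGroup +-abelianGroup using (⁻¹-∙-comm)

    0+ : ∀ d → zipWith ℕ._+_ (replicate n 0) d ≡ d
    0+ = Vec.zipWith-identityˡ ℕ.+-identityˡ

    ⟪⟫-scale : ∀ f c p → ⟪ f ⟫ (constant c *ᴾ p) ≈ c * ⟪ f ⟫ p
    ⟪⟫-scale f c p = trans (⟪⟫-*ᴾ f (constant c) p) (trans (⟪⟫-monomial (λ d → ⟪ (λ d′ → f (zipWith ℕ._+_ d d′)) ⟫ p) c _)
      (*-congˡ (⟪⟫-congᶠ (λ d → reflexive (cong f (0+ d))) p)))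

    private
      ≋-trans : ∀ {p q r} → p ≋ q → q ≋ r → p ≋ r
      ≋-trans h k = ext λ f → trans (functional h f) (functional k f)

      *ᴾ-comm : ∀ p q → p *ᴾ q ≋ q *ᴾ p
      *ᴾ-comm p q = ext λ f → trans (⟪⟫-*ᴾ f p q) (trans (⟪⟫-swap _ p q)
        (trans (⟪⟫-congᶠ (λ d → ⟪⟫-congᶠ (λ d′ → reflexive (cong f (Vec.zipWith-comm ℕ.+-comm d′ d))) p) q) (sym (⟪⟫-*ᴾ f q p))))

      *ᴾ-congˡ : ∀ p {q q′} → q ≋ q′ → p *ᴾ q ≋ p *ᴾ q′
      *ᴾ-congˡ p {q} {q′} h = ext λ f → trans (⟪⟫-*ᴾ f p q)
        (trans (⟪⟫-congᶠ (λ d → functional h _) p) (sym (⟪⟫-*ᴾ f p q′)))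

      *ᴾ-cong : ∀ {p p′ q q′} → p ≋ p′ → q ≋ q′ → p *ᴾ q ≋ p′ *ᴾ q′
      *ᴾ-cong {p} {p′} {q} {q′} h k = ≋-trans (*ᴾ-congˡ p k) (≋-trans (*ᴾ-comm p q′) (≋-trans (*ᴾ-congˡ q′ h) (*ᴾ-comm q′ p′)))

      *ᴾ-assoc : ∀ p q r → (p *ᴾ q) *ᴾ r ≋ p *ᴾ (q *ᴾ r)
      *ᴾ-assoc p q r = ext λ f → begin
        ⟪ f ⟫ ((p *ᴾ q) *ᴾ r)
          ≈⟨ trans (⟪⟫-*ᴾ f (p *ᴾ q) r) (⟪⟫-*ᴾ _ p q) ⟩
        ⟪ (λ d → ⟪ (λ d′ → ⟪ (λ d″ → f (zipWith ℕ._+_ (zipWith ℕ._+_ d d′) d″)) ⟫ r) ⟫ q) ⟫ p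
          ≈⟨ ⟪⟫-congᶠ (λ d → trans (⟪⟫-congᶠ (λ d′ → ⟪⟫-congᶠ (λ d″ → reflexive (cong f (Vec.zipWith-assoc ℕ.+-assoc d d′ d″))) r) q) (sym (⟪⟫-*ᴾ _ q r))) p ⟩
        ⟪ (λ d → ⟪ (λ d′ → f (zipWith ℕ._+_ d d′)) ⟫ (q *ᴾ r)) ⟫ p
          ≈⟨ ⟪⟫-*ᴾ f p (q *ᴾ r) ⟨
        ⟪ f ⟫ (p *ᴾ (q *ᴾ r)) ∎
        where open ≈

      *ᴾ-identityˡ : ∀ p → constant 1# *ᴾ p ≋ p
      *ᴾ-identityˡ p = ext λ f → trans (⟪⟫-scale f 1# p) (*-identityˡ _)

      +ᴾ-ext : ∀ p q f {x y} → ⟪ f ⟫ p ≈ x → ⟪ f ⟫ q ≈ y → ⟪ f ⟫ (p +ᴾ q) ≈ x + y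
      +ᴾ-ext p q f h k = trans (⟪⟫-+ᴾ f p q) (+-cong h k)

      *ᴾ-distribʳ : ∀ p q r → (q +ᴾ r) *ᴾ p ≋ q *ᴾ p +ᴾ r *ᴾ p
      *ᴾ-distribʳ p q r = ext λ f → trans (⟪⟫-*ᴾ f (q +ᴾ r) p) (trans (⟪⟫-+ᴾ _ q r)
        (sym (+ᴾ-ext (q *ᴾ p) (r *ᴾ p) f (⟪⟫-*ᴾ f q p) (⟪⟫-*ᴾ f r p))))

      +ᴾ-cong : ∀ {p p′ q q′} → p ≋ p′ → q ≋ q′ → p +ᴾ q ≋ p′ +ᴾ q′
      +ᴾ-cong {p} {p′} {q} {q′} h k = ext λ f → trans (+ᴾ-ext p q f (functional h f) (functional k f)) (sym (⟪⟫-+ᴾ f p′ q′))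

      +ᴾ-comm : ∀ p q → p +ᴾ q ≋ q +ᴾ p
      +ᴾ-comm p q = ext λ f → trans (⟪⟫-+ᴾ f p q) (trans (+-comm _ _) (sym (⟪⟫-+ᴾ f q p)))

      +ᴾ-inverseˡ : ∀ p → -ᴾ p +ᴾ p ≋ []
      +ᴾ-inverseˡ p = ext λ f → trans (+ᴾ-ext (-ᴾ p) p f (⟪⟫-neg f p) refl) (-‿inverseˡ _)

    ≡⇒≋ : ∀ {p q} → p ≡ q → p ≋ q
    ≡⇒≋ ≡.refl = ext λ f → refl

    polynomialRing : CommutativeRing a (a ⊔ ℓ)
    polynomialRing = record
      { Carrier = Polynomial
      ; _≈_ = _≋_
      ; _+_ = _+ᴾ_
      ; _*_ = _*ᴾ_
      ; -_ = -ᴾ_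
      ; 0# = []
      ; 1# = constant 1#
      ; isCommutativeRing = record
        { isRing = record
          { +-isAbelianGroup = record
            { isGroup = record
              { isMonoid = record
                { isSemigroup = record
                  { isMagma = record
                    { isEquivalence = record
                      { refl  = ext λ f → refl
                      ; sym   = λ h → ext λ f → sym (functional h f)
                      ; trans = ≋-trans
                      }
                    ; ∙-cong = +ᴾ-cong
                    }
                  ; assoc = λ p q r → ≡⇒≋ (List.++-assoc p q r)
                  }
                ; identity = (λ p → ≡⇒≋ ≡.refl) , λ p → ≡⇒≋ (List.++-identityʳ p)
                }
              ; inverse = +ᴾ-inverseˡ , λ p → ≋-trans (+ᴾ-comm p (-ᴾ p)) (+ᴾ-inverseˡ p)
              ; ⁻¹-cong = λ {p} {q} h → ext λ f → trans (⟪⟫-neg f p) (trans (-‿cong (functional h f)) (sym (⟪⟫-neg f q)))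
              }
            ; comm = +ᴾ-comm
            }
          ; *-cong = *ᴾ-cong
          ; *-assoc = *ᴾ-assoc
          ; *-identity = *ᴾ-identityˡ , λ p → ≋-trans (*ᴾ-comm p (constant 1#)) (*ᴾ-identityˡ p)
          ; distrib = (λ p q r → ≋-trans (*ᴾ-comm p (q +ᴾ r))
                        (≋-trans (*ᴾ-distribʳ p q r) (+ᴾ-cong (*ᴾ-comm q p) (*ᴾ-comm r p))))
                    , *ᴾ-distribʳ
          }
        ; *-comm = *ᴾ-comm
        }
      }

    private
      module 𝓟 = CommutativeRing polynomialRing
      module Π = Algebra.Properties.CommutativeMonoid.Sum 𝓟.*-commutativeMonoid
      module P = Algebra.Definitions.RawSemiring rawSemiring
      module ≋ = Relation.Binary.Reasoning.Setoid 𝓟.setoid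
      open Algebra.Properties.Monoid.Mult 𝓟.*-monoid using (×-homo-+; ×-congʳ) renaming (_×_ to infixr 8 _^ᵐ_)

      ^ᴾ≡ : ∀ p k → p P.^ k ≡ k ^ᵐ p
      ^ᴾ≡ p zero    = ≡.refl
      ^ᴾ≡ p (suc k) = cong (p *ᴾ_) (^ᴾ≡ p k)

    infixr 8 _^ᵛ_
    _^ᵛ_ : Vector Polynomial n → Vec ℕ n → Polynomial
    q ^ᵛ d = P.product λ i → q i P.^ lookup d i

    private
      ^ᵛ≋ : ∀ q d → q ^ᵛ d ≋ Π.sum (λ i → lookup d i ^ᵐ q i)
      ^ᵛ≋ q d = Π.sum-cong-≋ λ i → ≡⇒≋ (^ᴾ≡ (q i) (lookup d i))

    ^ᵛ-cong : ∀ {q q′} → (∀ i → q i ≋ q′ i) → ∀ d → q ^ᵛ d ≋ q′ ^ᵛ d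
    ^ᵛ-cong {q} {q′} h d = 𝓟.trans (^ᵛ≋ q d) (𝓟.trans (Π.sum-cong-≋ λ i → ×-congʳ (lookup d i) (h i)) (𝓟.sym (^ᵛ≋ q′ d)))

    ^ᵛ-+ : ∀ q d d′ → q ^ᵛ zipWith ℕ._+_ d d′ ≋ q ^ᵛ d *ᴾ q ^ᵛ d′
    ^ᵛ-+ q d d′ = begin
      q ^ᵛ zipWith ℕ._+_ d d′                                   ≈⟨ ^ᵛ≋ q (zipWith ℕ._+_ d d′) ⟩
      Π.sum (λ i → lookup (zipWith ℕ._+_ d d′) i ^ᵐ q i)        ≈⟨ Π.sum-cong-≋ (λ i → 𝓟.trans (𝓟.reflexive (cong (_^ᵐ q i) (Vec.lookup-zipWith ℕ._+_ i d d′))) (×-homo-+ (q i) (lookup d i) (lookup d′ i))) ⟩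
      Π.sum (λ i → lookup d i ^ᵐ q i *ᴾ lookup d′ i ^ᵐ q i)     ≈⟨ Π.∑-distrib-+ (λ i → lookup d i ^ᵐ q i) (λ i → lookup d′ i ^ᵐ q i) ⟩
      Π.sum (λ i → lookup d i ^ᵐ q i) *ᴾ Π.sum (λ i → lookup d′ i ^ᵐ q i) ≈⟨ 𝓟.*-cong (^ᵛ≋ q d) (^ᵛ≋ q d′) ⟨
      q ^ᵛ d *ᴾ q ^ᵛ d′                                         ∎
      where open ≋

    ^ᵛ-0 : ∀ q → q ^ᵛ replicate n 0 ≋ constant 1#
    ^ᵛ-0 q = 𝓟.trans (^ᵛ≋ q (replicate n 0)) (𝓟.trans (Π.sum-cong-≋ λ i → 𝓟.reflexive (cong (_^ᵐ q i) (Vec.lookup-replicate i 0))) (Π.sum-replicate-zero n))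

    ^ᵛ-unit : ∀ q i → q ^ᵛ (replicate n 0 [ i ]≔ 1) ≋ q i
    ^ᵛ-unit q i = 𝓟.trans (^ᵛ≋ q (replicate n 0 [ i ]≔ 1)) (unit n q i)
      where
      unit : ∀ n (q : Vector Polynomial n) i → Π.sum (λ j → lookup (replicate n 0 [ i ]≔ 1) j ^ᵐ q j) ≋ q i
      unit (suc n) q zero = 𝓟.trans (𝓟.*-cong (𝓟.*-identityʳ (q zero))
        (𝓟.trans (Π.sum-cong-≋ λ j → 𝓟.reflexive (cong (_^ᵐ q (suc j)) (Vec.lookup-replicate j 0))) (Π.sum-replicate-zero n)))
        (𝓟.*-identityʳ (q zero))
      unit (suc n) q (suc i) = 𝓟.trans (𝓟.*-identityˡ _) (unit n (q ∘ suc) i)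

    -- Substitution is the transpose of the map sending `f` to d ↦ `⟪ f ⟫ (q ^ᵛ d)`. Hence it
    -- respects equality of polynomials, although it is defined by recursion on a list of terms.
    ⟪⟫-substitute : ∀ f q p → ⟪ f ⟫ (substitute q p) ≈ ⟪ (λ d → ⟪ f ⟫ (q ^ᵛ d)) ⟫ p
    ⟪⟫-substitute f q []            = refl
    ⟪⟫-substitute f q ((c , d) ∷ p) = trans (⟪⟫-+ᴾ f (constant c *ᴾ q ^ᵛ d) (substitute q p))
      (+-cong (⟪⟫-scale f c (q ^ᵛ d)) (⟪⟫-substitute f q p))

    substitute-cong : ∀ {q q′ p p′} → (∀ i → q i ≋ q′ i) → p ≋ p′ → substitute q p ≋ substitute q′ p′
    substitute-cong {q} {q′} {p} {p′} h k = ext λ f → trans (⟪⟫-substitute f q p)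
      (trans (⟪⟫-congᶠ (λ d → functional (^ᵛ-cong h d) f) p)
        (trans (functional k _) (sym (⟪⟫-substitute f q′ p′))))

    substitute-+ : ∀ q p p′ → substitute q (p +ᴾ p′) ≋ substitute q p +ᴾ substitute q p′
    substitute-+ q p p′ = ext λ f → trans (⟪⟫-substitute f q (p +ᴾ p′)) (trans (⟪⟫-+ᴾ _ p p′)
      (sym (+ᴾ-ext (substitute q p) (substitute q p′) f (⟪⟫-substitute f q p) (⟪⟫-substitute f q p′))))

    substitute-* : ∀ q p p′ → substitute q (p *ᴾ p′) ≋ substitute q p *ᴾ substitute q p′
    substitute-* q p p′ = ext λ f → begin
      ⟪ f ⟫ (substitute q (p *ᴾ p′))
        ≈⟨ trans (⟪⟫-substitute f q (p *ᴾ p′)) (⟪⟫-*ᴾ _ p p′) ⟩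
      ⟪ (λ d → ⟪ (λ d′ → ⟪ f ⟫ (q ^ᵛ zipWith ℕ._+_ d d′)) ⟫ p′) ⟫ p
        ≈⟨ ⟪⟫-congᶠ (λ d → begin
             ⟪ (λ d′ → ⟪ f ⟫ (q ^ᵛ zipWith ℕ._+_ d d′)) ⟫ p′
               ≈⟨ ⟪⟫-congᶠ (λ d′ → trans (functional (^ᵛ-+ q d d′) f) (⟪⟫-*ᴾ f (q ^ᵛ d) (q ^ᵛ d′))) p′ ⟩
             ⟪ (λ d′ → ⟪ (λ e → ⟪ (λ e′ → f (zipWith ℕ._+_ e e′)) ⟫ (q ^ᵛ d′)) ⟫ (q ^ᵛ d)) ⟫ p′
               ≈⟨ ⟪⟫-swap _ p′ (q ^ᵛ d) ⟩
             ⟪ (λ e → ⟪ (λ d′ → ⟪ (λ e′ → f (zipWith ℕ._+_ e e′)) ⟫ (q ^ᵛ d′)) ⟫ p′) ⟫ (q ^ᵛ d)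
               ≈⟨ ⟪⟫-congᶠ (λ e → sym (⟪⟫-substitute _ q p′)) (q ^ᵛ d) ⟩
             ⟪ (λ e → ⟪ (λ e′ → f (zipWith ℕ._+_ e e′)) ⟫ (substitute q p′)) ⟫ (q ^ᵛ d) ∎) p ⟩
      ⟪ (λ d → ⟪ (λ e → ⟪ (λ e′ → f (zipWith ℕ._+_ e e′)) ⟫ (substitute q p′)) ⟫ (q ^ᵛ d)) ⟫ p
        ≈⟨ ⟪⟫-substitute _ q p ⟨
      ⟪ (λ e → ⟪ (λ e′ → f (zipWith ℕ._+_ e e′)) ⟫ (substitute q p′)) ⟫ (substitute q p)
        ≈⟨ ⟪⟫-*ᴾ f (substitute q p) (substitute q p′) ⟨
      ⟪ f ⟫ (substitute q p *ᴾ substitute q p′) ∎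
      where open ≈

    ⟪⟫-constant : ∀ f c → ⟪ f ⟫ (constant c) ≈ c * f (replicate n 0)
    ⟪⟫-constant f c = ⟪⟫-monomial f c _

    substitute-constant : ∀ q c → substitute q (constant c) ≋ constant c
    substitute-constant q c = ext λ f → trans (⟪⟫-substitute f q (constant c)) (trans (⟪⟫-constant (λ d → ⟪ f ⟫ (q ^ᵛ d)) c)
      (trans (*-congˡ (trans (functional (^ᵛ-0 q) f) (trans (⟪⟫-constant f 1#) (*-identityˡ _)))) (sym (⟪⟫-constant f c))))

    substitute-var : ∀ q i → substitute q (var i) ≋ q i
    substitute-var q i = ext λ f → trans (⟪⟫-substitute f q (var i)) (trans (⟪⟫-monomial (λ d → ⟪ f ⟫ (q ^ᵛ d)) 1# (replicate n 0 [ i ]≔ 1))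
      (trans (*-identityˡ _) (functional (^ᵛ-unit q i) f)))

    constant-cong : ∀ {c c′} → c ≈ c′ → constant c ≋ constant c′
    constant-cong h = ext λ f → +-congʳ (*-congʳ h)

    constant-+ : ∀ c c′ → constant (c + c′) ≋ constant c +ᴾ constant c′
    constant-+ c c′ = ext λ f → trans (⟪⟫-constant f (c + c′)) (trans (distribʳ _ c c′)
      (sym (+ᴾ-ext (constant c) (constant c′) f (⟪⟫-constant f c) (⟪⟫-constant f c′))))

    constant-* : ∀ c c′ → constant (c * c′) ≋ constant c *ᴾ constant c′
    constant-* c c′ = ext λ f → trans (⟪⟫-constant f (c * c′)) (trans (*-assoc c c′ _)
      (sym (trans (⟪⟫-scale f c (constant c′)) (*-congˡ (⟪⟫-constant f c′)))))

    constant-0 : constant 0# ≋ []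
    constant-0 = ext λ f → trans (⟪⟫-constant f 0#) (zeroˡ _)

    constant-neg : ∀ c → constant (- c) ≋ -ᴾ constant c
    constant-neg c = ≡⇒≋ ≡.refl

    ⟪⟫-combination : ∀ {k} f c (p : Vector Polynomial k) → ⟪ f ⟫ (combination c p) ≈ sum (λ i → c i * ⟪ f ⟫ (p i))
    ⟪⟫-combination {zero}  f c p = refl
    ⟪⟫-combination {suc k} f c p = trans (⟪⟫-+ᴾ f (constant (c zero) *ᴾ p zero) (combination (c ∘ suc) (p ∘ suc)))
      (+-cong (⟪⟫-scale f (c zero) (p zero)) (⟪⟫-combination f (c ∘ suc) (p ∘ suc)))

    substitute-combination : ∀ {k} q c (p : Vector Polynomial k) →
                             substitute q (combination c p) ≋ combination c (substitute q ∘ p)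
    substitute-combination {zero}  q c p = 𝓟.refl
    substitute-combination {suc k} q c p = 𝓟.trans (substitute-+ q (constant (c zero) *ᴾ p zero) (combination (c ∘ suc) (p ∘ suc)))
      (𝓟.+-cong (𝓟.trans (substitute-* q (constant (c zero)) (p zero)) (𝓟.*-congʳ (substitute-constant q (c zero))))
                (substitute-combination q (c ∘ suc) (p ∘ suc)))

    combination-cong : ∀ {k c c′} {p p′ : Vector Polynomial k} → (∀ i → c i ≈ c′ i) → (∀ i → p i ≋ p′ i) →
                       combination c p ≋ combination c′ p′
    combination-cong {zero}  h h′ = 𝓟.refl
    combination-cong {suc k} h h′ = 𝓟.+-cong (𝓟.*-cong (constant-cong (h zero)) (h′ zero)) (combination-cong (h ∘ suc) (h′ ∘ suc))

-- Matrices acting by linear substitution: monomial matrices, degree, evaluation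

module MatrixActions where

  open PolynomialRings

  open RingBasics

  module MatrixAction {a ℓ} (R : CommutativeRing a ℓ) (n : ℕ) where
    open CommutativeRing R hiding (zero)
    open Defs.Polynomials R n
    open Defs.Matrices R n
    open PolynomialAlgebra R n
    open Summation R using ([_]·_)
    open Algebra.Properties.Semiring.Sum semiring using (sum; sum-cong-≋; sum-replicate-zero; ∑-comm; *-distribˡ-sum; *-distribʳ-sum)
    open Algebra.Properties.Semiring.Exp semiring using (_^_; ^-homo-*; ^-congˡ)
    private
      module 𝓟 = CommutativeRing polynomialRing
      module P = Algebra.Definitions.RawSemiring rawSemiring
      module ≈ = Relation.Binary.Reasoning.Setoid setoid
      module ≋ = Relation.Binary.Reasoning.Setoid 𝓟.setoid
      module * = Algebra.Properties.CommutativeSemigroup *-commutativeSemigroup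

    unit : ∀ {m} → Fin m → Vec ℕ m
    unit {m} i = replicate m 0 [ i ]≔ 1

    linear : Vector Carrier n → Polynomial
    linear v = combination v var

    ⟪⟫-linear : ∀ f v → ⟪ f ⟫ (linear v) ≈ sum (λ j → v j * f (unit j))
    ⟪⟫-linear f v = trans (⟪⟫-combination f v var)
      (sum-cong-≋ λ j → *-congˡ {v j} (trans (⟪⟫-monomial f 1# (unit j)) (*-identityˡ _)))

    linear-cong : ∀ {v w} → (∀ i → v i ≈ w i) → linear v ≋ linear w
    linear-cong h = combination-cong h (λ i → 𝓟.refl)

    •-congˡ : ∀ A B p → A ≈ᴹ B → A • p ≋ B • p
    •-congˡ A B p h = substitute-cong {λ i → linear (A i)} {λ i → linear (B i)} (λ i → linear-cong (h i)) (𝓟.refl {p})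

    •-congʳ : ∀ A {p q} → p ≋ q → A • p ≋ A • q
    •-congʳ A h = substitute-cong {λ i → linear (A i)} {λ i → linear (A i)} (λ i → 𝓟.refl {linear (A i)}) h

    private
      substitute-^ : ∀ q p k → substitute q (p P.^ k) ≋ substitute q p P.^ k
      substitute-^ q p zero    = substitute-constant q 1#
      substitute-^ q p (suc k) = 𝓟.trans (substitute-* q p (p P.^ k)) (𝓟.*-congˡ {substitute q p} (substitute-^ q p k))

      substitute-product : ∀ q {m} (p : Vector Polynomial m) → substitute q (P.product p) ≋ P.product (substitute q ∘ p)
      substitute-product q {zero}  p = substitute-constant q 1#
      substitute-product q {suc m} p = 𝓟.trans (substitute-* q (p zero) (P.product (p ∘ suc)))
        (𝓟.*-congˡ {substitute q (p zero)} (substitute-product q (p ∘ suc)))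

      product-cong : ∀ {m} {p q : Vector Polynomial m} → (∀ i → p i ≋ q i) → P.product p ≋ P.product q
      product-cong {zero}  h = 𝓟.refl
      product-cong {suc m} h = 𝓟.*-cong (h zero) (product-cong (h ∘ suc))

    substitute-^ᵛ : ∀ q r d → substitute q (r ^ᵛ d) ≋ (substitute q ∘ r) ^ᵛ d
    substitute-^ᵛ q r d = 𝓟.trans (substitute-product q (λ i → r i P.^ lookup d i))
      (product-cong {p = λ i → substitute q (r i P.^ lookup d i)} λ i → substitute-^ q (r i) (lookup d i))

    substitute-substitute : ∀ q r p → substitute q (substitute r p) ≋ substitute (substitute q ∘ r) p
    substitute-substitute q r p = ext λ f → begin
      ⟪ f ⟫ (substitute q (substitute r p))                          ≈⟨ ⟪⟫-substitute f q (substitute r p) ⟩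
      ⟪ (λ d → ⟪ f ⟫ (q ^ᵛ d)) ⟫ (substitute r p)                    ≈⟨ ⟪⟫-substitute (λ d → ⟪ f ⟫ (q ^ᵛ d)) r p ⟩
      ⟪ (λ e → ⟪ (λ d → ⟪ f ⟫ (q ^ᵛ d)) ⟫ (r ^ᵛ e)) ⟫ p              ≈⟨ ⟪⟫-congᶠ (λ e → trans (sym (⟪⟫-substitute f q (r ^ᵛ e))) (functional (substitute-^ᵛ q r e) f)) p ⟩
      ⟪ (λ e → ⟪ f ⟫ ((substitute q ∘ r) ^ᵛ e)) ⟫ p                  ≈⟨ ⟪⟫-substitute f (substitute q ∘ r) p ⟨
      ⟪ f ⟫ (substitute (substitute q ∘ r) p)                        ∎
      where open ≈

    •-linear : ∀ A v → A • linear v ≋ linear (λ j → sum λ k → v k * A k j)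
    •-linear A v = 𝓟.trans (substitute-combination (λ i → linear (A i)) v var)
      (𝓟.trans (combination-cong (λ i → refl) (substitute-var (λ i → linear (A i)))) (ext λ f → begin
        ⟪ f ⟫ (combination v (λ i → linear (A i)))               ≈⟨ ⟪⟫-combination f v (λ i → linear (A i)) ⟩
        sum (λ k → v k * ⟪ f ⟫ (linear (A k)))                   ≈⟨ sum-cong-≋ (λ k → *-congˡ {v k} (⟪⟫-linear f (A k))) ⟩
        sum (λ k → v k * sum (λ j → A k j * f (unit j)))         ≈⟨ sum-cong-≋ (λ k → trans (*-distribˡ-sum (v k) (λ j → A k j * f (unit j))) (sum-cong-≋ λ j → sym (*-assoc (v k) (A k j) (f (unit j))))) ⟩
        sum (λ k → sum (λ j → v k * A k j * f (unit j)))         ≈⟨ ∑-comm (λ k j → v k * A k j * f (unit j)) ⟩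
        sum (λ j → sum (λ k → v k * A k j * f (unit j)))         ≈⟨ sum-cong-≋ (λ j → sym (*-distribʳ-sum (f (unit j)) (λ k → v k * A k j))) ⟩
        sum (λ j → sum (λ k → v k * A k j) * f (unit j))         ≈⟨ ⟪⟫-linear f (λ j → sum λ k → v k * A k j) ⟨
        ⟪ f ⟫ (linear (λ j → sum λ k → v k * A k j))             ∎))
      where open ≈

    -- Substituting by `A` and then by `B` turns the i-th variable into the i-th row of A B. The
    -- action is thus on the right, which governs the order of factors in all products of generators
    -- below.
    •-* : ∀ A B p → (A *ᴹ B) • p ≋ B • (A • p)
    •-* A B p = 𝓟.sym (𝓟.trans (substitute-substitute (λ i → linear (B i)) (λ i → linear (A i)) p)
      (substitute-cong {λ i → B • linear (A i)} {λ i → linear ((A *ᴹ B) i)} (λ i → •-linear B (A i)) (𝓟.refl {p})))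

    private
      sum-indicator : ∀ {m} (i : Fin m) (t : Vector Carrier m) → sum (λ j → [ does (i Fin.≟ j) ]· t j) ≈ t i
      sum-indicator {suc m} zero    t = trans (+-congˡ (sum-replicate-zero m)) (+-identityʳ (t zero))
      sum-indicator {suc m} (suc i) t = trans (+-identityˡ _) (sum-indicator i (t ∘ suc))

    linear-unit : ∀ c i → linear (λ j → [ does (i Fin.≟ j) ]· c) ≋ (c , unit i) ∷ []
    linear-unit c i = ext λ f → trans (⟪⟫-linear f _)
      (trans (sum-cong-≋ λ j → lemma (does (i Fin.≟ j)) (f (unit j)))
        (trans (sum-indicator i (λ j → c * f (unit j))) (sym (⟪⟫-monomial f c (unit i)))))
      where
      lemma : ∀ b x → ([ b ]· c) * x ≈ [ b ]· (c * x)
      lemma true  x = refl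
      lemma false x = zeroˡ x

    infixr 7 _·_
    _·_ : ∀ {m} → ℕ → Vec ℕ m → Vec ℕ m
    zero  · e = replicate _ 0
    suc k · e = zipWith ℕ._+_ e (k · e)

    total : ∀ {m l} → Vector (Vec ℕ l) m → Vec ℕ l
    total {zero}  e = replicate _ 0
    total {suc m} e = zipWith ℕ._+_ (e zero) (total (e ∘ suc))

    power : ∀ {m} → Vector Carrier m → Vec ℕ m → Carrier
    power c []      = 1#
    power c (k ∷ d) = c zero ^ k * power (c ∘ suc) d

    private
      monomial-^ : ∀ c e k → ((c , e) ∷ []) P.^ k ≡ (c ^ k , k · e) ∷ []
      monomial-^ c e zero    = ≡.refl
      monomial-^ c e (suc k) = cong (((c , e) ∷ []) *ᴾ_) (monomial-^ c e k)

      monomial-product : ∀ {m} (c : Vector Carrier m) (e : Vector (Vec ℕ n) m) d →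
        P.product (λ i → ((c i , e i) ∷ []) P.^ lookup d i) ≡ (power c d , total λ i → lookup d i · e i) ∷ []
      monomial-product c e []      = ≡.refl
      monomial-product c e (k ∷ d) = cong₂ _*ᴾ_ (monomial-^ (c zero) (e zero) k) (monomial-product (c ∘ suc) (e ∘ suc) d)

      lookup-· : ∀ {m} k (e : Vec ℕ m) j → lookup (k · e) j ≡ k ℕ.* lookup e j
      lookup-· zero    e j = Vec.lookup-replicate j 0
      lookup-· (suc k) e j = ≡.trans (Vec.lookup-zipWith ℕ._+_ j e (k · e)) (cong (lookup e j ℕ.+_) (lookup-· k e j))

      lookup-unit : ∀ {m} (i j : Fin m) → lookup (unit i) j ≡ (if does (i Fin.≟ j) then 1 else 0)
      lookup-unit zero    zero    = ≡.refl
      lookup-unit zero    (suc j) = Vec.lookup-replicate j 0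
      lookup-unit (suc i) zero    = ≡.refl
      lookup-unit (suc i) (suc j) = lookup-unit i j

      lookup-total-0 : ∀ {m l} (e : Vector (Vec ℕ l) m) j → (∀ i → lookup (e i) j ≡ 0) → lookup (total e) j ≡ 0
      lookup-total-0 {zero}  e j h = Vec.lookup-replicate j 0
      lookup-total-0 {suc m} e j h = ≡.trans (Vec.lookup-zipWith ℕ._+_ j (e zero) _)
        (cong₂ ℕ._+_ (h zero) (lookup-total-0 (e ∘ suc) j (h ∘ suc)))

      lookup-total : ∀ {m l} (e : Vector (Vec ℕ l) m) j i → (∀ i′ → i ≢ i′ → lookup (e i′) j ≡ 0) →
                     lookup (total e) j ≡ lookup (e i) j
      lookup-total {suc m} e j zero    h = ≡.trans (Vec.lookup-zipWith ℕ._+_ j (e zero) _)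
        (≡.trans (cong (lookup (e zero) j ℕ.+_) (lookup-total-0 (e ∘ suc) j λ i → h (suc i) λ ())) (ℕ.+-identityʳ _))
      lookup-total {suc m} e j (suc i) h = ≡.trans (Vec.lookup-zipWith ℕ._+_ j (e zero) _)
        (cong₂ ℕ._+_ (h zero λ ()) (lookup-total (e ∘ suc) j i λ i′ i≢ → h (suc i′) (i≢ ∘ Fin.suc-injective)))

    permute : (Fin n → Fin n) → Vec ℕ n → Vec ℕ n
    permute ρ e = Vec.tabulate (lookup e ∘ ρ)

    module _ (π ρ : Fin n → Fin n) (π∘ρ : ∀ j → π (ρ j) ≡ j) (ρ∘π : ∀ i → ρ (π i) ≡ i) where

      private
        total-unit : ∀ d → total (λ i → lookup d i · unit (π i)) ≡ permute ρ d
        total-unit d = ≡.trans (≡.sym (Vec.tabulate∘lookup _)) (Vec.tabulate-cong λ j → begin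
          lookup (total (λ i → lookup d i · unit (π i))) j       ≡⟨ lookup-total _ j (ρ j) (λ i ρj≢i → ≡.trans (lookup-· (lookup d i) (unit (π i)) j)
                                                                      (≡.trans (cong (lookup d i ℕ.*_) (≡.trans (lookup-unit (π i) j) (cong (if_then 1 else 0)
                                                                        (dec-false (π i Fin.≟ j) λ { ≡.refl → ρj≢i (ρ∘π i) })))) (ℕ.*-zeroʳ (lookup d i)))) ⟩
          lookup (lookup d (ρ j) · unit (π (ρ j))) j             ≡⟨ lookup-· (lookup d (ρ j)) (unit (π (ρ j))) j ⟩
          lookup d (ρ j) ℕ.* lookup (unit (π (ρ j))) j           ≡⟨ cong (lookup d (ρ j) ℕ.*_) (≡.trans (lookup-unit (π (ρ j)) j)
                                                                      (cong (if_then 1 else 0) (dec-true (π (ρ j) Fin.≟ j) (π∘ρ j)))) ⟩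
          lookup d (ρ j) ℕ.* 1                                   ≡⟨ ℕ.*-identityʳ _ ⟩
          lookup d (ρ j)                                         ∎)
          where open ≡.≡-Reasoning

        permute-injective : ∀ {d e} → permute ρ d ≡ permute ρ e → d ≡ e
        permute-injective {d} {e} h = ≡.trans (≡.sym (Vec.tabulate∘lookup d)) (≡.trans (Vec.tabulate-cong λ i → begin
          lookup d i                        ≡⟨ cong (lookup d) (ρ∘π i) ⟨
          lookup d (ρ (π i))                ≡⟨ Vec.lookup∘tabulate (lookup d ∘ ρ) (π i) ⟨
          lookup (permute ρ d) (π i)        ≡⟨ cong (λ t → lookup t (π i)) h ⟩
          lookup (permute ρ e) (π i)        ≡⟨ Vec.lookup∘tabulate (lookup e ∘ ρ) (π i) ⟩
          lookup e (ρ (π i))                ≡⟨ cong (lookup e) (ρ∘π i) ⟩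
          lookup e i                        ∎) (Vec.tabulate∘lookup e))
          where open ≡.≡-Reasoning

      -- Sends the variable i to c_i times the variable π i. The exponent of the variable j
      -- afterwards is the former exponent at ρ j, hence `permute ρ`.
      monomialMatrix : Vector Carrier n → Matrix
      monomialMatrix c i j = [ does (π i Fin.≟ j) ]· c i

      ⟪⟫-monomialMatrix : ∀ c f p → ⟪ f ⟫ (monomialMatrix c • p) ≈ ⟪ (λ d → power c d * f (permute ρ d)) ⟫ p
      ⟪⟫-monomialMatrix c f p = trans (functional (substitute-cong {λ i → linear (monomialMatrix c i)} {λ i → (c i , unit (π i)) ∷ []}
        (λ i → linear-unit (c i) (π i)) (𝓟.refl {p})) f)
        (trans (⟪⟫-substitute f (λ i → (c i , unit (π i)) ∷ []) p) (⟪⟫-congᶠ (λ d →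
          trans (reflexive (cong ⟪ f ⟫ (monomial-product c (unit ∘ π) d)))
            (trans (⟪⟫-monomial f (power c d) _) (*-congˡ (reflexive (cong f (total-unit d)))))) p))

      -- Exponents are permuted injectively, so only the exponent `e` of `p` contributes to this
      -- coefficient.
      coefficient-monomialMatrix : ∀ c p e → coefficient (monomialMatrix c • p) (permute ρ e) ≈ power c e * coefficient p e
      coefficient-monomialMatrix c p e = begin
        coefficient (monomialMatrix c • p) (permute ρ e)              ≈⟨ coefficient-δ (monomialMatrix c • p) (permute ρ e) ⟩
        ⟪ δ (permute ρ e) ⟫ (monomialMatrix c • p)                    ≈⟨ ⟪⟫-monomialMatrix c (δ (permute ρ e)) p ⟩
        ⟪ (λ d → power c d * δ (permute ρ e) (permute ρ d)) ⟫ p       ≈⟨ ⟪⟫-congᶠ step p ⟩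
        ⟪ (λ d → power c e * δ e d) ⟫ p                               ≈⟨ ⟪⟫-*ˡ (power c e) (δ e) p ⟩
        power c e * ⟪ δ e ⟫ p                                         ≈⟨ *-congˡ (coefficient-δ p e) ⟨
        power c e * coefficient p e                                   ∎
        where
        open ≈
        step : ∀ d → power c d * δ (permute ρ e) (permute ρ d) ≈ power c e * δ e d
        step d with d ≟ᵉ e
        ... | yes ≡.refl = *-congˡ (reflexive (cong ([_]· 1#) (dec-true (permute ρ d ≟ᵉ permute ρ d) ≡.refl)))
        ... | no d≢e = trans (*-congˡ (reflexive (cong ([_]· 1#) (dec-false (permute ρ d ≟ᵉ permute ρ e) (d≢e ∘ permute-injective)))))
                         (trans (zeroʳ _) (sym (zeroʳ _)))

    private
      power-1 : ∀ {m} (d : Vec ℕ m) → power (λ _ → 1#) d ≈ 1#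
      power-1 []      = refl
      power-1 (k ∷ d) = trans (*-cong (1^ k) (power-1 d)) (*-identityˡ 1#)
        where
        1^ : ∀ k → 1# ^ k ≈ 1#
        1^ zero    = refl
        1^ (suc k) = trans (*-identityˡ _) (1^ k)

    •-I : ∀ p → I • p ≋ p
    •-I p = ext λ f → trans (⟪⟫-monomialMatrix id id (λ _ → ≡.refl) (λ _ → ≡.refl) (λ _ → 1#) f p)
      (⟪⟫-congᶠ (λ d → trans (*-cong (power-1 d) (reflexive (cong f (Vec.tabulate∘lookup d)))) (*-identityˡ _)) p)

    ⟨⟩-invariant : ∀ {s} {S : Pred Matrix s} p → (∀ A → S A → A • p ≋ p) → ∀ A → ⟨ S ⟩ᴹ A → A • p ≋ p
    ⟨⟩-invariant p h A (generator A∈) = h A A∈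
    ⟨⟩-invariant p h _ identity = •-I p
    ⟨⟩-invariant p h _ (product {A} {B} A∈ B∈) = 𝓟.trans (•-* A B p)
      (𝓟.trans (•-congʳ B (⟨⟩-invariant p h A A∈)) (⟨⟩-invariant p h B B∈))
    -- `p` is rewritten as `A • p`, so that `B` meets its inverse.
    ⟨⟩-invariant p h B (inverse {A} A∈ AB≈I _) = begin
      B • p           ≈⟨ •-congʳ B (⟨⟩-invariant p h A A∈) ⟨
      B • (A • p)     ≈⟨ •-* A B p ⟨
      (A *ᴹ B) • p    ≈⟨ •-congˡ (A *ᴹ B) I p AB≈I ⟩
      I • p           ≈⟨ •-I p ⟩
      p               ∎
      where open ≋
    ⟨⟩-invariant p h B (respects {A} A≈B A∈) = 𝓟.trans (•-congˡ B A p (λ i j → sym (A≈B i j))) (⟨⟩-invariant p h A A∈)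

    -- A condition on the listed terms, even those that cancel. It passes to products by inspection,
    -- whereas `Homogeneous` concerns coefficients and respects equality of polynomials.
    HasDegree : ℕ → Polynomial → Set a
    HasDegree k = All λ (c , d) → Vec.sum d ≡ k

    HasDegree⇒Homogeneous : ∀ {k p} → HasDegree k p → Homogeneous k p
    HasDegree⇒Homogeneous []                      e e≢k = refl
    HasDegree⇒Homogeneous {p = (c , d) ∷ p} (d≡k ∷ h) e e≢k = trans
      (+-cong (reflexive (cong ([_]· c) (dec-false (d ≟ᵉ e) λ { ≡.refl → e≢k d≡k }))) (HasDegree⇒Homogeneous h e e≢k))
      (+-identityˡ 0#)

    Homogeneous-cong : ∀ {k p q} → p ≋ q → Homogeneous k p → Homogeneous k q
    Homogeneous-cong p≋q h e e≢k = trans (sym (≋⇒≈ᴾ p≋q e)) (h e e≢k)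

    sum-+ : ∀ {m} (d e : Vec ℕ m) → Vec.sum (zipWith ℕ._+_ d e) ≡ Vec.sum d ℕ.+ Vec.sum e
    sum-+ []      []      = ≡.refl
    sum-+ (k ∷ d) (l ∷ e) = ≡.trans (cong (k ℕ.+ l ℕ.+_) (sum-+ d e)) (+-interchange k l _ _)
      where open Algebra.Properties.CommutativeSemigroup ℕ.+-commutativeSemigroup renaming (interchange to +-interchange)

    sum-0 : ∀ m → Vec.sum (replicate m 0) ≡ 0
    sum-0 zero    = ≡.refl
    sum-0 (suc m) = sum-0 m

    sum-unit : ∀ {m} (i : Fin m) → Vec.sum (unit i) ≡ 1
    sum-unit {suc m} zero    = cong suc (sum-0 m)
    sum-unit {suc m} (suc i) = sum-unit i

    HasDegree-* : ∀ {k l p q} → HasDegree k p → HasDegree l q → HasDegree (k ℕ.+ l) (p *ᴾ q)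
    HasDegree-* []      hq = []
    HasDegree-* {p = (c , d) ∷ p} (h ∷ hp) hq = All.++⁺
      (All.map⁺ (All.map (λ {t} h′ → ≡.trans (sum-+ d (proj₂ t)) (cong₂ ℕ._+_ h h′)) hq)) (HasDegree-* hp hq)

    private
      HasDegree-1 : HasDegree 0 (constant 1#)
      HasDegree-1 = sum-0 n ∷ []

      HasDegree-^ : ∀ {p} → HasDegree 1 p → ∀ k → HasDegree k (p P.^ k)
      HasDegree-^ h zero    = HasDegree-1
      HasDegree-^ h (suc k) = HasDegree-* h (HasDegree-^ h k)

      HasDegree-product : ∀ {m} {q : Vector Polynomial m} → (∀ i → HasDegree 1 (q i)) → ∀ d →
                          HasDegree (Vec.sum d) (P.product λ i → q i P.^ lookup d i)
      HasDegree-product h []      = HasDegree-1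
      HasDegree-product h (k ∷ d) = HasDegree-* (HasDegree-^ (h zero) k) (HasDegree-product (h ∘ suc) d)

      HasDegree-combination : ∀ {m} (v : Vector Carrier m) (p : Vector Polynomial m) → (∀ i → HasDegree 1 (p i)) →
                              HasDegree 1 (combination v p)
      HasDegree-combination {zero}  v p h = []
      HasDegree-combination {suc m} v p h = All.++⁺ (HasDegree-* {p = constant (v zero)} (sum-0 n ∷ []) (h zero))
        (HasDegree-combination (v ∘ suc) (p ∘ suc) (h ∘ suc))

    -- Exponents of other degrees have coefficient zero in `p`; for those of degree k, the image of
    -- the monomial is a product of k linear forms.
    •-Homogeneous : ∀ A {k p} → Homogeneous k p → Homogeneous k (A • p)
    •-Homogeneous A {k} {p} h e e≢k = trans (coefficient-δ (A • p) e) (trans (⟪⟫-substitute (δ e) (λ i → linear (A i)) p)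
      (⟪⟫-vanish p _ λ d → vanish d (Vec.sum d ℕ.≟ k)))
      where
      vanish : ∀ d → Dec (Vec.sum d ≡ k) → coefficient p d * ⟪ δ e ⟫ ((λ i → linear (A i)) ^ᵛ d) ≈ 0#
      vanish d (no d≢k) = trans (*-congʳ (h d d≢k)) (zeroˡ _)
      vanish d (yes ≡.refl) = trans (*-congˡ (trans (sym (coefficient-δ ((λ i → linear (A i)) ^ᵛ d) e))
        (HasDegree⇒Homogeneous (HasDegree-product (λ i → HasDegree-combination (A i) var λ j → sum-unit j ∷ []) d) e e≢k))) (zeroʳ _)

    evaluate : Vector Carrier n → Polynomial → Carrier
    evaluate v = ⟪ power v ⟫

    private
      power-+ : ∀ {m} (v : Vector Carrier m) d e → power v (zipWith ℕ._+_ d e) ≈ power v d * power v e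
      power-+ v []      []      = sym (*-identityˡ 1#)
      power-+ v (k ∷ d) (l ∷ e) = trans (*-cong (^-homo-* (v zero) k l) (power-+ (v ∘ suc) d e)) (*.interchange _ _ _ _)

      power-0 : ∀ {m} (v : Vector Carrier m) → power v (replicate m 0) ≈ 1#
      power-0 {zero}  v = refl
      power-0 {suc m} v = trans (*-identityˡ _) (power-0 (v ∘ suc))

      power-unit : ∀ {m} (v : Vector Carrier m) i → power v (unit i) ≈ v i
      power-unit v zero    = trans (*-cong (*-identityʳ (v zero)) (power-0 (v ∘ suc))) (*-identityʳ (v zero))
      power-unit v (suc i) = trans (*-identityˡ _) (power-unit (v ∘ suc) i)

    power-cong : ∀ {m} {v w : Vector Carrier m} → (∀ i → v i ≈ w i) → ∀ d → power v d ≈ power w d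
    power-cong h []      = refl
    power-cong h (k ∷ d) = *-cong (^-congˡ k (h zero)) (power-cong (h ∘ suc) d)

    evaluate-* : ∀ v p q → evaluate v (p *ᴾ q) ≈ evaluate v p * evaluate v q
    evaluate-* v p q = trans (⟪⟫-*ᴾ (power v) p q) (trans (⟪⟫-congᶠ (λ d → trans (⟪⟫-congᶠ (power-+ v d) q) (trans (⟪⟫-*ˡ (power v d) (power v) q) (*-comm _ _))) p)
      (trans (⟪⟫-*ˡ (evaluate v q) (power v) p) (*-comm _ _)))

    private
      evaluate-1 : ∀ v → evaluate v (constant 1#) ≈ 1#
      evaluate-1 v = trans (⟪⟫-constant (power v) 1#) (trans (*-identityˡ _) (power-0 v))

      evaluate-^ : ∀ v p k → evaluate v (p P.^ k) ≈ evaluate v p ^ k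
      evaluate-^ v p zero    = evaluate-1 v
      evaluate-^ v p (suc k) = trans (evaluate-* v p (p P.^ k)) (*-congˡ (evaluate-^ v p k))

      evaluate-product : ∀ v {m} (q : Vector Polynomial m) d →
                         evaluate v (P.product λ i → q i P.^ lookup d i) ≈ power (evaluate v ∘ q) d
      evaluate-product v q []      = evaluate-1 v
      evaluate-product v q (k ∷ d) = trans (evaluate-* v (q zero P.^ k) (P.product λ i → q (suc i) P.^ lookup d i))
        (*-cong (evaluate-^ v (q zero) k) (evaluate-product v (q ∘ suc) d))

    evaluate-• : ∀ A v p → evaluate v (A • p) ≈ evaluate (λ i → sum λ j → A i j * v j) p
    evaluate-• A v p = trans (⟪⟫-substitute (power v) (λ i → linear (A i)) p)
      (⟪⟫-congᶠ {λ d → ⟪ power v ⟫ ((λ i → linear (A i)) ^ᵛ d)} {power (λ i → sum λ j → A i j * v j)} (λ d →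
      trans (evaluate-product v (λ i → linear (A i)) d) (power-cong {v = λ i → evaluate v (linear (A i))} (λ i → trans (⟪⟫-linear (power v) (A i))
        (sum-cong-≋ λ j → *-congˡ {A i j} (power-unit v j))) d)) p)

-- Exact arithmetic with eighth roots of unity

module CyclotomicNumbers where

  open RingBasics
  open PolynomialRings
  open MatrixActions

  -- (a + b ζ + c ζ² + d ζ³) / 2ᵏ, where ζ⁴ = -1.
  data Cyclotomic : Set where
    cyclotomic : (a b c d : ℤ) (k : ℕ) → Cyclotomic

  module _ where
    open Data.Integer.Base using (_+_; _*_; _-_)

    infixl 6 _⊞_
    infixl 7 _⊠_
    _⊞_ _⊠_ : Cyclotomic → Cyclotomic → Cyclotomic
    cyclotomic a b c d k ⊞ cyclotomic e f g h l =
      cyclotomic (s * a + t * e) (s * b + t * f) (s * c + t * g) (s * d + t * h) (k ℕ.⊔ l)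
      where
      s t : ℤ
      s = + (2 ℕ.^ (l ℕ.∸ k))
      t = + (2 ℕ.^ (k ℕ.∸ l))
    cyclotomic a b c d k ⊠ cyclotomic e f g h l = cyclotomic
      (a * e - b * h - c * g - d * f)
      (a * f + b * e - c * h - d * g)
      (a * g + b * f + c * e - d * h)
      (a * h + b * g + c * f + d * e)
      (k ℕ.+ l)

    infix 4 _≃_ _≟ᶜ_
    -- Equality of the fractions, by cross-multiplication.
    data _≃_ : Cyclotomic → Cyclotomic → Set where
      cross : ∀ {a b c d k e f g h l} →
              + (2 ℕ.^ l) * a ≡ + (2 ℕ.^ k) * e → + (2 ℕ.^ l) * b ≡ + (2 ℕ.^ k) * f →
              + (2 ℕ.^ l) * c ≡ + (2 ℕ.^ k) * g → + (2 ℕ.^ l) * d ≡ + (2 ℕ.^ k) * h →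
              cyclotomic a b c d k ≃ cyclotomic e f g h l

    _≟ᶜ_ : ∀ x y → Dec (x ≃ y)
    cyclotomic a b c d k ≟ᶜ cyclotomic e f g h l = map′ (λ (p , q , r , s) → cross p q r s) (λ { (cross p q r s) → p , q , r , s })
      (_ ℤ.≟ _ ×-dec _ ℤ.≟ _ ×-dec _ ℤ.≟ _ ×-dec _ ℤ.≟ _)

  intᶜ : ℤ → Cyclotomic
  intᶜ k = cyclotomic k 0ℤ 0ℤ 0ℤ 0

  ζᶜ : ℕ → Cyclotomic
  ζᶜ zero    = intᶜ 1ℤ
  ζᶜ (suc k) = cyclotomic 0ℤ 1ℤ 0ℤ 0ℤ 0 ⊠ ζᶜ k

  infixl 7 _⊠ᴹ_
  CMatrix : Set
  CMatrix = Fin 6 → Fin 6 → Cyclotomic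

  0ᶜ : Cyclotomic
  0ᶜ = cyclotomic 0ℤ 0ℤ 0ℤ 0ℤ 0

  _⊠ᴹ_ : CMatrix → CMatrix → CMatrix
  (A ⊠ᴹ B) i j = Data.Vec.Functional.foldr _⊞_ 0ᶜ λ k → A i k ⊠ B k j

  module CyclotomicEvaluation {r ℓ} (R : CommutativeRing r ℓ)
    (ζ half : CommutativeRing.Carrier R) (ζ⁴≈-1 : RingBasics.FourthPowerIs-1 R ζ) (half+half≈1 : RingBasics.IsHalf R half) where
    open CommutativeRing R hiding (zero)

    open Integers R
    open Algebra.Properties.Semiring.Exp semiring using (_^_; ^-homo-*)
    open Algebra.Properties.Semiring.Sum semiring using (sum; sum-cong-≋)
    open Defs.Matrices R 6
    open Relation.Binary.Reasoning.Setoid setoid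

    numerator : ℤ → ℤ → ℤ → ℤ → Carrier
    numerator a b c d = fromℤ a + fromℤ b * ζ + fromℤ c * (ζ * ζ) + fromℤ d * (ζ * ζ * ζ)

    ⟦_⟧ : Cyclotomic → Carrier
    ⟦ cyclotomic a b c d k ⟧ = half ^ k * numerator a b c d

    private
      half^*2^ : ∀ k → half ^ k * fromℤ (+ (2 ℕ.^ k)) ≈ 1#
      half^*2^ zero    = trans (*-identityˡ _) fromℤ-1
      half^*2^ (suc k) = begin
        half * half ^ k * fromℤ (+ (2 ℕ.* 2 ℕ.^ k))                    ≈⟨ *-congˡ (trans (reflexive (cong fromℤ (ℤ.pos-* 2 (2 ℕ.^ k)))) (fromℤ-* (+ 2) (+ (2 ℕ.^ k)))) ⟩
        half * half ^ k * (fromℤ (+ 2) * fromℤ (+ (2 ℕ.^ k)))          ≈⟨ solve 3 (λ h x y → h :* x :* (con (+ 2) :* y) := (h :+ h) :* (x :* y)) refl half (half ^ k) (fromℤ (+ (2 ℕ.^ k))) ⟩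
        (half + half) * (half ^ k * fromℤ (+ (2 ℕ.^ k)))               ≈⟨ *-cong half+half≈1 (half^*2^ k) ⟩
        1# * 1#                                                        ≈⟨ *-identityˡ 1# ⟩
        1#                                                             ∎

      numerator-scale : ∀ s a b c d → numerator (s ℤ.* a) (s ℤ.* b) (s ℤ.* c) (s ℤ.* d) ≈ fromℤ s * numerator a b c d
      numerator-scale s a b c d = trans
        (+-cong (+-cong (+-cong (fromℤ-* s a) (*-congʳ (fromℤ-* s b))) (*-congʳ (fromℤ-* s c))) (*-congʳ (fromℤ-* s d)))
        (solve 6 (λ s a b c d z → s :* a :+ s :* b :* z :+ s :* c :* (z :* z) :+ s :* d :* (z :* z :* z)
            := s :* (a :+ b :* z :+ c :* (z :* z) :+ d :* (z :* z :* z))) refl (fromℤ s) (fromℤ a) (fromℤ b) (fromℤ c) (fromℤ d) ζ)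

      numerator-+ : ∀ a b c d e f g h → numerator (a ℤ.+ e) (b ℤ.+ f) (c ℤ.+ g) (d ℤ.+ h) ≈ numerator a b c d + numerator e f g h
      numerator-+ a b c d e f g h = trans
        (+-cong (+-cong (+-cong (fromℤ-+ a e) (*-congʳ (fromℤ-+ b f))) (*-congʳ (fromℤ-+ c g))) (*-congʳ (fromℤ-+ d h)))
        (solve 9 (λ a b c d e f g h z → a :+ e :+ (b :+ f) :* z :+ (c :+ g) :* (z :* z) :+ (d :+ h) :* (z :* z :* z)
            := (a :+ b :* z :+ c :* (z :* z) :+ d :* (z :* z :* z)) :+ (e :+ f :* z :+ g :* (z :* z) :+ h :* (z :* z :* z)))
          refl (fromℤ a) (fromℤ b) (fromℤ c) (fromℤ d) (fromℤ e) (fromℤ f) (fromℤ g) (fromℤ h) ζ)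

      half^-shift : ∀ k m x → half ^ (k ℕ.+ m) * (fromℤ (+ (2 ℕ.^ m)) * x) ≈ half ^ k * x
      half^-shift k m x = begin
        half ^ (k ℕ.+ m) * (fromℤ (+ (2 ℕ.^ m)) * x)          ≈⟨ *-congʳ (^-homo-* half k m) ⟩
        half ^ k * half ^ m * (fromℤ (+ (2 ℕ.^ m)) * x)       ≈⟨ solve 4 (λ a b c x → a :* b :* (c :* x) := a :* x :* (b :* c)) refl (half ^ k) (half ^ m) _ x ⟩
        half ^ k * x * (half ^ m * fromℤ (+ (2 ℕ.^ m)))       ≈⟨ *-congˡ (half^*2^ m) ⟩
        half ^ k * x * 1#                                     ≈⟨ *-identityʳ _ ⟩
        half ^ k * x                                          ∎

      ⊔≡+∸ : ∀ m n → m ℕ.⊔ n ≡ m ℕ.+ (n ℕ.∸ m)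
      ⊔≡+∸ zero    n       = ≡.refl
      ⊔≡+∸ (suc m) zero    = cong suc (≡.sym (ℕ.+-identityʳ m))
      ⊔≡+∸ (suc m) (suc n) = cong suc (⊔≡+∸ m n)

      half^-⊔ˡ : ∀ k l x → half ^ (k ℕ.⊔ l) * (fromℤ (+ (2 ℕ.^ (l ℕ.∸ k))) * x) ≈ half ^ k * x
      half^-⊔ˡ k l x = trans (*-congʳ (reflexive (cong (half ^_) (⊔≡+∸ k l)))) (half^-shift k (l ℕ.∸ k) x)

      half^-⊔ʳ : ∀ k l x → half ^ (k ℕ.⊔ l) * (fromℤ (+ (2 ℕ.^ (k ℕ.∸ l))) * x) ≈ half ^ l * x
      half^-⊔ʳ k l x = trans (*-congʳ (reflexive (cong (half ^_) (ℕ.⊔-comm k l)))) (half^-⊔ˡ l k x)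

    ⟦⟧-⊞ : ∀ x y → ⟦ x ⊞ y ⟧ ≈ ⟦ x ⟧ + ⟦ y ⟧
    ⟦⟧-⊞ (cyclotomic a b c d k) (cyclotomic e f g h l) = begin
      half ^ (k ℕ.⊔ l) * numerator (s ℤ.* a ℤ.+ t ℤ.* e) (s ℤ.* b ℤ.+ t ℤ.* f) (s ℤ.* c ℤ.+ t ℤ.* g) (s ℤ.* d ℤ.+ t ℤ.* h)
        ≈⟨ *-congˡ (trans (numerator-+ (s ℤ.* a) (s ℤ.* b) (s ℤ.* c) (s ℤ.* d) (t ℤ.* e) (t ℤ.* f) (t ℤ.* g) (t ℤ.* h))
                     (+-cong (numerator-scale s a b c d) (numerator-scale t e f g h))) ⟩
      half ^ (k ℕ.⊔ l) * (fromℤ s * numerator a b c d + fromℤ t * numerator e f g h)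
        ≈⟨ distribˡ _ _ _ ⟩
      half ^ (k ℕ.⊔ l) * (fromℤ s * numerator a b c d) + half ^ (k ℕ.⊔ l) * (fromℤ t * numerator e f g h)
        ≈⟨ +-cong (half^-⊔ˡ k l _) (half^-⊔ʳ k l _) ⟩
      half ^ k * numerator a b c d + half ^ l * numerator e f g h ∎
      where
      s t : ℤ
      s = + (2 ℕ.^ (l ℕ.∸ k))
      t = + (2 ℕ.^ (k ℕ.∸ l))

    private
      fromℤ-- : ∀ x y → fromℤ (x ℤ.- y) ≈ fromℤ x - fromℤ y
      fromℤ-- x y = trans (fromℤ-+ x (ℤ.- y)) (+-congˡ (fromℤ-neg y))

      fromℤ-+* : ∀ x {u} c d → fromℤ x ≈ u → fromℤ (x ℤ.+ c ℤ.* d) ≈ u + fromℤ c * fromℤ d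
      fromℤ-+* x c d p = trans (fromℤ-+ x (c ℤ.* d)) (+-cong p (fromℤ-* c d))
      fromℤ--* : ∀ x {u} c d → fromℤ x ≈ u → fromℤ (x ℤ.- c ℤ.* d) ≈ u - fromℤ c * fromℤ d
      fromℤ--* x c d p = trans (fromℤ-- x (c ℤ.* d)) (+-cong p (-‿cong (fromℤ-* c d)))

    ⟦⟧-⊠ : ∀ x y → ⟦ x ⊠ y ⟧ ≈ ⟦ x ⟧ * ⟦ y ⟧
    ⟦⟧-⊠ (cyclotomic a b c d k) (cyclotomic e f g h l) = begin
      half ^ (k ℕ.+ l) * numerator (a ℤ.* e ℤ.- b ℤ.* h ℤ.- c ℤ.* g ℤ.- d ℤ.* f) (a ℤ.* f ℤ.+ b ℤ.* e ℤ.- c ℤ.* h ℤ.- d ℤ.* g)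
                                   (a ℤ.* g ℤ.+ b ℤ.* f ℤ.+ c ℤ.* e ℤ.- d ℤ.* h) (a ℤ.* h ℤ.+ b ℤ.* g ℤ.+ c ℤ.* f ℤ.+ d ℤ.* e)
        ≈⟨ *-cong (^-homo-* half k l) (+-cong (+-cong (+-cong
             (fromℤ--* (a ℤ.* e ℤ.- b ℤ.* h ℤ.- c ℤ.* g) d f (fromℤ--* (a ℤ.* e ℤ.- b ℤ.* h) c g (fromℤ--* (a ℤ.* e) b h (fromℤ-* a e))))
             (*-congʳ (fromℤ--* (a ℤ.* f ℤ.+ b ℤ.* e ℤ.- c ℤ.* h) d g (fromℤ--* (a ℤ.* f ℤ.+ b ℤ.* e) c h (fromℤ-+* (a ℤ.* f) b e (fromℤ-* a f))))))
             (*-congʳ (fromℤ--* (a ℤ.* g ℤ.+ b ℤ.* f ℤ.+ c ℤ.* e) d h (fromℤ-+* (a ℤ.* g ℤ.+ b ℤ.* f) c e (fromℤ-+* (a ℤ.* g) b f (fromℤ-* a g))))))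
             (*-congʳ (fromℤ-+* (a ℤ.* h ℤ.+ b ℤ.* g ℤ.+ c ℤ.* f) d e (fromℤ-+* (a ℤ.* h ℤ.+ b ℤ.* g) c f (fromℤ-+* (a ℤ.* h) b g (fromℤ-* a h)))))) ⟩
      -- The solver treats ζ as a free variable, so the two sides differ by a multiple of ζ⁴ + 1.
      -- The multiplier, which collects the terms of degree 4 to 6 in ζ, is made explicit as `w`,
      -- and its product with ζ⁴ + 1 is then annihilated.
      _ ≈⟨ solve 11 (λ u v a b c d e f g h z →
             u :* v :* (a :* e :- b :* h :- c :* g :- d :* f :+ (a :* f :+ b :* e :- c :* h :- d :* g) :* z
               :+ (a :* g :+ b :* f :+ c :* e :- d :* h) :* (z :* z) :+ (a :* h :+ b :* g :+ c :* f :+ d :* e) :* (z :* z :* z))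
             := u :* (a :+ b :* z :+ c :* (z :* z) :+ d :* (z :* z :* z)) :* (v :* (e :+ f :* z :+ g :* (z :* z) :+ h :* (z :* z :* z)))
               :- (z :* z :* (z :* z) :- :- con 1ℤ) :* (u :* v :* (b :* h :+ c :* g :+ d :* f :+ (c :* h :+ d :* g) :* z :+ d :* h :* (z :* z))))
           refl (half ^ k) (half ^ l) (fromℤ a) (fromℤ b) (fromℤ c) (fromℤ d) (fromℤ e) (fromℤ f) (fromℤ g) (fromℤ h) ζ ⟩
      ⟦ cyclotomic a b c d k ⟧ * ⟦ cyclotomic e f g h l ⟧ - (ζ * ζ * (ζ * ζ) - - fromℤ 1ℤ) * w
        ≈⟨ +-congˡ (-‿cong (trans (*-congʳ (trans (+-cong ζ⁴≈-1 (-‿cong (-‿cong fromℤ-1))) (-‿inverseʳ (- 1#)))) (zeroˡ w))) ⟩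
      ⟦ cyclotomic a b c d k ⟧ * ⟦ cyclotomic e f g h l ⟧ - 0#
        ≈⟨ solve 1 (λ x → x :- con 0ℤ := x) refl _ ⟩
      ⟦ cyclotomic a b c d k ⟧ * ⟦ cyclotomic e f g h l ⟧ ∎
      where
      w : Carrier
      w = half ^ k * half ^ l * (fromℤ b * fromℤ h + fromℤ c * fromℤ g + fromℤ d * fromℤ f
            + (fromℤ c * fromℤ h + fromℤ d * fromℤ g) * ζ + fromℤ d * fromℤ h * (ζ * ζ))

    ⟦⟧-cong : ∀ {x y} → x ≃ y → ⟦ x ⟧ ≈ ⟦ y ⟧
    ⟦⟧-cong {cyclotomic a b c d k} {cyclotomic e f g h l} (cross p q r s) = begin
      half ^ k * numerator a b c d                                             ≈⟨ half^-shift k l _ ⟨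
      half ^ (k ℕ.+ l) * (fromℤ (+ (2 ℕ.^ l)) * numerator a b c d)             ≈⟨ *-cong (reflexive (cong (half ^_) (ℕ.+-comm k l))) (begin
        fromℤ (+ (2 ℕ.^ l)) * numerator a b c d                                  ≈⟨ numerator-scale S a b c d ⟨
        numerator (S ℤ.* a) (S ℤ.* b) (S ℤ.* c) (S ℤ.* d)                        ≈⟨ reflexive (cong₂ (λ (x , y) (u , v) → numerator x y u v) (cong₂ _,_ p q) (cong₂ _,_ r s)) ⟩
        numerator (T ℤ.* e) (T ℤ.* f) (T ℤ.* g) (T ℤ.* h)                        ≈⟨ numerator-scale T e f g h ⟩
        fromℤ (+ (2 ℕ.^ k)) * numerator e f g h                                  ∎) ⟩
      half ^ (l ℕ.+ k) * (fromℤ (+ (2 ℕ.^ k)) * numerator e f g h)             ≈⟨ half^-shift l k _ ⟩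
      half ^ l * numerator e f g h                                             ∎
      where
      S T : ℤ
      S = + (2 ℕ.^ l)
      T = + (2 ℕ.^ k)

    ⟦_⟧ᴹ : CMatrix → Matrix
    ⟦ A ⟧ᴹ i j = ⟦ A i j ⟧

    ⟦⟧-0 : ⟦ 0ᶜ ⟧ ≈ 0#
    ⟦⟧-0 = solve 2 (λ x z → x :* (con 0ℤ :+ con 0ℤ :* z :+ con 0ℤ :* (z :* z) :+ con 0ℤ :* (z :* z :* z)) := con 0ℤ) refl 1# ζ

    ⟦⟧ᴹ-* : ∀ A B → ⟦ A ⊠ᴹ B ⟧ᴹ ≈ᴹ ⟦ A ⟧ᴹ *ᴹ ⟦ B ⟧ᴹ
    ⟦⟧ᴹ-* A B i j = go λ k → A i k ⊠ B k j , ⟦⟧-⊠ (A i k) (B k j)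
      where
      go : ∀ {m} {t : Vector Carrier m} (f : ∀ k → Σ Cyclotomic λ x → ⟦ x ⟧ ≈ t k) →
           ⟦ Data.Vec.Functional.foldr _⊞_ 0ᶜ (proj₁ ∘ f) ⟧ ≈ sum t
      go {zero}  f = ⟦⟧-0
      go {suc m} f = trans (⟦⟧-⊞ (proj₁ (f zero)) _) (+-cong (proj₂ (f zero)) (go (f ∘ suc)))

    ⟦intᶜ⟧ : ∀ k → ⟦ intᶜ k ⟧ ≈ fromℤ k
    ⟦intᶜ⟧ k = trans (*-identityˡ _) (solve 2 (λ k z → k :+ con 0ℤ :* z :+ con 0ℤ :* (z :* z) :+ con 0ℤ :* (z :* z :* z) := k) refl (fromℤ k) ζ)

    private
      ⟦ζ⟧ : ⟦ cyclotomic 0ℤ 1ℤ 0ℤ 0ℤ 0 ⟧ ≈ ζ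
      ⟦ζ⟧ = trans (*-identityˡ _)
        (solve 1 (λ z → con 0ℤ :+ con 1ℤ :* z :+ con 0ℤ :* (z :* z) :+ con 0ℤ :* (z :* z :* z) := z) refl ζ)

    ⟦ζᶜ⟧ : ∀ k → ⟦ ζᶜ k ⟧ ≈ ζ ^ k
    ⟦ζᶜ⟧ zero    = trans (⟦intᶜ⟧ 1ℤ) fromℤ-1
    ⟦ζᶜ⟧ (suc k) = trans (⟦⟧-⊠ (cyclotomic 0ℤ 1ℤ 0ℤ 0ℤ 0) (ζᶜ k)) (*-cong ⟦ζ⟧ (⟦ζᶜ⟧ k))

    *ᴹ-cong : ∀ {A A′ B B′} → A ≈ᴹ A′ → B ≈ᴹ B′ → A *ᴹ B ≈ᴹ A′ *ᴹ B′
    *ᴹ-cong {A} {A′} {B} {B′} h h′ i j = sum-cong-≋ {6} {λ k → A i k * B k j} {λ k → A′ i k * B′ k j} λ k → *-cong (h i k) (h′ k j)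

-- The generators of `H` and some of their products in the plane coordinates

module GeneratorMatrices where

  open RingBasics
  open PolynomialRings
  open MatrixActions
  open CyclotomicNumbers

  infix 4 _≃ᴹ?_
  _≃ᴹ?_ : ∀ (A B : CMatrix) → Dec (∀ i j → A i j ≃ B i j)
  A ≃ᴹ? B = Fin.all? λ i → Fin.all? λ j → A i j ≟ᶜ B i j

  permutationᶜ : Vec (Fin 6) 6 → Vec ℕ 6 → CMatrix
  permutationᶜ π a i j = if does (lookup π i Fin.≟ j) then ζᶜ (lookup a i) else 0ᶜ

  integerᶜ : Cyclotomic → Vec (Vec ℤ 6) 6 → CMatrix
  integerᶜ c rows i j = c ⊠ intᶜ (lookup (lookup rows i) j)

  -- `κᶜ` is (z + z³)/2 = i/√2. Thus κ times the matrix with rows (1, 1) and (1, -1) is i times an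
  -- orthogonal involution, and two such factors multiply to 2κ² = -1.
  halfᶜ κᶜ : Cyclotomic
  halfᶜ = cyclotomic 1ℤ 0ℤ 0ℤ 0ℤ 1
  κᶜ    = cyclotomic 0ℤ 1ℤ 0ℤ 1ℤ 1

  2ℤ -2ℤ : ℤ
  2ℤ  = + 2
  -2ℤ = -[1+ 1 ]

  identityπ swap₁₂ swap₂₃ swapBE : Vec (Fin 6) 6
  identityπ = 0F ∷ 1F ∷ 2F ∷ 3F ∷ 4F ∷ 5F ∷ []
  swap₁₂    = 2F ∷ 3F ∷ 0F ∷ 1F ∷ 4F ∷ 5F ∷ []
  swap₂₃    = 0F ∷ 1F ∷ 4F ∷ 5F ∷ 2F ∷ 3F ∷ []
  swapBE    = 0F ∷ 1F ∷ 2F ∷ 3F ∷ 5F ∷ 4F ∷ []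

  X-rows U-rows : Vec (Vec ℤ 6) 6
  X-rows = (1ℤ ∷ 2ℤ ∷ 1ℤ ∷ 1ℤ ∷ 2ℤ ∷ 1ℤ ∷ [])
         ∷ (1ℤ ∷ 0ℤ ∷ -1ℤ ∷ 1ℤ ∷ 0ℤ ∷ -1ℤ ∷ [])
         ∷ (1ℤ ∷ -2ℤ ∷ 1ℤ ∷ 1ℤ ∷ -2ℤ ∷ 1ℤ ∷ [])
         ∷ (1ℤ ∷ 2ℤ ∷ 1ℤ ∷ -1ℤ ∷ -2ℤ ∷ -1ℤ ∷ [])
         ∷ (1ℤ ∷ 0ℤ ∷ -1ℤ ∷ -1ℤ ∷ 0ℤ ∷ 1ℤ ∷ [])
         ∷ (1ℤ ∷ -2ℤ ∷ 1ℤ ∷ -1ℤ ∷ 2ℤ ∷ -1ℤ ∷ [])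
         ∷ []
  U-rows = (1ℤ ∷ 0ℤ ∷ 1ℤ ∷ 0ℤ ∷ 0ℤ ∷ 0ℤ ∷ [])
         ∷ (0ℤ ∷ 0ℤ ∷ 0ℤ ∷ 1ℤ ∷ 0ℤ ∷ 1ℤ ∷ [])
         ∷ (1ℤ ∷ 0ℤ ∷ -1ℤ ∷ 0ℤ ∷ 0ℤ ∷ 0ℤ ∷ [])
         ∷ (0ℤ ∷ 0ℤ ∷ 0ℤ ∷ 1ℤ ∷ 0ℤ ∷ -1ℤ ∷ [])
         ∷ (0ℤ ∷ 2ℤ ∷ 0ℤ ∷ 0ℤ ∷ 0ℤ ∷ 0ℤ ∷ [])
         ∷ (0ℤ ∷ 0ℤ ∷ 0ℤ ∷ 0ℤ ∷ 2ℤ ∷ 0ℤ ∷ [])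
         ∷ []

  -- The change to the coordinates (s, p, t, q, B, E) and its inverse.
  Ûᶜ T̂ᶜ : CMatrix
  Ûᶜ = integerᶜ (intᶜ 1ℤ) U-rows
  T̂ᶜ = integerᶜ halfᶜ
    ( (1ℤ ∷ 0ℤ ∷ 1ℤ ∷ 0ℤ ∷ 0ℤ ∷ 0ℤ ∷ [])
    ∷ (0ℤ ∷ 0ℤ ∷ 0ℤ ∷ 0ℤ ∷ 1ℤ ∷ 0ℤ ∷ [])
    ∷ (1ℤ ∷ 0ℤ ∷ -1ℤ ∷ 0ℤ ∷ 0ℤ ∷ 0ℤ ∷ [])
    ∷ (0ℤ ∷ 1ℤ ∷ 0ℤ ∷ 1ℤ ∷ 0ℤ ∷ 0ℤ ∷ [])
    ∷ (0ℤ ∷ 0ℤ ∷ 0ℤ ∷ 0ℤ ∷ 0ℤ ∷ 1ℤ ∷ [])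
    ∷ (0ℤ ∷ 1ℤ ∷ 0ℤ ∷ -1ℤ ∷ 0ℤ ∷ 0ℤ ∷ [])
    ∷ [])

  -- In these coordinates `X` is a Hadamard matrix on the plane (s, p) and exchanges (t, q) with (B,
  -- E), again through Hadamard matrices.
  X′-rows : Vec (Vec ℤ 6) 6
  X′-rows = (1ℤ ∷ 1ℤ ∷ 0ℤ ∷ 0ℤ ∷ 0ℤ ∷ 0ℤ ∷ [])
          ∷ (1ℤ ∷ -1ℤ ∷ 0ℤ ∷ 0ℤ ∷ 0ℤ ∷ 0ℤ ∷ [])
          ∷ (0ℤ ∷ 0ℤ ∷ 0ℤ ∷ 0ℤ ∷ 1ℤ ∷ 1ℤ ∷ [])
          ∷ (0ℤ ∷ 0ℤ ∷ 0ℤ ∷ 0ℤ ∷ 1ℤ ∷ -1ℤ ∷ [])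
          ∷ (0ℤ ∷ 0ℤ ∷ 1ℤ ∷ 1ℤ ∷ 0ℤ ∷ 0ℤ ∷ [])
          ∷ (0ℤ ∷ 0ℤ ∷ 1ℤ ∷ -1ℤ ∷ 0ℤ ∷ 0ℤ ∷ [])
          ∷ []

  Xᶜ P₁ᶜ P₂ᶜ E₁ᶜ E₂ᶜ zIᶜ : CMatrix
  Xᶜ = integerᶜ κᶜ X′-rows
  P₁ᶜ = permutationᶜ swapBE (0 ∷ 0 ∷ 0 ∷ 0 ∷ 0 ∷ 0 ∷ [])
  P₂ᶜ = permutationᶜ swapBE (2 ∷ 2 ∷ 2 ∷ 6 ∷ 2 ∷ 2 ∷ [])
  E₁ᶜ = permutationᶜ swap₁₂ (0 ∷ 2 ∷ 0 ∷ 2 ∷ 1 ∷ 7 ∷ [])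
  E₂ᶜ = permutationᶜ swap₁₂ (0 ∷ 0 ∷ 0 ∷ 0 ∷ 1 ∷ 1 ∷ [])
  zIᶜ = permutationᶜ identityπ (replicate 6 1)

  P₁-rows P₂-rows : Vec (Vec ℤ 6) 6
  P₁-rows = (1ℤ ∷ 0ℤ ∷ 0ℤ ∷ 0ℤ ∷ 0ℤ ∷ 0ℤ ∷ [])
          ∷ (0ℤ ∷ 0ℤ ∷ 0ℤ ∷ 0ℤ ∷ 1ℤ ∷ 0ℤ ∷ [])
          ∷ (0ℤ ∷ 0ℤ ∷ 1ℤ ∷ 0ℤ ∷ 0ℤ ∷ 0ℤ ∷ [])
          ∷ (0ℤ ∷ 0ℤ ∷ 0ℤ ∷ 1ℤ ∷ 0ℤ ∷ 0ℤ ∷ [])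
          ∷ (0ℤ ∷ 1ℤ ∷ 0ℤ ∷ 0ℤ ∷ 0ℤ ∷ 0ℤ ∷ [])
          ∷ (0ℤ ∷ 0ℤ ∷ 0ℤ ∷ 0ℤ ∷ 0ℤ ∷ 1ℤ ∷ [])
          ∷ []
  P₂-rows = (1ℤ ∷ 0ℤ ∷ 0ℤ ∷ 0ℤ ∷ 0ℤ ∷ 0ℤ ∷ [])
          ∷ (0ℤ ∷ 0ℤ ∷ 0ℤ ∷ 0ℤ ∷ 1ℤ ∷ 0ℤ ∷ [])
          ∷ (0ℤ ∷ 0ℤ ∷ 1ℤ ∷ 0ℤ ∷ 0ℤ ∷ 0ℤ ∷ [])
          ∷ (0ℤ ∷ 0ℤ ∷ 0ℤ ∷ 0ℤ ∷ 0ℤ ∷ 1ℤ ∷ [])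
          ∷ (0ℤ ∷ 1ℤ ∷ 0ℤ ∷ 0ℤ ∷ 0ℤ ∷ 0ℤ ∷ [])
          ∷ (0ℤ ∷ 0ℤ ∷ 0ℤ ∷ 1ℤ ∷ 0ℤ ∷ 0ℤ ∷ [])
          ∷ []

  data Generator : Set where
    gX gP₁ gP₂ gE₁ gE₂ gzI : Generator

  diagonalᶜ : Vec Cyclotomic 6 → CMatrix
  diagonalᶜ d i j = if does (i Fin.≟ j) then lookup d i else 0ᶜ

  -ζᶜ : ℕ → Cyclotomic
  -ζᶜ k = intᶜ -1ℤ ⊠ ζᶜ k

  original conjugated : Generator → CMatrix
  original gX  = integerᶜ ((ζᶜ 3 ⊞ ζᶜ 1) ⊠ (halfᶜ ⊠ halfᶜ)) X-rows
  original gP₁ = integerᶜ (intᶜ 1ℤ) P₁-rows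
  original gP₂ = integerᶜ (ζᶜ 2) P₂-rows
  original gE₁ = diagonalᶜ (ζᶜ 0 ∷ ζᶜ 1 ∷ -ζᶜ 0 ∷ ζᶜ 2 ∷ -ζᶜ 3 ∷ -ζᶜ 2 ∷ [])
  original gE₂ = diagonalᶜ (ζᶜ 0 ∷ ζᶜ 1 ∷ -ζᶜ 0 ∷ ζᶜ 0 ∷ ζᶜ 1 ∷ -ζᶜ 0 ∷ [])
  original gzI = λ i j → ζᶜ 1 ⊠ diagonalᶜ (replicate 6 (ζᶜ 0)) i j
  conjugated gX  = Xᶜ
  conjugated gP₁ = P₁ᶜ
  conjugated gP₂ = P₂ᶜ
  conjugated gE₁ = E₁ᶜ
  conjugated gE₂ = E₂ᶜ
  conjugated gzI = zIᶜ

  -- Conjugation stated as an intertwining relation, which involves no inverse matrix.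
  conjugation : ∀ g i j → (Ûᶜ ⊠ᴹ original g) i j ≃ (conjugated g ⊠ᴹ Ûᶜ) i j
  conjugation gX  = from-yes (Ûᶜ ⊠ᴹ original gX  ≃ᴹ? conjugated gX  ⊠ᴹ Ûᶜ)
  conjugation gP₁ = from-yes (Ûᶜ ⊠ᴹ original gP₁ ≃ᴹ? conjugated gP₁ ⊠ᴹ Ûᶜ)
  conjugation gP₂ = from-yes (Ûᶜ ⊠ᴹ original gP₂ ≃ᴹ? conjugated gP₂ ⊠ᴹ Ûᶜ)
  conjugation gE₁ = from-yes (Ûᶜ ⊠ᴹ original gE₁ ≃ᴹ? conjugated gE₁ ⊠ᴹ Ûᶜ)
  conjugation gE₂ = from-yes (Ûᶜ ⊠ᴹ original gE₂ ≃ᴹ? conjugated gE₂ ⊠ᴹ Ûᶜ)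
  conjugation gzI = from-yes (Ûᶜ ⊠ᴹ original gzI ≃ᴹ? conjugated gzI ⊠ᴹ Ûᶜ)

  T̂Û≃I : ∀ i j → (T̂ᶜ ⊠ᴹ Ûᶜ) i j ≃ diagonalᶜ (replicate 6 (ζᶜ 0)) i j
  T̂Û≃I = from-yes (T̂ᶜ ⊠ᴹ Ûᶜ ≃ᴹ? diagonalᶜ (replicate 6 (ζᶜ 0)))

  ÛT̂≃I : ∀ i j → (Ûᶜ ⊠ᴹ T̂ᶜ) i j ≃ diagonalᶜ (replicate 6 (ζᶜ 0)) i j
  ÛT̂≃I = from-yes (Ûᶜ ⊠ᴹ T̂ᶜ ≃ᴹ? diagonalᶜ (replicate 6 (ζᶜ 0)))

  H-rows : Vec (Vec ℤ 6) 6
  H-rows = (1ℤ ∷ 1ℤ ∷ 0ℤ ∷ 0ℤ ∷ 0ℤ ∷ 0ℤ ∷ [])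
         ∷ (1ℤ ∷ -1ℤ ∷ 0ℤ ∷ 0ℤ ∷ 0ℤ ∷ 0ℤ ∷ [])
         ∷ (0ℤ ∷ 0ℤ ∷ 1ℤ ∷ 1ℤ ∷ 0ℤ ∷ 0ℤ ∷ [])
         ∷ (0ℤ ∷ 0ℤ ∷ 1ℤ ∷ -1ℤ ∷ 0ℤ ∷ 0ℤ ∷ [])
         ∷ (0ℤ ∷ 0ℤ ∷ 0ℤ ∷ 0ℤ ∷ 1ℤ ∷ 1ℤ ∷ [])
         ∷ (0ℤ ∷ 0ℤ ∷ 0ℤ ∷ 0ℤ ∷ 1ℤ ∷ -1ℤ ∷ [])
         ∷ []

  Hᶜ zIᶜ³ : CMatrix
  Hᶜ   = integerᶜ κᶜ H-rows
  zIᶜ³ = permutationᶜ identityπ (replicate 6 3)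

  -- Monomial elements of `H` that suffice for sorting exponents. Two of them are not generators:
  -- `r₂` is q ↦ -q, and `s₂₃` exchanges the planes (t, q) and (B, E).
  data Move : Set where
    p₁ e₁ e₂ r₂ s₂₃ : Move

  permutation : Move → Vec (Fin 6) 6
  permutation p₁  = swapBE
  permutation e₁  = swap₁₂
  permutation e₂  = swap₁₂
  permutation r₂  = identityπ
  permutation s₂₃ = swap₂₃

  phases : Move → Vec ℕ 6
  phases p₁  = 0 ∷ 0 ∷ 0 ∷ 0 ∷ 0 ∷ 0 ∷ []
  phases e₁  = 0 ∷ 2 ∷ 0 ∷ 2 ∷ 1 ∷ 7 ∷ []
  phases e₂  = 0 ∷ 0 ∷ 0 ∷ 0 ∷ 1 ∷ 1 ∷ []
  phases r₂  = 0 ∷ 0 ∷ 0 ∷ 4 ∷ 0 ∷ 0 ∷ []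
  phases s₂₃ = 0 ∷ 0 ∷ 0 ∷ 0 ∷ 0 ∷ 0 ∷ []

  moveᶜ : Move → CMatrix
  moveᶜ m = permutationᶜ (permutation m) (phases m)

  zIᶜ³-≃ : ∀ i j → (conjugated gzI ⊠ᴹ (conjugated gzI ⊠ᴹ conjugated gzI)) i j ≃ zIᶜ³ i j
  zIᶜ³-≃ = from-yes (conjugated gzI ⊠ᴹ (conjugated gzI ⊠ᴹ conjugated gzI) ≃ᴹ? zIᶜ³)

  -- X E₂ permutes the three planes cyclically, acting as a Hadamard matrix on each.
  C₂ᶜ : CMatrix
  C₂ᶜ = permutationᶜ (4F ∷ 5F ∷ 0F ∷ 1F ∷ 2F ∷ 3F ∷ []) (5 ∷ 5 ∷ 5 ∷ 5 ∷ 4 ∷ 4 ∷ [])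

  C₂ᶜ-≃ : ∀ i j → ((conjugated gX ⊠ᴹ conjugated gE₂) ⊠ᴹ (conjugated gX ⊠ᴹ conjugated gE₂)) i j ≃ C₂ᶜ i j
  C₂ᶜ-≃ = from-yes ((conjugated gX ⊠ᴹ conjugated gE₂) ⊠ᴹ (conjugated gX ⊠ᴹ conjugated gE₂) ≃ᴹ? C₂ᶜ)

  -- The third power of X E₂ brings every plane back to itself with a Hadamard matrix on each; the
  -- remaining scalar z⁵ is cancelled by z³.
  Hᶜ-≃ : ∀ i j → (zIᶜ³ ⊠ᴹ ((conjugated gX ⊠ᴹ conjugated gE₂) ⊠ᴹ C₂ᶜ)) i j ≃ Hᶜ i j
  Hᶜ-≃ = from-yes (zIᶜ³ ⊠ᴹ ((conjugated gX ⊠ᴹ conjugated gE₂) ⊠ᴹ C₂ᶜ) ≃ᴹ? Hᶜ)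

  -R₂ᶜ : CMatrix
  -R₂ᶜ = permutationᶜ identityπ (4 ∷ 4 ∷ 4 ∷ 0 ∷ 4 ∷ 4 ∷ [])

  -- Between the Hadamard matrices of `X`, the exchange of B and E becomes diag(1, -1) on the plane
  -- (t, q). The overall sign is 2κ² = -1.
  -R₂ᶜ-≃ : ∀ i j → (conjugated gX ⊠ᴹ (conjugated gP₁ ⊠ᴹ conjugated gX)) i j ≃ -R₂ᶜ i j
  -R₂ᶜ-≃ = from-yes (conjugated gX ⊠ᴹ (conjugated gP₁ ⊠ᴹ conjugated gX) ≃ᴹ? -R₂ᶜ)

  R₂ᶜ-≃ : ∀ i j → ((conjugated gzI ⊠ᴹ zIᶜ³) ⊠ᴹ -R₂ᶜ) i j ≃ moveᶜ r₂ i j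
  R₂ᶜ-≃ = from-yes ((conjugated gzI ⊠ᴹ zIᶜ³) ⊠ᴹ -R₂ᶜ ≃ᴹ? moveᶜ r₂)

  -- The Hadamard matrices of `X` and `Hᶜ` cancel up to 2κ² = -1, leaving the exchange of two
  -- planes; z⁴ = -1 removes the sign.
  S₂₃ᶜ-≃ : ∀ i j → ((conjugated gzI ⊠ᴹ zIᶜ³) ⊠ᴹ (conjugated gX ⊠ᴹ Hᶜ)) i j ≃ moveᶜ s₂₃ i j
  S₂₃ᶜ-≃ = from-yes ((conjugated gzI ⊠ᴹ zIᶜ³) ⊠ᴹ (conjugated gX ⊠ᴹ Hᶜ) ≃ᴹ? moveᶜ s₂₃)
  gP₁-≃ : ∀ i j → conjugated gP₁ i j ≃ moveᶜ p₁ i j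
  gP₁-≃ = from-yes (conjugated gP₁ ≃ᴹ? moveᶜ p₁)

  gE₁-≃ : ∀ i j → conjugated gE₁ i j ≃ moveᶜ e₁ i j
  gE₁-≃ = from-yes (conjugated gE₁ ≃ᴹ? moveᶜ e₁)

  gE₂-≃ : ∀ i j → conjugated gE₂ i j ≃ moveᶜ e₂ i j
  gE₂-≃ = from-yes (conjugated gE₂ ≃ᴹ? moveᶜ e₂)

  gP₂-≃ : ∀ i j → conjugated gP₂ i j ≃ permutationᶜ swapBE (2 ∷ 2 ∷ 2 ∷ 6 ∷ 2 ∷ 2 ∷ []) i j
  gP₂-≃ = from-yes (conjugated gP₂ ≃ᴹ? permutationᶜ swapBE (2 ∷ 2 ∷ 2 ∷ 6 ∷ 2 ∷ 2 ∷ []))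

  gzI-≃ : ∀ i j → conjugated gzI i j ≃ permutationᶜ identityπ (replicate 6 1) i j
  gzI-≃ = from-yes (conjugated gzI ≃ᴹ? permutationᶜ identityπ (replicate 6 1))

  gX-≃ : ∀ i j → conjugated gX i j ≃ integerᶜ κᶜ X′-rows i j
  gX-≃ = from-yes (conjugated gX ≃ᴹ? integerᶜ κᶜ X′-rows)

-- Transport of invariance between the two coordinate systems

module BlockCoordinates where

  open RingBasics
  open PolynomialRings
  open MatrixActions
  open CyclotomicNumbers
  open GeneratorMatrices

  module Symmetry {r ℓ} (R : CommutativeRing r ℓ)
    (ζ half : CommutativeRing.Carrier R) (ζ⁴≈-1 : RingBasics.FourthPowerIs-1 R ζ) (half+half≈1 : RingBasics.IsHalf R half) where
    open CommutativeRing R hiding (zero)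

    open CyclotomicEvaluation R ζ half ζ⁴≈-1 half+half≈1
    open Defs.Polynomials R 6
    open Defs.Matrices R 6
    open PolynomialAlgebra R 6
    open MatrixAction R 6
    open Algebra.Properties.Semiring.Exp semiring using (_^_)
    private
      module 𝓟 = CommutativeRing polynomialRing
      module ≋ = Relation.Binary.Reasoning.Setoid 𝓟.setoid

    -- `U • p` reads the variables of `p` as s, p, t, q, B, E and expands them in a, ..., f; `T`
    -- leads back.
    U T : Matrix
    U = ⟦ Ûᶜ ⟧ᴹ
    T = ⟦ T̂ᶜ ⟧ᴹ

    private
      product≈I : ∀ A B → (∀ i j → (A ⊠ᴹ B) i j ≃ diagonalᶜ (replicate 6 (ζᶜ 0)) i j) → ⟦ A ⟧ᴹ *ᴹ ⟦ B ⟧ᴹ ≈ᴹ I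
      product≈I A B h i j = trans (sym (⟦⟧ᴹ-* A B i j)) (trans (⟦⟧-cong (h i j)) entry)
        where
        entry : ⟦ diagonalᶜ (replicate 6 (ζᶜ 0)) i j ⟧ ≈ I i j
        entry rewrite Vec.lookup-replicate i (ζᶜ 0) with does (i Fin.≟ j)
        ... | true  = ⟦ζᶜ⟧ 0
        ... | false = ⟦⟧-0

    T•U• : ∀ p → T • (U • p) ≋ p
    T•U• p = 𝓟.trans (𝓟.sym (•-* U T p)) (𝓟.trans (•-congˡ (U *ᴹ T) I p (product≈I Ûᶜ T̂ᶜ ÛT̂≃I)) (•-I p))

    U•T• : ∀ p → U • (T • p) ≋ p
    U•T• p = 𝓟.trans (𝓟.sym (•-* T U p)) (𝓟.trans (•-congˡ (T *ᴹ U) I p (product≈I T̂ᶜ Ûᶜ T̂Û≃I)) (•-I p))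

    Fixes : CMatrix → Polynomial → Set _
    Fixes A p = ⟦ A ⟧ᴹ • p ≋ p

    FixedByGenerators : Polynomial → Set _
    FixedByGenerators p = ∀ g → Fixes (conjugated g) p

    private
      U•-conjugate : ∀ {A} g → A ≈ᴹ ⟦ original g ⟧ᴹ → ∀ p → A • (U • p) ≋ U • (⟦ conjugated g ⟧ᴹ • p)
      U•-conjugate {A} g h p = begin
        A • (U • p)                                     ≈⟨ •-* U A p ⟨
        (U *ᴹ A) • p                                    ≈⟨ •-congˡ (U *ᴹ A) (⟦ conjugated g ⟧ᴹ *ᴹ U) p (λ i j →
                                                             trans (*ᴹ-cong {U} {U} {A} {⟦ original g ⟧ᴹ} (λ _ _ → refl) h i j)
                                                               (trans (sym (⟦⟧ᴹ-* Ûᶜ (original g) i j))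
                                                                 (trans (⟦⟧-cong (conjugation g i j)) (⟦⟧ᴹ-* (conjugated g) Ûᶜ i j)))) ⟩
        (⟦ conjugated g ⟧ᴹ *ᴹ U) • p                    ≈⟨ •-* ⟦ conjugated g ⟧ᴹ U p ⟩
        U • (⟦ conjugated g ⟧ᴹ • p)                     ∎
        where open ≋

    module _ {s} {S : Pred Matrix s} where

      U•-invariant : (∀ A → S A → ∃ λ g → A ≈ᴹ ⟦ original g ⟧ᴹ) → ∀ {p} → FixedByGenerators p → InvariantRing ⟨ S ⟩ᴹ (U • p)
      U•-invariant S⊆ {p} h A A∈ = ≋⇒≈ᴾ (⟨⟩-invariant (U • p) step A A∈)
        where
        step : ∀ B → S B → B • (U • p) ≋ U • p
        step B B∈ = 𝓟.trans (U•-conjugate (proj₁ (S⊆ B B∈)) (proj₂ (S⊆ B B∈)) p) (•-congʳ U (h (proj₁ (S⊆ B B∈))))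

      T•-fixed : (∀ g → ∃ λ A → S A × A ≈ᴹ ⟦ original g ⟧ᴹ) → ∀ {q} → InvariantRing ⟨ S ⟩ᴹ q → FixedByGenerators (T • q)
      T•-fixed ⊆S {q} h g = begin
        ⟦ conjugated g ⟧ᴹ • (T • q)                   ≈⟨ T•U• (⟦ conjugated g ⟧ᴹ • (T • q)) ⟨
        T • (U • (⟦ conjugated g ⟧ᴹ • (T • q)))       ≈⟨ •-congʳ T (U•-conjugate g A≈ (T • q)) ⟨
        T • (A • (U • (T • q)))                       ≈⟨ •-congʳ T (•-congʳ A (U•T• q)) ⟩
        T • (A • q)                                   ≈⟨ •-congʳ T (≈ᴾ⇒≋ {A • q} {q} (h A (Defs.Matrices.generator A∈))) ⟩
        T • q                                         ∎
        where
        open ≋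
        A : Matrix
        A = proj₁ (⊆S g)
        A∈ : S A
        A∈ = proj₁ (proj₂ (⊆S g))
        A≈ : A ≈ᴹ ⟦ original g ⟧ᴹ
        A≈ = proj₂ (proj₂ (⊆S g))

    private
      Fixes-⊠ : ∀ A B p → Fixes A p → Fixes B p → Fixes (A ⊠ᴹ B) p
      Fixes-⊠ A B p h k = 𝓟.trans (•-congˡ ⟦ A ⊠ᴹ B ⟧ᴹ (⟦ A ⟧ᴹ *ᴹ ⟦ B ⟧ᴹ) p (⟦⟧ᴹ-* A B))
        (𝓟.trans (•-* ⟦ A ⟧ᴹ ⟦ B ⟧ᴹ p) (𝓟.trans (•-congʳ ⟦ B ⟧ᴹ h) k))

      Fixes-≃ : ∀ A B p → (∀ i j → A i j ≃ B i j) → Fixes A p → Fixes B p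
      Fixes-≃ A B p h k = 𝓟.trans (•-congˡ ⟦ B ⟧ᴹ ⟦ A ⟧ᴹ p (λ i j → sym (⟦⟧-cong (h i j)))) k

    module _ {p : Polynomial} (h : FixedByGenerators p) where
      private
        fixes-zI³ : Fixes zIᶜ³ p
        fixes-zI³ = Fixes-≃ (conjugated gzI ⊠ᴹ (conjugated gzI ⊠ᴹ conjugated gzI)) zIᶜ³ p zIᶜ³-≃
          (Fixes-⊠ (conjugated gzI) (conjugated gzI ⊠ᴹ conjugated gzI) p (h gzI) (Fixes-⊠ (conjugated gzI) (conjugated gzI) p (h gzI) (h gzI)))

        fixes-zI⁴ : Fixes (conjugated gzI ⊠ᴹ zIᶜ³) p
        fixes-zI⁴ = Fixes-⊠ (conjugated gzI) zIᶜ³ p (h gzI) fixes-zI³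

        fixes-XE₂ : Fixes (conjugated gX ⊠ᴹ conjugated gE₂) p
        fixes-XE₂ = Fixes-⊠ (conjugated gX) (conjugated gE₂) p (h gX) (h gE₂)

        fixes-C₂ : Fixes C₂ᶜ p
        fixes-C₂ = Fixes-≃ ((conjugated gX ⊠ᴹ conjugated gE₂) ⊠ᴹ (conjugated gX ⊠ᴹ conjugated gE₂)) C₂ᶜ p C₂ᶜ-≃
          (Fixes-⊠ (conjugated gX ⊠ᴹ conjugated gE₂) (conjugated gX ⊠ᴹ conjugated gE₂) p fixes-XE₂ fixes-XE₂)

        fixes-XP₁X : Fixes (conjugated gX ⊠ᴹ (conjugated gP₁ ⊠ᴹ conjugated gX)) p
        fixes-XP₁X = Fixes-⊠ (conjugated gX) (conjugated gP₁ ⊠ᴹ conjugated gX) p (h gX) (Fixes-⊠ (conjugated gP₁) (conjugated gX) p (h gP₁) (h gX))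

      fixes-H : Fixes Hᶜ p
      fixes-H = Fixes-≃ (zIᶜ³ ⊠ᴹ ((conjugated gX ⊠ᴹ conjugated gE₂) ⊠ᴹ C₂ᶜ)) Hᶜ p Hᶜ-≃
        (Fixes-⊠ zIᶜ³ ((conjugated gX ⊠ᴹ conjugated gE₂) ⊠ᴹ C₂ᶜ) p fixes-zI³ (Fixes-⊠ (conjugated gX ⊠ᴹ conjugated gE₂) C₂ᶜ p fixes-XE₂ fixes-C₂))

      fixes-move : ∀ m → Fixes (moveᶜ m) p
      fixes-move p₁  = Fixes-≃ (conjugated gP₁) (moveᶜ p₁) p gP₁-≃ (h gP₁)
      fixes-move e₁  = Fixes-≃ (conjugated gE₁) (moveᶜ e₁) p gE₁-≃ (h gE₁)
      fixes-move e₂  = Fixes-≃ (conjugated gE₂) (moveᶜ e₂) p gE₂-≃ (h gE₂)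
      fixes-move r₂  = Fixes-≃ ((conjugated gzI ⊠ᴹ zIᶜ³) ⊠ᴹ -R₂ᶜ) (moveᶜ r₂) p R₂ᶜ-≃ (Fixes-⊠ (conjugated gzI ⊠ᴹ zIᶜ³) -R₂ᶜ p fixes-zI⁴
        (Fixes-≃ (conjugated gX ⊠ᴹ (conjugated gP₁ ⊠ᴹ conjugated gX)) -R₂ᶜ p -R₂ᶜ-≃ fixes-XP₁X))
      fixes-move s₂₃ = Fixes-≃ ((conjugated gzI ⊠ᴹ zIᶜ³) ⊠ᴹ (conjugated gX ⊠ᴹ Hᶜ)) (moveᶜ s₂₃) p S₂₃ᶜ-≃
        (Fixes-⊠ (conjugated gzI ⊠ᴹ zIᶜ³) (conjugated gX ⊠ᴹ Hᶜ) p fixes-zI⁴ (Fixes-⊠ (conjugated gX) Hᶜ p (h gX) fixes-H))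

-- Exponents of degree 16 under the monomial elements

module ExponentOrbits where

  open RingBasics
  open PolynomialRings
  open MatrixActions
  open CyclotomicNumbers
  open GeneratorMatrices
  open BlockCoordinates

  Exponent : Set
  Exponent = Vec ℕ 6

  dot : ∀ {n} → Vec ℕ n → Vec ℕ n → ℕ
  dot []      []      = 0
  dot (k ∷ a) (l ∷ e) = k ℕ.* l ℕ.+ dot a e

  permuteᵉ : (Fin 6 → Fin 6) → Exponent → Exponent
  permuteᵉ ρ e = Vec.tabulate (lookup e ∘ ρ)

  -- Follows an exponent through the moves, the head of the list first. The number is the power of z
  -- by which the coefficient of an invariant is multiplied on the way.
  run : List Move → Exponent → Exponent × ℕ
  run []       e = e , 0
  run (m ∷ ms) e with run ms (permuteᵉ (lookup (permutation m)) e)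
  ... | e′ , k = e′ , k ℕ.+ dot (phases m) e

  involutive : ∀ m i → lookup (permutation m) (lookup (permutation m) i) ≡ i
  involutive p₁  = from-yes (Fin.all? λ i → lookup swapBE (lookup swapBE i) Fin.≟ i)
  involutive e₁  = from-yes (Fin.all? λ i → lookup swap₁₂ (lookup swap₁₂ i) Fin.≟ i)
  involutive e₂  = from-yes (Fin.all? λ i → lookup swap₁₂ (lookup swap₁₂ i) Fin.≟ i)
  involutive r₂  = from-yes (Fin.all? λ i → lookup identityπ (lookup identityπ i) Fin.≟ i)
  involutive s₂₃ = from-yes (Fin.all? λ i → lookup swap₂₃ (lookup swap₂₃ i) Fin.≟ i)

  -- Some power of a nontrivial eighth root of unity is -1.
  toMinusOne : ℕ → ℕ
  toMinusOne k with k % 8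
  ... | 0 = 0
  ... | 2 = 2
  ... | 4 = 1
  ... | 6 = 2
  ... | _ = 4

  -- Meaningful for k divisible by 4 only, which `orbits-real` guarantees for every phase that
  -- occurs.
  sign : ℕ → ℤ
  sign k with k % 8
  ... | 0 = 1ℤ
  ... | _ = -1ℤ

  _≟ᵉ′_ : ∀ (d e : Exponent) → Dec (d ≡ e)
  _≟ᵉ′_ = Vec.≡-dec ℕ._≟_

  -- In each of the `diagonalPaths` the permutations cancel, and a root of unity remains. In degree
  -- 16 all six roots are 1 exactly when every exponent is even, the exponents in each plane add up
  -- to a multiple of 4, and so do those of p, q and B. The 48 `orbitPaths` combine the exchanges of
  -- the two letters within the planes with the six permutations of the planes.
  diagonalPaths orbitPaths : List (List Move)
  diagonalPaths = (r₂ ∷ []) ∷ (e₂ ∷ r₂ ∷ e₂ ∷ []) ∷ (s₂₃ ∷ r₂ ∷ s₂₃ ∷ []) ∷ (e₂ ∷ e₂ ∷ [])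
                ∷ (s₂₃ ∷ e₂ ∷ e₂ ∷ s₂₃ ∷ []) ∷ (e₁ ∷ e₂ ∷ []) ∷ []
  orbitPaths = List.cartesianProductWith List._++_
    (List.cartesianProductWith List._++_ ([] ∷ (p₁ ∷ []) ∷ [])
      (List.cartesianProductWith List._++_ ([] ∷ (s₂₃ ∷ p₁ ∷ s₂₃ ∷ []) ∷ []) ([] ∷ (e₂ ∷ s₂₃ ∷ p₁ ∷ s₂₃ ∷ e₂ ∷ []) ∷ [])))
    ([] ∷ (s₂₃ ∷ []) ∷ (e₂ ∷ []) ∷ (e₂ ∷ s₂₃ ∷ []) ∷ (s₂₃ ∷ e₂ ∷ []) ∷ (e₂ ∷ s₂₃ ∷ e₂ ∷ []) ∷ [])

  insert : Exponent × ℕ → List (Exponent × ℕ) → List (Exponent × ℕ)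
  insert t [] = t ∷ []
  insert (e , k) ((e′ , k′) ∷ ts) = if does (e ≟ᵉ′ e′) then (e′ , k′) ∷ ts else (e′ , k′) ∷ insert (e , k) ts

  -- Exponents e in the orbit of r, with k such that x^e has zᵏ times the coefficient of x^r.
  orbit : List (List Move) → Exponent → List (Exponent × ℕ)
  orbit []           r = []
  orbit (ms ∷ paths) r = insert (run ms r) (orbit paths r)

  orbitRepresentatives : Vec Exponent 16
  orbitRepresentatives =
    (16 ∷ 0 ∷ 0 ∷ 0 ∷ 0 ∷ 0 ∷ []) ∷ (12 ∷ 4 ∷ 0 ∷ 0 ∷ 0 ∷ 0 ∷ []) ∷ (12 ∷ 0 ∷ 4 ∷ 0 ∷ 0 ∷ 0 ∷ []) ∷ (10 ∷ 2 ∷ 2 ∷ 2 ∷ 0 ∷ 0 ∷ []) ∷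
    (8 ∷ 8 ∷ 0 ∷ 0 ∷ 0 ∷ 0 ∷ []) ∷ (8 ∷ 4 ∷ 4 ∷ 0 ∷ 0 ∷ 0 ∷ []) ∷ (8 ∷ 0 ∷ 8 ∷ 0 ∷ 0 ∷ 0 ∷ []) ∷ (8 ∷ 0 ∷ 4 ∷ 4 ∷ 0 ∷ 0 ∷ []) ∷
    (8 ∷ 0 ∷ 4 ∷ 0 ∷ 4 ∷ 0 ∷ []) ∷ (8 ∷ 0 ∷ 2 ∷ 2 ∷ 2 ∷ 2 ∷ []) ∷ (6 ∷ 6 ∷ 2 ∷ 2 ∷ 0 ∷ 0 ∷ []) ∷ (6 ∷ 2 ∷ 6 ∷ 2 ∷ 0 ∷ 0 ∷ []) ∷
    (6 ∷ 2 ∷ 4 ∷ 0 ∷ 2 ∷ 2 ∷ []) ∷ (4 ∷ 4 ∷ 4 ∷ 4 ∷ 0 ∷ 0 ∷ []) ∷ (4 ∷ 4 ∷ 4 ∷ 0 ∷ 4 ∷ 0 ∷ []) ∷ (4 ∷ 4 ∷ 2 ∷ 2 ∷ 2 ∷ 2 ∷ []) ∷ []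

  surviving : ∀ {n} → Vec (List (Exponent × ℕ)) n → List Exponent
  surviving []       = []
  surviving (o ∷ os) = List.map proj₁ o List.++ surviving os

  open Data.List.Membership.DecPropositional _≟ᵉ′_ using (_∈?_)

  Killed : Exponent → Set
  Killed e = Any (λ ms → proj₁ (run ms e) ≡ e × (proj₂ (run ms e) ℕ.* toMinusOne (proj₂ (run ms e))) % 8 ≡ 4) diagonalPaths

  killed? : ∀ e → Dec (Killed e)
  killed? e = Any.any? (λ ms → proj₁ (run ms e) ≟ᵉ′ e ×-dec (proj₂ (run ms e) ℕ.* toMinusOne (proj₂ (run ms e))) % 8 ℕ.≟ 4) diagonalPaths

  -- A boolean search, so that its evaluation builds no proof terms; `all-of-sum-sound` converts the
  -- outcome into a statement about all vectors of sum s.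
  all-of-sum : ∀ n → ℕ → (Vec ℕ n → Bool) → Bool
  all-of-sum-from : ∀ n → ℕ → (Vec ℕ (suc n) → Bool) → ℕ → Bool
  all-of-sum zero    s P = if does (s ℕ.≟ 0) then P [] else true
  all-of-sum (suc n) s P = all-of-sum-from n s P s
  all-of-sum-from n s P zero    = all-of-sum n s (P ∘ (0 ∷_))
  all-of-sum-from n s P (suc k) = if all-of-sum n (s ℕ.∸ suc k) (P ∘ (suc k ∷_)) then all-of-sum-from n s P k else false

  member? : ∀ e (D : List Exponent) → Dec (e ∈ˡ D)
  member? e D = e ∈? D

  accountedFor : List Exponent → Exponent → Bool
  accountedFor D e = if isYes (killed? e) then true else isYes (e ∈? D)

  if-true : ∀ {b c} → (if b then c else false) ≡ true → b ≡ true × c ≡ true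
  if-true {true} h = ≡.refl , h

  if-false : ∀ {b c} → (if b then true else c) ≡ true → b ≡ true ⊎ c ≡ true
  if-false {true}  h = inj₁ ≡.refl
  if-false {false} h = inj₂ h

  isYes⇒ : ∀ {p} {P : Set p} (d : Dec P) → isYes d ≡ true → P
  isYes⇒ (yes p) _ = p

  all-of-sum-sound : ∀ n s P → all-of-sum n s P ≡ true → ∀ e → Vec.sum e ≡ s → P e ≡ true
  all-of-sum-sound zero    .0 P h []      ≡.refl = h
  all-of-sum-sound (suc n) s  P h (k ∷ e) k+e≡s = go s h (≡.subst (k ℕ.≤_) k+e≡s (ℕ.m≤m+n k (Vec.sum e)))
    where
    at : all-of-sum n (s ℕ.∸ k) (P ∘ (k ∷_)) ≡ true → P (k ∷ e) ≡ true
    at h = all-of-sum-sound n (s ℕ.∸ k) (P ∘ (k ∷_)) h e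
      (≡.trans (≡.sym (ℕ.m+n∸m≡n k (Vec.sum e))) (cong (ℕ._∸ k) k+e≡s))
    go : ∀ m → all-of-sum-from n s P m ≡ true → k ℕ.≤ m → P (k ∷ e) ≡ true
    go zero    h ℕ.z≤n = at h
    go (suc m) h k≤    with if-true h | ℕ.m≤n⇒m<n∨m≡n k≤
    ... | _ , h′ | inj₁ (ℕ.s≤s k≤m) = go m h′ k≤m
    ... | h′ , _ | inj₂ ≡.refl      = at h′

  survivors-unique : Unique (surviving (Vec.map (orbit orbitPaths) orbitRepresentatives))
  survivors-unique = isYes⇒ (unique? _≟ᵉ′_ (surviving (Vec.map (orbit orbitPaths) orbitRepresentatives))) ≡.refl

  accountedFor-cases : ∀ D e → accountedFor D e ≡ true → Killed e ⊎ e ∈ˡ D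
  accountedFor-cases D e h with if-false {isYes (killed? e)} {isYes (e ∈? D)} h
  ... | inj₁ kill = inj₁ (isYes⇒ (killed? e) kill)
  ... | inj₂ e∈   = inj₂ (isYes⇒ (e ∈? D) e∈)

  -- An evaluation over all 20349 exponents of degree 16 in six variables.
  all-accountedFor : all-of-sum 6 16 (accountedFor (surviving (Vec.map (orbit orbitPaths) orbitRepresentatives))) ≡ true
  all-accountedFor = ≡.refl

  killed-or-surviving : ∀ e → Vec.sum e ≡ 16 → Killed e ⊎ e ∈ˡ surviving (Vec.map (orbit orbitPaths) orbitRepresentatives)
  killed-or-surviving e h = accountedFor-cases (surviving (Vec.map (orbit orbitPaths) orbitRepresentatives)) e
    (all-of-sum-sound 6 16 (accountedFor (surviving (Vec.map (orbit orbitPaths) orbitRepresentatives))) all-accountedFor e h)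

-- The integral certificate for the linear equations

module OrbitCertificate where

  open RingBasics
  open PolynomialRings
  open MatrixActions
  open CyclotomicNumbers
  open GeneratorMatrices
  open BlockCoordinates
  open ExponentOrbits

  hadamard : Vec ℤ 6 → Vec ℤ 6
  hadamard v = Vec.tabulate λ i → Data.Vec.Functional.foldr ℤ._+_ 0ℤ λ j → lookup (lookup H-rows i) j ℤ.* lookup v j

  powerℤ : ∀ {n} → Vec ℤ n → Vec ℕ n → ℤ
  powerℤ []      []      = 1ℤ
  powerℤ (x ∷ v) (k ∷ e) = x ℤ.^ k ℤ.* powerℤ v e

  orbitSum : Vec ℤ 6 → List (Exponent × ℕ) → ℤ
  orbitSum v []            = 0ℤ
  orbitSum v ((e , k) ∷ o) = sign k ℤ.* powerℤ v e ℤ.+ orbitSum v o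

  -- An invariant Q of degree 16 takes the same value at v and at κ h, where h is `hadamard v`, and
  -- κ¹⁶ = 1/256. Hence 256 Q(v) - Q(h) = 0, with one coefficient for each orbit.
  equation : ∀ {n} → Vec (List (Exponent × ℕ)) n → Vec ℤ 6 → Vec ℤ n
  equation os v = Vec.map (λ o → + 256 ℤ.* orbitSum v o ℤ.- orbitSum (hadamard v) o) os

  -- One point for each equation: 16 unknowns and a solution space of dimension 6 require ten. With
  -- entries 0, 1 and 2 the sixteenth powers stay small.
  points : Vec (Vec ℤ 6) 10
  points =
      (+ 0 ∷ + 0 ∷ + 0 ∷ + 0 ∷ + 0 ∷ + 1 ∷ [])
    ∷ (+ 0 ∷ + 0 ∷ + 0 ∷ + 1 ∷ + 0 ∷ + 1 ∷ [])
    ∷ (+ 0 ∷ + 1 ∷ + 0 ∷ + 0 ∷ + 0 ∷ + 1 ∷ [])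
    ∷ (+ 0 ∷ + 0 ∷ + 0 ∷ + 1 ∷ + 1 ∷ + 1 ∷ [])
    ∷ (+ 0 ∷ + 1 ∷ + 0 ∷ + 1 ∷ + 0 ∷ + 1 ∷ [])
    ∷ (+ 0 ∷ + 0 ∷ + 0 ∷ + 0 ∷ + 1 ∷ + 2 ∷ [])
    ∷ (+ 0 ∷ + 1 ∷ + 0 ∷ + 1 ∷ + 1 ∷ + 1 ∷ [])
    ∷ (+ 1 ∷ + 1 ∷ + 0 ∷ + 1 ∷ + 0 ∷ + 1 ∷ [])
    ∷ (+ 0 ∷ + 0 ∷ + 0 ∷ + 1 ∷ + 1 ∷ + 2 ∷ [])
    ∷ (+ 0 ∷ + 1 ∷ + 0 ∷ + 0 ∷ + 1 ∷ + 2 ∷ [])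
    ∷ []

  equations : Vec (Vec ℤ 16) 10
  equations =
      (+ 254 ∷ -[1+ 1 ] ∷ + 0 ∷ + 0 ∷ -[1+ 0 ] ∷ + 0 ∷ + 0 ∷ + 0 ∷ + 0 ∷ + 0 ∷ + 0 ∷ + 0 ∷ + 0 ∷ + 0 ∷ + 0 ∷ + 0 ∷ [])
    ∷ (+ 508 ∷ -[1+ 3 ] ∷ -[1+ 503 ] ∷ + 4 ∷ -[1+ 1 ] ∷ + 8 ∷ + 252 ∷ -[1+ 3 ] ∷ + 0 ∷ + 0 ∷ + 2 ∷ -[1+ 3 ] ∷ + 0 ∷ -[1+ 0 ] ∷ + 0 ∷ + 0 ∷ [])
    ∷ (+ 508 ∷ -[1+ 3 ] ∷ + 504 ∷ -[1+ 3 ] ∷ -[1+ 1 ] ∷ -[1+ 7 ] ∷ + 252 ∷ -[1+ 3 ] ∷ + 0 ∷ + 0 ∷ -[1+ 1 ] ∷ -[1+ 3 ] ∷ + 0 ∷ -[1+ 0 ] ∷ + 0 ∷ + 0 ∷ [])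
    ∷ (-[1+ 64769 ] ∷ + 510 ∷ + 7200 ∷ + 0 ∷ + 255 ∷ -[1+ 479 ] ∷ + 0 ∷ + 0 ∷ + 0 ∷ + 0 ∷ + 0 ∷ + 0 ∷ + 0 ∷ + 0 ∷ + 0 ∷ + 0 ∷ [])
    ∷ (+ 762 ∷ -[1+ 5 ] ∷ + 504 ∷ -[1+ 3 ] ∷ -[1+ 2 ] ∷ -[1+ 7 ] ∷ + 756 ∷ -[1+ 11 ] ∷ -[1+ 247 ] ∷ + 2 ∷ -[1+ 1 ] ∷ -[1+ 11 ] ∷ + 8 ∷ -[1+ 2 ] ∷ + 4 ∷ + 1 ∷ [])
    ∷ (-[1+ 26269249 ] ∷ + 521150 ∷ + 0 ∷ + 0 ∷ + 58975 ∷ + 0 ∷ + 0 ∷ + 0 ∷ + 0 ∷ + 0 ∷ + 0 ∷ + 0 ∷ + 0 ∷ + 0 ∷ + 0 ∷ + 0 ∷ [])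
    ∷ (-[1+ 64515 ] ∷ + 508 ∷ + 504 ∷ -[1+ 3 ] ∷ + 254 ∷ -[1+ 7 ] ∷ + 252 ∷ -[1+ 3 ] ∷ + 512 ∷ + 256 ∷ -[1+ 1 ] ∷ -[1+ 3 ] ∷ + 0 ∷ -[1+ 0 ] ∷ -[1+ 255 ] ∷ + 0 ∷ [])
    ∷ (-[1+ 64515 ] ∷ + 508 ∷ -[1+ 14903 ] ∷ + 4 ∷ + 254 ∷ + 968 ∷ + 252 ∷ -[1+ 3 ] ∷ -[1+ 1407 ] ∷ -[1+ 255 ] ∷ + 2 ∷ -[1+ 3 ] ∷ + 64 ∷ -[1+ 0 ] ∷ + 320 ∷ + 0 ∷ [])
    ∷ (-[1+ 26268995 ] ∷ + 521148 ∷ + 9864 ∷ + 59076 ∷ + 58974 ∷ -[1+ 56183 ] ∷ + 52668 ∷ -[1+ 2627 ] ∷ + 0 ∷ + 0 ∷ + 738 ∷ -[1+ 1475 ] ∷ + 0 ∷ -[1+ 80 ] ∷ + 0 ∷ + 0 ∷ [])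
    ∷ (-[1+ 26268995 ] ∷ + 521148 ∷ -[1+ 9863 ] ∷ -[1+ 59075 ] ∷ + 58974 ∷ + 56184 ∷ + 52668 ∷ -[1+ 2627 ] ∷ + 0 ∷ + 0 ∷ -[1+ 737 ] ∷ -[1+ 1475 ] ∷ + 0 ∷ -[1+ 80 ] ∷ + 0 ∷ + 0 ∷ [])
    ∷ []

  -- The coefficients of 64 𝒲², …, 192 𝒲 (the six basis elements, in the coordinates
  -- s, …, E and with denominators cleared) at the orbit representatives.
  basisCoefficients : Vec (Vec ℤ 6) 16
  basisCoefficients =
      (+ 1 ∷ + 1 ∷ + 1 ∷ + 1 ∷ + 3 ∷ + 12 ∷ [])
    ∷ (+ 28 ∷ + 28 ∷ + 28 ∷ + 28 ∷ + 84 ∷ + 336 ∷ [])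
    ∷ (+ 12 ∷ + 0 ∷ + 6 ∷ + 0 ∷ + 36 ∷ + 72 ∷ [])
    ∷ (+ 144 ∷ + 0 ∷ + 72 ∷ + 0 ∷ + 432 ∷ + 864 ∷ [])
    ∷ (+ 198 ∷ + 198 ∷ + 198 ∷ + 198 ∷ + 594 ∷ + 2376 ∷ [])
    ∷ (+ 180 ∷ + 0 ∷ + 90 ∷ + 0 ∷ + 540 ∷ + 1080 ∷ [])
    ∷ (+ 38 ∷ + 2 ∷ + 2 ∷ + 0 ∷ + 114 ∷ + 24 ∷ [])
    ∷ (+ 100 ∷ + 28 ∷ + 28 ∷ + 0 ∷ + 684 ∷ + 144 ∷ [])
    ∷ (+ 60 ∷ + 0 ∷ -[1+ 5 ] ∷ + 0 ∷ + 180 ∷ -[1+ 71 ] ∷ [])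
    ∷ (-[1+ 143 ] ∷ + 0 ∷ -[1+ 71 ] ∷ + 0 ∷ + 720 ∷ -[1+ 287 ] ∷ [])
    ∷ (+ 2016 ∷ + 0 ∷ + 1008 ∷ + 0 ∷ + 6048 ∷ + 12096 ∷ [])
    ∷ (+ 864 ∷ + 0 ∷ + 0 ∷ + 0 ∷ + 1824 ∷ + 384 ∷ [])
    ∷ (+ 864 ∷ + 0 ∷ + 0 ∷ + 0 ∷ + 1440 ∷ -[1+ 575 ] ∷ [])
    ∷ (+ 5720 ∷ + 392 ∷ + 392 ∷ + 0 ∷ + 18696 ∷ + 3936 ∷ [])
    ∷ (-[1+ 23 ] ∷ + 0 ∷ -[1+ 83 ] ∷ + 0 ∷ + 1080 ∷ -[1+ 431 ] ∷ [])
    ∷ (+ 8352 ∷ + 0 ∷ -[1+ 1007 ] ∷ + 0 ∷ + 27360 ∷ -[1+ 10943 ] ∷ [])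
    ∷ []

  -- Supported on the orbits in positions 0, 2, 6, 7, 8 and 9, it is ℓ times the inverse of the 6 by
  -- 6 block of `basisCoefficients` there. The rows of `cofactor` at these positions vanish
  -- accordingly.
  leftInverse : Vec (Vec ℤ 16) 6
  leftInverse =
      (+ 0 ∷ + 0 ∷ -[1+ 101499 ] ∷ + 0 ∷ + 0 ∷ + 0 ∷ + 220500 ∷ -[1+ 15749 ] ∷ -[1+ 38499 ] ∷ -[1+ 5249 ] ∷ + 0 ∷ + 0 ∷ + 0 ∷ + 0 ∷ + 0 ∷ + 0 ∷ [])
    ∷ (+ 0 ∷ + 0 ∷ -[1+ 1623999 ] ∷ + 0 ∷ + 0 ∷ + 0 ∷ + 2016000 ∷ + 0 ∷ -[1+ 951999 ] ∷ + 0 ∷ + 0 ∷ + 0 ∷ + 0 ∷ + 0 ∷ + 0 ∷ + 0 ∷ [])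
    ∷ (+ 0 ∷ + 0 ∷ + 812000 ∷ + 0 ∷ + 0 ∷ + 0 ∷ -[1+ 1763999 ] ∷ + 126000 ∷ + 644000 ∷ -[1+ 41999 ] ∷ + 0 ∷ + 0 ∷ + 0 ∷ + 0 ∷ + 0 ∷ + 0 ∷ [])
    ∷ (+ 4032000 ∷ + 0 ∷ + 1008000 ∷ + 0 ∷ + 0 ∷ + 0 ∷ -[1+ 2015999 ] ∷ + 0 ∷ + 1008000 ∷ + 0 ∷ + 0 ∷ + 0 ∷ + 0 ∷ + 0 ∷ + 0 ∷ + 0 ∷ [])
    ∷ (+ 0 ∷ + 0 ∷ + 52500 ∷ + 0 ∷ + 0 ∷ + 0 ∷ -[1+ 73499 ] ∷ + 5250 ∷ + 31500 ∷ + 1750 ∷ + 0 ∷ + 0 ∷ + 0 ∷ + 0 ∷ + 0 ∷ + 0 ∷ [])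
    ∷ (+ 0 ∷ + 0 ∷ -[1+ 20999 ] ∷ + 0 ∷ + 0 ∷ + 0 ∷ + 147000 ∷ -[1+ 10499 ] ∷ -[1+ 62999 ] ∷ + 3500 ∷ + 0 ∷ + 0 ∷ + 0 ∷ + 0 ∷ + 0 ∷ + 0 ∷ [])
    ∷ []

  cofactor : Vec (Vec ℤ 10) 16
  cofactor =
      (+ 0 ∷ + 0 ∷ + 0 ∷ + 0 ∷ + 0 ∷ + 0 ∷ + 0 ∷ + 0 ∷ + 0 ∷ + 0 ∷ [])
    ∷ (+ 589750 ∷ + 0 ∷ + 0 ∷ + 0 ∷ + 0 ∷ + 10 ∷ + 0 ∷ + 0 ∷ + 0 ∷ + 0 ∷ [])
    ∷ (+ 0 ∷ + 0 ∷ + 0 ∷ + 0 ∷ + 0 ∷ + 0 ∷ + 0 ∷ + 0 ∷ + 0 ∷ + 0 ∷ [])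
    ∷ (-[1+ 2199119 ] ∷ -[1+ 12914 ] ∷ + 12915 ∷ -[1+ 8623 ] ∷ + 0 ∷ + 0 ∷ + 0 ∷ + 0 ∷ + 35 ∷ -[1+ 34 ] ∷ [])
    ∷ (-[1+ 5211499 ] ∷ + 0 ∷ + 0 ∷ + 0 ∷ + 0 ∷ -[1+ 19 ] ∷ + 0 ∷ + 0 ∷ + 0 ∷ + 0 ∷ [])
    ∷ (-[1+ 2141999 ] ∷ + 0 ∷ + 0 ∷ -[1+ 8399 ] ∷ + 0 ∷ + 0 ∷ + 0 ∷ + 0 ∷ + 0 ∷ + 0 ∷ [])
    ∷ (+ 0 ∷ + 0 ∷ + 0 ∷ + 0 ∷ + 0 ∷ + 0 ∷ + 0 ∷ + 0 ∷ + 0 ∷ + 0 ∷ [])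
    ∷ (+ 0 ∷ + 0 ∷ + 0 ∷ + 0 ∷ + 0 ∷ + 0 ∷ + 0 ∷ + 0 ∷ + 0 ∷ + 0 ∷ [])
    ∷ (+ 0 ∷ + 0 ∷ + 0 ∷ + 0 ∷ + 0 ∷ + 0 ∷ + 0 ∷ + 0 ∷ + 0 ∷ + 0 ∷ [])
    ∷ (+ 0 ∷ + 0 ∷ + 0 ∷ + 0 ∷ + 0 ∷ + 0 ∷ + 0 ∷ + 0 ∷ + 0 ∷ + 0 ∷ [])
    ∷ (+ 12966240 ∷ + 1033830 ∷ -[1+ 1033829 ] ∷ + 50848 ∷ + 0 ∷ + 0 ∷ + 0 ∷ + 0 ∷ -[1+ 69 ] ∷ + 70 ∷ [])
    ∷ (-[1+ 563499 ] ∷ + 141750 ∷ + 141750 ∷ + 0 ∷ + 0 ∷ + 3500 ∷ + 0 ∷ + 0 ∷ -[1+ 1749 ] ∷ -[1+ 1749 ] ∷ [])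
    ∷ (+ 68418000 ∷ -[1+ 62999 ] ∷ -[1+ 78749 ] ∷ + 126000 ∷ + 0 ∷ + 0 ∷ + 78750 ∷ + 63000 ∷ + 0 ∷ + 0 ∷ [])
    ∷ (+ 10318000 ∷ -[1+ 2582999 ] ∷ -[1+ 2582999 ] ∷ + 0 ∷ + 0 ∷ -[1+ 13999 ] ∷ + 0 ∷ + 0 ∷ + 7000 ∷ + 7000 ∷ [])
    ∷ (-[1+ 4031999 ] ∷ + 0 ∷ + 15750 ∷ + 0 ∷ + 0 ∷ + 0 ∷ -[1+ 15749 ] ∷ + 0 ∷ + 0 ∷ + 0 ∷ [])
    ∷ (-[1+ 519119999 ] ∷ -[1+ 3527999 ] ∷ -[1+ 7496999 ] ∷ -[1+ 1007999 ] ∷ + 4032000 ∷ + 0 ∷ -[1+ 566999 ] ∷ -[1+ 503999 ] ∷ + 0 ∷ + 0 ∷ [])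
    ∷ []

  private
    _≟ᵐ_ : ∀ {m n} (A B : Vec (Vec ℤ m) n) → Dec (A ≡ B)
    _≟ᵐ_ = Vec.≡-dec (Vec.≡-dec ℤ._≟_)

  equations-correct : Vec.map (equation (Vec.map (orbit orbitPaths) orbitRepresentatives)) points ≡ equations
  equations-correct = isYes⇒ (Vec.map (equation (Vec.map (orbit orbitPaths) orbitRepresentatives)) points ≟ᵐ equations) ≡.refl

  infixl 7 _⊛_
  _⊛_ : ∀ {l m n} → Vec (Vec ℤ m) l → Vec (Vec ℤ n) m → Fin l → Fin n → ℤ
  (A ⊛ B) i j = Data.Vec.Functional.foldr ℤ._+_ 0ℤ λ k → lookup (lookup A i) k ℤ.* lookup (lookup B k) j

  scalar : ∀ {n} → ℤ → Fin n → Fin n → ℤ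
  scalar c i j = if does (i Fin.≟ j) then c else 0ℤ

  -- With E the equations, Y the basis coefficients, L the left inverse and K the
  -- cofactor, L Y = ℓ and Y L + K E = ℓ for the scalar ℓ, opaque
  -- because a numeral of this size must not be unfolded in a ring.
  abstract
    ℓ : ℕ
    ℓ = 4032000

    ℓ-nonZero : ℕ.NonZero ℓ
    ℓ-nonZero = _

    L*Y≡ℓ : ∀ i j → (leftInverse ⊛ basisCoefficients) i j ≡ scalar (+ ℓ) i j
    L*Y≡ℓ = from-yes (Fin.all? λ i → Fin.all? λ j → (leftInverse ⊛ basisCoefficients) i j ℤ.≟ scalar (+ ℓ) i j)

    Y*L+K*E≡ℓ : ∀ i j → (basisCoefficients ⊛ leftInverse) i j ℤ.+ (cofactor ⊛ equations) i j ≡ scalar (+ ℓ) i j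
    Y*L+K*E≡ℓ = from-yes (Fin.all? λ i → Fin.all? λ j →
      (basisCoefficients ⊛ leftInverse) i j ℤ.+ (cofactor ⊛ equations) i j ℤ.≟ scalar (+ ℓ) i j)

  -- When the phases in an orbit are signs, its contribution to the value at an integral point is an
  -- integer times the orbit coefficient.
  Real : List (Exponent × ℕ) → Set
  Real = All λ (e , k) → Vec.sum e ≡ 16 × (k % 8 ≡ 0 ⊎ k % 8 ≡ 4)

  orbits-real : VecAll.All Real (Vec.map (orbit orbitPaths) orbitRepresentatives)
  orbits-real = isYes⇒ (VecAll.all? (All.all? λ (e , k) → Vec.sum e ℕ.≟ 16 ×-dec (k % 8 ℕ.≟ 0 ⊎-dec k % 8 ℕ.≟ 4)) (Vec.map (orbit orbitPaths) orbitRepresentatives)) ≡.refl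

  2κ²≃-1 : intᶜ (+ 2) ⊠ (κᶜ ⊠ κᶜ) ≃ intᶜ -1ℤ
  2κ²≃-1 = from-yes (intᶜ (+ 2) ⊠ (κᶜ ⊠ κᶜ) ≟ᶜ intᶜ -1ℤ)

-- Invariants of degree 16 and their sixteen orbit coefficients

module OrbitSpanning where

  open RingBasics
  open PolynomialRings
  open MatrixActions
  open CyclotomicNumbers
  open GeneratorMatrices
  open BlockCoordinates
  open ExponentOrbits
  open OrbitCertificate

  open Data.List.Membership.DecPropositional _≟ᵉ′_ using (_∈?_)

  module Spanning {r r′} (R : CommutativeRing r r′)
    (ζ half : CommutativeRing.Carrier R) (ζ⁴≈-1 : RingBasics.FourthPowerIs-1 R ζ) (half+half≈1 : RingBasics.IsHalf R half) where
    open CommutativeRing R hiding (zero)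

    open Integers R
    open CyclotomicEvaluation R ζ half ζ⁴≈-1 half+half≈1
    open Symmetry R ζ half ζ⁴≈-1 half+half≈1
    open Summation R
    open Defs.Polynomials R 6
    open Defs.Matrices R 6
    open PolynomialAlgebra R 6
    open MatrixAction R 6
    open Algebra.Properties.Semiring.Exp semiring using (_^_; ^-homo-*; ^-assocʳ; ^-congˡ)
    open Algebra.Properties.CommutativeSemiring.Exp commutativeSemiring using (^-distrib-*)
    open Algebra.Properties.Semiring.Sum semiring using (sum; sum-cong-≋; ∑-distrib-+; ∑-comm; *-distribˡ-sum; *-distribʳ-sum; sum-replicate-zero)
    open Algebra.Properties.Ring ring using (-1*x≈-x)
    private
      module 𝓟 = CommutativeRing polynomialRing
      module ≈ = Relation.Binary.Reasoning.Setoid setoid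

    ζ⁴≈ : ζ ^ 4 ≈ - 1#
    ζ⁴≈ = trans (solve 2 (λ z o → z :* (z :* (z :* (z :* o))) := z :* z :* (z :* z) :* o) refl ζ 1#)
      (trans (*-congʳ ζ⁴≈-1) (*-identityʳ _))

    private
      power-phases : ∀ {n} (a e : Vec ℕ n) → power (λ i → ζ ^ lookup a i) e ≈ ζ ^ dot a e
      power-phases []      []      = refl
      power-phases (k ∷ a) (l ∷ e) = trans (*-cong (^-assocʳ ζ k l) (power-phases a e)) (sym (^-homo-* ζ (k ℕ.* l) (dot a e)))

      ζ⁸≈1 : ζ ^ 8 ≈ 1#
      ζ⁸≈1 = trans (^-homo-* ζ 4 4) (trans (*-cong ζ⁴≈ ζ⁴≈) (solve 1 (λ x → :- x :* :- x := x :* x) refl 1# ⟨trans⟩ *-identityˡ 1#))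
        where
        infixl 5 _⟨trans⟩_
        _⟨trans⟩_ : ∀ {x y z} → x ≈ y → y ≈ z → x ≈ z
        _⟨trans⟩_ = trans

      1^ : ∀ k → 1# ^ k ≈ 1#
      1^ zero    = refl
      1^ (suc k) = trans (*-identityˡ _) (1^ k)

    ζ^% : ∀ k → ζ ^ k ≈ ζ ^ (k % 8)
    ζ^% k = begin
      ζ ^ k                                     ≡⟨ cong (ζ ^_) (m≡m%n+[m/n]*n k 8) ⟩
      ζ ^ (k % 8 ℕ.+ k ℕ./ 8 ℕ.* 8)             ≈⟨ ^-homo-* ζ (k % 8) (k ℕ./ 8 ℕ.* 8) ⟩
      ζ ^ (k % 8) * ζ ^ (k ℕ./ 8 ℕ.* 8)         ≈⟨ *-congˡ (trans (reflexive (cong (ζ ^_) (ℕ.*-comm (k ℕ./ 8) 8))) (sym (^-assocʳ ζ 8 (k ℕ./ 8)))) ⟩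
      ζ ^ (k % 8) * (ζ ^ 8) ^ (k ℕ./ 8)         ≈⟨ *-congˡ (trans (^-congˡ (k ℕ./ 8) ζ⁸≈1) (1^ (k ℕ./ 8))) ⟩
      ζ ^ (k % 8) * 1#                          ≈⟨ *-identityʳ _ ⟩
      ζ ^ (k % 8)                               ∎
      where open ≈

    private
      halve : ∀ x → x + x ≈ 0# → x ≈ 0#
      halve x h = trans (sym (trans (*-congʳ half+half≈1) (*-identityˡ x)))
        (trans (solve 2 (λ h x → (h :+ h) :* x := h :* (x :+ x)) refl half x) (trans (*-congˡ h) (zeroʳ half)))

      -- Iterating m times gives x = ζ^(k m) x = -x, and 2 is invertible. Passing to -1 avoids
      -- inverting 1 - ζᵏ.
      fixed-by-root : ∀ k m x → (k ℕ.* m) % 8 ≡ 4 → x ≈ ζ ^ k * x → x ≈ 0#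
      fixed-by-root k m x e h = halve x (trans (+-congˡ (trans (iterate m) (begin
        (ζ ^ k) ^ m * x           ≈⟨ *-congʳ (^-assocʳ ζ k m) ⟩
        ζ ^ (k ℕ.* m) * x         ≈⟨ *-congʳ (trans (ζ^% (k ℕ.* m)) (trans (reflexive (cong (ζ ^_) e)) ζ⁴≈)) ⟩
        - 1# * x                  ≈⟨ -1*x≈-x x ⟩
        - x                       ∎))) (-‿inverseʳ x))
        where
        open ≈
        iterate : ∀ m → x ≈ (ζ ^ k) ^ m * x
        iterate zero    = sym (*-identityˡ x)
        iterate (suc m) = trans h (trans (*-congˡ (iterate m)) (sym (*-assoc (ζ ^ k) ((ζ ^ k) ^ m) x)))

      ζ^-sign : ∀ k → k % 8 ≡ 0 ⊎ k % 8 ≡ 4 → ζ ^ k ≈ fromℤ (sign k)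
      ζ^-sign k h with k % 8 | ζ^% k
      ζ^-sign k (inj₁ ≡.refl) | _ | e = trans e (sym fromℤ-1)
      ζ^-sign k (inj₂ ≡.refl) | _ | e = trans e (trans ζ⁴≈ (-‿cong (sym fromℤ-1)))

      fromℤ-^ : ∀ x k → fromℤ (x ℤ.^ k) ≈ fromℤ x ^ k
      fromℤ-^ x zero    = fromℤ-1
      fromℤ-^ x (suc k) = trans (fromℤ-* x (x ℤ.^ k)) (*-congˡ (fromℤ-^ x k))

      fromℤ-power : ∀ {n} (v : Vec ℤ n) e → power (λ i → fromℤ (lookup v i)) e ≈ fromℤ (powerℤ v e)
      fromℤ-power []      []      = sym fromℤ-1
      fromℤ-power (x ∷ v) (k ∷ e) = trans (*-cong (sym (fromℤ-^ x k)) (fromℤ-power v e)) (sym (fromℤ-* (x ℤ.^ k) (powerℤ v e)))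

      power-scale : ∀ {n} c (v : Vector Carrier n) e → power (λ i → c * v i) e ≈ c ^ Vec.sum e * power v e
      power-scale c v []      = sym (*-identityˡ 1#)
      power-scale c v (k ∷ e) = begin
        (c * v zero) ^ k * power (λ i → c * v (suc i)) e             ≈⟨ *-cong (^-distrib-* c (v zero) k) (power-scale c (v ∘ suc) e) ⟩
        c ^ k * v zero ^ k * (c ^ Vec.sum e * power (v ∘ suc) e)     ≈⟨ solve 4 (λ a b c d → a :* b :* (c :* d) := a :* c :* (b :* d)) refl (c ^ k) (v zero ^ k) (c ^ Vec.sum e) _ ⟩
        c ^ k * c ^ Vec.sum e * (v zero ^ k * power (v ∘ suc) e)     ≈⟨ *-congʳ (^-homo-* c k (Vec.sum e)) ⟨
        c ^ (k ℕ.+ Vec.sum e) * (v zero ^ k * power (v ∘ suc) e)     ∎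
        where open ≈

    κ : Carrier
    κ = ⟦ κᶜ ⟧

    2κ²≈-1 : fromℤ (+ 2) * (κ * κ) ≈ - 1#
    2κ²≈-1 = begin
      fromℤ (+ 2) * (κ * κ)                 ≈⟨ *-cong (⟦intᶜ⟧ (+ 2)) (⟦⟧-⊠ κᶜ κᶜ) ⟨
      ⟦ intᶜ (+ 2) ⟧ * ⟦ κᶜ ⊠ κᶜ ⟧          ≈⟨ ⟦⟧-⊠ (intᶜ (+ 2)) (κᶜ ⊠ κᶜ) ⟨
      ⟦ intᶜ (+ 2) ⊠ (κᶜ ⊠ κᶜ) ⟧            ≈⟨ ⟦⟧-cong 2κ²≃-1 ⟩
      ⟦ intᶜ -1ℤ ⟧                          ≈⟨ trans (⟦intᶜ⟧ -1ℤ) (-‿cong fromℤ-1) ⟩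
      - 1#                                  ∎
      where open ≈

    infixr 8 _⊡_
    _⊡_ : ∀ {m n} → (Fin m → Fin n → ℤ) → Vector Carrier n → Vector Carrier m
    (A ⊡ y) i = sum λ j → fromℤ (A i j) * y j

    entries : ∀ {m n} → Vec (Vec ℤ n) m → Fin m → Fin n → ℤ
    entries A i j = lookup (lookup A i) j

    private
      fromℤ-sum : ∀ {m} (t : Fin m → ℤ) → fromℤ (Data.Vec.Functional.foldr ℤ._+_ 0ℤ t) ≈ sum (fromℤ ∘ t)
      fromℤ-sum {zero}  t = refl
      fromℤ-sum {suc m} t = trans (fromℤ-+ (t zero) _) (+-congˡ (fromℤ-sum (t ∘ suc)))

    ⊡-⊛ : ∀ {l m n} (A : Vec (Vec ℤ m) l) (B : Vec (Vec ℤ n) m) y i → ((A ⊛ B) ⊡ y) i ≈ (entries A ⊡ entries B ⊡ y) i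
    ⊡-⊛ A B y i = begin
      sum (λ j → fromℤ ((A ⊛ B) i j) * y j)
        ≈⟨ sum-cong-≋ (λ j → trans (*-congʳ (trans (fromℤ-sum (λ k → entries A i k ℤ.* entries B k j)) (sum-cong-≋ λ k → fromℤ-* (entries A i k) (entries B k j))))
             (*-distribʳ-sum (y j) (λ k → fromℤ (entries A i k) * fromℤ (entries B k j)))) ⟩
      sum (λ j → sum (λ k → fromℤ (entries A i k) * fromℤ (entries B k j) * y j))
        ≈⟨ ∑-comm (λ j k → fromℤ (entries A i k) * fromℤ (entries B k j) * y j) ⟩
      sum (λ k → sum (λ j → fromℤ (entries A i k) * fromℤ (entries B k j) * y j))
        ≈⟨ sum-cong-≋ (λ k → trans (sum-cong-≋ λ j → *-assoc (fromℤ (entries A i k)) (fromℤ (entries B k j)) (y j))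
             (sym (*-distribˡ-sum (fromℤ (entries A i k)) (λ j → fromℤ (entries B k j) * y j)))) ⟩
      sum (λ k → fromℤ (entries A i k) * sum (λ j → fromℤ (entries B k j) * y j)) ∎
      where open ≈

    ⊡-cong : ∀ {m n} {A B : Fin m → Fin n → ℤ} → (∀ i j → A i j ≡ B i j) → ∀ y i → (A ⊡ y) i ≈ (B ⊡ y) i
    ⊡-cong h y i = sum-cong-≋ λ j → *-congʳ (reflexive (cong fromℤ (h i j)))

    ⊡-zero : ∀ {m n} (A : Fin m → Fin n → ℤ) {y} → (∀ j → y j ≈ 0#) → ∀ i → (A ⊡ y) i ≈ 0#
    ⊡-zero {n = n} A h i = trans (sum-cong-≋ λ j → trans (*-congˡ {fromℤ (A i j)} (h j)) (zeroʳ _)) (sum-replicate-zero n)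

    ⊡-+ : ∀ {m n} (A B : Fin m → Fin n → ℤ) y i → ((λ i j → A i j ℤ.+ B i j) ⊡ y) i ≈ (A ⊡ y) i + (B ⊡ y) i
    ⊡-+ A B y i = trans (sum-cong-≋ λ j → trans (*-congʳ (fromℤ-+ (A i j) (B i j))) (distribʳ (y j) _ _)) (∑-distrib-+ (λ j → fromℤ (A i j) * y j) (λ j → fromℤ (B i j) * y j))

    ⊡-scalar : ∀ {n} c (y : Vector Carrier n) i → (scalar c ⊡ y) i ≈ fromℤ c * y i
    ⊡-scalar {suc n} c y zero = trans (+-congˡ (trans (sum-cong-≋ λ j → zeroˡ (y (suc j))) (sum-replicate-zero n))) (+-identityʳ _)
    ⊡-scalar {suc n} c y (suc i) = trans (+-congʳ (zeroˡ (y zero))) (trans (+-identityˡ _) (⊡-scalar c (y ∘ suc) i))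

    module _ {Q : Polynomial} (h : FixedByGenerators Q) (homogeneous : Homogeneous 16 Q) where
      private
        move : ∀ m e → coefficient Q (permute (lookup (permutation m)) e) ≈ ζ ^ dot (phases m) e * coefficient Q e
        move m e = begin
          coefficient Q e′                                       ≈⟨ ≋⇒≈ᴾ (fixes-move h m) e′ ⟨
          coefficient (⟦ moveᶜ m ⟧ᴹ • Q) e′                      ≈⟨ ≋⇒≈ᴾ (•-congˡ ⟦ moveᶜ m ⟧ᴹ M Q entry) e′ ⟩
          coefficient (M • Q) e′                                 ≈⟨ coefficient-monomialMatrix (lookup π) (lookup π) (involutive m) (involutive m) (λ i → ζ ^ lookup a i) Q e ⟩
          power (λ i → ζ ^ lookup a i) e * coefficient Q e       ≈⟨ *-congʳ (power-phases a e) ⟩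
          ζ ^ dot a e * coefficient Q e                          ∎
          where
          open ≈
          π : Vec (Fin 6) 6
          π = permutation m
          a : Vec ℕ 6
          a = phases m
          e′ : Exponent
          e′ = permute (lookup π) e
          M : Matrix
          M = monomialMatrix (lookup π) (lookup π) (involutive m) (involutive m) (λ i → ζ ^ lookup a i)
          entry : ⟦ moveᶜ m ⟧ᴹ ≈ᴹ M
          entry i j with does (lookup π i Fin.≟ j)
          ... | true  = ⟦ζᶜ⟧ (lookup a i)
          ... | false = ⟦⟧-0

        along : ∀ ms e → coefficient Q (proj₁ (run ms e)) ≈ ζ ^ proj₂ (run ms e) * coefficient Q e
        along []       e = sym (*-identityˡ _)
        along (m ∷ ms) e = begin
          coefficient Q (proj₁ (run ms e′))                              ≈⟨ along ms e′ ⟩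
          ζ ^ k * coefficient Q e′                                       ≈⟨ *-congˡ (move m e) ⟩
          ζ ^ k * (ζ ^ dot (phases m) e * coefficient Q e)               ≈⟨ *-assoc _ _ _ ⟨
          ζ ^ k * ζ ^ dot (phases m) e * coefficient Q e                 ≈⟨ *-congʳ (^-homo-* ζ k (dot (phases m) e)) ⟨
          ζ ^ (k ℕ.+ dot (phases m) e) * coefficient Q e                 ∎
          where
          open ≈
          e′ : Exponent
          e′ = permute (lookup (permutation m)) e
          k : ℕ
          k = proj₂ (run ms e′)

        killed⇒0 : ∀ e → Killed e → coefficient Q e ≈ 0#
        killed⇒0 e kill = from (Any.satisfied kill)
          where
          from : (∃ λ ms → proj₁ (run ms e) ≡ e × (proj₂ (run ms e) ℕ.* toMinusOne (proj₂ (run ms e))) % 8 ≡ 4) → coefficient Q e ≈ 0#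
          from (ms , fixed , k≡4) = fixed-by-root (proj₂ (run ms e)) (toMinusOne (proj₂ (run ms e))) (coefficient Q e) k≡4
            (trans (reflexive (cong (coefficient Q) (≡.sym fixed))) (along ms e))

        vanishes : ∀ e → e ∉ˡ surviving (Vec.map (orbit orbitPaths) orbitRepresentatives) → coefficient Q e ≈ 0#
        vanishes e e∉ = bySum (Vec.sum e ℕ.≟ 16)
          where
          bySum : Dec (Vec.sum e ≡ 16) → coefficient Q e ≈ 0#
          bySum (no e≢16)  = homogeneous e e≢16
          bySum (yes e≡16) = Data.Sum.[ killed⇒0 e , (λ e∈ → contradiction e∈ e∉) ]′ (killed-or-surviving e e≡16)

        InOrbit : Exponent → Exponent × ℕ → Set r′
        InOrbit r (e , k) = coefficient Q e ≈ ζ ^ k * coefficient Q r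

        in-orbit : ∀ r paths → All (InOrbit r) (orbit paths r)
        in-orbit r []           = []
        in-orbit r (ms ∷ paths) = add (run ms r) (orbit paths r) (along ms r) (in-orbit r paths)
          where
          add : ∀ t ts → InOrbit r t → All (InOrbit r) ts → All (InOrbit r) (insert t ts)
          add t [] p [] = p ∷ []
          add (e , k) ((e′ , k′) ∷ ts) p (q ∷ qs) with does (e ≟ᵉ′ e′)
          ... | true  = q ∷ qs
          ... | false = q ∷ add (e , k) ts p qs

      orbitCoefficients : Vector Carrier 16
      orbitCoefficients i = coefficient Q (lookup orbitRepresentatives i)

      private
        -- Generic in the paths, so that orbits are not unfolded.
        orbits-determine : ∀ e paths {n} (rs : Vec Exponent n) → (∀ i → coefficient Q (lookup rs i) ≈ 0#) →
                           e ∈ˡ surviving (Vec.map (orbit paths) rs) → coefficient Q e ≈ 0#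
        orbits-determine e paths (r ∷ rs) z e∈ = Data.Sum.[ inOne (in-orbit r paths) , orbits-determine e paths rs (z ∘ suc) ]′
          (List.∈-++⁻ (List.map proj₁ (orbit paths r)) e∈)
          where
          inOne : ∀ {o} → All (InOrbit r) o → e ∈ˡ List.map proj₁ o → coefficient Q e ≈ 0#
          inOne (p ∷ ps) (here ≡.refl) = trans p (trans (*-congˡ (z zero)) (zeroʳ _))
          inOne (p ∷ ps) (there i)     = inOne ps i

        determined : ∀ e paths → (∀ i → orbitCoefficients i ≈ 0#) → (e ∉ˡ surviving (Vec.map (orbit paths) orbitRepresentatives) → coefficient Q e ≈ 0#) →
                     coefficient Q e ≈ 0#
        determined e paths y≈0 v = byMembership (member? e (surviving (Vec.map (orbit paths) orbitRepresentatives)))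
          where
          byMembership : Dec (e ∈ˡ surviving (Vec.map (orbit paths) orbitRepresentatives)) → coefficient Q e ≈ 0#
          byMembership (yes e∈) = orbits-determine e paths orbitRepresentatives y≈0 e∈
          byMembership (no e∉)  = v e∉

      -- In degree 16 a coefficient of `Q` is either killed by a diagonal element or a root of unity
      -- times the coefficient at a representative; in other degrees it is zero.
      orbitCoefficients-determine : (∀ i → orbitCoefficients i ≈ 0#) → ∀ e → coefficient Q e ≈ 0#
      orbitCoefficients-determine y≈0 e = determined e orbitPaths y≈0 (vanishes e)

      private
        -- The value of `Q` at an integral point, written as a linear form in the orbit
        -- coefficients.
        value : List (List Move) → ∀ {n} → Vec Exponent n → Vec ℤ 6 → Carrier
        value paths rs v = sum λ i → fromℤ (orbitSum v (orbit paths (lookup rs i))) * coefficient Q (lookup rs i)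

        scaled : Carrier → Vec ℤ 6 → Vector Carrier 6
        scaled c v i = c * fromℤ (lookup v i)

        orbit-value : ∀ c v r {o} → All (InOrbit r) o → Real o →
                      ∑ (List.map proj₁ o) (λ e → coefficient Q e * power (scaled c v) e) ≈ c ^ 16 * (fromℤ (orbitSum v o) * coefficient Q r)
        orbit-value c v r []       []               = sym (trans (*-congˡ (zeroˡ _)) (zeroʳ _))
        orbit-value c v r {(e , k) ∷ o} (p ∷ ps) ((e≡16 , k%8) ∷ qs) = begin
          coefficient Q e * power (scaled c v) e + ∑ (List.map proj₁ o) (λ e → coefficient Q e * power (scaled c v) e)
            ≈⟨ +-cong (*-cong (trans p (*-congʳ (ζ^-sign k k%8)))
                              (trans (power-scale c (λ i → fromℤ (lookup v i)) e) (*-cong (reflexive (cong (c ^_) e≡16)) (fromℤ-power v e))))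
                      (orbit-value c v r ps qs) ⟩
          fromℤ (sign k) * coefficient Q r * (c ^ 16 * fromℤ (powerℤ v e)) + c ^ 16 * (fromℤ (orbitSum v o) * coefficient Q r)
            ≈⟨ solve 5 (λ s y c p o → s :* y :* (c :* p) :+ c :* (o :* y) := c :* ((s :* p :+ o) :* y)) refl (fromℤ (sign k)) (coefficient Q r) (c ^ 16) (fromℤ (powerℤ v e)) (fromℤ (orbitSum v o)) ⟩
          c ^ 16 * ((fromℤ (sign k) * fromℤ (powerℤ v e) + fromℤ (orbitSum v o)) * coefficient Q r)
            ≈⟨ *-congˡ (*-congʳ (trans (fromℤ-+ (sign k ℤ.* powerℤ v e) (orbitSum v o)) (+-congʳ (fromℤ-* (sign k) (powerℤ v e))))) ⟨
          c ^ 16 * (fromℤ (sign k ℤ.* powerℤ v e ℤ.+ orbitSum v o) * coefficient Q r) ∎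
          where open ≈

        orbits-value : ∀ paths c v {n} (rs : Vec Exponent n) → VecAll.All Real (Vec.map (orbit paths) rs) →
                       ∑ (surviving (Vec.map (orbit paths) rs)) (λ e → coefficient Q e * power (scaled c v) e) ≈ c ^ 16 * value paths rs v
        orbits-value paths c v []       VecAll.[]       = sym (zeroʳ _)
        orbits-value paths c v (r ∷ rs) (p VecAll.∷ ps) = trans (∑-++ (List.map proj₁ (orbit paths r)) (surviving (Vec.map (orbit paths) rs)))
          (trans (+-cong (orbit-value c v r (in-orbit r paths) p) (orbits-value paths c v rs ps)) (sym (distribˡ _ _ _)))

        evaluate-scaled : ∀ c v → evaluate (scaled c v) Q ≈ c ^ 16 * value orbitPaths orbitRepresentatives v
        evaluate-scaled c v = trans (expand-support survivors-unique Q vanishes (power (scaled c v)))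
          (orbits-value orbitPaths c v orbitRepresentatives orbits-real)

        -- 256 κ¹⁶ = (2κ²)⁸. In `power-of` a variable replaces κ, so that the fraction behind it
        -- stays folded.
        256*κ¹⁶≈1 : fromℤ (+ 256) * κ ^ 16 ≈ 1#
        256*κ¹⁶≈1 = power-of κ 2κ²≈-1
          where
          power-of : ∀ k → fromℤ (+ 2) * (k * k) ≈ - 1# → fromℤ (+ 256) * k ^ 16 ≈ 1#
          power-of k h = begin
            fromℤ (+ 256) * k ^ 16           ≈⟨ solve 1 (λ k → con (+ 256) :* k :^ 16 := (con (+ 2) :* (k :* k)) :^ 8) refl k ⟩
            (fromℤ (+ 2) * (k * k)) ^ 8      ≈⟨ ^-congˡ 8 (trans h (-‿cong (sym fromℤ-1))) ⟩
            (- fromℤ 1ℤ) ^ 8                 ≈⟨ solve 0 ((:- con 1ℤ) :^ 8 := con 1ℤ) refl ⟩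
            fromℤ 1ℤ                         ≈⟨ fromℤ-1 ⟩
            1#                               ∎
            where open ≈

        hadamard-scaled : ∀ v i → sum (λ j → ⟦ Hᶜ i j ⟧ * scaled 1# v j) ≈ scaled κ (hadamard v) i
        hadamard-scaled v i = begin
          sum (λ j → ⟦ κᶜ ⊠ intᶜ (entries H-rows i j) ⟧ * (1# * fromℤ (lookup v j)))
            ≈⟨ sum-cong-≋ (λ j → trans (*-cong (trans (⟦⟧-⊠ κᶜ (intᶜ (entries H-rows i j))) (*-congˡ (⟦intᶜ⟧ (entries H-rows i j)))) (*-identityˡ _))
                 (trans (*-assoc κ _ _) (*-congˡ (sym (fromℤ-* (entries H-rows i j) (lookup v j)))))) ⟩
          sum (λ j → κ * fromℤ (entries H-rows i j ℤ.* lookup v j))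
            ≈⟨ *-distribˡ-sum κ (λ j → fromℤ (entries H-rows i j ℤ.* lookup v j)) ⟨
          κ * sum (λ j → fromℤ (entries H-rows i j ℤ.* lookup v j))
            ≈⟨ *-congˡ (trans (sym (fromℤ-sum λ j → entries H-rows i j ℤ.* lookup v j))
                 (reflexive (cong fromℤ (≡.sym (Vec.lookup∘tabulate (λ i → Data.Vec.Functional.foldr ℤ._+_ 0ℤ λ j → entries H-rows i j ℤ.* lookup v j) i))))) ⟩
          κ * fromℤ (lookup (hadamard v) i) ∎
          where open ≈

        -- `Hᶜ` fixes `Q`, so `Q` agrees at v and at κ times `hadamard v`; homogeneity takes out the
        -- factor κ¹⁶.
        invariance : ∀ v → fromℤ (+ 256) * value orbitPaths orbitRepresentatives v ≈ value orbitPaths orbitRepresentatives (hadamard v)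
        invariance v = begin
          fromℤ (+ 256) * V v                                             ≈⟨ *-congˡ (trans (*-congʳ (1^ 16)) (*-identityˡ (V v))) ⟨
          fromℤ (+ 256) * (1# ^ 16 * V v)                                 ≈⟨ *-congˡ (evaluate-scaled 1# v) ⟨
          fromℤ (+ 256) * evaluate (scaled 1# v) Q                        ≈⟨ *-congˡ (functional (fixes-H h) (power (scaled 1# v))) ⟨
          fromℤ (+ 256) * evaluate (scaled 1# v) (⟦ Hᶜ ⟧ᴹ • Q)            ≈⟨ *-congˡ (evaluate-• ⟦ Hᶜ ⟧ᴹ (scaled 1# v) Q) ⟩
          fromℤ (+ 256) * evaluate (λ i → sum λ j → ⟦ Hᶜ i j ⟧ * scaled 1# v j) Q
            ≈⟨ *-congˡ (⟪⟫-congᶠ (power-cong (hadamard-scaled v)) Q) ⟩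
          fromℤ (+ 256) * evaluate (scaled κ (hadamard v)) Q              ≈⟨ *-congˡ (evaluate-scaled κ (hadamard v)) ⟩
          fromℤ (+ 256) * (κ ^ 16 * V (hadamard v))                       ≈⟨ *-assoc _ _ _ ⟨
          fromℤ (+ 256) * κ ^ 16 * V (hadamard v)                         ≈⟨ trans (*-congʳ 256*κ¹⁶≈1) (*-identityˡ (V (hadamard v))) ⟩
          V (hadamard v)                                                  ∎
          where
          open ≈
          V : Vec ℤ 6 → Carrier
          V = value orbitPaths orbitRepresentatives

        -- Stated for arbitrary paths and for any table equal to the computed one, which keeps
        -- orbits and numerals folded during type checking.
        equations-hold : ∀ paths E → Vec.map (equation (Vec.map (orbit paths) orbitRepresentatives)) points ≡ E →
                         (∀ v → fromℤ (+ 256) * value paths orbitRepresentatives v ≈ value paths orbitRepresentatives (hadamard v)) →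
                         ∀ m → (entries E ⊡ orbitCoefficients) m ≈ 0#
        equations-hold paths E E≡ inv m = begin
          sum (λ i → fromℤ (entries E m i) * y i)
            ≈⟨ sum-cong-≋ (λ i → *-congʳ {y i} (trans (reflexive (cong fromℤ (entry i))) (trans (fromℤ-+ (+ 256 ℤ.* a i) (ℤ.- b i)) (+-cong (fromℤ-* (+ 256) (a i)) (fromℤ-neg (b i)))))) ⟩
          sum (λ i → (fromℤ (+ 256) * fromℤ (a i) + - fromℤ (b i)) * y i)
            ≈⟨ sum-cong-≋ (λ i → solve 4 (λ n a b y → (n :* a :+ :- b) :* y := n :* (a :* y) :+ :- (con 1ℤ) :* (b :* y)) refl (fromℤ (+ 256)) (fromℤ (a i)) (fromℤ (b i)) (y i)) ⟩
          sum (λ i → fromℤ (+ 256) * (fromℤ (a i) * y i) + - fromℤ 1ℤ * (fromℤ (b i) * y i))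
            ≈⟨ ∑-distrib-+ (λ i → fromℤ (+ 256) * (fromℤ (a i) * y i)) (λ i → - fromℤ 1ℤ * (fromℤ (b i) * y i)) ⟩
          sum (λ i → fromℤ (+ 256) * (fromℤ (a i) * y i)) + sum (λ i → - fromℤ 1ℤ * (fromℤ (b i) * y i))
            ≈⟨ +-cong (*-distribˡ-sum (fromℤ (+ 256)) (λ i → fromℤ (a i) * y i)) (*-distribˡ-sum (- fromℤ 1ℤ) (λ i → fromℤ (b i) * y i)) ⟨
          fromℤ (+ 256) * value paths orbitRepresentatives v + - fromℤ 1ℤ * value paths orbitRepresentatives (hadamard v)
            ≈⟨ +-cong (inv v) (trans (*-congʳ (-‿cong fromℤ-1)) (-1*x≈-x _)) ⟩
          value paths orbitRepresentatives (hadamard v) + - value paths orbitRepresentatives (hadamard v)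
            ≈⟨ -‿inverseʳ _ ⟩
          0# ∎
          where
          open ≈
          y : Vector Carrier 16
          y = orbitCoefficients
          v : Vec ℤ 6
          v = lookup points m
          a b : Fin 16 → ℤ
          a i = orbitSum v (orbit paths (lookup orbitRepresentatives i))
          b i = orbitSum (hadamard v) (orbit paths (lookup orbitRepresentatives i))
          entry : ∀ i → entries E m i ≡ + 256 ℤ.* a i ℤ.- b i
          entry i = ≡.trans (cong (λ E → entries E m i) (≡.sym E≡))
            (≡.trans (cong (λ t → lookup t i) (Vec.lookup-map m (equation (Vec.map (orbit paths) orbitRepresentatives)) points))
              (≡.trans (Vec.lookup-map i (λ o → + 256 ℤ.* orbitSum v o ℤ.- orbitSum (hadamard v) o) (Vec.map (orbit paths) orbitRepresentatives))
                (cong (λ o → + 256 ℤ.* orbitSum v o ℤ.- orbitSum (hadamard v) o) (Vec.lookup-map i (orbit paths) orbitRepresentatives))))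

      -- For the vector y of orbit coefficients, ℓ y = Y (L y) + K (E y) and E y = 0. So y is, up to
      -- ℓ, the combination of the columns of Y with coordinates L y.
      orbitCoefficients-combination : ∀ i → fromℤ (+ ℓ) * orbitCoefficients i ≈ (entries basisCoefficients ⊡ entries leftInverse ⊡ orbitCoefficients) i
      orbitCoefficients-combination i = begin
        fromℤ (+ ℓ) * y i                                                                             ≈⟨ ⊡-scalar (+ ℓ) y i ⟨
        (scalar (+ ℓ) ⊡ y) i                                                                          ≈⟨ ⊡-cong Y*L+K*E≡ℓ y i ⟨
        ((λ i j → (basisCoefficients ⊛ leftInverse) i j ℤ.+ (cofactor ⊛ equations) i j) ⊡ y) i     ≈⟨ ⊡-+ (basisCoefficients ⊛ leftInverse) (cofactor ⊛ equations) y i ⟩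
        ((basisCoefficients ⊛ leftInverse) ⊡ y) i + ((cofactor ⊛ equations) ⊡ y) i                 ≈⟨ +-cong (⊡-⊛ basisCoefficients leftInverse y i) (⊡-⊛ cofactor equations y i) ⟩
        (entries basisCoefficients ⊡ entries leftInverse ⊡ y) i + (entries cofactor ⊡ entries equations ⊡ y) i
          ≈⟨ +-congˡ (⊡-zero (entries cofactor) (equations-hold orbitPaths equations equations-correct invariance) i) ⟩
        (entries basisCoefficients ⊡ entries leftInverse ⊡ y) i + 0#                               ≈⟨ +-identityʳ _ ⟩
        (entries basisCoefficients ⊡ entries leftInverse ⊡ y) i                                    ∎
        where
        open ≈
        y : Vector Carrier 16
        y = orbitCoefficients

-- Quadratic forms in the pairings

module PairingForms where

  open RingBasics
  open PolynomialRings
  open MatrixActions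
  open CyclotomicNumbers
  open GeneratorMatrices
  open BlockCoordinates
  open ExponentOrbits
  open OrbitCertificate
  open OrbitSpanning

  infixl 6 _⊹_
  infixl 7 _⊗_
  -- One syntax with several readings: elements of a ring (`eval`), input for the ring solver
  -- (`toSolver`), and polynomials over ℤ with computable coefficients
  -- (`IntegerPolynomials.polynomial`).
  data Expr (m : ℕ) : Set where
    letter  : Fin m → Expr m
    int     : ℤ → Expr m
    _⊹_ _⊗_ : Expr m → Expr m → Expr m

  bind : ∀ {l m} → (Fin l → Expr m) → Expr l → Expr m
  bind σ (letter i) = σ i
  bind σ (int k)    = int k
  bind σ (e ⊹ e′)   = bind σ e ⊹ bind σ e′
  bind σ (e ⊗ e′)   = bind σ e ⊗ bind σ e′

  -- X⁴ X′⁴ + X⁴ Y′⁴ + Y⁴ X′⁴ + Y⁴ Y′⁴ + 12 X² Y² X′² Y′²: the polarization of the weight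
  -- enumerator X⁸ + 14 X⁴ Y⁴ + Y⁸ of ℰ₈, as a quadratic form in X⁴ + Y⁴ and X² Y².
  pairing : Expr 4
  pairing = (X⁴ ⊹ Y⁴) ⊗ (X′⁴ ⊹ Y′⁴) ⊹ int (+ 12) ⊗ (X² ⊗ Y² ⊗ (X′² ⊗ Y′²))
    where
    X² Y² X′² Y′² X⁴ Y⁴ X′⁴ Y′⁴ : Expr 4
    X²  = letter 0F ⊗ letter 0F
    Y²  = letter 1F ⊗ letter 1F
    X′² = letter 2F ⊗ letter 2F
    Y′² = letter 3F ⊗ letter 3F
    X⁴  = X² ⊗ X²
    Y⁴  = Y² ⊗ Y²
    X′⁴ = X′² ⊗ X′²
    Y′⁴ = Y′² ⊗ Y′²

  -- The planes (s, p), (t, q), (B, E) paired with themselves and each other.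
  pairs : Vec (Vec (Fin 6) 4) 6
  pairs = (0F ∷ 1F ∷ 0F ∷ 1F ∷ []) ∷ (2F ∷ 3F ∷ 2F ∷ 3F ∷ []) ∷ (4F ∷ 5F ∷ 4F ∷ 5F ∷ [])
        ∷ (0F ∷ 1F ∷ 2F ∷ 3F ∷ []) ∷ (0F ∷ 1F ∷ 4F ∷ 5F ∷ []) ∷ (2F ∷ 3F ∷ 4F ∷ 5F ∷ []) ∷ []

  pairingOf : Fin 6 → Expr 6
  pairingOf l = bind (letter ∘ lookup (lookup pairs l)) pairing

  -- The letters N are the pairings of the planes with themselves, the letters D those of distinct
  -- planes. `ΣN` is twice the enumerator of (`E₈`, `K₈`) and `W` eight times that of (`E₈`, `Q₈`),
  -- as `2EK` and `8EQ` show.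
  N₁ N₂ N₃ D₁₂ D₁₃ D₂₃ ΣN W : Expr 6
  N₁  = letter 0F
  N₂  = letter 1F
  N₃  = letter 2F
  D₁₂ = letter 3F
  D₁₃ = letter 4F
  D₂₃ = letter 5F
  ΣN  = N₁ ⊹ N₂ ⊹ N₃
  W   = ΣN ⊹ int (+ 6) ⊗ (D₁₂ ⊹ D₁₃ ⊹ int -1ℤ ⊗ D₂₃)

  -- With D the symmetric matrix of the pairings and q the one with q₁₁ = q₂₂ = q₃₃ = 1
  -- and q₁₂ = q₁₃ = - q₂₃ = 3, the last two forms are (tr q D)² + 2 tr (q D q D) and
  -- 4 (tr q D · tr D + 2 tr (q D²)).
  basisForm : Fin 6 → Expr 6
  basisForm 0F = W ⊗ W
  basisForm 1F = ΣN ⊗ ΣN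
  basisForm 2F = W ⊗ ΣN
  basisForm 3F = N₁ ⊗ N₁ ⊹ N₂ ⊗ N₂ ⊹ N₃ ⊗ N₃
  basisForm 4F = W ⊗ W
    ⊹ N₁ ⊗ (int (+ 2) ⊗ N₁ ⊹ int (+ 36) ⊗ N₂ ⊹ int (+ 36) ⊗ N₃ ⊹ int (+ 24) ⊗ D₁₂ ⊹ int (+ 24) ⊗ D₁₃ ⊹ int (+ 72) ⊗ D₂₃)
    ⊹ N₂ ⊗ (int (+ 2) ⊗ N₂ ⊹ int (+ 36) ⊗ N₃ ⊹ int (+ 24) ⊗ D₁₂ ⊹ int -[1+ 71 ] ⊗ D₁₃ ⊹ int -[1+ 23 ] ⊗ D₂₃)
    ⊹ N₃ ⊗ (int (+ 2) ⊗ N₃ ⊹ int -[1+ 71 ] ⊗ D₁₂ ⊹ int (+ 24) ⊗ D₁₃ ⊹ int -[1+ 23 ] ⊗ D₂₃)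
    ⊹ D₁₂ ⊗ (int (+ 40) ⊗ D₁₂ ⊹ int (+ 48) ⊗ D₁₃ ⊹ int -[1+ 47 ] ⊗ D₂₃)
    ⊹ D₁₃ ⊗ (int (+ 40) ⊗ D₁₃ ⊹ int -[1+ 47 ] ⊗ D₂₃)
    ⊹ D₂₃ ⊗ (int (+ 40) ⊗ D₂₃)
  basisForm 5F = int (+ 4) ⊗ (W ⊗ ΣN
    ⊹ N₁ ⊗ (int (+ 2) ⊗ N₁ ⊹ int (+ 12) ⊗ D₁₂ ⊹ int (+ 12) ⊗ D₁₃)
    ⊹ N₂ ⊗ (int (+ 2) ⊗ N₂ ⊹ int (+ 12) ⊗ D₁₂ ⊹ int -[1+ 11 ] ⊗ D₂₃)
    ⊹ N₃ ⊗ (int (+ 2) ⊗ N₃ ⊹ int (+ 12) ⊗ D₁₃ ⊹ int -[1+ 11 ] ⊗ D₂₃)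
    ⊹ D₁₂ ⊗ (int (+ 4) ⊗ D₁₂ ⊹ int -[1+ 11 ] ⊗ D₁₃ ⊹ int (+ 12) ⊗ D₂₃)
    ⊹ D₁₃ ⊗ (int (+ 4) ⊗ D₁₃ ⊹ int (+ 12) ⊗ D₂₃)
    ⊹ D₂₃ ⊗ (int (+ 4) ⊗ D₂₃))

  basisExpr : Fin 6 → Expr 6
  basisExpr k = bind pairingOf (basisForm k)

  -- The first three are the products of the factors 8 and 2 belonging to `W` and `ΣN`. The last two
  -- arise as 192 = 3 · 8 · 8 and 192 = 12 · 8 · 2 / 1, the factors 3 and 12 being those of
  -- `∑-Q-form²` and `∑-Q-K-form`.
  denominators : Vec ℕ 6
  denominators = 64 ∷ 4 ∷ 16 ∷ 2 ∷ 192 ∷ 192 ∷ []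

  module Evaluation {r ℓ} (R : CommutativeRing r ℓ) where
    open CommutativeRing R hiding (zero)
    open Integers R

    eval : ∀ {m} → Vector Carrier m → Expr m → Carrier
    eval ρ (letter i) = ρ i
    eval ρ (int k)    = fromℤ k
    eval ρ (e ⊹ e′)   = eval ρ e + eval ρ e′
    eval ρ (e ⊗ e′)   = eval ρ e * eval ρ e′

    eval-cong : ∀ {m} {ρ ρ′ : Vector Carrier m} → (∀ i → ρ i ≈ ρ′ i) → ∀ e → eval ρ e ≈ eval ρ′ e
    eval-cong h (letter i) = h i
    eval-cong h (int k)    = refl
    eval-cong h (e ⊹ e′)   = +-cong (eval-cong h e) (eval-cong h e′)
    eval-cong h (e ⊗ e′)   = *-cong (eval-cong h e) (eval-cong h e′)

    eval-bind : ∀ {l m} (ρ : Vector Carrier m) (σ : Fin l → Expr m) e → eval ρ (bind σ e) ≡ eval (eval ρ ∘ σ) e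
    eval-bind ρ σ (letter i) = ≡.refl
    eval-bind ρ σ (int k)    = ≡.refl
    eval-bind ρ σ (e ⊹ e′)   = cong₂ _+_ (eval-bind ρ σ e) (eval-bind ρ σ e′)
    eval-bind ρ σ (e ⊗ e′)   = cong₂ _*_ (eval-bind ρ σ e) (eval-bind ρ σ e′)

    toSolver : ∀ {l m} → Vec (Term m) l → Expr l → Term m
    toSolver ρ (letter i) = lookup ρ i
    toSolver ρ (int k)    = con k
    toSolver ρ (e ⊹ e′)   = toSolver ρ e :+ toSolver ρ e′
    toSolver ρ (e ⊗ e′)   = toSolver ρ e :* toSolver ρ e′

    -- The actions of X and of E₁, E₂ on the pairings.
    swapped₂₃ swapped₁₂ : Vector Carrier 6 → Vec Carrier 6
    swapped₂₃ ρ = ρ 0F ∷ ρ 2F ∷ ρ 1F ∷ ρ 4F ∷ ρ 3F ∷ ρ 5F ∷ []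
    swapped₁₂ ρ = ρ 1F ∷ ρ 0F ∷ ρ 2F ∷ ρ 3F ∷ - ρ 5F ∷ - ρ 4F ∷ []

    -- Exchanging planes 2 and 3 replaces D by P D Pᵗ for a permutation matrix P that preserves q,
    -- so the traces in D and q do not change; the sum of squares in `basisForm 3F` is symmetric.
    basisForm-swap₂₃ : ∀ ρ k → eval (lookup (swapped₂₃ ρ)) (basisForm k) ≈ eval ρ (basisForm k)
    basisForm-swap₂₃ ρ 0F = solve 6 (λ n₁ n₂ n₃ d₁₂ d₁₃ d₂₃ → toSolver (n₁ ∷ n₃ ∷ n₂ ∷ d₁₃ ∷ d₁₂ ∷ d₂₃ ∷ []) (basisForm 0F)
      := toSolver (n₁ ∷ n₂ ∷ n₃ ∷ d₁₂ ∷ d₁₃ ∷ d₂₃ ∷ []) (basisForm 0F)) refl (ρ 0F) (ρ 1F) (ρ 2F) (ρ 3F) (ρ 4F) (ρ 5F)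
    basisForm-swap₂₃ ρ 1F = solve 6 (λ n₁ n₂ n₃ d₁₂ d₁₃ d₂₃ → toSolver (n₁ ∷ n₃ ∷ n₂ ∷ d₁₃ ∷ d₁₂ ∷ d₂₃ ∷ []) (basisForm 1F)
      := toSolver (n₁ ∷ n₂ ∷ n₃ ∷ d₁₂ ∷ d₁₃ ∷ d₂₃ ∷ []) (basisForm 1F)) refl (ρ 0F) (ρ 1F) (ρ 2F) (ρ 3F) (ρ 4F) (ρ 5F)
    basisForm-swap₂₃ ρ 2F = solve 6 (λ n₁ n₂ n₃ d₁₂ d₁₃ d₂₃ → toSolver (n₁ ∷ n₃ ∷ n₂ ∷ d₁₃ ∷ d₁₂ ∷ d₂₃ ∷ []) (basisForm 2F)
      := toSolver (n₁ ∷ n₂ ∷ n₃ ∷ d₁₂ ∷ d₁₃ ∷ d₂₃ ∷ []) (basisForm 2F)) refl (ρ 0F) (ρ 1F) (ρ 2F) (ρ 3F) (ρ 4F) (ρ 5F)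
    basisForm-swap₂₃ ρ 3F = solve 6 (λ n₁ n₂ n₃ d₁₂ d₁₃ d₂₃ → toSolver (n₁ ∷ n₃ ∷ n₂ ∷ d₁₃ ∷ d₁₂ ∷ d₂₃ ∷ []) (basisForm 3F)
      := toSolver (n₁ ∷ n₂ ∷ n₃ ∷ d₁₂ ∷ d₁₃ ∷ d₂₃ ∷ []) (basisForm 3F)) refl (ρ 0F) (ρ 1F) (ρ 2F) (ρ 3F) (ρ 4F) (ρ 5F)
    basisForm-swap₂₃ ρ 4F = solve 6 (λ n₁ n₂ n₃ d₁₂ d₁₃ d₂₃ → toSolver (n₁ ∷ n₃ ∷ n₂ ∷ d₁₃ ∷ d₁₂ ∷ d₂₃ ∷ []) (basisForm 4F)
      := toSolver (n₁ ∷ n₂ ∷ n₃ ∷ d₁₂ ∷ d₁₃ ∷ d₂₃ ∷ []) (basisForm 4F)) refl (ρ 0F) (ρ 1F) (ρ 2F) (ρ 3F) (ρ 4F) (ρ 5F)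
    basisForm-swap₂₃ ρ 5F = solve 6 (λ n₁ n₂ n₃ d₁₂ d₁₃ d₂₃ → toSolver (n₁ ∷ n₃ ∷ n₂ ∷ d₁₃ ∷ d₁₂ ∷ d₂₃ ∷ []) (basisForm 5F)
      := toSolver (n₁ ∷ n₂ ∷ n₃ ∷ d₁₂ ∷ d₁₃ ∷ d₂₃ ∷ []) (basisForm 5F)) refl (ρ 0F) (ρ 1F) (ρ 2F) (ρ 3F) (ρ 4F) (ρ 5F)

    -- Here P exchanges planes 1 and 2 and negates plane 3. It preserves q because q₁₃ = - q₂₃.
    basisForm-swap₁₂ : ∀ ρ k → eval (lookup (swapped₁₂ ρ)) (basisForm k) ≈ eval ρ (basisForm k)
    basisForm-swap₁₂ ρ 0F = solve 6 (λ n₁ n₂ n₃ d₁₂ d₁₃ d₂₃ → toSolver (n₂ ∷ n₁ ∷ n₃ ∷ d₁₂ ∷ :- d₂₃ ∷ :- d₁₃ ∷ []) (basisForm 0F)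
      := toSolver (n₁ ∷ n₂ ∷ n₃ ∷ d₁₂ ∷ d₁₃ ∷ d₂₃ ∷ []) (basisForm 0F)) refl (ρ 0F) (ρ 1F) (ρ 2F) (ρ 3F) (ρ 4F) (ρ 5F)
    basisForm-swap₁₂ ρ 1F = solve 6 (λ n₁ n₂ n₃ d₁₂ d₁₃ d₂₃ → toSolver (n₂ ∷ n₁ ∷ n₃ ∷ d₁₂ ∷ :- d₂₃ ∷ :- d₁₃ ∷ []) (basisForm 1F)
      := toSolver (n₁ ∷ n₂ ∷ n₃ ∷ d₁₂ ∷ d₁₃ ∷ d₂₃ ∷ []) (basisForm 1F)) refl (ρ 0F) (ρ 1F) (ρ 2F) (ρ 3F) (ρ 4F) (ρ 5F)
    basisForm-swap₁₂ ρ 2F = solve 6 (λ n₁ n₂ n₃ d₁₂ d₁₃ d₂₃ → toSolver (n₂ ∷ n₁ ∷ n₃ ∷ d₁₂ ∷ :- d₂₃ ∷ :- d₁₃ ∷ []) (basisForm 2F)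
      := toSolver (n₁ ∷ n₂ ∷ n₃ ∷ d₁₂ ∷ d₁₃ ∷ d₂₃ ∷ []) (basisForm 2F)) refl (ρ 0F) (ρ 1F) (ρ 2F) (ρ 3F) (ρ 4F) (ρ 5F)
    basisForm-swap₁₂ ρ 3F = solve 6 (λ n₁ n₂ n₃ d₁₂ d₁₃ d₂₃ → toSolver (n₂ ∷ n₁ ∷ n₃ ∷ d₁₂ ∷ :- d₂₃ ∷ :- d₁₃ ∷ []) (basisForm 3F)
      := toSolver (n₁ ∷ n₂ ∷ n₃ ∷ d₁₂ ∷ d₁₃ ∷ d₂₃ ∷ []) (basisForm 3F)) refl (ρ 0F) (ρ 1F) (ρ 2F) (ρ 3F) (ρ 4F) (ρ 5F)
    basisForm-swap₁₂ ρ 4F = solve 6 (λ n₁ n₂ n₃ d₁₂ d₁₃ d₂₃ → toSolver (n₂ ∷ n₁ ∷ n₃ ∷ d₁₂ ∷ :- d₂₃ ∷ :- d₁₃ ∷ []) (basisForm 4F)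
      := toSolver (n₁ ∷ n₂ ∷ n₃ ∷ d₁₂ ∷ d₁₃ ∷ d₂₃ ∷ []) (basisForm 4F)) refl (ρ 0F) (ρ 1F) (ρ 2F) (ρ 3F) (ρ 4F) (ρ 5F)
    basisForm-swap₁₂ ρ 5F = solve 6 (λ n₁ n₂ n₃ d₁₂ d₁₃ d₂₃ → toSolver (n₂ ∷ n₁ ∷ n₃ ∷ d₁₂ ∷ :- d₂₃ ∷ :- d₁₃ ∷ []) (basisForm 5F)
      := toSolver (n₁ ∷ n₂ ∷ n₃ ∷ d₁₂ ∷ d₁₃ ∷ d₂₃ ∷ []) (basisForm 5F)) refl (ρ 0F) (ρ 1F) (ρ 2F) (ρ 3F) (ρ 4F) (ρ 5F)

    -- With f = X⁴ + Y⁴ and g = X² Y², the Hadamard matrix acts by f ↦ 2f + 12g and g ↦ f - 2g,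
    -- which multiplies f f′ + 12 g g′ by 16. The scaling contributes c⁸, and 16 c⁸ = (4c⁴)² = 1.
    pairing-hadamard : ∀ c → c * c * (c * c) * fromℤ (+ 4) ≈ 1# → ∀ x y x′ y′ →
      eval (lookup (c * (x + y) ∷ c * (x - y) ∷ c * (x′ + y′) ∷ c * (x′ - y′) ∷ [])) pairing ≈ eval (lookup (x ∷ y ∷ x′ ∷ y′ ∷ [])) pairing
    pairing-hadamard c h x y x′ y′ = begin
      eval (lookup (c * (x + y) ∷ c * (x - y) ∷ c * (x′ + y′) ∷ c * (x′ - y′) ∷ [])) pairing
        ≈⟨ solve 5 (λ c x y x′ y′ → toSolver (c :* (x :+ y) ∷ c :* (x :- y) ∷ c :* (x′ :+ y′) ∷ c :* (x′ :- y′) ∷ []) pairing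
             := c :* c :* (c :* c) :* con (+ 4) :* (c :* c :* (c :* c) :* con (+ 4)) :* toSolver (x ∷ y ∷ x′ ∷ y′ ∷ []) pairing) refl c x y x′ y′ ⟩
      c * c * (c * c) * fromℤ (+ 4) * (c * c * (c * c) * fromℤ (+ 4)) * eval (lookup (x ∷ y ∷ x′ ∷ y′ ∷ [])) pairing
        ≈⟨ *-congʳ (trans (*-cong h h) (*-identityˡ 1#)) ⟩
      1# * eval (lookup (x ∷ y ∷ x′ ∷ y′ ∷ [])) pairing
        ≈⟨ *-identityˡ _ ⟩
      eval (lookup (x ∷ y ∷ x′ ∷ y′ ∷ [])) pairing ∎
      where open Relation.Binary.Reasoning.Setoid setoid

-- Action of the generators on the pairings

module SignedPermutations where

  open RingBasics
  open PolynomialRings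
  open MatrixActions
  open CyclotomicNumbers
  open GeneratorMatrices
  open BlockCoordinates
  open ExponentOrbits
  open OrbitCertificate
  open OrbitSpanning
  open PairingForms

  -- Permutations of (X, Y, X′, Y′) under which the pairing is unchanged; these are the ones that
  -- the generators produce.
  data PairSymmetry : Set where
    keep flipʳ flip exchange : PairSymmetry

  rearrange : ∀ {a} {A : Set a} → PairSymmetry → Vec A 4 → Vec A 4
  rearrange keep     v                       = v
  rearrange flipʳ    (x ∷ y ∷ x′ ∷ y′ ∷ []) = x ∷ y ∷ y′ ∷ x′ ∷ []
  rearrange flip     (x ∷ y ∷ x′ ∷ y′ ∷ []) = y ∷ x ∷ y′ ∷ x′ ∷ []
  rearrange exchange (x ∷ y ∷ x′ ∷ y′ ∷ []) = x′ ∷ y′ ∷ x ∷ y ∷ []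

  -- The exponents of ζ in the five terms of the pairing.
  termPhases : Vec ℕ 4 → Vec ℕ 5
  termPhases (a ∷ b ∷ a′ ∷ b′ ∷ []) = a ℕ.* 4 ℕ.+ a′ ℕ.* 4 ∷ a ℕ.* 4 ℕ.+ b′ ℕ.* 4 ∷ b ℕ.* 4 ℕ.+ a′ ℕ.* 4 ∷ b ℕ.* 4 ℕ.+ b′ ℕ.* 4
    ∷ a ℕ.* 2 ℕ.+ b ℕ.* 2 ℕ.+ (a′ ℕ.* 2 ℕ.+ b′ ℕ.* 2) ∷ []

  -- How a monomial matrix acts on the six pairings: with which sign, to which target.
  record Signed (π : Vec (Fin 6) 6) (a : Vec ℕ 6) : Set where
    field
      target     : Vec (Fin 6) 6
      phase      : Vec ℕ 6
      symmetry   : Vec PairSymmetry 6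
      rearranged : ∀ l → Vec.map (lookup π) (lookup pairs l) ≡ rearrange (lookup symmetry l) (lookup pairs (lookup target l))
      phases≡    : ∀ l → Vec.map (_% 8) (termPhases (Vec.map (lookup a) (lookup pairs l))) ≡ replicate 5 (lookup phase l % 8)
      real       : ∀ l → lookup phase l % 8 ≡ 0 ⊎ lookup phase l % 8 ≡ 4

  signed : ∀ π a (target : Vec (Fin 6) 6) (phase : Vec ℕ 6) (symmetry : Vec PairSymmetry 6) →
    True (Fin.all? λ l → Vec.≡-dec Fin._≟_ (Vec.map (lookup π) (lookup pairs l)) (rearrange (lookup symmetry l) (lookup pairs (lookup target l)))) →
    True (Fin.all? λ l → Vec.≡-dec ℕ._≟_ (Vec.map (_% 8) (termPhases (Vec.map (lookup a) (lookup pairs l)))) (replicate 5 (lookup phase l % 8))) →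
    True (Fin.all? λ l → lookup phase l % 8 ℕ.≟ 0 ⊎-dec lookup phase l % 8 ℕ.≟ 4) → Signed π a
  signed π a t p s h₁ h₂ h₃ = record { target = t ; phase = p ; symmetry = s
    ; rearranged = toWitness h₁ ; phases≡ = toWitness h₂ ; real = toWitness h₃ }

  signedP₁ : Signed swapBE (0 ∷ 0 ∷ 0 ∷ 0 ∷ 0 ∷ 0 ∷ [])
  signedP₁ = signed _ _ identityπ (replicate 6 0) (keep ∷ keep ∷ flip ∷ keep ∷ flipʳ ∷ flipʳ ∷ []) _ _ _

  signedP₂ : Signed swapBE (2 ∷ 2 ∷ 2 ∷ 6 ∷ 2 ∷ 2 ∷ [])
  signedP₂ = signed _ _ identityπ (replicate 6 0) (keep ∷ keep ∷ flip ∷ keep ∷ flipʳ ∷ flipʳ ∷ []) _ _ _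

  signedE₁ : Signed swap₁₂ (0 ∷ 2 ∷ 0 ∷ 2 ∷ 1 ∷ 7 ∷ [])
  signedE₁ = signed _ _ (1F ∷ 0F ∷ 2F ∷ 3F ∷ 5F ∷ 4F ∷ []) (0 ∷ 0 ∷ 0 ∷ 0 ∷ 4 ∷ 4 ∷ []) (keep ∷ keep ∷ keep ∷ exchange ∷ keep ∷ keep ∷ []) _ _ _

  signedE₂ : Signed swap₁₂ (0 ∷ 0 ∷ 0 ∷ 0 ∷ 1 ∷ 1 ∷ [])
  signedE₂ = signed _ _ (1F ∷ 0F ∷ 2F ∷ 3F ∷ 5F ∷ 4F ∷ []) (0 ∷ 0 ∷ 0 ∷ 0 ∷ 4 ∷ 4 ∷ []) (keep ∷ keep ∷ keep ∷ exchange ∷ keep ∷ keep ∷ []) _ _ _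

  signedzI : Signed identityπ (replicate 6 1)
  signedzI = signed _ _ identityπ (replicate 6 0) (replicate 6 keep) _ _ _

  rowExpr : ∀ {m l} → Vec ℤ m → (Fin m → Fin l) → Expr l
  rowExpr []      σ = int 0ℤ
  rowExpr (k ∷ h) σ = int k ⊗ letter (σ zero) ⊹ rowExpr h (σ ∘ suc)

  module EvaluationProperties {r ℓ} (R : CommutativeRing r ℓ) where
    open CommutativeRing R hiding (zero)
    open Integers R
    open Evaluation R

    pairing-rearrange : ∀ {n} (w : Vector Carrier n) s v → eval (w ∘ lookup (rearrange s v)) pairing ≈ eval (w ∘ lookup v) pairing
    pairing-rearrange w keep     v                       = refl
    pairing-rearrange w flipʳ    (x ∷ y ∷ x′ ∷ y′ ∷ []) = solve 4 (λ x y x′ y′ → toSolver (x ∷ y ∷ y′ ∷ x′ ∷ []) pairing := toSolver (x ∷ y ∷ x′ ∷ y′ ∷ []) pairing) refl (w x) (w y) (w x′) (w y′)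
    pairing-rearrange w flip     (x ∷ y ∷ x′ ∷ y′ ∷ []) = solve 4 (λ x y x′ y′ → toSolver (y ∷ x ∷ y′ ∷ x′ ∷ []) pairing := toSolver (x ∷ y ∷ x′ ∷ y′ ∷ []) pairing) refl (w x) (w y) (w x′) (w y′)
    pairing-rearrange w exchange (x ∷ y ∷ x′ ∷ y′ ∷ []) = solve 4 (λ x y x′ y′ → toSolver (x′ ∷ y′ ∷ x ∷ y ∷ []) pairing := toSolver (x ∷ y ∷ x′ ∷ y′ ∷ []) pairing) refl (w x) (w y) (w x′) (w y′)

    fourth : Carrier → Carrier
    fourth u = u * u * (u * u)

    pairing-scaled : ∀ (u v : Vector Carrier 4) ε →
      fourth (u 0F) * fourth (u 2F) ≈ ε → fourth (u 0F) * fourth (u 3F) ≈ ε → fourth (u 1F) * fourth (u 2F) ≈ ε →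
      fourth (u 1F) * fourth (u 3F) ≈ ε → u 0F * u 0F * (u 1F * u 1F) * (u 2F * u 2F * (u 3F * u 3F)) ≈ ε →
      eval (λ i → u i * v i) pairing ≈ ε * eval v pairing
    pairing-scaled u v ε h₁ h₂ h₃ h₄ h₅ = begin
      eval (λ i → u i * v i) pairing
        ≈⟨ solve 8 (λ a b a′ b′ x y x′ y′ →
             toSolver (a :* x ∷ b :* y ∷ a′ :* x′ ∷ b′ :* y′ ∷ []) pairing
               := f a :* f a′ :* (f x :* f x′) :+ f a :* f b′ :* (f x :* f y′) :+ f b :* f a′ :* (f y :* f x′) :+ f b :* f b′ :* (f y :* f y′)
                  :+ a :* a :* (b :* b) :* (a′ :* a′ :* (b′ :* b′)) :* (con (+ 12) :* (x :* x :* (y :* y) :* (x′ :* x′ :* (y′ :* y′))))) refl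
             (u 0F) (u 1F) (u 2F) (u 3F) (v 0F) (v 1F) (v 2F) (v 3F) ⟩
      fourth (u 0F) * fourth (u 2F) * (fourth (v 0F) * fourth (v 2F)) + fourth (u 0F) * fourth (u 3F) * (fourth (v 0F) * fourth (v 3F))
        + fourth (u 1F) * fourth (u 2F) * (fourth (v 1F) * fourth (v 2F)) + fourth (u 1F) * fourth (u 3F) * (fourth (v 1F) * fourth (v 3F))
        + u 0F * u 0F * (u 1F * u 1F) * (u 2F * u 2F * (u 3F * u 3F)) * (fromℤ (+ 12) * (v 0F * v 0F * (v 1F * v 1F) * (v 2F * v 2F * (v 3F * v 3F))))
        ≈⟨ +-cong (+-cong (+-cong (+-cong (*-congʳ h₁) (*-congʳ h₂)) (*-congʳ h₃)) (*-congʳ h₄)) (*-congʳ h₅) ⟩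
      ε * (fourth (v 0F) * fourth (v 2F)) + ε * (fourth (v 0F) * fourth (v 3F)) + ε * (fourth (v 1F) * fourth (v 2F)) + ε * (fourth (v 1F) * fourth (v 3F))
        + ε * (fromℤ (+ 12) * (v 0F * v 0F * (v 1F * v 1F) * (v 2F * v 2F * (v 3F * v 3F))))
        ≈⟨ solve 5 (λ e x y x′ y′ → e :* (f x :* f x′) :+ e :* (f x :* f y′) :+ e :* (f y :* f x′) :+ e :* (f y :* f y′)
                  :+ e :* (con (+ 12) :* (x :* x :* (y :* y) :* (x′ :* x′ :* (y′ :* y′)))) := e :* toSolver (x ∷ y ∷ x′ ∷ y′ ∷ []) pairing) refl
             ε (v 0F) (v 1F) (v 2F) (v 3F) ⟩
      ε * eval v pairing ∎
      where
      open Relation.Binary.Reasoning.Setoid setoid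
      f : ∀ {n} → Term n → Term n
      f x = x :* x :* (x :* x)

    pairings : Vector Carrier 6 → Vector Carrier 6
    pairings y l = eval y (pairingOf l)

    module _ (image y : Vector Carrier 6) where

      basisExpr-invariant : ∀ k (letters : Vector Carrier 6) → (∀ l → pairings image l ≈ letters l) →
                            eval letters (basisForm k) ≈ eval (pairings y) (basisForm k) → eval image (basisExpr k) ≈ eval y (basisExpr k)
      basisExpr-invariant k letters h h′ = trans (reflexive (eval-bind image pairingOf (basisForm k)))
        (trans (eval-cong h (basisForm k)) (trans h′ (sym (reflexive (eval-bind y pairingOf (basisForm k))))))

    module _ (c : Carrier) (y : Vector Carrier 6) where

      hadamardImage : Vec Carrier 6
      hadamardImage = c * (y 0F + y 1F) ∷ c * (y 0F - y 1F) ∷ c * (y 4F + y 5F) ∷ c * (y 4F - y 5F) ∷ c * (y 2F + y 3F) ∷ c * (y 2F - y 3F) ∷ []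

      pairings-hadamard : fourth c * fromℤ (+ 4) ≈ 1# → ∀ l → pairings (lookup hadamardImage) l ≈ lookup (swapped₂₃ (pairings y)) l
      pairings-hadamard h 0F = pairing-hadamard c h (y 0F) (y 1F) (y 0F) (y 1F)
      pairings-hadamard h 1F = pairing-hadamard c h (y 4F) (y 5F) (y 4F) (y 5F)
      pairings-hadamard h 2F = pairing-hadamard c h (y 2F) (y 3F) (y 2F) (y 3F)
      pairings-hadamard h 3F = pairing-hadamard c h (y 0F) (y 1F) (y 4F) (y 5F)
      pairings-hadamard h 4F = pairing-hadamard c h (y 0F) (y 1F) (y 2F) (y 3F)
      pairings-hadamard h 5F = trans (pairing-hadamard c h (y 4F) (y 5F) (y 2F) (y 3F)) (pairing-rearrange y exchange (2F ∷ 3F ∷ 4F ∷ 5F ∷ []))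

      X′-rows-image : ∀ i → c * eval y (rowExpr (lookup X′-rows i) id) ≈ lookup hadamardImage i
      X′-rows-image 0F = solve 7 (λ c s p t q B E → c :* toSolver (s ∷ p ∷ t ∷ q ∷ B ∷ E ∷ []) (rowExpr (lookup X′-rows 0F) id) := c :* (s :+ p)) refl
        c (y 0F) (y 1F) (y 2F) (y 3F) (y 4F) (y 5F)
      X′-rows-image 1F = solve 7 (λ c s p t q B E → c :* toSolver (s ∷ p ∷ t ∷ q ∷ B ∷ E ∷ []) (rowExpr (lookup X′-rows 1F) id) := c :* (s :- p)) refl
        c (y 0F) (y 1F) (y 2F) (y 3F) (y 4F) (y 5F)
      X′-rows-image 2F = solve 7 (λ c s p t q B E → c :* toSolver (s ∷ p ∷ t ∷ q ∷ B ∷ E ∷ []) (rowExpr (lookup X′-rows 2F) id) := c :* (B :+ E)) refl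
        c (y 0F) (y 1F) (y 2F) (y 3F) (y 4F) (y 5F)
      X′-rows-image 3F = solve 7 (λ c s p t q B E → c :* toSolver (s ∷ p ∷ t ∷ q ∷ B ∷ E ∷ []) (rowExpr (lookup X′-rows 3F) id) := c :* (B :- E)) refl
        c (y 0F) (y 1F) (y 2F) (y 3F) (y 4F) (y 5F)
      X′-rows-image 4F = solve 7 (λ c s p t q B E → c :* toSolver (s ∷ p ∷ t ∷ q ∷ B ∷ E ∷ []) (rowExpr (lookup X′-rows 4F) id) := c :* (t :+ q)) refl
        c (y 0F) (y 1F) (y 2F) (y 3F) (y 4F) (y 5F)
      X′-rows-image 5F = solve 7 (λ c s p t q B E → c :* toSolver (s ∷ p ∷ t ∷ q ∷ B ∷ E ∷ []) (rowExpr (lookup X′-rows 5F) id) := c :* (t :- q)) refl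
        c (y 0F) (y 1F) (y 2F) (y 3F) (y 4F) (y 5F)

  module IntegerPolynomials where
    open Defs.Polynomials ℤ.+-*-commutativeRing 6 public

    polynomial : Expr 6 → Polynomial
    polynomial (letter i) = var i
    polynomial (int k)    = constant k
    polynomial (e ⊹ e′)   = polynomial e +ᴾ polynomial e′
    polynomial (e ⊗ e′)   = polynomial e *ᴾ polynomial e′

    agrees? : ∀ k p → Dec (∀ i → coefficient p (lookup orbitRepresentatives i) ≡ lookup (lookup basisCoefficients i) k)
    agrees? k p = Fin.all? λ i → coefficient p (lookup orbitRepresentatives i) ℤ.≟ lookup (lookup basisCoefficients i) k

    -- The forms are expanded over ℤ, where coefficients evaluate; `base-change` carries the result
    -- to the ring in question.
    basisCoefficients-correct : ∀ k i → coefficient (polynomial (basisExpr k)) (lookup orbitRepresentatives i) ≡ lookup (lookup basisCoefficients i) k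
    basisCoefficients-correct 0F = isYes⇒ (agrees? 0F (polynomial (basisExpr 0F))) ≡.refl
    basisCoefficients-correct 1F = isYes⇒ (agrees? 1F (polynomial (basisExpr 1F))) ≡.refl
    basisCoefficients-correct 2F = isYes⇒ (agrees? 2F (polynomial (basisExpr 2F))) ≡.refl
    basisCoefficients-correct 3F = isYes⇒ (agrees? 3F (polynomial (basisExpr 3F))) ≡.refl
    basisCoefficients-correct 4F = isYes⇒ (agrees? 4F (polynomial (basisExpr 4F))) ≡.refl
    basisCoefficients-correct 5F = isYes⇒ (agrees? 5F (polynomial (basisExpr 5F))) ≡.refl

-- Invariance and coefficients of the six forms

module FormPolynomials where

  open RingBasics
  open PolynomialRings
  open MatrixActions
  open CyclotomicNumbers
  open GeneratorMatrices
  open BlockCoordinates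
  open ExponentOrbits
  open OrbitCertificate
  open OrbitSpanning
  open PairingForms
  open SignedPermutations

  module BasisPolynomials {r ℓ} (R : CommutativeRing r ℓ)
    (ζ half : CommutativeRing.Carrier R) (ζ⁴≈-1 : RingBasics.FourthPowerIs-1 R ζ) (half+half≈1 : RingBasics.IsHalf R half) where
    open CommutativeRing R hiding (zero)

    open Integers R using (fromℤ; fromℤ-1; fromℤ-+; fromℤ-*; fromℤ-neg)
    open CyclotomicEvaluation R ζ half ζ⁴≈-1 half+half≈1
    open Symmetry R ζ half ζ⁴≈-1 half+half≈1
    open Spanning R ζ half ζ⁴≈-1 half+half≈1
    open Summation R
    open Defs.Polynomials R 6
    open Defs.Matrices R 6
    open PolynomialAlgebra R 6
    open MatrixAction R 6
    open Algebra.Properties.Semiring.Exp semiring using (_^_; ^-homo-*; ^-assocʳ; ^-congˡ)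
    module 𝓟 = CommutativeRing polynomialRing
    module I𝓟 = Integers polynomialRing
    open Evaluation polynomialRing
    private
      module I = IntegerPolynomials
      module ≈ = Relation.Binary.Reasoning.Setoid setoid
      module ≋ = Relation.Binary.Reasoning.Setoid 𝓟.setoid

    constant-fromℤ : ∀ k → constant (fromℤ k) ≋ I𝓟.fromℤ k
    constant-fromℤ (+ n)    = natural n
      where
      natural : ∀ n → constant (fromℤ (+ n)) ≋ I𝓟.fromℤ (+ n)
      natural zero    = constant-0
      natural (suc n) = 𝓟.trans (constant-+ 1# (fromℤ (+ n))) (𝓟.+-congˡ (natural n))
    constant-fromℤ -[1+ n ] = 𝓟.trans (constant-neg (fromℤ (+ suc n))) (𝓟.-‿cong (constant-fromℤ (+ suc n)))

    •-eval : ∀ A {m} (ρ : Vector Polynomial m) e → A • eval ρ e ≋ eval (λ i → A • ρ i) e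
    •-eval A ρ (letter i) = 𝓟.refl
    •-eval A ρ (int k)    = 𝓟.trans (•-congʳ A (𝓟.sym (constant-fromℤ k)))
      (𝓟.trans (substitute-constant (λ i → linear (A i)) (fromℤ k)) (constant-fromℤ k))
    •-eval A ρ (e ⊹ e′)   = 𝓟.trans (substitute-+ (λ i → linear (A i)) (eval ρ e) (eval ρ e′)) (𝓟.+-cong (•-eval A ρ e) (•-eval A ρ e′))
    •-eval A ρ (e ⊗ e′)   = 𝓟.trans (substitute-* (λ i → linear (A i)) (eval ρ e) (eval ρ e′)) (𝓟.*-cong (•-eval A ρ e) (•-eval A ρ e′))

    basisPolynomial : Fin 6 → Polynomial
    basisPolynomial k = eval var (basisExpr k)

    private
      letters : Vector Polynomial 6
      letters l = eval var (pairingOf l)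

      ⟪⟫ᶻ : (Vec ℕ 6 → Carrier) → I.Polynomial → Carrier
      ⟪⟫ᶻ f p = ∑ p λ (c , d) → fromℤ c * f d

      ⟪⟫ᶻ-*ᴾ : ∀ f p q → ⟪⟫ᶻ f (p I.*ᴾ q) ≈ ⟪⟫ᶻ (λ d → ⟪⟫ᶻ (λ d′ → f (zipWith ℕ._+_ d d′)) q) p
      ⟪⟫ᶻ-*ᴾ f p q = trans (∑-cartesian _ p q _) (∑-cong p λ (c , d) →
        trans (∑-cong q λ (c′ , d′) → trans (*-congʳ (fromℤ-* c c′)) (*-assoc (fromℤ c) (fromℤ c′) _)) (∑-*ˡ q (fromℤ c) _))

      -- The induction treats all functionals at once: in a product, the second factor is read
      -- through the shifted functional d′ ↦ f (d + d′).
      base-change : ∀ e f → ⟪ f ⟫ (eval var e) ≈ ⟪⟫ᶻ f (I.polynomial e)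
      base-change (letter i) f = +-congʳ (*-congʳ (sym fromℤ-1))
      base-change (int k)    f = sym (functional (constant-fromℤ k) f)
      base-change (e ⊹ e′)   f = trans (⟪⟫-+ᴾ f (eval var e) (eval var e′)) (trans (+-cong (base-change e f) (base-change e′ f))
        (sym (∑-++ (I.polynomial e) (I.polynomial e′))))
      base-change (e ⊗ e′)   f = trans (⟪⟫-*ᴾ f (eval var e) (eval var e′)) (trans
        (trans (⟪⟫-congᶠ (λ d → base-change e′ (λ d′ → f (zipWith ℕ._+_ d d′))) (eval var e)) (base-change e _))
        (sym (⟪⟫ᶻ-*ᴾ f (I.polynomial e) (I.polynomial e′))))

      ⟪⟫ᶻ-δ : ∀ p e → ⟪⟫ᶻ (δ e) p ≈ fromℤ (I.coefficient p e)
      ⟪⟫ᶻ-δ []            e = refl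
      ⟪⟫ᶻ-δ ((c , d) ∷ p) e = trans (+-cong (lemma (does (d ≟ᵉ e))) (⟪⟫ᶻ-δ p e)) (sym (fromℤ-+ (if does (d ≟ᵉ e) then c else 0ℤ) (I.coefficient p e)))
        where
        lemma : ∀ b → fromℤ c * [ b ]· 1# ≈ fromℤ (if b then c else 0ℤ)
        lemma true  = *-identityʳ _
        lemma false = zeroʳ _

    coefficient-basisPolynomial : ∀ k i → coefficient (basisPolynomial k) (lookup orbitRepresentatives i) ≈ fromℤ (entries basisCoefficients i k)
    coefficient-basisPolynomial k i = trans (coefficient-δ (basisPolynomial k) e) (trans (base-change (basisExpr k) (δ e))
      (trans (⟪⟫ᶻ-δ (I.polynomial (basisExpr k)) e) (reflexive (cong fromℤ (I.basisCoefficients-correct k i)))))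
      where
      e : Vec ℕ 6
      e = lookup orbitRepresentatives i

    •-var : ∀ A i → A • var i ≋ linear (A i)
    •-var A i = substitute-var (λ i → linear (A i)) i

    linear-row : ∀ c (h : Vec ℤ 6) → linear (λ j → ⟦ c ⊠ intᶜ (lookup h j) ⟧) ≋ constant ⟦ c ⟧ *ᴾ eval var (rowExpr h id)
    linear-row c h = go h var id
      where
      go : ∀ {m} (h : Vec ℤ m) (v : Vector Polynomial 6) (σ : Fin m → Fin 6) →
           combination (λ j → ⟦ c ⊠ intᶜ (lookup h j) ⟧) (v ∘ σ) ≋ constant ⟦ c ⟧ *ᴾ eval v (rowExpr h σ)
      go []      v σ = 𝓟.sym (𝓟.zeroʳ (constant ⟦ c ⟧))
      go (k ∷ h) v σ = begin
        constant ⟦ c ⊠ intᶜ k ⟧ *ᴾ v (σ zero) +ᴾ combination (λ j → ⟦ c ⊠ intᶜ (lookup h j) ⟧) (v ∘ σ ∘ suc)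
          ≈⟨ 𝓟.+-cong (𝓟.*-congʳ (𝓟.trans (constant-cong (trans (⟦⟧-⊠ c (intᶜ k)) (*-congˡ (⟦intᶜ⟧ k))))
               (𝓟.trans (constant-* ⟦ c ⟧ (fromℤ k)) (𝓟.*-congˡ {constant ⟦ c ⟧} (constant-fromℤ k))))) (go h v (σ ∘ suc)) ⟩
        constant ⟦ c ⟧ *ᴾ I𝓟.fromℤ k *ᴾ v (σ zero) +ᴾ constant ⟦ c ⟧ *ᴾ eval v (rowExpr h (σ ∘ suc))
          ≈⟨ 𝓟.+-congʳ (𝓟.*-assoc (constant ⟦ c ⟧) (I𝓟.fromℤ k) (v (σ zero))) ⟩
        constant ⟦ c ⟧ *ᴾ (I𝓟.fromℤ k *ᴾ v (σ zero)) +ᴾ constant ⟦ c ⟧ *ᴾ eval v (rowExpr h (σ ∘ suc))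
          ≈⟨ 𝓟.distribˡ (constant ⟦ c ⟧) (I𝓟.fromℤ k *ᴾ v (σ zero)) (eval v (rowExpr h (σ ∘ suc))) ⟨
        constant ⟦ c ⟧ *ᴾ (I𝓟.fromℤ k *ᴾ v (σ zero) +ᴾ eval v (rowExpr h (σ ∘ suc))) ∎
        where open ≋

    open EvaluationProperties polynomialRing

    private
      module _ (π : Vec (Fin 6) 6) (a : Vec ℕ 6) where

        permutationImage : Vector Polynomial 6
        permutationImage i = constant (ζ ^ lookup a i) *ᴾ var (lookup π i)

        •-permutation : ∀ i → ⟦ permutationᶜ π a ⟧ᴹ • var i ≋ permutationImage i
        •-permutation i = 𝓟.trans (•-var ⟦ permutationᶜ π a ⟧ᴹ i) (𝓟.trans (linear-cong {λ j → ⟦ permutationᶜ π a i j ⟧} {λ j → [ does (lookup π i Fin.≟ j) ]· (ζ ^ lookup a i)} entry)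
          (𝓟.trans (linear-unit (ζ ^ lookup a i) (lookup π i)) (ext λ f → sym (trans (⟪⟫-scale f (ζ ^ lookup a i) (var (lookup π i)))
            (trans (*-congˡ (trans (⟪⟫-monomial f 1# (unit (lookup π i))) (*-identityˡ _))) (sym (⟪⟫-monomial f (ζ ^ lookup a i) (unit (lookup π i)))))))))
          where
          entry : ∀ j → ⟦ permutationᶜ π a i j ⟧ ≈ [ does (lookup π i Fin.≟ j) ]· (ζ ^ lookup a i)
          entry j with does (lookup π i Fin.≟ j)
          ... | true  = ⟦ζᶜ⟧ (lookup a i)
          ... | false = ⟦⟧-0

      constant-fourth : ∀ u → fourth (constant u) ≋ constant (u * u * (u * u))
      constant-fourth u = 𝓟.sym (𝓟.trans (constant-* (u * u) (u * u)) (𝓟.*-cong (constant-* u u) (constant-* u u)))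

      ζ-fourth : ∀ a → ζ ^ a * ζ ^ a * (ζ ^ a * ζ ^ a) ≈ ζ ^ (a ℕ.* 4)
      ζ-fourth a = trans (solve 1 (λ x → x :* x :* (x :* x) := x :^ 4) refl (ζ ^ a)) (^-assocʳ ζ a 4)
        where open Integers R using (solve; _:*_; _:^_; _:=_)

      ζ-square : ∀ a → ζ ^ a * ζ ^ a ≈ ζ ^ (a ℕ.* 2)
      ζ-square a = trans (*-congˡ (sym (*-identityʳ _))) (^-assocʳ ζ a 2)

      ζ-mod : ∀ k l → k % 8 ≡ l % 8 → ζ ^ k ≈ ζ ^ l
      ζ-mod k l h = trans (ζ^% k) (trans (reflexive (cong (ζ ^_) h)) (sym (ζ^% l)))

      pairing-phases : ∀ (a : Vec ℕ 4) (v : Vector Polynomial 4) e → Vec.map (_% 8) (termPhases a) ≡ replicate 5 (e % 8) →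
                       eval (λ i → constant (ζ ^ lookup a i) *ᴾ v i) pairing ≋ constant (ζ ^ e) *ᴾ eval v pairing
      pairing-phases (a ∷ b ∷ a′ ∷ b′ ∷ []) v e h = pairing-scaled (λ i → constant (ζ ^ lookup (a ∷ b ∷ a′ ∷ b′ ∷ []) i)) v (constant (ζ ^ e))
        (fours a a′ (at 0F)) (fours a b′ (at 1F)) (fours b a′ (at 2F)) (fours b b′ (at 3F))
        (𝓟.trans (𝓟.sym (𝓟.trans (constant-* (x a * x a * (x b * x b)) (x a′ * x a′ * (x b′ * x b′)))
            (𝓟.*-cong (𝓟.trans (constant-* (x a * x a) (x b * x b)) (𝓟.*-cong (constant-* (x a) (x a)) (constant-* (x b) (x b))))
                      (𝓟.trans (constant-* (x a′ * x a′) (x b′ * x b′)) (𝓟.*-cong (constant-* (x a′) (x a′)) (constant-* (x b′) (x b′)))))))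
          (constant-cong (trans (*-cong (trans (*-cong (ζ-square a) (ζ-square b)) (sym (^-homo-* ζ (a ℕ.* 2) (b ℕ.* 2))))
                                        (trans (*-cong (ζ-square a′) (ζ-square b′)) (sym (^-homo-* ζ (a′ ℕ.* 2) (b′ ℕ.* 2)))))
            (trans (sym (^-homo-* ζ (a ℕ.* 2 ℕ.+ b ℕ.* 2) (a′ ℕ.* 2 ℕ.+ b′ ℕ.* 2))) (ζ-mod (a ℕ.* 2 ℕ.+ b ℕ.* 2 ℕ.+ (a′ ℕ.* 2 ℕ.+ b′ ℕ.* 2)) e (at 4F))))))
        where
        x : ℕ → Carrier
        x k = ζ ^ k
        at : ∀ i → lookup (termPhases (a ∷ b ∷ a′ ∷ b′ ∷ [])) i % 8 ≡ e % 8
        at i = ≡.trans (≡.sym (Vec.lookup-map i (_% 8) (termPhases (a ∷ b ∷ a′ ∷ b′ ∷ [])))) (≡.trans (cong (λ t → lookup t i) h) (Vec.lookup-replicate i (e % 8)))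
        fours : ∀ k l → (k ℕ.* 4 ℕ.+ l ℕ.* 4) % 8 ≡ e % 8 → fourth (constant (x k)) *ᴾ fourth (constant (x l)) ≋ constant (ζ ^ e)
        fours k l h = 𝓟.trans (𝓟.*-cong (constant-fourth (x k)) (constant-fourth (x l)))
          (𝓟.trans (𝓟.sym (constant-* (x k * x k * (x k * x k)) (x l * x l * (x l * x l)))) (constant-cong
            (trans (*-cong (ζ-fourth k) (ζ-fourth l)) (trans (sym (^-homo-* ζ (k ℕ.* 4) (l ℕ.* 4))) (ζ-mod (k ℕ.* 4 ℕ.+ l ℕ.* 4) e h)))))

      -- All five terms of a pairing receive the phase recorded in `S`, and a symmetry of the
      -- pairing puts the permuted letters back in order.
      pairings-signed : ∀ π a (S : Signed π a) l → pairings (permutationImage π a) l ≋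
                        constant (ζ ^ lookup (Signed.phase S) l) *ᴾ pairings var (lookup (Signed.target S) l)
      pairings-signed π a S l = begin
        pairings (permutationImage π a) l
          ≈⟨ 𝓟.reflexive (eval-bind (permutationImage π a) (letter ∘ lookup P) pairing) ⟩
        eval (λ j → permutationImage π a (lookup P j)) pairing
          ≈⟨ eval-cong (λ j → 𝓟.*-cong (𝓟.reflexive (cong (λ k → constant (ζ ^ k)) (≡.sym (Vec.lookup-map j (lookup a) P))))
               (𝓟.reflexive (cong var (≡.sym (Vec.lookup-map j (lookup π) P))))) pairing ⟩
        eval (λ j → constant (ζ ^ lookup (Vec.map (lookup a) P) j) *ᴾ var (lookup (Vec.map (lookup π) P) j)) pairing
          ≈⟨ pairing-phases (Vec.map (lookup a) P) (λ j → var (lookup (Vec.map (lookup π) P) j)) (lookup phase l) (phases≡ l) ⟩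
        constant (ζ ^ lookup phase l) *ᴾ eval (var ∘ lookup (Vec.map (lookup π) P)) pairing
          ≈⟨ 𝓟.*-congˡ {constant (ζ ^ lookup phase l)} (𝓟.trans (𝓟.reflexive (cong (λ v → eval (var ∘ lookup v) pairing) (rearranged l)))
               (pairing-rearrange var (lookup symmetry l) (lookup pairs (lookup target l)))) ⟩
        constant (ζ ^ lookup phase l) *ᴾ eval (var ∘ lookup (lookup pairs (lookup target l))) pairing
          ≈⟨ 𝓟.*-congˡ {constant (ζ ^ lookup phase l)} (𝓟.reflexive (eval-bind var (letter ∘ lookup (lookup pairs (lookup target l))) pairing)) ⟨
        constant (ζ ^ lookup phase l) *ᴾ pairings var (lookup target l) ∎
        where
        open ≋
        open Signed S
        P : Vec (Fin 6) 4
        P = lookup pairs l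

      unsigned : ∀ g π a → (∀ i j → conjugated g i j ≃ permutationᶜ π a i j) → ∀ i → ⟦ conjugated g ⟧ᴹ • var i ≋ permutationImage π a i
      unsigned g π a h i = 𝓟.trans (•-congˡ ⟦ conjugated g ⟧ᴹ ⟦ permutationᶜ π a ⟧ᴹ (var i) (λ j k → ⟦⟧-cong (h j k))) (•-permutation π a i)

      fixed-by-permutation : ∀ g π a (S : Signed π a) → (∀ i j → conjugated g i j ≃ permutationᶜ π a i j) → ∀ k (ρ : Vector Polynomial 6) →
                             (∀ l → constant (ζ ^ lookup (Signed.phase S) l) *ᴾ pairings var (lookup (Signed.target S) l) ≋ ρ l) →
                             eval ρ (basisForm k) ≋ eval (pairings var) (basisForm k) → ⟦ conjugated g ⟧ᴹ • basisPolynomial k ≋ basisPolynomial k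
      fixed-by-permutation g π a S h k ρ h₁ h₂ = begin
        ⟦ conjugated g ⟧ᴹ • eval var (basisExpr k)                ≈⟨ •-eval ⟦ conjugated g ⟧ᴹ var (basisExpr k) ⟩
        eval (λ i → ⟦ conjugated g ⟧ᴹ • var i) (basisExpr k)      ≈⟨ eval-cong (unsigned g π a h) (basisExpr k) ⟩
        eval (permutationImage π a) (basisExpr k)                 ≈⟨ basisExpr-invariant (permutationImage π a) var k ρ (λ l → 𝓟.trans (pairings-signed π a S l) (h₁ l)) h₂ ⟩
        eval var (basisExpr k)                                    ∎
        where open ≋

      ζ⁰ : ∀ p → constant (ζ ^ 0) *ᴾ p ≋ p
      ζ⁰ = 𝓟.*-identityˡ

      -ζ⁴ : ∀ p → constant (ζ ^ 4) *ᴾ p ≋ -ᴾ p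
      -ζ⁴ p = ext λ f → trans (⟪⟫-scale f (ζ ^ 4) p) (trans (*-congʳ ζ⁴≈) (trans (-1*x≈-x _) (sym (⟪⟫-neg f p))))
        where open Algebra.Properties.Ring ring using (-1*x≈-x)

      identity-target : ∀ l → constant (ζ ^ lookup (replicate 6 0) l) *ᴾ pairings var (lookup identityπ l) ≋ pairings var l
      identity-target 0F = ζ⁰ (pairings var 0F)
      identity-target 1F = ζ⁰ (pairings var 1F)
      identity-target 2F = ζ⁰ (pairings var 2F)
      identity-target 3F = ζ⁰ (pairings var 3F)
      identity-target 4F = ζ⁰ (pairings var 4F)
      identity-target 5F = ζ⁰ (pairings var 5F)

      swapped-target : ∀ l → constant (ζ ^ lookup (0 ∷ 0 ∷ 0 ∷ 0 ∷ 4 ∷ 4 ∷ []) l) *ᴾ pairings var (lookup (1F ∷ 0F ∷ 2F ∷ 3F ∷ 5F ∷ 4F ∷ []) l)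
                       ≋ lookup (swapped₁₂ (pairings var)) l
      swapped-target 0F = ζ⁰ (pairings var 1F)
      swapped-target 1F = ζ⁰ (pairings var 0F)
      swapped-target 2F = ζ⁰ (pairings var 2F)
      swapped-target 3F = ζ⁰ (pairings var 3F)
      swapped-target 4F = -ζ⁴ (pairings var 5F)
      swapped-target 5F = -ζ⁴ (pairings var 4F)

      -- 4κ⁴ = (2κ²)² = (-1)².
      κ⁴*4≈1 : fourth (constant ⟦ κᶜ ⟧) *ᴾ I𝓟.fromℤ (+ 4) ≋ constant 1#
      κ⁴*4≈1 = 𝓟.trans (𝓟.*-cong (constant-fourth ⟦ κᶜ ⟧) (𝓟.sym (constant-fromℤ (+ 4))))
        (𝓟.trans (𝓟.sym (constant-* (κ * κ * (κ * κ)) (fromℤ (+ 4)))) (constant-cong (begin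
          κ * κ * (κ * κ) * fromℤ (+ 4)                               ≈⟨ solve 1 (λ k → k :* k :* (k :* k) :* con (+ 4) := con (+ 2) :* (k :* k) :* (con (+ 2) :* (k :* k))) refl κ ⟩
          fromℤ (+ 2) * (κ * κ) * (fromℤ (+ 2) * (κ * κ))             ≈⟨ *-cong 2κ²≈-1 2κ²≈-1 ⟩
          - 1# * - 1#                                                 ≈⟨ solve 1 (λ x → :- x :* :- x := x :* x) refl 1# ⟩
          1# * 1#                                                     ≈⟨ *-identityˡ 1# ⟩
          1#                                                          ∎)))
        where
        open ≈
        open Integers R using (solve; _:*_; :-_; con; _:=_)

      X-image : ∀ i → ⟦ conjugated gX ⟧ᴹ • var i ≋ lookup (hadamardImage (constant ⟦ κᶜ ⟧) var) i
      X-image i = 𝓟.trans (•-var ⟦ conjugated gX ⟧ᴹ i) (𝓟.trans (linear-cong {⟦ conjugated gX ⟧ᴹ i} {λ j → ⟦ κᶜ ⊠ intᶜ (lookup (lookup X′-rows i) j) ⟧} (λ j → ⟦⟧-cong (gX-≃ i j))) (𝓟.trans (linear-row κᶜ (lookup X′-rows i)) (X′-rows-image (constant ⟦ κᶜ ⟧) var i)))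

    -- On the pairings, `X` induces the exchange of planes 2 and 3, `E₁` and `E₂` the signed
    -- exchange of planes 1 and 2, and the other generators act trivially.
    basisPolynomial-fixed : ∀ k → FixedByGenerators (basisPolynomial k)
    basisPolynomial-fixed k gX  = 𝓟.trans (•-eval ⟦ conjugated gX ⟧ᴹ var (basisExpr k)) (𝓟.trans (eval-cong X-image (basisExpr k))
      (basisExpr-invariant (lookup (hadamardImage (constant ⟦ κᶜ ⟧) var)) var k (lookup (swapped₂₃ (pairings var)))
        (pairings-hadamard (constant ⟦ κᶜ ⟧) var κ⁴*4≈1) (basisForm-swap₂₃ (pairings var) k)))
    basisPolynomial-fixed k gP₁ = fixed-by-permutation gP₁ swapBE _ signedP₁ gP₁-≃ k (pairings var) identity-target 𝓟.refl
    basisPolynomial-fixed k gP₂ = fixed-by-permutation gP₂ swapBE _ signedP₂ gP₂-≃ k (pairings var) identity-target 𝓟.refl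
    basisPolynomial-fixed k gE₁ = fixed-by-permutation gE₁ swap₁₂ _ signedE₁ gE₁-≃ k (lookup (swapped₁₂ (pairings var))) swapped-target (basisForm-swap₁₂ (pairings var) k)
    basisPolynomial-fixed k gE₂ = fixed-by-permutation gE₂ swap₁₂ _ signedE₂ gE₂-≃ k (lookup (swapped₁₂ (pairings var))) swapped-target (basisForm-swap₁₂ (pairings var) k)
    basisPolynomial-fixed k gzI = fixed-by-permutation gzI identityπ _ signedzI gzI-≃ k (pairings var) identity-target 𝓟.refl

-- From the integral certificate to a basis

module BasisCriterion where

  open RingBasics
  open PolynomialRings
  open MatrixActions
  open CyclotomicNumbers
  open GeneratorMatrices
  open BlockCoordinates
  open ExponentOrbits
  open OrbitCertificate
  open OrbitSpanning
  open PairingForms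
  open SignedPermutations
  open FormPolynomials

  module BasisTheorem {r r′} (R : CommutativeRing r r′)
    (ζ half : CommutativeRing.Carrier R) (ζ⁴≈-1 : RingBasics.FourthPowerIs-1 R ζ) (half+half≈1 : RingBasics.IsHalf R half)
    (reciprocal : RingBasics.HasReciprocals R) where
    open CommutativeRing R hiding (zero)

    open Integers R using (fromℤ)
    open CyclotomicEvaluation R ζ half ζ⁴≈-1 half+half≈1
    open Symmetry R ζ half ζ⁴≈-1 half+half≈1
    open Spanning R ζ half ζ⁴≈-1 half+half≈1
    open Defs.Polynomials R 6
    open Defs.Matrices R 6
    open PolynomialAlgebra R 6
    open MatrixAction R 6
    open Algebra.Properties.Semiring.Sum semiring using (sum; sum-cong-≋; *-distribˡ-sum; sum-replicate-zero)
    open Algebra.Properties.Ring ring using (-‿distribˡ-*; -1*x≈-x)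
    open Algebra.Properties.Group +-group using (x∙y⁻¹≈ε⇒x≈y)
    open Algebra.Properties.CommutativeSemigroup *-commutativeSemigroup using (x∙yz≈y∙xz)
    private
      module 𝓟 = CommutativeRing polynomialRing
      module ≈ = Relation.Binary.Reasoning.Setoid setoid
      module ≋ = Relation.Binary.Reasoning.Setoid 𝓟.setoid

      coefficient-combination : ∀ {k} (c : Vector Carrier k) p e → coefficient (combination c p) e ≈ sum (λ i → c i * coefficient (p i) e)
      coefficient-combination c p e = trans (coefficient-δ (combination c p) e) (trans (⟪⟫-combination (δ e) c p)
        (sum-cong-≋ λ i → *-congˡ {c i} (sym (coefficient-δ (p i) e))))

      •-combination : ∀ A {k} (c : Vector Carrier k) p → A • combination c p ≋ combination c (λ i → A • p i)
      •-combination A c p = substitute-combination (λ i → linear (A i)) c p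

      •-scaled : ∀ A c p → A • (constant c *ᴾ p) ≋ constant c *ᴾ (A • p)
      •-scaled A c p = 𝓟.trans (substitute-* (λ i → linear (A i)) (constant c) p) (𝓟.*-congʳ (substitute-constant (λ i → linear (A i)) c))

      Homogeneous-combination : ∀ {k d} (c : Vector Carrier k) p → (∀ i → Homogeneous d (p i)) → Homogeneous d (combination c p)
      Homogeneous-combination {k} c p h e e≢d = trans (coefficient-combination c p e)
        (trans (sum-cong-≋ λ i → trans (*-congˡ {c i} (h i e e≢d)) (zeroʳ (c i))) (sum-replicate-zero k))

      Homogeneous-scaled : ∀ {d} c p → Homogeneous d p → Homogeneous d (constant c *ᴾ p)
      Homogeneous-scaled c p h e e≢d = trans (coefficient-δ (constant c *ᴾ p) e) (trans (⟪⟫-scale (δ e) c p)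
        (trans (*-congˡ (trans (sym (coefficient-δ p e)) (h e e≢d))) (zeroʳ c)))

      combination-scaled : ∀ {k} (c d : Vector Carrier k) p → combination c (λ i → constant (d i) *ᴾ p i) ≋ combination (λ i → c i * d i) p
      combination-scaled c d p = ext λ f → trans (⟪⟫-combination f c (λ i → constant (d i) *ᴾ p i))
        (trans (sum-cong-≋ λ i → trans (*-congˡ {c i} (⟪⟫-scale f (d i) (p i))) (sym (*-assoc (c i) (d i) _)))
          (sym (⟪⟫-combination f (λ i → c i * d i) p)))

      1/ : ℕ → Carrier
      1/ n = proj₁ (reciprocal (ℕ.pred n))

      1/*n : ∀ n .{{_ : ℕ.NonZero n}} → 1/ n * fromℤ (+ n) ≈ 1#
      1/*n (suc n) = proj₂ (reciprocal n)

      cancel : ∀ n .{{_ : ℕ.NonZero n}} x → 1/ n * (fromℤ (+ n) * x) ≈ x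
      cancel n x = trans (sym (*-assoc (1/ n) (fromℤ (+ n)) x)) (trans (*-congʳ (1/*n n)) (*-identityˡ x))

      denominators-nonZero : ∀ k → ℕ.NonZero (lookup denominators k)
      denominators-nonZero 0F = _
      denominators-nonZero 1F = _
      denominators-nonZero 2F = _
      denominators-nonZero 3F = _
      denominators-nonZero 4F = _
      denominators-nonZero 5F = _

      m 1/m : Vector Carrier 6
      m k   = fromℤ (+ lookup denominators k)
      1/m k = 1/ (lookup denominators k)

      1/m*m : ∀ k → 1/m k * m k ≈ 1#
      1/m*m k = 1/*n (lookup denominators k) {{denominators-nonZero k}}

    -- Forms and enumerators are parameters known by their properties alone, which reduces the
    -- argument to linear algebra and keeps these large polynomials folded.
    module _ {s} {S : Pred Matrix s}
      (S⊆ : ∀ A → S A → ∃ λ g → A ≈ᴹ ⟦ original g ⟧ᴹ)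
      (⊆S : ∀ g → ∃ λ A → S A × A ≈ᴹ ⟦ original g ⟧ᴹ)
      (basisPolynomial : Vector Polynomial 6)
      (basisPolynomial-fixed : ∀ k → FixedByGenerators (basisPolynomial k))
      (coefficient-basisPolynomial : ∀ k i → coefficient (basisPolynomial k) (lookup orbitRepresentatives i) ≈ fromℤ (entries basisCoefficients i k))
      (p : Vector Polynomial 6)
      (p-formula : ∀ k → constant (m k) *ᴾ p k ≋ U • basisPolynomial k)
      (p-homogeneous : ∀ k → Homogeneous 16 (p k)) where

      private
        p≋ : ∀ k → p k ≋ constant (1/m k) *ᴾ (U • basisPolynomial k)
        p≋ k = begin
          p k                                               ≈⟨ 𝓟.*-identityˡ (p k) ⟨
          constant 1# *ᴾ p k                                ≈⟨ 𝓟.*-congʳ {p k} (𝓟.trans (𝓟.sym (constant-* (1/m k) (m k))) (constant-cong (1/m*m k))) ⟨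
          constant (1/m k) *ᴾ constant (m k) *ᴾ p k         ≈⟨ 𝓟.*-assoc (constant (1/m k)) (constant (m k)) (p k) ⟩
          constant (1/m k) *ᴾ (constant (m k) *ᴾ p k)       ≈⟨ 𝓟.*-congˡ {constant (1/m k)} (p-formula k) ⟩
          constant (1/m k) *ᴾ (U • basisPolynomial k)       ∎
          where open ≋

        combination-p : ∀ c → combination c p ≋ U • combination (λ k → c k * 1/m k) basisPolynomial
        combination-p c = 𝓟.trans (combination-cong {c = c} {c′ = c} {p = p} {p′ = λ k → constant (1/m k) *ᴾ (U • basisPolynomial k)} (λ k → refl) p≋)
          (𝓟.trans (combination-scaled c 1/m (λ k → U • basisPolynomial k)) (𝓟.sym (•-combination U (λ k → c k * 1/m k) basisPolynomial)))

        -- Homogeneity is inherited from the enumerators through the inverse change of coordinates,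
        -- so the large expressions need no inspection.
        basisPolynomial-homogeneous : ∀ k → Homogeneous 16 (basisPolynomial k)
        basisPolynomial-homogeneous k = Homogeneous-cong (T•U• (basisPolynomial k))
          (•-Homogeneous T {p = U • basisPolynomial k} (Homogeneous-cong (p-formula k) (Homogeneous-scaled (m k) (p k) (p-homogeneous k))))

        invariant : ∀ k → InvariantRing ⟨ S ⟩ᴹ (p k)
        invariant k A A∈ = ≋⇒≈ᴾ (begin
          A • p k                                              ≈⟨ •-congʳ A (p≋ k) ⟩
          A • (constant (1/m k) *ᴾ (U • basisPolynomial k))    ≈⟨ •-scaled A (1/m k) (U • basisPolynomial k) ⟩
          constant (1/m k) *ᴾ (A • (U • basisPolynomial k))    ≈⟨ 𝓟.*-congˡ {constant (1/m k)} (≈ᴾ⇒≋ {A • (U • basisPolynomial k)} {U • basisPolynomial k}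
                                                                    (U•-invariant S⊆ (basisPolynomial-fixed k) A A∈)) ⟩
          constant (1/m k) *ᴾ (U • basisPolynomial k)          ≈⟨ p≋ k ⟨
          p k                                                  ∎)
          where open ≋

        ℓ⁻¹ : Carrier
        ℓ⁻¹ = 1/ ℓ

        coefficients-at-orbits : ∀ d i → coefficient (combination d basisPolynomial) (lookup orbitRepresentatives i) ≈ (entries basisCoefficients ⊡ d) i
        coefficients-at-orbits d i = trans (coefficient-combination d basisPolynomial (lookup orbitRepresentatives i))
          (sum-cong-≋ λ k → trans (*-congˡ {d k} (coefficient-basisPolynomial k i)) (*-comm (d k) _))

        -- A relation among the enumerators becomes a relation d among the forms. Its coefficients
        -- at the orbit representatives say Y d = 0, and L Y = ℓ yields ℓ d = 0.
        independent : ∀ c → combination c p ≈ᴾ [] → ∀ k → c k ≈ 0#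
        independent c h k = begin
          c k                               ≈⟨ trans (*-congˡ (1/m*m k)) (*-identityʳ (c k)) ⟨
          c k * (1/m k * m k)               ≈⟨ *-assoc (c k) (1/m k) (m k) ⟨
          d k * m k                         ≈⟨ *-congʳ {m k} (trans (sym (cancel ℓ {{ℓ-nonZero}} (d k))) (trans (*-congˡ ℓd≈0) (zeroʳ ℓ⁻¹))) ⟩
          0# * m k                          ≈⟨ zeroˡ (m k) ⟩
          0#                                ∎
          where
          open ≈
          d : Vector Carrier 6
          d k = c k * 1/m k
          vanishing : combination d basisPolynomial ≋ []
          vanishing = 𝓟.trans (𝓟.sym (T•U• (combination d basisPolynomial))) (•-congʳ T (𝓟.trans (𝓟.sym (combination-p c)) (≈ᴾ⇒≋ {combination c p} {[]} h)))
          ℓd≈0 : fromℤ (+ ℓ) * d k ≈ 0#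
          ℓd≈0 = begin
            fromℤ (+ ℓ) * d k                                               ≈⟨ ⊡-scalar (+ ℓ) d k ⟨
            (scalar (+ ℓ) ⊡ d) k                                            ≈⟨ ⊡-cong L*Y≡ℓ d k ⟨
            ((leftInverse ⊛ basisCoefficients) ⊡ d) k                    ≈⟨ ⊡-⊛ leftInverse basisCoefficients d k ⟩
            (entries leftInverse ⊡ entries basisCoefficients ⊡ d) k      ≈⟨ ⊡-zero (entries leftInverse) (λ i → trans (sym (coefficients-at-orbits d i))
                                                                              (≋⇒≈ᴾ vanishing (lookup orbitRepresentatives i))) k ⟩
            0#                                                           ∎

        module _ (q : Polynomial) (q-invariant : InvariantRing ⟨ S ⟩ᴹ q) (q-homogeneous : Homogeneous 16 q) where

          Q : Polynomial
          Q = T • q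

          Q-fixed : FixedByGenerators Q
          Q-fixed = T•-fixed ⊆S {q} q-invariant

          Q-homogeneous : Homogeneous 16 Q
          Q-homogeneous = •-Homogeneous T {p = q} q-homogeneous

          y : Vector Carrier 16
          y = orbitCoefficients Q-fixed Q-homogeneous

          -- `d` holds the coordinates with respect to the forms, read off by the left inverse; `c`
          -- converts them to the enumerators through the denominators.
          d c : Vector Carrier 6
          d k = ℓ⁻¹ * (entries leftInverse ⊡ y) k
          c k = d k * m k

          -- `Q` minus its candidate is set up as one combination of seven polynomials, so that
          -- invariance and homogeneity pass to it by linearity.
          coefficients : Vector Carrier 7
          coefficients zero    = 1#
          coefficients (suc k) = - d k

          polynomials : Vector Polynomial 7
          polynomials zero    = Q
          polynomials (suc k) = basisPolynomial k

          difference : Polynomial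
          difference = combination coefficients polynomials

          difference-fixed : FixedByGenerators difference
          difference-fixed g = 𝓟.trans (•-combination ⟦ conjugated g ⟧ᴹ coefficients polynomials)
            (combination-cong {c = coefficients} {c′ = coefficients} {p = λ i → ⟦ conjugated g ⟧ᴹ • polynomials i} {p′ = polynomials} (λ i → refl)
              λ { zero → Q-fixed g ; (suc k) → basisPolynomial-fixed k g })

          difference-homogeneous : Homogeneous 16 difference
          difference-homogeneous = Homogeneous-combination coefficients polynomials
            λ { zero → Q-homogeneous ; (suc k) → basisPolynomial-homogeneous k }

          coefficient-difference : ∀ e → coefficient difference e ≈ coefficient Q e + - coefficient (combination d basisPolynomial) e
          coefficient-difference e = trans (coefficient-combination coefficients polynomials e)
            (+-cong (*-identityˡ _) (trans (sum-cong-≋ λ k → trans (sym (-‿distribˡ-* (d k) (coefficient (basisPolynomial k) e))) (sym (-1*x≈-x _)))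
              (trans (sym (*-distribˡ-sum (- 1#) (λ k → d k * coefficient (basisPolynomial k) e)))
                (trans (-1*x≈-x _) (-‿cong (sym (coefficient-combination d basisPolynomial e)))))))

          y≈ : ∀ i → y i ≈ (entries basisCoefficients ⊡ d) i
          y≈ i = begin
            y i                                                                                       ≈⟨ cancel ℓ {{ℓ-nonZero}} (y i) ⟨
            ℓ⁻¹ * (fromℤ (+ ℓ) * y i)                                                                 ≈⟨ *-congˡ (orbitCoefficients-combination Q-fixed Q-homogeneous i) ⟩
            ℓ⁻¹ * sum (λ k → fromℤ (entries basisCoefficients i k) * (entries leftInverse ⊡ y) k)     ≈⟨ *-distribˡ-sum ℓ⁻¹ (λ k → fromℤ (entries basisCoefficients i k) * (entries leftInverse ⊡ y) k) ⟩
            sum (λ k → ℓ⁻¹ * (fromℤ (entries basisCoefficients i k) * (entries leftInverse ⊡ y) k))   ≈⟨ sum-cong-≋ (λ k → x∙yz≈y∙xz ℓ⁻¹ (fromℤ (entries basisCoefficients i k)) ((entries leftInverse ⊡ y) k)) ⟩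
            (entries basisCoefficients ⊡ d) i                                                         ∎
            where open ≈

          difference≈0 : ∀ e → coefficient difference e ≈ 0#
          difference≈0 = orbitCoefficients-determine difference-fixed difference-homogeneous λ i →
            trans (coefficient-difference (lookup orbitRepresentatives i))
              (trans (+-congˡ (-‿cong (trans (coefficients-at-orbits d i) (sym (y≈ i))))) (-‿inverseʳ (y i)))

          Q≋ : Q ≋ combination d basisPolynomial
          Q≋ = ≈ᴾ⇒≋ {Q} {combination d basisPolynomial} λ e →
            x∙y⁻¹≈ε⇒x≈y _ _ (trans (sym (coefficient-difference e)) (difference≈0 e))

          spans : q ≈ᴾ combination c p
          spans = ≋⇒≈ᴾ (begin
            q                                                                 ≈⟨ U•T• q ⟨
            U • Q                                                             ≈⟨ •-congʳ U Q≋ ⟩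
            U • combination d basisPolynomial                                 ≈⟨ •-congʳ U (combination-cong {c = d} {c′ = λ k → c k * 1/m k} {p = basisPolynomial} {p′ = basisPolynomial}
                                                                                   (λ k → sym (trans (*-assoc (d k) (m k) (1/m k)) (trans (*-congˡ (trans (*-comm (m k) (1/m k)) (1/m*m k))) (*-identityʳ (d k)))))
                                                                                   (λ k → 𝓟.refl {basisPolynomial k})) ⟩
            U • combination (λ k → c k * 1/m k) basisPolynomial               ≈⟨ combination-p c ⟨
            combination c p                                                   ∎)
            where open ≋

      isBasis : IsBasis (λ q → InvariantRing ⟨ S ⟩ᴹ q × Homogeneous 16 q) p
      isBasis = record
        { inside      = λ k → invariant k , p-homogeneous k
        ; independent = independent
        ; spanning    = λ q (h , h′) → c q h h′ , spans q h h′
        }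

-- Functions on pairs of letters

module PairFunctions where

  open RingBasics
  open Defs using (Word)

  -- The functions on pairs of letters whose products over four pairs make up the
  -- indicator functions of the codes; σ, τ and β are attached to s, t and B.
  Letters : ℕ → Set
  Letters m = Fin m → Fin m → ℤ

  table : ∀ {m} → Vec (Vec ℤ m) m → Letters m
  table rows i j = lookup (lookup rows i) j

  -- A word lies in `E₈` or `D₁₆` when its pairs are all constant with an even number of 11, or all
  -- nonconstant with an even number of 10. Adding the signed table selects the even number, at the
  -- cost of a factor 2.
  binary : Vec (Letters 2) 4
  binary = table ((1ℤ ∷ 0ℤ ∷ []) ∷ (0ℤ ∷ 1ℤ  ∷ []) ∷ [])
         ∷ table ((1ℤ ∷ 0ℤ ∷ []) ∷ (0ℤ ∷ -1ℤ ∷ []) ∷ [])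
         ∷ table ((0ℤ ∷ 1ℤ ∷ []) ∷ (1ℤ ∷ 0ℤ  ∷ []) ∷ [])
         ∷ table ((0ℤ ∷ 1ℤ ∷ []) ∷ (-1ℤ ∷ 0ℤ ∷ []) ∷ []) ∷ []

  -- Restriction to even or odd letters, without and with a sign at 2 or 3. A word lies in `K₈` or
  -- `K₁₆` when its letters are all even or all odd and the number of letters 2, respectively 3, is
  -- even.
  characters : Vec (Vec ℤ 4) 4
  characters = (1ℤ ∷ 0ℤ ∷ 1ℤ ∷ 0ℤ ∷ []) ∷ (1ℤ ∷ 0ℤ ∷ -1ℤ ∷ 0ℤ ∷ []) ∷ (0ℤ ∷ 1ℤ ∷ 0ℤ ∷ 1ℤ ∷ []) ∷ (0ℤ ∷ 1ℤ ∷ 0ℤ ∷ -1ℤ ∷ []) ∷ []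

  quaternary : Fin 4 → Letters 4
  quaternary l i j = lookup (lookup characters l) i ℤ.* lookup (lookup characters l) j

  -- x ≡ y ≡ r (mod 2) and x - y ≡ 2 d (mod 4).
  parityClass : Fin 2 → Fin 2 → Letters 4
  parityClass 0F 0F = table ((1ℤ ∷ 0ℤ ∷ 0ℤ ∷ 0ℤ ∷ []) ∷ (0ℤ ∷ 0ℤ ∷ 0ℤ ∷ 0ℤ ∷ []) ∷ (0ℤ ∷ 0ℤ ∷ 1ℤ ∷ 0ℤ ∷ []) ∷ (0ℤ ∷ 0ℤ ∷ 0ℤ ∷ 0ℤ ∷ []) ∷ [])
  parityClass 0F 1F = table ((0ℤ ∷ 0ℤ ∷ 1ℤ ∷ 0ℤ ∷ []) ∷ (0ℤ ∷ 0ℤ ∷ 0ℤ ∷ 0ℤ ∷ []) ∷ (1ℤ ∷ 0ℤ ∷ 0ℤ ∷ 0ℤ ∷ []) ∷ (0ℤ ∷ 0ℤ ∷ 0ℤ ∷ 0ℤ ∷ []) ∷ [])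
  parityClass 1F 0F = table ((0ℤ ∷ 0ℤ ∷ 0ℤ ∷ 0ℤ ∷ []) ∷ (0ℤ ∷ 1ℤ ∷ 0ℤ ∷ 0ℤ ∷ []) ∷ (0ℤ ∷ 0ℤ ∷ 0ℤ ∷ 0ℤ ∷ []) ∷ (0ℤ ∷ 0ℤ ∷ 0ℤ ∷ 1ℤ ∷ []) ∷ [])
  parityClass 1F 1F = table ((0ℤ ∷ 0ℤ ∷ 0ℤ ∷ 0ℤ ∷ []) ∷ (0ℤ ∷ 0ℤ ∷ 0ℤ ∷ 1ℤ ∷ []) ∷ (0ℤ ∷ 0ℤ ∷ 0ℤ ∷ 0ℤ ∷ []) ∷ (0ℤ ∷ 1ℤ ∷ 0ℤ ∷ 0ℤ ∷ []) ∷ [])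

  double : ℕ → ℕ
  double zero    = zero
  double (suc k) = suc (suc (double k))

  overPairs : ∀ {m k} .{{_ : NonZero m}} → Vec (Letters m) k → Word m (double k) → ℤ
  overPairs []       []          = 1ℤ
  overPairs (g ∷ gs) (x ∷ y ∷ w) = g x y ℤ.* overPairs gs w

  sumℤ : List ℤ → ℤ
  sumℤ = List.foldr ℤ._+_ 0ℤ

-- Enumerators of integer-valued functions on words

module SumsOverWords where

  open RingBasics
  open PairFunctions
  open Defs using (Word; words)

  module WordSums {r ℓ} (R : CommutativeRing r ℓ) (x : Fin 2 → Fin 4 → CommutativeRing.Carrier R) where
    open CommutativeRing R hiding (zero)
    open Integers R
    open Summation R
    open Relation.Binary.Reasoning.Setoid setoid
    private
      module * = Algebra.Properties.CommutativeSemigroup *-commutativeSemigroup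

    wordProduct : ∀ {n} → Word 2 n → Word 4 n → Carrier
    wordProduct []      []      = 1#
    wordProduct (i ∷ u) (j ∷ v) = x i j * wordProduct u v

    private
      ∑-words : ∀ {m} .{{_ : NonZero m}} n (F : Word m (suc n) → Carrier) →
                ∑ (words (suc n)) F ≈ ∑ (List.allFin m) (λ i → ∑ (words n) λ w → F (i ∷ w))
      ∑-words {m} n F = ∑-cartesian _∷_ (List.allFin m) (words n) F

      ∑-words-++ : ∀ {m} .{{_ : NonZero m}} k l (F : Word m (k ℕ.+ l) → Carrier) →
                   ∑ (words (k ℕ.+ l)) F ≈ ∑ (words k) (λ w → ∑ (words l) λ w′ → F (w Vec.++ w′))
      ∑-words-++ zero    l F = sym (+-identityʳ _)
      ∑-words-++ {m} (suc k) l F = trans (∑-words (k ℕ.+ l) F) (trans (∑-cong (List.allFin m) λ i → ∑-words-++ k l (λ w → F (i ∷ w)))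
        (sym (∑-words k (λ w → ∑ (words l) λ w′ → F (w Vec.++ w′)))))

      wordProduct-++ : ∀ {k l} (u : Word 2 k) v (u′ : Word 2 l) v′ → wordProduct (u Vec.++ u′) (v Vec.++ v′) ≈ wordProduct u v * wordProduct u′ v′
      wordProduct-++ []      []      u′ v′ = sym (*-identityˡ _)
      wordProduct-++ (i ∷ u) (j ∷ v) u′ v′ = trans (*-congˡ (wordProduct-++ u v u′ v′)) (sym (*-assoc _ _ _))

      ∑∑-* : ∀ {s t} {A : Set s} {B : Set t} xs ys (f : A → Carrier) (g : B → Carrier) →
             ∑ xs (λ a → ∑ ys λ b → f a * g b) ≈ ∑ xs f * ∑ ys g
      ∑∑-* xs ys f g = trans (∑-cong xs λ a → ∑-*ˡ ys (f a) g) (∑-*ʳ xs (∑ ys g) f)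

    opaque
      -- The weight enumerator extended bilinearly from codes to integer-valued functions. It is
      -- opaque so that the lists of all words stay folded.
      𝒵 : ∀ {n} → (Word 2 n → ℤ) → (Word 4 n → ℤ) → Carrier
      𝒵 {n} φ ψ = ∑ (words n) λ u → ∑ (words n) λ v → fromℤ (φ u) * (fromℤ (ψ v) * wordProduct u v)

    opaque
      unfolding 𝒵

      -- The product of the variables along a word is multiplicative under concatenation, so the sum
      -- over both kinds of words factors.
      𝒵-++ : ∀ {k l} {Φ : Word 2 (k ℕ.+ l) → ℤ} {Ψ : Word 4 (k ℕ.+ l) → ℤ} (φ : Word 2 k → ℤ) φ′ ψ ψ′ → (∀ u u′ → Φ (u Vec.++ u′) ≡ φ u ℤ.* φ′ u′) → (∀ v v′ → Ψ (v Vec.++ v′) ≡ ψ v ℤ.* ψ′ v′) →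
             𝒵 Φ Ψ ≈ 𝒵 φ ψ * 𝒵 φ′ ψ′
      𝒵-++ {k} {l} {Φ} {Ψ} φ φ′ ψ ψ′ h h′ = begin
        𝒵 Φ Ψ
          ≈⟨ ∑-words-++ k l _ ⟩
        ∑ (words k) (λ u → ∑ (words l) λ u′ → ∑ (words (k ℕ.+ l)) λ v → fromℤ (Φ (u Vec.++ u′)) * (fromℤ (Ψ v) * wordProduct (u Vec.++ u′) v))
          ≈⟨ ∑-cong (words k) (λ u → ∑-cong (words l) λ u′ → trans (∑-words-++ k l _)
               (trans (∑-cong (words k) λ v → ∑-cong (words l) λ v′ → term u u′ v v′) (∑∑-* (words k) (words l) (f u) (g u′)))) ⟩
        ∑ (words k) (λ u → ∑ (words l) λ u′ → ∑ (words k) (f u) * ∑ (words l) (g u′))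
          ≈⟨ ∑∑-* (words k) (words l) (λ u → ∑ (words k) (f u)) (λ u′ → ∑ (words l) (g u′)) ⟩
        𝒵 φ ψ * 𝒵 φ′ ψ′ ∎
        where
        f : Word 2 k → Word 4 k → Carrier
        f u v = fromℤ (φ u) * (fromℤ (ψ v) * wordProduct u v)
        g : Word 2 l → Word 4 l → Carrier
        g u v = fromℤ (φ′ u) * (fromℤ (ψ′ v) * wordProduct u v)
        term : ∀ u u′ v v′ → fromℤ (Φ (u Vec.++ u′)) * (fromℤ (Ψ (v Vec.++ v′)) * wordProduct (u Vec.++ u′) (v Vec.++ v′)) ≈ f u v * g u′ v′
        term u u′ v v′ = trans
          (*-cong (trans (reflexive (cong fromℤ (h u u′))) (fromℤ-* (φ u) (φ′ u′)))
            (*-cong (trans (reflexive (cong fromℤ (h′ v v′))) (fromℤ-* (ψ v) (ψ′ v′))) (wordProduct-++ u v u′ v′)))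
          (trans (*-congˡ (*.interchange _ _ _ _)) (*.interchange _ _ _ _))

      𝒵-sumˡ : ∀ {n} c (φ : Word 2 n → ℤ) (φs : List (Word 2 n → ℤ)) ψ → (∀ u → c ℤ.* φ u ≡ sumℤ (List.map (λ φ′ → φ′ u) φs)) →
               fromℤ c * 𝒵 φ ψ ≈ ∑ φs (λ φ′ → 𝒵 φ′ ψ)
      𝒵-sumˡ {n} c φ φs ψ h = begin
        fromℤ c * 𝒵 φ ψ
          ≈⟨ trans (∑-cong (words n) λ u → trans (∑-cong (words n) λ v → *-assoc (fromℤ c) (fromℤ (φ u)) _) (∑-*ˡ (words n) (fromℤ c) _)) (∑-*ˡ (words n) (fromℤ c) _) ⟨
        ∑ (words n) (λ u → ∑ (words n) λ v → fromℤ c * fromℤ (φ u) * (fromℤ (ψ v) * wordProduct u v))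
          ≈⟨ ∑-cong (words n) (λ u → ∑-cong (words n) λ v → trans (*-congʳ (trans (sym (fromℤ-* c (φ u))) (trans (reflexive (cong fromℤ (h u))) (fromℤ-sum φs u))))
               (sym (∑-*ʳ φs _ (λ φ′ → fromℤ (φ′ u))))) ⟩
        ∑ (words n) (λ u → ∑ (words n) λ v → ∑ φs λ φ′ → fromℤ (φ′ u) * (fromℤ (ψ v) * wordProduct u v))
          ≈⟨ trans (∑-cong (words n) λ u → ∑-swap (words n) φs _) (∑-swap (words n) φs _) ⟩
        ∑ φs (λ φ′ → 𝒵 {n} φ′ ψ) ∎
        where
        fromℤ-sum : ∀ (φs : List (Word 2 n → ℤ)) (u : Word 2 n) → fromℤ (sumℤ (List.map (λ φ′ → φ′ u) φs)) ≈ ∑ φs (λ φ′ → fromℤ (φ′ u))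
        fromℤ-sum []       u = refl
        fromℤ-sum (φ ∷ φs) u = trans (fromℤ-+ (φ u) _) (+-congˡ (fromℤ-sum φs u))

      𝒵-sumʳ : ∀ {n} c (φ : Word 2 n → ℤ) ψ (ψs : List (Word 4 n → ℤ)) → (∀ v → c ℤ.* ψ v ≡ sumℤ (List.map (λ ψ′ → ψ′ v) ψs)) →
               fromℤ c * 𝒵 φ ψ ≈ ∑ ψs (λ ψ′ → 𝒵 {n} φ ψ′)
      𝒵-sumʳ {n} c φ ψ ψs h = begin
        fromℤ c * 𝒵 φ ψ
          ≈⟨ trans (∑-cong (words n) λ u → trans (∑-cong (words n) λ v → *.x∙yz≈y∙xz (fromℤ (φ u)) (fromℤ c) _) (∑-*ˡ (words n) (fromℤ c) _)) (∑-*ˡ (words n) (fromℤ c) _) ⟨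
        ∑ (words n) (λ u → ∑ (words n) λ v → fromℤ (φ u) * (fromℤ c * (fromℤ (ψ v) * wordProduct u v)))
          ≈⟨ ∑-cong (words n) (λ u → ∑-cong (words n) λ v → *-congˡ (trans (sym (*-assoc _ _ _)) (trans (*-congʳ (trans (sym (fromℤ-* c (ψ v))) (trans (reflexive (cong fromℤ (h v))) (fromℤ-sum ψs v))))
               (sym (∑-*ʳ ψs _ (λ ψ′ → fromℤ (ψ′ v))))))) ⟩
        ∑ (words n) (λ u → ∑ (words n) λ v → fromℤ (φ u) * ∑ ψs λ ψ′ → fromℤ (ψ′ v) * wordProduct u v)
          ≈⟨ ∑-cong (words n) (λ u → ∑-cong (words n) λ v → sym (∑-*ˡ ψs (fromℤ (φ u)) _)) ⟩
        ∑ (words n) (λ u → ∑ (words n) λ v → ∑ ψs λ ψ′ → fromℤ (φ u) * (fromℤ (ψ′ v) * wordProduct u v))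
          ≈⟨ trans (∑-cong (words n) λ u → ∑-swap (words n) ψs _) (∑-swap (words n) ψs _) ⟩
        ∑ ψs (λ ψ′ → 𝒵 {n} φ ψ′) ∎
        where
        fromℤ-sum : ∀ (ψs : List (Word 4 n → ℤ)) (v : Word 4 n) → fromℤ (sumℤ (List.map (λ ψ′ → ψ′ v) ψs)) ≈ ∑ ψs (λ ψ′ → fromℤ (ψ′ v))
        fromℤ-sum []       v = refl
        fromℤ-sum (ψ ∷ ψs) v = trans (fromℤ-+ (ψ v) _) (+-congˡ (fromℤ-sum ψs v))

    onPairs : ∀ {m} .{{_ : NonZero m}} → Letters m → Word m 2 → ℤ
    onPairs g (i ∷ j ∷ []) = g i j

    private
      opaque
        unfolding 𝒵

        𝒵-empty : 𝒵 (overPairs []) (overPairs []) ≈ 1#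
        𝒵-empty = solve 1 (λ o → con 1ℤ :* (con 1ℤ :* o) :+ con 0ℤ :+ con 0ℤ := o) refl 1#

    -- Cutting off one pair of letters at a time leaves only sums over words of length 2.
    𝒵-overPairs : ∀ {k} (φs : Vec (Letters 2) k) (ψs : Vec (Letters 4) k) →
                  𝒵 (overPairs φs) (overPairs ψs) ≈ Vec.foldr (λ _ → Carrier) _*_ 1# (zipWith (λ φ ψ → 𝒵 (onPairs φ) (onPairs ψ)) φs ψs)
    𝒵-overPairs []       []       = 𝒵-empty
    𝒵-overPairs (φ ∷ φs) (ψ ∷ ψs) = trans (𝒵-++ {k = 2} {Φ = overPairs (φ ∷ φs)} {Ψ = overPairs (ψ ∷ ψs)} (onPairs φ) (overPairs φs) (onPairs ψ) (overPairs ψs)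
        (λ { (i ∷ j ∷ []) u′ → ≡.refl }) (λ { (i ∷ j ∷ []) v′ → ≡.refl }))
      (*-congˡ (𝒵-overPairs φs ψs))

-- Certified tests for membership in a code

module CodeTests where

  open RingBasics
  open PairFunctions
  open Defs using (Word; Span; ℤmod-abelianGroup; Word-abelianGroup)

  every : ∀ m → (Fin m → Bool) → Bool
  every zero    P = true
  every (suc m) P = if P zero then every m (P ∘ suc) else false

  everyWord : ∀ {m} .{{_ : NonZero m}} n → (Word m n → Bool) → Bool
  everyWord     zero    P = P []
  everyWord {m} (suc n) P = every m λ i → everyWord n (P ∘ (i ∷_))

  if-true₂ : ∀ {b c} → (if b then c else false) ≡ true → b ≡ true × c ≡ true
  if-true₂ {true} h = ≡.refl , h

  every-sound : ∀ m P → every m P ≡ true → ∀ i → P i ≡ true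
  every-sound (suc m) P h zero    = proj₁ (if-true₂ h)
  every-sound (suc m) P h (suc i) = every-sound m (P ∘ suc) (proj₂ (if-true₂ h)) i

  everyWord-sound : ∀ {m} .{{_ : NonZero m}} n (P : Word m n → Bool) → everyWord n P ≡ true → ∀ w → P w ≡ true
  everyWord-sound     zero    P h []      = h
  everyWord-sound {m} (suc n) P h (i ∷ w) = everyWord-sound n (P ∘ (i ∷_)) (every-sound m _ h i) w

  module _ {m n : ℕ} .{{_ : NonZero m}} where
    private
      module ℤₘ = AbelianGroup (ℤmod-abelianGroup m)
      module W  = AbelianGroup (Word-abelianGroup m n)
    open Algebra.Definitions.RawMonoid W.rawMonoid using () renaming (_×_ to _×ʷ_)
    private
      module + = Algebra.Properties.CommutativeSemigroup ℤₘ.commutativeSemigroup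

    encode : List ℕ → List (Word m n) → Word m n
    encode (k ∷ ks) (g ∷ gs) = (k ×ʷ g) W.∙ encode ks gs
    encode _        _        = W.ε

    encode∈Span : ∀ ks rows → Span rows (encode ks rows)
    encode∈Span ks rows = go ks rows λ g∈ → Defs.row g∈
      where
      multiple : ∀ k {g} → Span rows g → Span rows (k ×ʷ g)
      multiple zero    p = Defs.null
      multiple (suc k) p = Defs.plus p (multiple k p)
      go : ∀ ks gs → (∀ {g} → g ∈ˡ gs → Span rows g) → Span rows (encode ks gs)
      go []       _        _ = Defs.null
      go (k ∷ ks) []       _ = Defs.null
      go (k ∷ ks) (g ∷ gs) p = Defs.plus (multiple k (p (here ≡.refl))) (go ks gs (p ∘ there))

    -- A parity check: coefficients other than 1 are encoded by repeating a position.
    functional : List (Fin n) → Word m n → Fin m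
    functional []       w = ℤₘ.ε
    functional (i ∷ is) w = lookup w i ℤₘ.∙ functional is w

    functional-∙ : ∀ is u v → functional is (u W.∙ v) ≡ functional is u ℤₘ.∙ functional is v
    functional-∙ []       u v = ≡.sym (ℤₘ.identityˡ ℤₘ.ε)
    functional-∙ (i ∷ is) u v = ≡.trans (cong₂ ℤₘ._∙_ (Vec.lookup-zipWith ℤₘ._∙_ i u v) (functional-∙ is u v)) (+.interchange (lookup u i) (lookup v i) (functional is u) (functional is v))

    functional-ε : ∀ is → functional is W.ε ≡ ℤₘ.ε
    functional-ε []       = ≡.refl
    functional-ε (i ∷ is) = ≡.trans (cong₂ ℤₘ._∙_ (Vec.lookup-replicate i ℤₘ.ε) (functional-ε is)) (ℤₘ.identityˡ ℤₘ.ε)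

    functional-Span : ∀ is {rows} → All (λ g → functional is g ≡ ℤₘ.ε) rows → ∀ {u} → Span rows u → functional is u ≡ ℤₘ.ε
    functional-Span is h (Defs.row g∈)  = All.lookup h g∈
    functional-Span is h Defs.null      = functional-ε is
    functional-Span is h (Defs.plus {u} {v} p q) = ≡.trans (functional-∙ is u v)
      (≡.trans (cong₂ ℤₘ._∙_ (functional-Span is h p) (functional-Span is h q)) (ℤₘ.identityˡ ℤₘ.ε))
    functional-Span is h (Defs.minus {u} p) = ≡.trans (≡.sym (ℤₘ.identityˡ _)) (≡.trans (cong (ℤₘ._∙ functional is (u W.⁻¹)) (≡.sym (functional-Span is h p)))
      (≡.trans (≡.sym (functional-∙ is u (u W.⁻¹))) (≡.trans (cong (functional is) (W.inverseʳ u)) (functional-ε is))))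

    vanish : List (List (Fin n)) → Word m n → Bool
    vanish []       w = true
    vanish (c ∷ cs) w = if does (functional c w Fin.≟ ℤₘ.ε) then vanish cs w else false

    Checks : List (List (Fin n)) → List (Word m n) → Set
    Checks cs rows = All (λ c → All (λ g → functional c g ≡ ℤₘ.ε) rows) cs

    checks? : ∀ cs rows → Dec (Checks cs rows)
    checks? cs rows = All.all? (λ c → All.all? (λ g → functional c g Fin.≟ ℤₘ.ε) rows) cs

    vanish-Span : ∀ {cs rows} → Checks cs rows → ∀ {u} → Span rows u → vanish cs u ≡ true
    vanish-Span []       p = ≡.refl
    vanish-Span {c ∷ cs} (h ∷ hs) {u} p with functional c u Fin.≟ ℤₘ.ε
    ... | yes _ = vanish-Span hs p
    ... | no ¬h = contradiction (functional-Span c h p) ¬h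

  indicator : ∀ {p} {P : Set p} → Dec P → ℤ
  indicator d = if does d then 1ℤ else 0ℤ

  module _ {m n : ℕ} .{{_ : NonZero m}} (rows : List (Word m n)) (checks : List (List (Fin n)))
    (decode : Word m n → List ℕ) (c : ℤ) (value : Word m n → ℤ) where

    decodes : Word m n → Bool
    decodes u = isYes (Vec.≡-dec Fin._≟_ (encode (decode u) rows) u)

    codeTest : Word m n → Bool
    codeTest u = if vanish checks u
      then (if isYes (value u ℤ.≟ c) then decodes u else false)
      else isYes (value u ℤ.≟ 0ℤ)

    private
      isYes⇒′ : ∀ {p} {P : Set p} (d : Dec P) → isYes d ≡ true → P
      isYes⇒′ (yes p) _ = p

    -- Membership is certified by decoding into the generators, nonmembership by a check that fails,
    -- so the decision procedure of the code is never run. Words passing all checks must have value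
    -- c, the others value 0.
    code-indicator : Checks checks rows → everyWord n codeTest ≡ true → ∀ u (d : Dec (Span rows u)) → c ℤ.* indicator d ≡ value u
    code-indicator h t u d = go d (vanish checks u) ≡.refl (everyWord-sound n codeTest t u)
      where
      go : (d : Dec (Span rows u)) → ∀ b → vanish checks u ≡ b →
           (if b then (if isYes (value u ℤ.≟ c) then decodes u else false) else isYes (value u ℤ.≟ 0ℤ)) ≡ true →
           c ℤ.* indicator d ≡ value u
      go (yes p) true  e t = ≡.trans (ℤ.*-identityʳ c) (≡.sym (isYes⇒′ (value u ℤ.≟ c) (proj₁ (if-true₂ t))))
      go (yes p) false e t = contradiction (≡.trans (≡.sym (vanish-Span h p)) e) λ ()
      go (no ¬p) true  e t = contradiction (subst (Span rows) (isYes⇒′ (Vec.≡-dec Fin._≟_ (encode (decode u) rows) u) (proj₂ (if-true₂ t)))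
                               (encode∈Span (decode u) rows)) ¬p
      go (no ¬p) false e t = ≡.trans (ℤ.*-zeroʳ c) (≡.sym (isYes⇒′ (value u ℤ.≟ 0ℤ) t))

-- The codes `E₈`, `D₁₆`, `Q₈` and `K₈`

module CodeChecks where

  open RingBasics
  open PairFunctions
  open CodeTests
  open Defs using (Word)

  E₈-rows : List (Word 2 8)
  E₈-rows = List.map (Vec.map (_mod 2))
    ( (1 ∷ 1 ∷ 1 ∷ 1 ∷ 0 ∷ 0 ∷ 0 ∷ 0 ∷ [])
    ∷ (0 ∷ 0 ∷ 1 ∷ 1 ∷ 1 ∷ 1 ∷ 0 ∷ 0 ∷ [])
    ∷ (0 ∷ 0 ∷ 0 ∷ 0 ∷ 1 ∷ 1 ∷ 1 ∷ 1 ∷ [])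
    ∷ (1 ∷ 0 ∷ 1 ∷ 0 ∷ 1 ∷ 0 ∷ 1 ∷ 0 ∷ [])
    ∷ [])

  D₁₆-rows : List (Word 2 16)
  D₁₆-rows = List.map (Vec.map (_mod 2))
    ( (1 ∷ 1 ∷ 1 ∷ 1 ∷ 0 ∷ 0 ∷ 0 ∷ 0 ∷ 0 ∷ 0 ∷ 0 ∷ 0 ∷ 0 ∷ 0 ∷ 0 ∷ 0 ∷ [])
    ∷ (0 ∷ 0 ∷ 1 ∷ 1 ∷ 1 ∷ 1 ∷ 0 ∷ 0 ∷ 0 ∷ 0 ∷ 0 ∷ 0 ∷ 0 ∷ 0 ∷ 0 ∷ 0 ∷ [])
    ∷ (0 ∷ 0 ∷ 0 ∷ 0 ∷ 1 ∷ 1 ∷ 1 ∷ 1 ∷ 0 ∷ 0 ∷ 0 ∷ 0 ∷ 0 ∷ 0 ∷ 0 ∷ 0 ∷ [])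
    ∷ (0 ∷ 0 ∷ 0 ∷ 0 ∷ 0 ∷ 0 ∷ 1 ∷ 1 ∷ 1 ∷ 1 ∷ 0 ∷ 0 ∷ 0 ∷ 0 ∷ 0 ∷ 0 ∷ [])
    ∷ (0 ∷ 0 ∷ 0 ∷ 0 ∷ 0 ∷ 0 ∷ 0 ∷ 0 ∷ 1 ∷ 1 ∷ 1 ∷ 1 ∷ 0 ∷ 0 ∷ 0 ∷ 0 ∷ [])
    ∷ (0 ∷ 0 ∷ 0 ∷ 0 ∷ 0 ∷ 0 ∷ 0 ∷ 0 ∷ 0 ∷ 0 ∷ 1 ∷ 1 ∷ 1 ∷ 1 ∷ 0 ∷ 0 ∷ [])
    ∷ (0 ∷ 0 ∷ 0 ∷ 0 ∷ 0 ∷ 0 ∷ 0 ∷ 0 ∷ 0 ∷ 0 ∷ 0 ∷ 0 ∷ 1 ∷ 1 ∷ 1 ∷ 1 ∷ [])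
    ∷ (1 ∷ 0 ∷ 1 ∷ 0 ∷ 1 ∷ 0 ∷ 1 ∷ 0 ∷ 1 ∷ 0 ∷ 1 ∷ 0 ∷ 1 ∷ 0 ∷ 1 ∷ 0 ∷ [])
    ∷ [])

  Q₈-rows : List (Word 4 8)
  Q₈-rows = List.map (Vec.map (_mod 4))
    ( (0 ∷ 0 ∷ 1 ∷ 1 ∷ 0 ∷ 2 ∷ 1 ∷ 3 ∷ [])
    ∷ (0 ∷ 0 ∷ 0 ∷ 2 ∷ 1 ∷ 3 ∷ 1 ∷ 1 ∷ [])
    ∷ (1 ∷ 1 ∷ 0 ∷ 2 ∷ 0 ∷ 0 ∷ 1 ∷ 3 ∷ [])
    ∷ (0 ∷ 2 ∷ 0 ∷ 2 ∷ 0 ∷ 2 ∷ 0 ∷ 2 ∷ [])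
    ∷ (0 ∷ 0 ∷ 0 ∷ 0 ∷ 0 ∷ 0 ∷ 2 ∷ 2 ∷ [])
    ∷ [])

  K₈-rows : List (Word 4 8)
  K₈-rows = List.map (Vec.map (_mod 4))
    ( (1 ∷ 1 ∷ 1 ∷ 1 ∷ 1 ∷ 1 ∷ 1 ∷ 1 ∷ [])
    ∷ (0 ∷ 2 ∷ 0 ∷ 0 ∷ 0 ∷ 0 ∷ 0 ∷ 2 ∷ [])
    ∷ (0 ∷ 0 ∷ 2 ∷ 0 ∷ 0 ∷ 0 ∷ 0 ∷ 2 ∷ [])
    ∷ (0 ∷ 0 ∷ 0 ∷ 2 ∷ 0 ∷ 0 ∷ 0 ∷ 2 ∷ [])
    ∷ (0 ∷ 0 ∷ 0 ∷ 0 ∷ 2 ∷ 0 ∷ 0 ∷ 2 ∷ [])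
    ∷ (0 ∷ 0 ∷ 0 ∷ 0 ∷ 0 ∷ 2 ∷ 0 ∷ 2 ∷ [])
    ∷ (0 ∷ 0 ∷ 0 ∷ 0 ∷ 0 ∷ 0 ∷ 2 ∷ 2 ∷ [])
    ∷ [])

  -- Each check is a list of positions at which the entries of a codeword sum to zero.
  E₈-checks : List (List (Fin 8))
  E₈-checks = List.map (List.map fin)
    ( (0 ∷ 1 ∷ 2 ∷ 3 ∷ [])
    ∷ (2 ∷ 3 ∷ 4 ∷ 5 ∷ [])
    ∷ (4 ∷ 5 ∷ 6 ∷ 7 ∷ [])
    ∷ (0 ∷ 2 ∷ 4 ∷ 6 ∷ [])
    ∷ [])
    where
    fin : ℕ → Fin 8
    fin k = k mod 8

  D₁₆-checks : List (List (Fin 16))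
  D₁₆-checks = List.map (List.map fin)
    ( (0 ∷ 1 ∷ 2 ∷ 3 ∷ [])
    ∷ (2 ∷ 3 ∷ 4 ∷ 5 ∷ [])
    ∷ (4 ∷ 5 ∷ 6 ∷ 7 ∷ [])
    ∷ (6 ∷ 7 ∷ 8 ∷ 9 ∷ [])
    ∷ (8 ∷ 9 ∷ 10 ∷ 11 ∷ [])
    ∷ (10 ∷ 11 ∷ 12 ∷ 13 ∷ [])
    ∷ (12 ∷ 13 ∷ 14 ∷ 15 ∷ [])
    ∷ (0 ∷ 2 ∷ 4 ∷ 6 ∷ 8 ∷ 10 ∷ 12 ∷ 14 ∷ [])
    ∷ [])
    where
    fin : ℕ → Fin 16
    fin k = k mod 16

  -- All generators occur as checks, the code being self-orthogonal; the first four checks say that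
  -- the letters of each pair agree modulo 2.
  Q₈-checks : List (List (Fin 8))
  Q₈-checks = List.map (List.map fin)
    ( (0 ∷ 0 ∷ 1 ∷ 1 ∷ [])
    ∷ (2 ∷ 2 ∷ 3 ∷ 3 ∷ [])
    ∷ (4 ∷ 4 ∷ 5 ∷ 5 ∷ [])
    ∷ (6 ∷ 6 ∷ 7 ∷ 7 ∷ [])
    ∷ (2 ∷ 3 ∷ 5 ∷ 5 ∷ 6 ∷ 7 ∷ 7 ∷ 7 ∷ [])
    ∷ (3 ∷ 3 ∷ 4 ∷ 5 ∷ 5 ∷ 5 ∷ 6 ∷ 7 ∷ [])
    ∷ (0 ∷ 1 ∷ 3 ∷ 3 ∷ 6 ∷ 7 ∷ 7 ∷ 7 ∷ [])
    ∷ (1 ∷ 1 ∷ 3 ∷ 3 ∷ 5 ∷ 5 ∷ 7 ∷ 7 ∷ [])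
    ∷ [])
    where
    fin : ℕ → Fin 8
    fin k = k mod 8

  K₈-checks : List (List (Fin 8))
  K₈-checks = List.map (List.map fin)
    ( (0 ∷ 0 ∷ 7 ∷ 7 ∷ [])
    ∷ (1 ∷ 1 ∷ 7 ∷ 7 ∷ [])
    ∷ (2 ∷ 2 ∷ 7 ∷ 7 ∷ [])
    ∷ (3 ∷ 3 ∷ 7 ∷ 7 ∷ [])
    ∷ (4 ∷ 4 ∷ 7 ∷ 7 ∷ [])
    ∷ (5 ∷ 5 ∷ 7 ∷ 7 ∷ [])
    ∷ (6 ∷ 6 ∷ 7 ∷ 7 ∷ [])
    ∷ (0 ∷ 1 ∷ 2 ∷ 3 ∷ 4 ∷ 5 ∷ 6 ∷ 7 ∷ [])
    ∷ [])
    where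
    fin : ℕ → Fin 8
    fin k = k mod 8

  infixl 9 _!_
  _!_ : ∀ {m n} .{{_ : NonZero m}} .{{_ : NonZero n}} → Word m n → ℕ → ℕ
  _!_ {n = n} w k = Fin.toℕ (lookup w (k mod n))

  -- Halves a residue modulo 4 that is even whenever the word being decoded is a codeword.
  half : ℕ → ℕ
  half 2 = 1
  half 3 = 1
  half _ = 0

  -- The last generator vanishes at the second entry of every pair, so these entries give the first
  -- three coefficients by back substitution; the first pair then gives the last one. No reduction
  -- modulo 2 is made.
  E₈-decode : Word 2 8 → List ℕ
  E₈-decode u = u ! 1 ∷ u ! 3 ℕ.+ u ! 1 ∷ u ! 5 ℕ.+ (u ! 3 ℕ.+ u ! 1) ∷ u ! 0 ℕ.+ u ! 1 ∷ []

  D₁₆-decode : Word 2 16 → List ℕ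
  D₁₆-decode u = List.map (λ c → List.foldr (λ k s → u ! k ℕ.+ s) 0 c)
    ((1 ∷ []) ∷ (1 ∷ 3 ∷ []) ∷ (1 ∷ 3 ∷ 5 ∷ []) ∷ (1 ∷ 3 ∷ 5 ∷ 7 ∷ []) ∷ (1 ∷ 3 ∷ 5 ∷ 7 ∷ 9 ∷ []) ∷ (1 ∷ 3 ∷ 5 ∷ 7 ∷ 9 ∷ 11 ∷ [])
      ∷ (1 ∷ 3 ∷ 5 ∷ 7 ∷ 9 ∷ 11 ∷ 13 ∷ []) ∷ (0 ∷ 1 ∷ []) ∷ [])

  -- Entries 2, 4 and 0 meet only the first, second and third generator. The last two coefficients
  -- are half of what remains at entries 1 and 6, with 3 in the role of -1 modulo 4.
  Q₈-decode : Word 4 8 → List ℕ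
  Q₈-decode w = w ! 2 ∷ w ! 4 ∷ w ! 0 ∷ half ((w ! 1 ℕ.+ 3 ℕ.* w ! 0) % 4) ∷ half ((w ! 6 ℕ.+ 3 ℕ.* (w ! 2 ℕ.+ w ! 4 ℕ.+ w ! 0)) % 4) ∷ []

  K-decode : ∀ {n} → Word 4 (suc n) → ℕ → List ℕ
  K-decode w l = w ! 0 ∷ List.map (λ j → half ((w ! suc j ℕ.+ 3 ℕ.* w ! 0) % 4)) (List.upTo l)

  -- Equal to _*_, but does not evaluate its second argument when the first is zero.
  lazy* : ℤ → ℤ → ℤ
  lazy* (+ 0) y = 0ℤ
  lazy* x     y = x ℤ.* y

  lazy*≡* : ∀ x y → lazy* x y ≡ x ℤ.* y
  lazy*≡* (+ 0)      y = ≡.sym (ℤ.*-zeroˡ y)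
  lazy*≡* (+ suc n)  y = ≡.refl
  lazy*≡* -[1+ n ]   y = ≡.refl

  overPairs′ : ∀ {m k} .{{_ : NonZero m}} → Vec (Letters m) k → Word m (double k) → ℤ
  overPairs′ []       []          = 1ℤ
  overPairs′ (g ∷ gs) (x ∷ y ∷ w) = lazy* (g x y) (overPairs′ gs w)

  overPairs′≡ : ∀ {m k} .{{_ : NonZero m}} (gs : Vec (Letters m) k) w → overPairs′ gs w ≡ overPairs gs w
  overPairs′≡ []       []          = ≡.refl
  overPairs′≡ (g ∷ gs) (x ∷ y ∷ w) = ≡.trans (lazy*≡* (g x y) _) (cong (g x y ℤ.*_) (overPairs′≡ gs w))

  sumOver : ∀ {m k} .{{_ : NonZero m}} → List (Vec (Letters m) k) → Word m (double k) → ℤ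
  sumOver gss w = sumℤ (List.map (λ gs → overPairs′ gs w) gss)

  binaries : (k : ℕ) → List (Vec (Letters 2) k)
  binaries k = List.map (λ i → replicate k (lookup binary i)) (List.allFin 4)

  quaternaries : (k : ℕ) → List (Vec (Letters 4) k)
  quaternaries k = List.map (λ l → replicate k (quaternary l)) (List.allFin 4)

  -- 𝒬₈ is the disjoint union of sixteen products of four parity classes.
  Q₈-types : List (Vec (Fin 2 × Fin 2) 4)
  Q₈-types = List.cartesianProductWith (λ (rs , cs) d → Vec.zip rs (Vec.map (_+ d) cs))
    ( (0F ∷ 0F ∷ 0F ∷ 0F ∷ [] , 0F ∷ 0F ∷ 0F ∷ 0F ∷ [])
    ∷ (0F ∷ 0F ∷ 1F ∷ 1F ∷ [] , 0F ∷ 1F ∷ 1F ∷ 0F ∷ [])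
    ∷ (0F ∷ 1F ∷ 0F ∷ 1F ∷ [] , 0F ∷ 0F ∷ 1F ∷ 1F ∷ [])
    ∷ (0F ∷ 1F ∷ 1F ∷ 0F ∷ [] , 0F ∷ 1F ∷ 0F ∷ 1F ∷ [])
    ∷ (1F ∷ 0F ∷ 0F ∷ 1F ∷ [] , 0F ∷ 1F ∷ 0F ∷ 1F ∷ [])
    ∷ (1F ∷ 0F ∷ 1F ∷ 0F ∷ [] , 0F ∷ 0F ∷ 1F ∷ 1F ∷ [])
    ∷ (1F ∷ 1F ∷ 0F ∷ 0F ∷ [] , 0F ∷ 1F ∷ 1F ∷ 0F ∷ [])
    ∷ (1F ∷ 1F ∷ 1F ∷ 1F ∷ [] , 0F ∷ 0F ∷ 0F ∷ 0F ∷ [])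
    ∷ []) (List.allFin 2)
    where
    _+_ : Fin 2 → Fin 2 → Fin 2
    0F + d  = d
    1F + 0F = 1F
    1F + 1F = 0F

  Q₈-classes : List (Vec (Letters 4) 4)
  Q₈-classes = List.map (Vec.map λ (r , c) → parityClass r c) Q₈-types

  E₈-test : everyWord 8 (codeTest E₈-rows E₈-checks E₈-decode (+ 2) (sumOver (binaries 4))) ≡ true
  E₈-test = ≡.refl

  D₁₆-test : everyWord 16 (codeTest D₁₆-rows D₁₆-checks D₁₆-decode (+ 2) (sumOver (binaries 8))) ≡ true
  D₁₆-test = ≡.refl

  Q₈-test : everyWord 8 (codeTest Q₈-rows Q₈-checks Q₈-decode 1ℤ (sumOver Q₈-classes)) ≡ true
  Q₈-test = ≡.refl

  K₈-test : everyWord 8 (codeTest K₈-rows K₈-checks (λ w → K-decode w 6) (+ 2) (sumOver (quaternaries 4))) ≡ true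
  K₈-test = ≡.refl

-- Indicator functions of codes, and halves of the words of `K₁₆`

module CodeIndicators where

  open RingBasics
  open PairFunctions
  open CodeTests
  open CodeChecks
  open Defs using (Word; E₈; Q₈; K₈; D₁₆; _⊕_; LinearCode; ℤmod-abelianGroup; Word-abelianGroup)

  sumOver≡ : ∀ {m k} .{{_ : NonZero m}} (gss : List (Vec (Letters m) k)) w →
             sumOver gss w ≡ sumℤ (List.map (λ φ → φ w) (List.map overPairs gss))
  sumOver≡ []         w = ≡.refl
  sumOver≡ (gs ∷ gss) w = cong₂ ℤ._+_ (overPairs′≡ gs w) (sumOver≡ gss w)

  𝟙 : ∀ {m n} .{{_ : NonZero m}} → LinearCode m n → Word m n → ℤ
  𝟙 C u = indicator (LinearCode.member? C u)

  𝟙-E₈ : ∀ u → + 2 ℤ.* 𝟙 E₈ u ≡ sumℤ (List.map (λ φ → φ u) (List.map overPairs (binaries 4)))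
  𝟙-E₈ u = ≡.trans (code-indicator E₈-rows E₈-checks E₈-decode (+ 2) (sumOver (binaries 4)) (from-yes (checks? E₈-checks E₈-rows)) E₈-test u (LinearCode.member? E₈ u))
    (sumOver≡ (binaries 4) u)

  𝟙-D₁₆ : ∀ u → + 2 ℤ.* 𝟙 D₁₆ u ≡ sumℤ (List.map (λ φ → φ u) (List.map overPairs (binaries 8)))
  𝟙-D₁₆ u = ≡.trans (code-indicator D₁₆-rows D₁₆-checks D₁₆-decode (+ 2) (sumOver (binaries 8)) (from-yes (checks? D₁₆-checks D₁₆-rows)) D₁₆-test u (LinearCode.member? D₁₆ u))
    (sumOver≡ (binaries 8) u)

  𝟙-Q₈ : ∀ v → 1ℤ ℤ.* 𝟙 Q₈ v ≡ sumℤ (List.map (λ φ → φ v) (List.map overPairs Q₈-classes))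
  𝟙-Q₈ v = ≡.trans (code-indicator Q₈-rows Q₈-checks Q₈-decode 1ℤ (sumOver Q₈-classes) (from-yes (checks? Q₈-checks Q₈-rows)) Q₈-test v (LinearCode.member? Q₈ v))
    (sumOver≡ Q₈-classes v)

  𝟙-K₈ : ∀ v → + 2 ℤ.* 𝟙 K₈ v ≡ sumℤ (List.map (λ φ → φ v) (List.map overPairs (quaternaries 4)))
  𝟙-K₈ v = ≡.trans (code-indicator K₈-rows K₈-checks (λ w → K-decode w 6) (+ 2) (sumOver (quaternaries 4)) (from-yes (checks? K₈-checks K₈-rows)) K₈-test v (LinearCode.member? K₈ v))
    (sumOver≡ (quaternaries 4) v)

  indicator-× : ∀ {p q r} {P : Set p} {Q : Set q} {R : Set r} → (P → Q × R) → (Q × R → P) →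
                (p? : Dec P) (q? : Dec Q) (r? : Dec R) → indicator p? ≡ indicator q? ℤ.* indicator r?
  indicator-× f g (yes p) (yes q) (yes r) = ≡.refl
  indicator-× f g (yes p) (yes q) (no ¬r) = contradiction (proj₂ (f p)) ¬r
  indicator-× f g (yes p) (no ¬q) r?      = contradiction (proj₁ (f p)) ¬q
  indicator-× f g (no ¬p) (yes q) (yes r) = contradiction (g (q , r)) ¬p
  indicator-× f g (no ¬p) (yes q) (no ¬r) = ≡.refl
  indicator-× f g (no ¬p) (no ¬q) r?      = ≡.refl

  𝟙-⊕ : ∀ {m k l} .{{_ : NonZero m}} (C : LinearCode m k) (D : LinearCode m l) u v → 𝟙 (C ⊕ D) (u Vec.++ v) ≡ 𝟙 C u ℤ.* 𝟙 D v
  𝟙-⊕ {m} C D u v = indicator-× split join (LinearCode.member? (C ⊕ D) (u Vec.++ v)) (LinearCode.member? C u) (LinearCode.member? D v)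
    where
    split : LinearCode.Member (C ⊕ D) (u Vec.++ v) → LinearCode.Member C u × LinearCode.Member D v
    split (u′ , v′ , u′∈ , v′∈ , e) = subst (LinearCode.Member C) (≡.sym (Vec.++-injectiveˡ u u′ e)) u′∈
                                    , subst (LinearCode.Member D) (≡.sym (Vec.++-injectiveʳ u u′ e)) v′∈
    join : LinearCode.Member C u × LinearCode.Member D v → LinearCode.Member (C ⊕ D) (u Vec.++ v)
    join (u∈ , v∈) = u , v , u∈ , v∈ , ≡.refl

  overPairs-halves : ∀ {m} .{{_ : NonZero m}} (g : Letters m) u u′ →
                     overPairs (replicate 8 g) (u Vec.++ u′) ≡ overPairs (replicate 4 g) u ℤ.* overPairs (replicate 4 g) u′
  overPairs-halves g (u₀ ∷ u₁ ∷ u₂ ∷ u₃ ∷ u₄ ∷ u₅ ∷ u₆ ∷ u₇ ∷ []) u′ =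
    regroup (g u₀ u₁) (g u₂ u₃) (g u₄ u₅) (g u₆ u₇) (overPairs (replicate 4 g) u′)
    where
    regroup : ∀ a b c d e → a ℤ.* (b ℤ.* (c ℤ.* (d ℤ.* e))) ≡ a ℤ.* (b ℤ.* (c ℤ.* (d ℤ.* 1ℤ))) ℤ.* e
    regroup = ℤ-Ring.solve-∀

  module _ {m k l : ℕ} .{{_ : NonZero m}} where

    functional-↑ˡ : ∀ is (u : Word m k) (v : Word m l) → functional (List.map (Fin._↑ˡ l) is) (u Vec.++ v) ≡ functional is u
    functional-↑ˡ []       u v = ≡.refl
    functional-↑ˡ (i ∷ is) u v = cong₂ (AbelianGroup._∙_ (ℤmod-abelianGroup m)) (Vec.lookup-++ˡ u v i) (functional-↑ˡ is u v)

    functional-↑ʳ : ∀ is (u : Word m k) (v : Word m l) → functional (List.map (k Fin.↑ʳ_) is) (u Vec.++ v) ≡ functional is v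
    functional-↑ʳ []       u v = ≡.refl
    functional-↑ʳ (i ∷ is) u v = cong₂ (AbelianGroup._∙_ (ℤmod-abelianGroup m)) (Vec.lookup-++ʳ u v i) (functional-↑ʳ is u v)

    functional-both : ∀ is js (u : Word m k) (v : Word m l) → functional (List.map (Fin._↑ˡ l) is List.++ List.map (k Fin.↑ʳ_) js) (u Vec.++ v)
                      ≡ AbelianGroup._∙_ (ℤmod-abelianGroup m) (functional is u) (functional js v)
    functional-both []       js u v = ≡.trans (functional-↑ʳ js u v) (≡.sym (AbelianGroup.identityˡ (ℤmod-abelianGroup m) _))
    functional-both (i ∷ is) js u v = ≡.trans (cong₂ (AbelianGroup._∙_ (ℤmod-abelianGroup m)) (Vec.lookup-++ˡ u v i) (functional-both is js u v))
      (≡.sym (AbelianGroup.assoc (ℤmod-abelianGroup m) _ _ _))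

  vanish-map : ∀ {m n n′} .{{_ : NonZero m}} (f : Fin n → Fin n′) (u : Word m n) (w : Word m n′) →
               (∀ is → functional (List.map f is) w ≡ functional is u) → ∀ cs → vanish (List.map (List.map f) cs) w ≡ vanish cs u
  vanish-map f u w h []       = ≡.refl
  vanish-map {m} f u w h (c ∷ cs) = cong₂ (λ x b → if does (x Fin.≟ AbelianGroup.ε (ℤmod-abelianGroup m)) then b else false) (h c) (vanish-map f u w h cs)

  -- A word of 𝒦₁₆ is cut into two halves.  A half whose entries have the same
  -- parity enters only through the parity of its last entry and its sum.
  K₁₆-rows : List (Word 4 16)
  K₁₆-rows = List.map (Vec.map (_mod 4)) (replicate 16 1 ∷ List.tabulate λ (j : Fin 14) → replicate 16 0 Vec.[ suc (Fin.inject₁ j) ]≔ 2 Vec.[ Fin.fromℕ 15 ]≔ 2)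

  parityChecks : List (List (Fin 8))
  parityChecks = List.map (λ j → Fin.inject₁ j ∷ Fin.inject₁ j ∷ Fin.fromℕ 7 ∷ Fin.fromℕ 7 ∷ []) (List.allFin 7)

  last total : Word 4 8 → Fin 4
  last  v = functional (Fin.fromℕ 7 ∷ Fin.fromℕ 7 ∷ []) v
  total v = functional (List.allFin 8) v

  -- last v is twice the last entry.
  characterValue : Fin 4 → Fin 4 → Vec ℤ 4
  characterValue 0F 0F = 1ℤ ∷ 1ℤ  ∷ 0ℤ ∷ 0ℤ  ∷ []
  characterValue 0F _  = 1ℤ ∷ -1ℤ ∷ 0ℤ ∷ 0ℤ  ∷ []
  characterValue _  0F = 0ℤ ∷ 0ℤ  ∷ 1ℤ ∷ 1ℤ  ∷ []
  characterValue _  _  = 0ℤ ∷ 0ℤ  ∷ 1ℤ ∷ -1ℤ ∷ []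

  even : Fin 4 → Bool
  even 0F = true
  even 2F = true
  even _  = false

  -- A standard half with the parity encoded by e and with sum s; it completes any half of constant
  -- parity with the same data to a word of `K₁₆`.
  complement : Fin 4 → Fin 4 → Word 4 8
  complement e s = replicate 7 (parity e) Vec.++ (((Fin.toℕ (parity e) ℕ.+ Fin.toℕ s) mod 4) ∷ [])
    where
    parity : Fin 4 → Fin 4
    parity 0F = 0F
    parity _  = 1F

  characterSums : Word 4 8 → Vec ℤ 4
  characterSums v = Vec.tabulate λ l → overPairs′ (replicate 4 (quaternary l)) v

  decodes₁₆ : Word 4 16 → Bool
  decodes₁₆ w = isYes (Vec.≡-dec Fin._≟_ (encode (K-decode w 14) K₁₆-rows) w)

  module W = AbelianGroup (Word-abelianGroup 4 8)

  -- For a half v of constant parity and its complement c, both v ++ c and 0 ++ (v - c) are decoded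
  -- in `K₁₆`. Two halves with the same c can then be joined by adding such words, without a search
  -- over pairs of halves.
  halfTest : Word 4 8 → Bool
  halfTest v = if vanish parityChecks v
    then (if even (last v) then (if even (total v)
      then (if isYes (Vec.≡-dec ℤ._≟_ (characterSums v) (characterValue (last v) (total v)))
        then (if decodes₁₆ (v Vec.++ complement (last v) (total v)) then decodes₁₆ (W.ε Vec.++ (v W.∙ complement (last v) (total v) W.⁻¹)) else false)
        else false) else false) else false)
    else isYes (Vec.≡-dec ℤ._≟_ (characterSums v) (replicate 4 0ℤ))

  halves-test : everyWord 8 halfTest ≡ true
  halves-test = ≡.refl

  -- Only the doubled last entry and the sum of each half matter, which leaves 4⁴ cases. For even
  -- residues, a sum of 0 modulo 4 forces equality.
  profileTest : Word 4 4 → Bool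
  profileTest (e ∷ s ∷ e′ ∷ s′ ∷ []) =
    if even e then if even s then if even e′ then if even s′
      then (if isYes (e ∙ e′ Fin.≟ 0F)
        then (if isYes (s ∙ s′ Fin.≟ 0F)
          then (if isYes (e Fin.≟ e′) then (if isYes (s Fin.≟ s′) then isYes (value ℤ.≟ + 2) else false) else false)
          else isYes (value ℤ.≟ 0ℤ))
        else isYes (value ℤ.≟ 0ℤ))
      else true else true else true else true
    where
    open AbelianGroup (ℤmod-abelianGroup 4) using (_∙_)
    value : ℤ
    value = sumℤ (List.map (λ l → lookup (characterValue e s) l ℤ.* lookup (characterValue e′ s′) l) (List.allFin 4))

  profiles-test : everyWord 4 profileTest ≡ true
  profiles-test = ≡.refl

-- The indicator function of `K₁₆`

module IndicatorK₁₆ where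

  open RingBasics
  open PairFunctions
  open CodeTests
  open CodeChecks
  open CodeIndicators
  open Defs using (Word; K₁₆; LinearCode; Span; ℤmod-abelianGroup)

  isYes⇒ : ∀ {p} {P : Set p} (d : Dec P) → isYes d ≡ true → P
  isYes⇒ (yes p) _ = p

  Half : Word 4 8 → Set
  Half v = (vanish parityChecks v ≡ true × even (last v) ≡ true × even (total v) ≡ true × characterSums v ≡ characterValue (last v) (total v)
              × Span K₁₆-rows (v Vec.++ complement (last v) (total v)) × Span K₁₆-rows (W.ε Vec.++ (v W.∙ complement (last v) (total v) W.⁻¹)))
         ⊎ (vanish parityChecks v ≡ false × characterSums v ≡ replicate 4 0ℤ)

  decodes₁₆-sound : ∀ w → decodes₁₆ w ≡ true → Span K₁₆-rows w
  decodes₁₆-sound w t = subst (Span K₁₆-rows) (isYes⇒ (Vec.≡-dec Fin._≟_ (encode (K-decode w 14) K₁₆-rows) w) t) (encode∈Span (K-decode w 14) K₁₆-rows)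

  half-word : ∀ v → Half v
  half-word v = go (vanish parityChecks v) ≡.refl (even (last v)) ≡.refl (even (total v)) ≡.refl
    (Vec.≡-dec ℤ._≟_ (characterSums v) (characterValue (last v) (total v))) (decodes₁₆ (v Vec.++ complement (last v) (total v))) ≡.refl
    (everyWord-sound 8 halfTest halves-test v)
    where
    d₂ : Bool
    d₂ = decodes₁₆ (W.ε Vec.++ (v W.∙ complement (last v) (total v) W.⁻¹))
    -- The subtests are generalised to arbitrary outcomes, so that splitting into cases does not
    -- evaluate them.
    go : ∀ b → vanish parityChecks v ≡ b → ∀ e → even (last v) ≡ e → ∀ e′ → even (total v) ≡ e′ →
         (c : Dec (characterSums v ≡ characterValue (last v) (total v))) → ∀ d → decodes₁₆ (v Vec.++ complement (last v) (total v)) ≡ d →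
         (if b then (if e then (if e′ then (if isYes c then (if d then d₂ else false) else false) else false) else false)
          else isYes (Vec.≡-dec ℤ._≟_ (characterSums v) (replicate 4 0ℤ))) ≡ true → Half v
    go true  h true h₁ true h₂ (yes h₃) true h₄ t = inj₁ (h , h₁ , h₂ , h₃ , decodes₁₆-sound _ h₄ , decodes₁₆-sound _ t)
    go false h _    _  _    _  _        _    _  t = inj₂ (h , isYes⇒ (Vec.≡-dec ℤ._≟_ (characterSums v) (replicate 4 0ℤ)) t)

  dot : Vec ℤ 4 → Vec ℤ 4 → ℤ
  dot a b = sumℤ (List.map (λ l → lookup a l ℤ.* lookup b l) (List.allFin 4))

  module _ (e s e′ s′ : Fin 4) where
    private
      module ℤ₄ = AbelianGroup (ℤmod-abelianGroup 4)

    profileValue : ℤ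
    profileValue = dot (characterValue e s) (characterValue e′ s′)

    profiles : even e ≡ true → even s ≡ true → even e′ ≡ true → even s′ ≡ true →
               (e ≡ e′ × s ≡ s′ × profileValue ≡ + 2) ⊎ ((e ℤ₄.∙ e′ ≡ 0F → s ℤ₄.∙ s′ ≢ 0F) × profileValue ≡ 0ℤ)
    profiles h₁ h₂ h₃ h₄ = go _ h₁ _ h₂ _ h₃ _ h₄ (e ℤ₄.∙ e′ Fin.≟ 0F) (s ℤ₄.∙ s′ Fin.≟ 0F) (e Fin.≟ e′) (s Fin.≟ s′)
      (everyWord-sound 4 profileTest profiles-test (e ∷ s ∷ e′ ∷ s′ ∷ []))
      where
      go : ∀ b₁ → b₁ ≡ true → ∀ b₂ → b₂ ≡ true → ∀ b₃ → b₃ ≡ true → ∀ b₄ → b₄ ≡ true →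
           (c : Dec (e ℤ₄.∙ e′ ≡ 0F)) (d : Dec (s ℤ₄.∙ s′ ≡ 0F)) (x : Dec (e ≡ e′)) (y : Dec (s ≡ s′)) →
           (if b₁ then if b₂ then if b₃ then if b₄
             then (if isYes c then (if isYes d then (if isYes x then (if isYes y then isYes (profileValue ℤ.≟ + 2) else false) else false)
                   else isYes (profileValue ℤ.≟ 0ℤ)) else isYes (profileValue ℤ.≟ 0ℤ))
            else true else true else true else true) ≡ true →
           (e ≡ e′ × s ≡ s′ × profileValue ≡ + 2) ⊎ ((e ℤ₄.∙ e′ ≡ 0F → s ℤ₄.∙ s′ ≢ 0F) × profileValue ≡ 0ℤ)
      go true _ true _ true _ true _ (yes _) (yes _) (yes x) (yes y) t = inj₁ (x , y , isYes⇒ (profileValue ℤ.≟ + 2) t)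
      go true _ true _ true _ true _ (yes _) (no ¬d) _       _       t = inj₂ ((λ _ → ¬d) , isYes⇒ (profileValue ℤ.≟ 0ℤ) t)
      go true _ true _ true _ true _ (no ¬c) _       _       _       t = inj₂ ((λ c → contradiction c ¬c) , isYes⇒ (profileValue ℤ.≟ 0ℤ) t)

  overPairs-K₁₆ : ∀ v v′ → sumℤ (List.map (λ ψ → ψ (v Vec.++ v′)) (List.map overPairs (quaternaries 8)))
                  ≡ dot (characterSums v) (characterSums v′)
  overPairs-K₁₆ v v′ = go (List.allFin 4)
    where
    at : ∀ l v → overPairs (replicate 4 (quaternary l)) v ≡ lookup (characterSums v) l
    at l v = ≡.trans (≡.sym (overPairs′≡ (replicate 4 (quaternary l)) v)) (≡.sym (Vec.lookup∘tabulate (λ l → overPairs′ (replicate 4 (quaternary l)) v) l))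
    go : ∀ ls → sumℤ (List.map (λ ψ → ψ (v Vec.++ v′)) (List.map overPairs (List.map (λ l → replicate 8 (quaternary l)) ls)))
                ≡ sumℤ (List.map (λ l → lookup (characterSums v) l ℤ.* lookup (characterSums v′) l) ls)
    go []       = ≡.refl
    go (l ∷ ls) = cong₂ ℤ._+_ (≡.trans (overPairs-halves (quaternary l) v v′) (cong₂ ℤ._*_ (at l v) (at l v′))) (go ls)

  module _ (v v′ : Word 4 8) where
    private
      module ℤ₄ = AbelianGroup (ℤmod-abelianGroup 4)

      lastChecks totalChecks : List (Fin 16)
      lastChecks  = List.map (Fin._↑ˡ 8) (Fin.fromℕ 7 ∷ Fin.fromℕ 7 ∷ []) List.++ List.map (8 Fin.↑ʳ_) (Fin.fromℕ 7 ∷ Fin.fromℕ 7 ∷ [])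
      totalChecks = List.map (Fin._↑ˡ 8) (List.allFin 8) List.++ List.map (8 Fin.↑ʳ_) (List.allFin 8)

      K₁₆⇒last : Span K₁₆-rows (v Vec.++ v′) → last v ℤ₄.∙ last v′ ≡ 0F
      K₁₆⇒last p = ≡.trans (≡.sym (functional-both (Fin.fromℕ 7 ∷ Fin.fromℕ 7 ∷ []) (Fin.fromℕ 7 ∷ Fin.fromℕ 7 ∷ []) v v′))
        (functional-Span lastChecks (from-yes (All.all? (λ g → functional lastChecks g Fin.≟ 0F) K₁₆-rows)) p)

      K₁₆⇒total : Span K₁₆-rows (v Vec.++ v′) → total v ℤ₄.∙ total v′ ≡ 0F
      K₁₆⇒total p = ≡.trans (≡.sym (functional-both (List.allFin 8) (List.allFin 8) v v′))
        (functional-Span totalChecks (from-yes (All.all? (λ g → functional totalChecks g Fin.≟ 0F) K₁₆-rows)) p)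

      K₁₆⇒vanishˡ : Span K₁₆-rows (v Vec.++ v′) → vanish parityChecks v ≡ true
      K₁₆⇒vanishˡ p = ≡.trans (≡.sym (vanish-map (Fin._↑ˡ 8) v (v Vec.++ v′) (λ is → functional-↑ˡ is v v′) parityChecks))
        (vanish-Span (from-yes (checks? (List.map (List.map (Fin._↑ˡ 8)) parityChecks) K₁₆-rows)) p)

      K₁₆⇒vanishʳ : Span K₁₆-rows (v Vec.++ v′) → vanish parityChecks v′ ≡ true
      K₁₆⇒vanishʳ p = ≡.trans (≡.sym (vanish-map (8 Fin.↑ʳ_) v′ (v Vec.++ v′) (λ is → functional-↑ʳ is v v′) parityChecks))
        (vanish-Span (from-yes (checks? (List.map (List.map (8 Fin.↑ʳ_)) parityChecks) K₁₆-rows)) p)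

      zero-products : ∀ (a b : Vec ℤ 4) → a ≡ replicate 4 0ℤ ⊎ b ≡ replicate 4 0ℤ → dot a b ≡ 0ℤ
      zero-products .(0ℤ ∷ 0ℤ ∷ 0ℤ ∷ 0ℤ ∷ []) (b₀ ∷ b₁ ∷ b₂ ∷ b₃ ∷ []) (inj₁ ≡.refl) = ≡.refl
      zero-products (a₀ ∷ a₁ ∷ a₂ ∷ a₃ ∷ []) .(0ℤ ∷ 0ℤ ∷ 0ℤ ∷ 0ℤ ∷ []) (inj₂ ≡.refl) = vanishing a₀ a₁ a₂ a₃
        where
        vanishing : ∀ a b c d → a ℤ.* 0ℤ ℤ.+ (b ℤ.* 0ℤ ℤ.+ (c ℤ.* 0ℤ ℤ.+ (d ℤ.* 0ℤ ℤ.+ 0ℤ))) ≡ 0ℤ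
        vanishing = ℤ-Ring.solve-∀

      outside : ¬ Span K₁₆-rows (v Vec.++ v′) → (d : Dec (Span K₁₆-rows (v Vec.++ v′))) → + 2 ℤ.* indicator d ≡ 0ℤ
      outside ¬p (yes p) = contradiction p ¬p
      outside ¬p (no _)  = ≡.refl

      inside : Span K₁₆-rows (v Vec.++ v′) → (d : Dec (Span K₁₆-rows (v Vec.++ v′))) → + 2 ℤ.* indicator d ≡ + 2
      inside p (yes _) = ≡.refl
      inside p (no ¬p) = contradiction p ¬p

      -- (v ++ c) + (0 ++ (v′ - c)) = v ++ v′.
      glue : ∀ c → Span K₁₆-rows (v Vec.++ c) → Span K₁₆-rows (W.ε Vec.++ (v′ W.∙ c W.⁻¹)) → Span K₁₆-rows (v Vec.++ v′)
      glue c p q = subst (Span K₁₆-rows) (≡.trans (Vec.zipWith-++ ℤ₄._∙_ v c W.ε (v′ W.∙ c W.⁻¹))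
        (cong₂ Vec._++_ (W.identityʳ v) (≡.trans (W.comm c _) (≡.trans (W.assoc v′ (c W.⁻¹) c) (≡.trans (cong (v′ W.∙_) (W.inverseˡ c)) (W.identityʳ v′))))))
        (Defs.plus p q)

      -- Equal profiles give a codeword and the value 2. For different ones, `last` or `total` is a
      -- check that fails on the concatenation, and the products of characters add up to 0.
      both : ∀ e s e′ s′ χ χ′ (d : Dec (Span K₁₆-rows (v Vec.++ v′))) → χ ≡ characterValue e s → χ′ ≡ characterValue e′ s′ →
             Span K₁₆-rows (v Vec.++ complement e s) → Span K₁₆-rows (W.ε Vec.++ (v′ W.∙ complement e′ s′ W.⁻¹)) →
             (Span K₁₆-rows (v Vec.++ v′) → e ℤ₄.∙ e′ ≡ 0F) → (Span K₁₆-rows (v Vec.++ v′) → s ℤ₄.∙ s′ ≡ 0F) →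
             (e ≡ e′ × s ≡ s′ × profileValue e s e′ s′ ≡ + 2) ⊎ ((e ℤ₄.∙ e′ ≡ 0F → s ℤ₄.∙ s′ ≢ 0F) × profileValue e s e′ s′ ≡ 0ℤ) →
             + 2 ℤ.* indicator d ≡ dot χ χ′
      both e s _ _ _ _ d ≡.refl ≡.refl p q _ _ (inj₁ (≡.refl , ≡.refl , f)) = ≡.trans (inside (glue (complement e s) p q) d) (≡.sym f)
      both e s e′ s′ _ _ d ≡.refl ≡.refl _ _ h k (inj₂ (n , f)) = ≡.trans (outside (λ r → contradiction (k r) (n (h r))) d) (≡.sym f)

      character-products : (d : Dec (Span K₁₆-rows (v Vec.++ v′))) → Half v → Half v′ →
        + 2 ℤ.* indicator d ≡ dot (characterSums v) (characterSums v′)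
      character-products d (inj₂ (h , z)) _ = ≡.trans (outside (λ p → contradiction (≡.trans (≡.sym (K₁₆⇒vanishˡ p)) h) λ ()) d)
        (≡.sym (zero-products (characterSums v) (characterSums v′) (inj₁ z)))
      character-products d (inj₁ _) (inj₂ (h , z)) = ≡.trans (outside (λ p → contradiction (≡.trans (≡.sym (K₁₆⇒vanishʳ p)) h) λ ()) d)
        (≡.sym (zero-products (characterSums v) (characterSums v′) (inj₂ z)))
      character-products d (inj₁ (_ , e , s , c , p , _)) (inj₁ (_ , e′ , s′ , c′ , _ , q)) =
        both (last v) (total v) (last v′) (total v′) (characterSums v) (characterSums v′) d c c′ p q K₁₆⇒last K₁₆⇒total
          (profiles (last v) (total v) (last v′) (total v′) e s e′ s′)

    K₁₆-halves : (d : Dec (Span K₁₆-rows (v Vec.++ v′))) → + 2 ℤ.* indicator d ≡ sumℤ (List.map (λ ψ → ψ (v Vec.++ v′)) (List.map overPairs (quaternaries 8)))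
    K₁₆-halves d = ≡.trans (character-products d (half-word v) (half-word v′)) (≡.sym (overPairs-K₁₆ v v′))

  K₁₆-indicator : ∀ w (d : Dec (Span K₁₆-rows w)) → + 2 ℤ.* indicator d ≡ sumℤ (List.map (λ ψ → ψ w) (List.map overPairs (quaternaries 8)))
  K₁₆-indicator w d with Vec.splitAt 8 w
  ... | v , v′ , ≡.refl = K₁₆-halves v v′ d

  -- The decision procedure of the code appears as one argument of an arbitrary statement about
  -- decisions, so it need not be unfolded for `K₁₆`.
  𝟙-intro : ∀ {m n} .{{_ : NonZero m}} (C : LinearCode m n) w {c x} → (∀ (d : Dec (LinearCode.Member C w)) → c ℤ.* indicator d ≡ x) → c ℤ.* 𝟙 C w ≡ x
  𝟙-intro C w h = h (LinearCode.member? C w)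

  𝟙-K₁₆ : ∀ w → + 2 ℤ.* 𝟙 K₁₆ w ≡ sumℤ (List.map (λ ψ → ψ w) (List.map overPairs (quaternaries 8)))
  𝟙-K₁₆ w = 𝟙-intro K₁₆ w {+ 2} (K₁₆-indicator w)

-- Enumerators as quadratic forms in the pairings

module WeightForms where

  open RingBasics
  open PairFunctions
  open SumsOverWords
  open CodeTests
  open CodeIndicators using (overPairs-halves)
  open CodeChecks using (binaries; quaternaries; Q₈-classes; Q₈-types)
  open PairingForms using (Expr; letter; int; _⊹_; _⊗_; bind; pairingOf; basisForm; basisExpr; denominators; W; ΣN; module Evaluation)
  open Defs using (Word; words)

  module _ {m : ℕ} where
    ∑ᴱ : ∀ {t} {A : Set t} → List A → (A → Expr m) → Expr m
    ∑ᴱ []       f = int 0ℤ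
    ∑ᴱ (x ∷ xs) f = f x ⊹ ∑ᴱ xs f

  letterClass : Fin 2 → Fin 4 → Fin 6
  letterClass i j = lookup (lookup ((0F ∷ 1F ∷ 2F ∷ 1F ∷ []) ∷ (3F ∷ 4F ∷ 5F ∷ 4F ∷ []) ∷ []) i) j

  pairTerm : Letters 2 → Letters 4 → Word 2 2 → Word 4 2 → Expr 6
  pairTerm φ ψ (i ∷ i′ ∷ []) (j ∷ j′ ∷ []) = int (φ i i′) ⊗ (int (ψ j j′) ⊗ (letter (letterClass i j) ⊗ letter (letterClass i′ j′)))

  pairSum : Letters 2 → Letters 4 → Expr 6
  pairSum φ ψ = ∑ᴱ (words 2) λ u → ∑ᴱ (words 2) (pairTerm φ ψ u)

  coordinate : Fin 6 → Expr 6
  coordinate 0F = letter 0F ⊹ letter 2F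
  coordinate 1F = letter 3F ⊹ letter 5F
  coordinate 2F = letter 0F ⊹ int -1ℤ ⊗ letter 2F
  coordinate 3F = letter 3F ⊹ int -1ℤ ⊗ letter 5F
  coordinate 4F = letter 1F ⊹ letter 1F
  coordinate 5F = letter 4F ⊹ letter 4F

  inPlane : Fin 3 → Expr 2 → Expr 6
  inPlane 0F = bind (lookup (letter 0F ∷ letter 1F ∷ []))
  inPlane 1F = bind (lookup (letter 2F ∷ letter 3F ∷ []))
  inPlane 2F = bind (lookup (letter 4F ∷ letter 5F ∷ []))

  -- The squares of planeForm are squareForm of X⁴ + Y⁴ and X² Y².
  planeForm squareForm : Fin 4 → Expr 2
  planeForm 0F = letter 0F ⊗ letter 0F ⊹ letter 1F ⊗ letter 1F
  planeForm 1F = letter 0F ⊗ letter 0F ⊹ int -1ℤ ⊗ (letter 1F ⊗ letter 1F)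
  planeForm 2F = int (+ 2) ⊗ (letter 0F ⊗ letter 1F)
  planeForm 3F = int 0ℤ
  squareForm 0F = letter 0F ⊹ int (+ 2) ⊗ letter 1F
  squareForm 1F = letter 0F ⊹ int -[1+ 1 ] ⊗ letter 1F
  squareForm 2F = int (+ 4) ⊗ letter 1F
  squareForm 3F = int 0ℤ

  -- Summed against the variables of one letter, the four characters give a + c = s, a - c = t, 2b =
  -- B and b - b = 0 (likewise p, q, E). So the character selects a plane or annihilates the sum,
  -- and the binary table selects the form in that plane.
  characterForm squaredForm : Fin 4 → Fin 4 → Expr 6
  characterForm k 0F = inPlane 0F (planeForm k)
  characterForm k 1F = inPlane 1F (planeForm k)
  characterForm k 2F = inPlane 2F (planeForm k)
  characterForm k 3F = int 0ℤ
  squaredForm k 0F = inPlane 0F (squareForm k)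
  squaredForm k 1F = inPlane 1F (squareForm k)
  squaredForm k 2F = inPlane 2F (squareForm k)
  squaredForm k 3F = int 0ℤ

  -- Twice the sum over a parity class. The even classes are half the sum or half the difference of
  -- the first two characters on pairs; the two odd classes agree because 1 and 3 carry the same
  -- variable.
  classForm : Fin 4 → Fin 2 → Fin 2 → Expr 6
  classForm k 0F 0F = characterForm k 0F ⊹ characterForm k 1F
  classForm k 0F 1F = characterForm k 0F ⊹ int -1ℤ ⊗ characterForm k 1F
  classForm k 1F _  = characterForm k 2F

  -- Enumerators with one code replaced by a product over pairs: 8 times that of `Q₈` and twice that
  -- of `K₈` against the binary table k, and twice that of `E₈` against the character l (`8Q`, `2K`,
  -- `2L`).
  Q-form K-form L-form : Fin 4 → Expr 6
  Q-form k = x ⊗ x ⊹ y ⊗ y ⊹ z ⊗ z ⊹ int (+ 6) ⊗ (x ⊗ y ⊹ x ⊗ z ⊹ int -1ℤ ⊗ (y ⊗ z))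
    where
    x y z : Expr 6
    x = squaredForm k 0F
    y = squaredForm k 1F
    z = squaredForm k 2F
  K-form k = ∑ᴱ (List.allFin 4) λ l → squaredForm k l ⊗ squaredForm k l
  L-form l = ∑ᴱ (List.allFin 4) λ k → squaredForm k l ⊗ squaredForm k l

  -- The pairings in terms of X⁴ + Y⁴ and X² Y² for each plane: the identities left to the solver
  -- drop from degree 16 to degree 4.
  reducedPairing : Fin 6 → Expr 6
  reducedPairing 0F = letter 0F ⊗ letter 0F ⊹ int (+ 12) ⊗ (letter 1F ⊗ letter 1F)
  reducedPairing 1F = letter 2F ⊗ letter 2F ⊹ int (+ 12) ⊗ (letter 3F ⊗ letter 3F)
  reducedPairing 2F = letter 4F ⊗ letter 4F ⊹ int (+ 12) ⊗ (letter 5F ⊗ letter 5F)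
  reducedPairing 3F = letter 0F ⊗ letter 2F ⊹ int (+ 12) ⊗ (letter 1F ⊗ letter 3F)
  reducedPairing 4F = letter 0F ⊗ letter 4F ⊹ int (+ 12) ⊗ (letter 1F ⊗ letter 5F)
  reducedPairing 5F = letter 2F ⊗ letter 4F ⊹ int (+ 12) ⊗ (letter 3F ⊗ letter 5F)

  module WeightIdentities {r ℓ} (R : CommutativeRing r ℓ)
    (½ : CommutativeRing.Carrier R) (½+½≈1 : RingBasics.IsHalf R ½) (ρ : Vector (CommutativeRing.Carrier R) 6) where
    open CommutativeRing R hiding (zero)
    open Integers R
    open Summation R
    open Evaluation R
    open WordSums R (λ i j → ρ (letterClass i j))
    open Relation.Binary.Reasoning.Setoid setoid

    y γ : Vector Carrier 6
    y i = eval ρ (coordinate i)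
    γ 0F = y 0F * y 0F * (y 0F * y 0F) + y 1F * y 1F * (y 1F * y 1F)
    γ 1F = y 0F * y 0F * (y 1F * y 1F)
    γ 2F = y 2F * y 2F * (y 2F * y 2F) + y 3F * y 3F * (y 3F * y 3F)
    γ 3F = y 2F * y 2F * (y 3F * y 3F)
    γ 4F = y 4F * y 4F * (y 4F * y 4F) + y 5F * y 5F * (y 5F * y 5F)
    γ 5F = y 4F * y 4F * (y 5F * y 5F)

    private
      two-cancel : ∀ {u v} → fromℤ (+ 2) * u ≈ fromℤ (+ 2) * v → u ≈ v
      two-cancel {u} {v} h = trans (sym (halve u)) (trans (*-congˡ h) (halve v))
        where
        halve : ∀ u → ½ * (fromℤ (+ 2) * u) ≈ u
        halve u = trans (solve 2 (λ h u → h :* (con (+ 2) :* u) := (h :+ h) :* u) refl ½ u) (trans (*-congʳ ½+½≈1) (*-identityˡ u))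

    P : Fin 4 → Letters 4 → Carrier
    P k g = 𝒵 (onPairs (lookup binary k)) (onPairs g)

    opaque
      unfolding 𝒵

      pairSum-eval : ∀ φ ψ → 𝒵 (onPairs φ) (onPairs ψ) ≈ eval ρ (pairSum φ ψ)
      pairSum-eval φ ψ = outer (words 2)
        where
        term : ∀ u v → fromℤ (onPairs φ u) * (fromℤ (onPairs ψ v) * wordProduct u v) ≈ eval ρ (pairTerm φ ψ u v)
        term (i ∷ i′ ∷ []) (j ∷ j′ ∷ []) = *-congˡ (*-congˡ (*-congˡ (*-identityʳ _)))
        inner : ∀ u vs → ∑ vs (λ v → fromℤ (onPairs φ u) * (fromℤ (onPairs ψ v) * wordProduct u v)) ≈ eval ρ (∑ᴱ vs (pairTerm φ ψ u))
        inner u []       = refl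
        inner u (v ∷ vs) = +-cong (term u v) (inner u vs)
        outer : ∀ us → ∑ us (λ u → ∑ (words 2) λ v → fromℤ (onPairs φ u) * (fromℤ (onPairs ψ v) * wordProduct u v))
                ≈ eval ρ (∑ᴱ us λ u → ∑ᴱ (words 2) (pairTerm φ ψ u))
        outer []       = refl
        outer (u ∷ us) = +-cong (inner u (words 2)) (outer us)

    pairSum-character : ∀ k l → eval ρ (pairSum (lookup binary k) (quaternary l)) ≈ eval ρ (bind coordinate (characterForm k l))
    pairSum-character 0F 0F = solve 6 (λ a b c d e f → toSolver (a ∷ b ∷ c ∷ d ∷ e ∷ f ∷ []) (pairSum (lookup binary 0F) (quaternary 0F)) := toSolver (a ∷ b ∷ c ∷ d ∷ e ∷ f ∷ []) (bind coordinate (characterForm 0F 0F))) refl (ρ 0F) (ρ 1F) (ρ 2F) (ρ 3F) (ρ 4F) (ρ 5F)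
    pairSum-character 0F 1F = solve 6 (λ a b c d e f → toSolver (a ∷ b ∷ c ∷ d ∷ e ∷ f ∷ []) (pairSum (lookup binary 0F) (quaternary 1F)) := toSolver (a ∷ b ∷ c ∷ d ∷ e ∷ f ∷ []) (bind coordinate (characterForm 0F 1F))) refl (ρ 0F) (ρ 1F) (ρ 2F) (ρ 3F) (ρ 4F) (ρ 5F)
    pairSum-character 0F 2F = solve 6 (λ a b c d e f → toSolver (a ∷ b ∷ c ∷ d ∷ e ∷ f ∷ []) (pairSum (lookup binary 0F) (quaternary 2F)) := toSolver (a ∷ b ∷ c ∷ d ∷ e ∷ f ∷ []) (bind coordinate (characterForm 0F 2F))) refl (ρ 0F) (ρ 1F) (ρ 2F) (ρ 3F) (ρ 4F) (ρ 5F)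
    pairSum-character 0F 3F = solve 6 (λ a b c d e f → toSolver (a ∷ b ∷ c ∷ d ∷ e ∷ f ∷ []) (pairSum (lookup binary 0F) (quaternary 3F)) := toSolver (a ∷ b ∷ c ∷ d ∷ e ∷ f ∷ []) (bind coordinate (characterForm 0F 3F))) refl (ρ 0F) (ρ 1F) (ρ 2F) (ρ 3F) (ρ 4F) (ρ 5F)
    pairSum-character 1F 0F = solve 6 (λ a b c d e f → toSolver (a ∷ b ∷ c ∷ d ∷ e ∷ f ∷ []) (pairSum (lookup binary 1F) (quaternary 0F)) := toSolver (a ∷ b ∷ c ∷ d ∷ e ∷ f ∷ []) (bind coordinate (characterForm 1F 0F))) refl (ρ 0F) (ρ 1F) (ρ 2F) (ρ 3F) (ρ 4F) (ρ 5F)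
    pairSum-character 1F 1F = solve 6 (λ a b c d e f → toSolver (a ∷ b ∷ c ∷ d ∷ e ∷ f ∷ []) (pairSum (lookup binary 1F) (quaternary 1F)) := toSolver (a ∷ b ∷ c ∷ d ∷ e ∷ f ∷ []) (bind coordinate (characterForm 1F 1F))) refl (ρ 0F) (ρ 1F) (ρ 2F) (ρ 3F) (ρ 4F) (ρ 5F)
    pairSum-character 1F 2F = solve 6 (λ a b c d e f → toSolver (a ∷ b ∷ c ∷ d ∷ e ∷ f ∷ []) (pairSum (lookup binary 1F) (quaternary 2F)) := toSolver (a ∷ b ∷ c ∷ d ∷ e ∷ f ∷ []) (bind coordinate (characterForm 1F 2F))) refl (ρ 0F) (ρ 1F) (ρ 2F) (ρ 3F) (ρ 4F) (ρ 5F)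
    pairSum-character 1F 3F = solve 6 (λ a b c d e f → toSolver (a ∷ b ∷ c ∷ d ∷ e ∷ f ∷ []) (pairSum (lookup binary 1F) (quaternary 3F)) := toSolver (a ∷ b ∷ c ∷ d ∷ e ∷ f ∷ []) (bind coordinate (characterForm 1F 3F))) refl (ρ 0F) (ρ 1F) (ρ 2F) (ρ 3F) (ρ 4F) (ρ 5F)
    pairSum-character 2F 0F = solve 6 (λ a b c d e f → toSolver (a ∷ b ∷ c ∷ d ∷ e ∷ f ∷ []) (pairSum (lookup binary 2F) (quaternary 0F)) := toSolver (a ∷ b ∷ c ∷ d ∷ e ∷ f ∷ []) (bind coordinate (characterForm 2F 0F))) refl (ρ 0F) (ρ 1F) (ρ 2F) (ρ 3F) (ρ 4F) (ρ 5F)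
    pairSum-character 2F 1F = solve 6 (λ a b c d e f → toSolver (a ∷ b ∷ c ∷ d ∷ e ∷ f ∷ []) (pairSum (lookup binary 2F) (quaternary 1F)) := toSolver (a ∷ b ∷ c ∷ d ∷ e ∷ f ∷ []) (bind coordinate (characterForm 2F 1F))) refl (ρ 0F) (ρ 1F) (ρ 2F) (ρ 3F) (ρ 4F) (ρ 5F)
    pairSum-character 2F 2F = solve 6 (λ a b c d e f → toSolver (a ∷ b ∷ c ∷ d ∷ e ∷ f ∷ []) (pairSum (lookup binary 2F) (quaternary 2F)) := toSolver (a ∷ b ∷ c ∷ d ∷ e ∷ f ∷ []) (bind coordinate (characterForm 2F 2F))) refl (ρ 0F) (ρ 1F) (ρ 2F) (ρ 3F) (ρ 4F) (ρ 5F)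
    pairSum-character 2F 3F = solve 6 (λ a b c d e f → toSolver (a ∷ b ∷ c ∷ d ∷ e ∷ f ∷ []) (pairSum (lookup binary 2F) (quaternary 3F)) := toSolver (a ∷ b ∷ c ∷ d ∷ e ∷ f ∷ []) (bind coordinate (characterForm 2F 3F))) refl (ρ 0F) (ρ 1F) (ρ 2F) (ρ 3F) (ρ 4F) (ρ 5F)
    pairSum-character 3F 0F = solve 6 (λ a b c d e f → toSolver (a ∷ b ∷ c ∷ d ∷ e ∷ f ∷ []) (pairSum (lookup binary 3F) (quaternary 0F)) := toSolver (a ∷ b ∷ c ∷ d ∷ e ∷ f ∷ []) (bind coordinate (characterForm 3F 0F))) refl (ρ 0F) (ρ 1F) (ρ 2F) (ρ 3F) (ρ 4F) (ρ 5F)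
    pairSum-character 3F 1F = solve 6 (λ a b c d e f → toSolver (a ∷ b ∷ c ∷ d ∷ e ∷ f ∷ []) (pairSum (lookup binary 3F) (quaternary 1F)) := toSolver (a ∷ b ∷ c ∷ d ∷ e ∷ f ∷ []) (bind coordinate (characterForm 3F 1F))) refl (ρ 0F) (ρ 1F) (ρ 2F) (ρ 3F) (ρ 4F) (ρ 5F)
    pairSum-character 3F 2F = solve 6 (λ a b c d e f → toSolver (a ∷ b ∷ c ∷ d ∷ e ∷ f ∷ []) (pairSum (lookup binary 3F) (quaternary 2F)) := toSolver (a ∷ b ∷ c ∷ d ∷ e ∷ f ∷ []) (bind coordinate (characterForm 3F 2F))) refl (ρ 0F) (ρ 1F) (ρ 2F) (ρ 3F) (ρ 4F) (ρ 5F)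
    pairSum-character 3F 3F = solve 6 (λ a b c d e f → toSolver (a ∷ b ∷ c ∷ d ∷ e ∷ f ∷ []) (pairSum (lookup binary 3F) (quaternary 3F)) := toSolver (a ∷ b ∷ c ∷ d ∷ e ∷ f ∷ []) (bind coordinate (characterForm 3F 3F))) refl (ρ 0F) (ρ 1F) (ρ 2F) (ρ 3F) (ρ 4F) (ρ 5F)

    pairSum-class : ∀ k r c → fromℤ (+ 2) * eval ρ (pairSum (lookup binary k) (parityClass r c)) ≈ eval ρ (bind coordinate (classForm k r c))
    pairSum-class 0F 0F 0F = solve 6 (λ a b c d e f → con (+ 2) :* toSolver (a ∷ b ∷ c ∷ d ∷ e ∷ f ∷ []) (pairSum (lookup binary 0F) (parityClass 0F 0F)) := toSolver (a ∷ b ∷ c ∷ d ∷ e ∷ f ∷ []) (bind coordinate (classForm 0F 0F 0F))) refl (ρ 0F) (ρ 1F) (ρ 2F) (ρ 3F) (ρ 4F) (ρ 5F)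
    pairSum-class 0F 0F 1F = solve 6 (λ a b c d e f → con (+ 2) :* toSolver (a ∷ b ∷ c ∷ d ∷ e ∷ f ∷ []) (pairSum (lookup binary 0F) (parityClass 0F 1F)) := toSolver (a ∷ b ∷ c ∷ d ∷ e ∷ f ∷ []) (bind coordinate (classForm 0F 0F 1F))) refl (ρ 0F) (ρ 1F) (ρ 2F) (ρ 3F) (ρ 4F) (ρ 5F)
    pairSum-class 0F 1F 0F = solve 6 (λ a b c d e f → con (+ 2) :* toSolver (a ∷ b ∷ c ∷ d ∷ e ∷ f ∷ []) (pairSum (lookup binary 0F) (parityClass 1F 0F)) := toSolver (a ∷ b ∷ c ∷ d ∷ e ∷ f ∷ []) (bind coordinate (classForm 0F 1F 0F))) refl (ρ 0F) (ρ 1F) (ρ 2F) (ρ 3F) (ρ 4F) (ρ 5F)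
    pairSum-class 0F 1F 1F = solve 6 (λ a b c d e f → con (+ 2) :* toSolver (a ∷ b ∷ c ∷ d ∷ e ∷ f ∷ []) (pairSum (lookup binary 0F) (parityClass 1F 1F)) := toSolver (a ∷ b ∷ c ∷ d ∷ e ∷ f ∷ []) (bind coordinate (classForm 0F 1F 1F))) refl (ρ 0F) (ρ 1F) (ρ 2F) (ρ 3F) (ρ 4F) (ρ 5F)
    pairSum-class 1F 0F 0F = solve 6 (λ a b c d e f → con (+ 2) :* toSolver (a ∷ b ∷ c ∷ d ∷ e ∷ f ∷ []) (pairSum (lookup binary 1F) (parityClass 0F 0F)) := toSolver (a ∷ b ∷ c ∷ d ∷ e ∷ f ∷ []) (bind coordinate (classForm 1F 0F 0F))) refl (ρ 0F) (ρ 1F) (ρ 2F) (ρ 3F) (ρ 4F) (ρ 5F)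
    pairSum-class 1F 0F 1F = solve 6 (λ a b c d e f → con (+ 2) :* toSolver (a ∷ b ∷ c ∷ d ∷ e ∷ f ∷ []) (pairSum (lookup binary 1F) (parityClass 0F 1F)) := toSolver (a ∷ b ∷ c ∷ d ∷ e ∷ f ∷ []) (bind coordinate (classForm 1F 0F 1F))) refl (ρ 0F) (ρ 1F) (ρ 2F) (ρ 3F) (ρ 4F) (ρ 5F)
    pairSum-class 1F 1F 0F = solve 6 (λ a b c d e f → con (+ 2) :* toSolver (a ∷ b ∷ c ∷ d ∷ e ∷ f ∷ []) (pairSum (lookup binary 1F) (parityClass 1F 0F)) := toSolver (a ∷ b ∷ c ∷ d ∷ e ∷ f ∷ []) (bind coordinate (classForm 1F 1F 0F))) refl (ρ 0F) (ρ 1F) (ρ 2F) (ρ 3F) (ρ 4F) (ρ 5F)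
    pairSum-class 1F 1F 1F = solve 6 (λ a b c d e f → con (+ 2) :* toSolver (a ∷ b ∷ c ∷ d ∷ e ∷ f ∷ []) (pairSum (lookup binary 1F) (parityClass 1F 1F)) := toSolver (a ∷ b ∷ c ∷ d ∷ e ∷ f ∷ []) (bind coordinate (classForm 1F 1F 1F))) refl (ρ 0F) (ρ 1F) (ρ 2F) (ρ 3F) (ρ 4F) (ρ 5F)
    pairSum-class 2F 0F 0F = solve 6 (λ a b c d e f → con (+ 2) :* toSolver (a ∷ b ∷ c ∷ d ∷ e ∷ f ∷ []) (pairSum (lookup binary 2F) (parityClass 0F 0F)) := toSolver (a ∷ b ∷ c ∷ d ∷ e ∷ f ∷ []) (bind coordinate (classForm 2F 0F 0F))) refl (ρ 0F) (ρ 1F) (ρ 2F) (ρ 3F) (ρ 4F) (ρ 5F)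
    pairSum-class 2F 0F 1F = solve 6 (λ a b c d e f → con (+ 2) :* toSolver (a ∷ b ∷ c ∷ d ∷ e ∷ f ∷ []) (pairSum (lookup binary 2F) (parityClass 0F 1F)) := toSolver (a ∷ b ∷ c ∷ d ∷ e ∷ f ∷ []) (bind coordinate (classForm 2F 0F 1F))) refl (ρ 0F) (ρ 1F) (ρ 2F) (ρ 3F) (ρ 4F) (ρ 5F)
    pairSum-class 2F 1F 0F = solve 6 (λ a b c d e f → con (+ 2) :* toSolver (a ∷ b ∷ c ∷ d ∷ e ∷ f ∷ []) (pairSum (lookup binary 2F) (parityClass 1F 0F)) := toSolver (a ∷ b ∷ c ∷ d ∷ e ∷ f ∷ []) (bind coordinate (classForm 2F 1F 0F))) refl (ρ 0F) (ρ 1F) (ρ 2F) (ρ 3F) (ρ 4F) (ρ 5F)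
    pairSum-class 2F 1F 1F = solve 6 (λ a b c d e f → con (+ 2) :* toSolver (a ∷ b ∷ c ∷ d ∷ e ∷ f ∷ []) (pairSum (lookup binary 2F) (parityClass 1F 1F)) := toSolver (a ∷ b ∷ c ∷ d ∷ e ∷ f ∷ []) (bind coordinate (classForm 2F 1F 1F))) refl (ρ 0F) (ρ 1F) (ρ 2F) (ρ 3F) (ρ 4F) (ρ 5F)
    pairSum-class 3F 0F 0F = solve 6 (λ a b c d e f → con (+ 2) :* toSolver (a ∷ b ∷ c ∷ d ∷ e ∷ f ∷ []) (pairSum (lookup binary 3F) (parityClass 0F 0F)) := toSolver (a ∷ b ∷ c ∷ d ∷ e ∷ f ∷ []) (bind coordinate (classForm 3F 0F 0F))) refl (ρ 0F) (ρ 1F) (ρ 2F) (ρ 3F) (ρ 4F) (ρ 5F)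
    pairSum-class 3F 0F 1F = solve 6 (λ a b c d e f → con (+ 2) :* toSolver (a ∷ b ∷ c ∷ d ∷ e ∷ f ∷ []) (pairSum (lookup binary 3F) (parityClass 0F 1F)) := toSolver (a ∷ b ∷ c ∷ d ∷ e ∷ f ∷ []) (bind coordinate (classForm 3F 0F 1F))) refl (ρ 0F) (ρ 1F) (ρ 2F) (ρ 3F) (ρ 4F) (ρ 5F)
    pairSum-class 3F 1F 0F = solve 6 (λ a b c d e f → con (+ 2) :* toSolver (a ∷ b ∷ c ∷ d ∷ e ∷ f ∷ []) (pairSum (lookup binary 3F) (parityClass 1F 0F)) := toSolver (a ∷ b ∷ c ∷ d ∷ e ∷ f ∷ []) (bind coordinate (classForm 3F 1F 0F))) refl (ρ 0F) (ρ 1F) (ρ 2F) (ρ 3F) (ρ 4F) (ρ 5F)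
    pairSum-class 3F 1F 1F = solve 6 (λ a b c d e f → con (+ 2) :* toSolver (a ∷ b ∷ c ∷ d ∷ e ∷ f ∷ []) (pairSum (lookup binary 3F) (parityClass 1F 1F)) := toSolver (a ∷ b ∷ c ∷ d ∷ e ∷ f ∷ []) (bind coordinate (classForm 3F 1F 1F))) refl (ρ 0F) (ρ 1F) (ρ 2F) (ρ 3F) (ρ 4F) (ρ 5F)

    eval-∑ : ∀ {m t} {A : Set t} (τ : Vector Carrier m) (xs : List A) (f : A → Expr m) → eval τ (∑ᴱ xs f) ≡ ∑ xs (λ x → eval τ (f x))
    eval-∑ τ []       f = ≡.refl
    eval-∑ τ (x ∷ xs) f = cong (λ t → eval τ (f x) + t) (eval-∑ τ xs f)

    P-character : ∀ k l → P k (quaternary l) ≈ eval y (characterForm k l)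
    P-character k l = trans (pairSum-eval (lookup binary k) (quaternary l))
      (trans (pairSum-character k l) (reflexive (eval-bind ρ coordinate (characterForm k l))))

    P-class : ∀ k r c → fromℤ (+ 2) * P k (parityClass r c) ≈ eval y (classForm k r c)
    P-class k r c = trans (*-congˡ (pairSum-eval (lookup binary k) (parityClass r c)))
      (trans (pairSum-class k r c) (reflexive (eval-bind ρ coordinate (classForm k r c))))

    inPlane-eval : ∀ τ p e → eval τ (inPlane p e) ≈ eval (lookup (τ (Fin.combine {3} {2} p 0F) ∷ τ (Fin.combine {3} {2} p 1F) ∷ [])) e
    inPlane-eval τ 0F e = trans (reflexive (eval-bind τ _ e)) (eval-cong (λ { 0F → refl ; 1F → refl }) e)
    inPlane-eval τ 1F e = trans (reflexive (eval-bind τ _ e)) (eval-cong (λ { 0F → refl ; 1F → refl }) e)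
    inPlane-eval τ 2F e = trans (reflexive (eval-bind τ _ e)) (eval-cong (λ { 0F → refl ; 1F → refl }) e)

    private
      planeForm-square : ∀ k X Y → eval (lookup (X ∷ Y ∷ [])) (planeForm k ⊗ planeForm k)
                         ≈ eval (lookup (X * X * (X * X) + Y * Y * (Y * Y) ∷ X * X * (Y * Y) ∷ [])) (squareForm k)
      planeForm-square 0F = solve 2 (λ X Y → toSolver (X ∷ Y ∷ []) (planeForm 0F ⊗ planeForm 0F) := toSolver (X :* X :* (X :* X) :+ Y :* Y :* (Y :* Y) ∷ X :* X :* (Y :* Y) ∷ []) (squareForm 0F)) refl
      planeForm-square 1F = solve 2 (λ X Y → toSolver (X ∷ Y ∷ []) (planeForm 1F ⊗ planeForm 1F) := toSolver (X :* X :* (X :* X) :+ Y :* Y :* (Y :* Y) ∷ X :* X :* (Y :* Y) ∷ []) (squareForm 1F)) refl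
      planeForm-square 2F = solve 2 (λ X Y → toSolver (X ∷ Y ∷ []) (planeForm 2F ⊗ planeForm 2F) := toSolver (X :* X :* (X :* X) :+ Y :* Y :* (Y :* Y) ∷ X :* X :* (Y :* Y) ∷ []) (squareForm 2F)) refl
      planeForm-square 3F = λ X Y → zeroˡ _

    character-square : ∀ k l → eval y (characterForm k l) * eval y (characterForm k l) ≈ eval γ (squaredForm k l)
    character-square k 0F = trans (*-cong (inPlane-eval y 0F (planeForm k)) (inPlane-eval y 0F (planeForm k))) (trans (planeForm-square k (y 0F) (y 1F)) (sym (inPlane-eval γ 0F (squareForm k))))
    character-square k 1F = trans (*-cong (inPlane-eval y 1F (planeForm k)) (inPlane-eval y 1F (planeForm k))) (trans (planeForm-square k (y 2F) (y 3F)) (sym (inPlane-eval γ 1F (squareForm k))))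
    character-square k 2F = trans (*-cong (inPlane-eval y 2F (planeForm k)) (inPlane-eval y 2F (planeForm k))) (trans (planeForm-square k (y 4F) (y 5F)) (sym (inPlane-eval γ 2F (squareForm k))))
    character-square k 3F = zeroˡ _

    H : Fin 4 → Word 2 8 → ℤ
    H k = overPairs (replicate 4 (lookup binary k))

    L : Fin 4 → Word 4 8 → ℤ
    L l = overPairs (replicate 4 (quaternary l))

    𝒵-H-L : ∀ k l → 𝒵 (H k) (L l) ≈ eval γ (squaredForm k l ⊗ squaredForm k l)
    𝒵-H-L k l = begin
      𝒵 (H k) (L l)
        ≈⟨ 𝒵-overPairs (replicate 4 (lookup binary k)) (replicate 4 (quaternary l)) ⟩
      p * (p * (p * (p * 1#)))
        ≈⟨ trans (*-congˡ (*-congˡ (*-congˡ (*-identityʳ p)))) (solve 1 (λ p → p :* (p :* (p :* p)) := p :* p :* (p :* p)) refl p) ⟩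
      p * p * (p * p)
        ≈⟨ *-cong p² p² ⟩
      eval γ (squaredForm k l ⊗ squaredForm k l) ∎
      where
      p : Carrier
      p = P k (quaternary l)
      p² : p * p ≈ eval γ (squaredForm k l)
      p² = trans (*-cong (P-character k l) (P-character k l)) (character-square k l)

    ∑-map₂ : ∀ {a b c} {A : Set a} {B : Set b} {C : Set c} (f : B → C) (g : A → B) xs (F : C → Carrier) →
             ∑ (List.map f (List.map g xs)) F ≈ ∑ xs (λ x → F (f (g x)))
    ∑-map₂ f g xs F = reflexive (≡.trans (∑-map f (List.map g xs) F) (∑-map g xs (λ b → F (f b))))

    module _ (F : Fin 2 → Fin 2 → Carrier) where
      typeProduct : Vec (Fin 2 × Fin 2) 4 → Carrier
      typeProduct ((r , c) ∷ (r′ , c′) ∷ (r″ , c″) ∷ (r‴ , c‴) ∷ []) = F r c * (F r′ c′ * (F r″ c″ * F r‴ c‴))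

      typeSum : Carrier
      typeSum = ∑ Q₈-types typeProduct

    typeSumᴱ : Expr 4
    typeSumᴱ = ∑ᴱ Q₈-types λ { ((r , c) ∷ (r′ , c′) ∷ (r″ , c″) ∷ (r‴ , c‴) ∷ []) → F r c ⊗ (F r′ c′ ⊗ (F r″ c″ ⊗ F r‴ c‴)) }
      where
      F : Fin 2 → Fin 2 → Expr 4
      F r c = letter (Fin.combine {2} {2} r c)

    private
      -- Each product has four factors, whence 2⁴.
      16-typeSum : ∀ F → fromℤ (+ 16) * typeSum F ≈ typeSum (λ r c → fromℤ (+ 2) * F r c)
      16-typeSum F = solve 4 (λ α β ε δ → con (+ 16) :* toSolver (α ∷ β ∷ ε ∷ δ ∷ []) typeSumᴱ
          := toSolver (con (+ 2) :* α ∷ con (+ 2) :* β ∷ con (+ 2) :* ε ∷ con (+ 2) :* δ ∷ []) typeSumᴱ) refl (F 0F 0F) (F 0F 1F) (F 1F 0F) (F 1F 1F)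

      typeSum-cong : ∀ {F F′} → (∀ r c → F r c ≈ F′ r c) → typeSum F ≈ typeSum F′
      typeSum-cong {F} {F′} h = ∑-cong Q₈-types {typeProduct F} {typeProduct F′} λ { ((r , c) ∷ (r′ , c′) ∷ (r″ , c″) ∷ (r‴ , c‴) ∷ []) → *-cong (h r c) (*-cong (h r′ c′) (*-cong (h r″ c″) (h r‴ c‴))) }

      typeValue : Carrier → Carrier → Carrier → Fin 2 → Fin 2 → Carrier
      typeValue x y z 0F 0F = x + y
      typeValue x y z 0F 1F = x + fromℤ -1ℤ * y
      typeValue x y z 1F _  = z

      -- The all-even types give (x + y)⁴ + (x - y)⁴, the all-odd ones 2z⁴, and each of the twelve
      -- mixed ones (x + y)(x - y) z²; hence the minus sign at y² z².
      typeSum-value : ∀ x y z → typeSum (typeValue x y z)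
        ≈ fromℤ (+ 2) * (x * x * (x * x) + y * y * (y * y) + z * z * (z * z) + fromℤ (+ 6) * (x * x * (y * y) + x * x * (z * z) + fromℤ -1ℤ * (y * y * (z * z))))
      typeSum-value = solve 3 (λ x y z → toSolver (x :+ y ∷ x :+ con -1ℤ :* y ∷ z ∷ z ∷ []) typeSumᴱ
        := con (+ 2) :* (x :* x :* (x :* x) :+ y :* y :* (y :* y) :+ z :* z :* (z :* z) :+ con (+ 6) :* (x :* x :* (y :* y) :+ x :* x :* (z :* z) :+ con -1ℤ :* (y :* y :* (z :* z))))) refl

      reduced-forms : ∀ l → eval y (pairingOf l) ≈ eval γ (reducedPairing l)
      reduced-forms 0F = refl
      reduced-forms 1F = refl
      reduced-forms 2F = refl
      reduced-forms 3F = refl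
      reduced-forms 4F = refl
      reduced-forms 5F = refl

      form : Expr 6 → Expr 6
      form = bind reducedPairing

      basisExpr-form : ∀ k → eval y (basisExpr k) ≈ eval γ (form (basisForm k))
      basisExpr-form k = trans (reflexive (eval-bind y pairingOf (basisForm k)))
        (trans (eval-cong reduced-forms (basisForm k)) (reflexive (≡.sym (eval-bind γ reducedPairing (basisForm k)))))

      ∑-Q-form : ∑ (List.allFin 4) (λ k → eval γ (Q-form k)) ≈ fromℤ (+ 2) * eval γ (form W)
      ∑-Q-form = solve 6 (λ a b c d e f → toSolver (a ∷ b ∷ c ∷ d ∷ e ∷ f ∷ []) (∑ᴱ (List.allFin 4) Q-form) := con (+ 2) :* toSolver (a ∷ b ∷ c ∷ d ∷ e ∷ f ∷ []) (form W)) refl (γ 0F) (γ 1F) (γ 2F) (γ 3F) (γ 4F) (γ 5F)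

      ∑-K-form : ∑ (List.allFin 4) (λ k → eval γ (K-form k)) ≈ fromℤ (+ 2) * eval γ (form ΣN)
      ∑-K-form = solve 6 (λ a b c d e f → toSolver (a ∷ b ∷ c ∷ d ∷ e ∷ f ∷ []) (∑ᴱ (List.allFin 4) K-form) := con (+ 2) :* toSolver (a ∷ b ∷ c ∷ d ∷ e ∷ f ∷ []) (form ΣN)) refl (γ 0F) (γ 1F) (γ 2F) (γ 3F) (γ 4F) (γ 5F)

      ∑-L-form² : ∑ (List.allFin 4) (λ l → eval γ (L-form l) * eval γ (L-form l)) ≈ fromℤ (+ 2) * (fromℤ (+ 2) * eval γ (form (basisForm 3F)))
      ∑-L-form² = solve 6 (λ a b c d e f → toSolver (a ∷ b ∷ c ∷ d ∷ e ∷ f ∷ []) (∑ᴱ (List.allFin 4) λ l → L-form l ⊗ L-form l) := con (+ 2) :* (con (+ 2) :* toSolver (a ∷ b ∷ c ∷ d ∷ e ∷ f ∷ []) (form (basisForm 3F)))) refl (γ 0F) (γ 1F) (γ 2F) (γ 3F) (γ 4F) (γ 5F)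

      -- The factor 3 clears the denominators that appear when this sum is written in the pairings.
      ∑-Q-form² : fromℤ (+ 3) * ∑ (List.allFin 4) (λ k → eval γ (Q-form k) * eval γ (Q-form k)) ≈ fromℤ (+ 2) * eval γ (form (basisForm 4F))
      ∑-Q-form² = solve 6 (λ a b c d e f → con (+ 3) :* toSolver (a ∷ b ∷ c ∷ d ∷ e ∷ f ∷ []) (∑ᴱ (List.allFin 4) λ k → Q-form k ⊗ Q-form k) := con (+ 2) :* toSolver (a ∷ b ∷ c ∷ d ∷ e ∷ f ∷ []) (form (basisForm 4F))) refl (γ 0F) (γ 1F) (γ 2F) (γ 3F) (γ 4F) (γ 5F)

      ∑-Q-K-form : fromℤ (+ 12) * ∑ (List.allFin 4) (λ k → eval γ (Q-form k) * eval γ (K-form k)) ≈ fromℤ (+ 2) * eval γ (form (basisForm 5F))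
      ∑-Q-K-form = solve 6 (λ a b c d e f → con (+ 12) :* toSolver (a ∷ b ∷ c ∷ d ∷ e ∷ f ∷ []) (∑ᴱ (List.allFin 4) λ k → Q-form k ⊗ K-form k) := con (+ 2) :* toSolver (a ∷ b ∷ c ∷ d ∷ e ∷ f ∷ []) (form (basisForm 5F))) refl (γ 0F) (γ 1F) (γ 2F) (γ 3F) (γ 4F) (γ 5F)

      scale-products : ∀ k l {f g f̂ ĝ : Fin 4 → Carrier} → (∀ i → fromℤ k * f i ≈ f̂ i) → (∀ i → fromℤ l * g i ≈ ĝ i) →
                       fromℤ k * fromℤ l * ∑ (List.allFin 4) (λ i → f i * g i) ≈ ∑ (List.allFin 4) (λ i → f̂ i * ĝ i)
      scale-products k l {f} {g} {f̂} {ĝ} h h′ = trans (sym (∑-*ˡ (List.allFin 4) (fromℤ k * fromℤ l) (λ i → f i * g i)))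
        (∑-cong (List.allFin 4) λ i → trans (solve 4 (λ a b x y → a :* b :* (x :* y) := a :* x :* (b :* y)) refl (fromℤ k) (fromℤ l) (f i) (g i)) (*-cong (h i) (h′ i)))

      scale-sum : ∀ k {f f̂ : Fin 4 → Carrier} → (∀ i → fromℤ k * f i ≈ f̂ i) → fromℤ k * ∑ (List.allFin 4) f ≈ ∑ (List.allFin 4) f̂
      scale-sum k {f} h = trans (sym (∑-*ˡ (List.allFin 4) (fromℤ k) f)) (∑-cong (List.allFin 4) h)

    -- The indicator functions are variables known only by their decompositions, so that no
    -- membership is decided while the identities are checked.
    module _
      (𝟙E : Word 2 8 → ℤ) (E-binaries : ∀ u → + 2 ℤ.* 𝟙E u ≡ sumℤ (List.map (λ φ → φ u) (List.map overPairs (binaries 4))))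
      (𝟙D : Word 2 16 → ℤ) (D-binaries : ∀ u → + 2 ℤ.* 𝟙D u ≡ sumℤ (List.map (λ φ → φ u) (List.map overPairs (binaries 8))))
      (𝟙Q : Word 4 8 → ℤ) (Q-classes : ∀ v → 1ℤ ℤ.* 𝟙Q v ≡ sumℤ (List.map (λ φ → φ v) (List.map overPairs Q₈-classes)))
      (𝟙K : Word 4 8 → ℤ) (K-quaternaries : ∀ v → + 2 ℤ.* 𝟙K v ≡ sumℤ (List.map (λ φ → φ v) (List.map overPairs (quaternaries 4))))
      (𝟙K₁₆ : Word 4 16 → ℤ) (K₁₆-quaternaries : ∀ v → + 2 ℤ.* 𝟙K₁₆ v ≡ sumℤ (List.map (λ φ → φ v) (List.map overPairs (quaternaries 8))))
      (𝟙EE : Word 2 16 → ℤ) (EE-splits : ∀ (u u′ : Word 2 8) → 𝟙EE (u Vec.++ u′) ≡ 𝟙E u ℤ.* 𝟙E u′)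
      (𝟙QQ : Word 4 16 → ℤ) (QQ-splits : ∀ (v v′ : Word 4 8) → 𝟙QQ (v Vec.++ v′) ≡ 𝟙Q v ℤ.* 𝟙Q v′)
      (𝟙QK : Word 4 16 → ℤ) (QK-splits : ∀ (v v′ : Word 4 8) → 𝟙QK (v Vec.++ v′) ≡ 𝟙Q v ℤ.* 𝟙K v′) where

      enumerators : Vec Carrier 6
      enumerators = 𝒵 𝟙E 𝟙Q * 𝒵 𝟙E 𝟙Q ∷ 𝒵 𝟙E 𝟙K * 𝒵 𝟙E 𝟙K ∷ 𝒵 𝟙EE 𝟙QK ∷ 𝒵 𝟙EE 𝟙K₁₆ ∷ 𝒵 𝟙D 𝟙QQ ∷ 𝒵 𝟙D 𝟙QK ∷ []

      private
        -- The factor 2⁴ clears the halves in the four parity classes of every type; the 2 in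
        -- `typeSum-value` cancels against it and leaves 8.
        8Q : ∀ k → fromℤ (+ 8) * 𝒵 (H k) 𝟙Q ≈ eval γ (Q-form k)
        8Q k = two-cancel (begin
          fromℤ (+ 2) * (fromℤ (+ 8) * 𝒵 (H k) 𝟙Q)
            ≈⟨ solve 1 (λ q → con (+ 2) :* (con (+ 8) :* q) := con (+ 16) :* (con 1ℤ :* q)) refl (𝒵 (H k) 𝟙Q) ⟩
          fromℤ (+ 16) * (fromℤ 1ℤ * 𝒵 (H k) 𝟙Q)
            ≈⟨ *-congˡ (trans (𝒵-sumʳ 1ℤ (H k) 𝟙Q (List.map overPairs Q₈-classes) Q-classes) (trans (∑-map₂ overPairs (Vec.map λ (r , c) → parityClass r c) Q₈-types (𝒵 (H k))) (∑-cong Q₈-types products))) ⟩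
          fromℤ (+ 16) * typeSum (λ r c → P k (parityClass r c))
            ≈⟨ trans (16-typeSum (λ r c → P k (parityClass r c))) (typeSum-cong {λ r c → fromℤ (+ 2) * P k (parityClass r c)} {typeValue x y′ z} λ { 0F 0F → P-class k 0F 0F ; 0F 1F → P-class k 0F 1F ; 1F 0F → P-class k 1F 0F ; 1F 1F → P-class k 1F 1F }) ⟩
          typeSum (typeValue x y′ z)
            ≈⟨ typeSum-value x y′ z ⟩
          fromℤ (+ 2) * (x * x * (x * x) + y′ * y′ * (y′ * y′) + z * z * (z * z) + fromℤ (+ 6) * (x * x * (y′ * y′) + x * x * (z * z) + fromℤ -1ℤ * (y′ * y′ * (z * z))))
            ≈⟨ *-congˡ (+-cong (+-cong (+-cong (*-cong x² x²) (*-cong y² y²)) (*-cong z² z²)) (*-congˡ (+-cong (+-cong (*-cong x² y²) (*-cong x² z²)) (*-congˡ (*-cong y² z²))))) ⟩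
          fromℤ (+ 2) * eval γ (Q-form k) ∎)
          where
          x y′ z : Carrier
          x  = eval y (characterForm k 0F)
          y′ = eval y (characterForm k 1F)
          z  = eval y (characterForm k 2F)
          x² : x * x ≈ eval γ (squaredForm k 0F)
          x² = character-square k 0F
          y² : y′ * y′ ≈ eval γ (squaredForm k 1F)
          y² = character-square k 1F
          z² : z * z ≈ eval γ (squaredForm k 2F)
          z² = character-square k 2F
          products : ∀ t → 𝒵 (H k) (overPairs (Vec.map (λ (r , c) → parityClass r c) t)) ≈ typeProduct (λ r c → P k (parityClass r c)) t
          products ((r , c) ∷ (r′ , c′) ∷ (r″ , c″) ∷ (r‴ , c‴) ∷ []) = trans
            (𝒵-overPairs (replicate 4 (lookup binary k)) (parityClass r c ∷ parityClass r′ c′ ∷ parityClass r″ c″ ∷ parityClass r‴ c‴ ∷ []))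
            (*-congˡ (*-congˡ (*-congˡ (*-identityʳ _))))

        2K : ∀ k → fromℤ (+ 2) * 𝒵 (H k) 𝟙K ≈ eval γ (K-form k)
        2K k = trans (𝒵-sumʳ (+ 2) (H k) 𝟙K (List.map overPairs (quaternaries 4)) K-quaternaries)
          (trans (∑-map₂ overPairs (λ l → replicate 4 (quaternary l)) (List.allFin 4) (𝒵 (H k))) (trans (∑-cong (List.allFin 4) λ l → 𝒵-H-L k l)
            (reflexive (≡.sym (eval-∑ γ (List.allFin 4) λ l → squaredForm k l ⊗ squaredForm k l)))))

        2L : ∀ l → fromℤ (+ 2) * 𝒵 𝟙E (L l) ≈ eval γ (L-form l)
        2L l = trans (𝒵-sumˡ (+ 2) 𝟙E (List.map overPairs (binaries 4)) (L l) E-binaries)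
          (trans (∑-map₂ overPairs (λ k → replicate 4 (lookup binary k)) (List.allFin 4) (λ φ → 𝒵 φ (L l))) (trans (∑-cong (List.allFin 4) λ k → 𝒵-H-L k l)
            (reflexive (≡.sym (eval-∑ γ (List.allFin 4) λ k → squaredForm k l ⊗ squaredForm k l)))))

        2E : ∀ ψ → fromℤ (+ 2) * 𝒵 𝟙E ψ ≈ ∑ (List.allFin 4) (λ k → 𝒵 (H k) ψ)
        2E ψ = trans (𝒵-sumˡ (+ 2) 𝟙E (List.map overPairs (binaries 4)) ψ E-binaries) (∑-map₂ overPairs (λ k → replicate 4 (lookup binary k)) (List.allFin 4) (λ φ → 𝒵 φ ψ))

        swap-scalars : ∀ k l x → fromℤ k * (fromℤ l * x) ≈ fromℤ l * (fromℤ k * x)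
        swap-scalars k l x = solve 3 (λ k l x → k :* (l :* x) := l :* (k :* x)) refl (fromℤ k) (fromℤ l) x

        8EQ : fromℤ (+ 8) * 𝒵 𝟙E 𝟙Q ≈ eval γ (form W)
        8EQ = two-cancel (trans (swap-scalars (+ 2) (+ 8) (𝒵 𝟙E 𝟙Q)) (trans (*-congˡ (2E 𝟙Q)) (trans (scale-sum (+ 8) {λ k → 𝒵 (H k) 𝟙Q} {λ k → eval γ (Q-form k)} 8Q) ∑-Q-form)))

        2EK : fromℤ (+ 2) * 𝒵 𝟙E 𝟙K ≈ eval γ (form ΣN)
        2EK = two-cancel (trans (*-congˡ (2E 𝟙K)) (trans (scale-sum (+ 2) {λ k → 𝒵 (H k) 𝟙K} {λ k → eval γ (K-form k)} 2K) ∑-K-form))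

        product-rule : ∀ k l {x y′ x̂ ŷ} → fromℤ k * x ≈ x̂ → fromℤ l * y′ ≈ ŷ → fromℤ (k ℤ.* l) * (x * y′) ≈ x̂ * ŷ
        product-rule k l {x} {y′} h h′ = trans (*-congʳ (fromℤ-* k l))
          (trans (solve 4 (λ a b x y → a :* b :* (x :* y) := a :* x :* (b :* y)) refl (fromℤ k) (fromℤ l) x y′) (*-cong h h′))

        -- A product over eight pairs splits into the same product over each half. So `D₁₆` against
        -- a function that factors over the halves becomes a sum over the binary tables of products
        -- of enumerators of length 8.
        2D : ∀ {Ψ : Word 4 16 → ℤ} ψ ψ′ → (∀ (v v′ : Word 4 8) → Ψ (v Vec.++ v′) ≡ ψ v ℤ.* ψ′ v′) →
             fromℤ (+ 2) * 𝒵 𝟙D Ψ ≈ ∑ (List.allFin 4) (λ k → 𝒵 (H k) ψ * 𝒵 (H k) ψ′)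
        2D {Ψ} ψ ψ′ h = trans (𝒵-sumˡ (+ 2) 𝟙D (List.map overPairs (binaries 8)) Ψ D-binaries)
          (trans (∑-map₂ overPairs (λ k → replicate 8 (lookup binary k)) (List.allFin 4) (λ φ → 𝒵 φ Ψ))
            (∑-cong (List.allFin 4) λ k → 𝒵-++ {k = 8} {l = 8} {overPairs (replicate 8 (lookup binary k))} {Ψ} (H k) (H k) ψ ψ′ (overPairs-halves (lookup binary k)) h))

        -- The same splitting with the sides exchanged: the characters run through `K₁₆`, and
        -- `E₈ ⊕ E₈` factors.
        2K₁₆ : fromℤ (+ 2) * 𝒵 𝟙EE 𝟙K₁₆ ≈ ∑ (List.allFin 4) (λ l → 𝒵 𝟙E (L l) * 𝒵 𝟙E (L l))
        2K₁₆ = trans (𝒵-sumʳ (+ 2) 𝟙EE 𝟙K₁₆ (List.map overPairs (quaternaries 8)) K₁₆-quaternaries)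
          (trans (∑-map₂ overPairs (λ l → replicate 8 (quaternary l)) (List.allFin 4) (𝒵 𝟙EE))
            (∑-cong (List.allFin 4) λ l → 𝒵-++ {k = 8} {l = 8} {𝟙EE} {overPairs (replicate 8 (quaternary l))} 𝟙E 𝟙E (L l) (L l) EE-splits (overPairs-halves (quaternary l))))

      enumerator-forms : ∀ k → fromℤ (+ lookup denominators k) * lookup enumerators k ≈ eval γ (form (basisForm k))
      enumerator-forms 0F = product-rule (+ 8) (+ 8) 8EQ 8EQ
      enumerator-forms 1F = product-rule (+ 2) (+ 2) 2EK 2EK
      enumerator-forms 2F = trans (*-congˡ (𝒵-++ {k = 8} {l = 8} {𝟙EE} {𝟙QK} 𝟙E 𝟙E 𝟙Q 𝟙K EE-splits QK-splits)) (product-rule (+ 8) (+ 2) 8EQ 2EK)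
      enumerator-forms 3F = two-cancel (two-cancel (trans (sym (*-assoc _ _ _)) (trans (*-congˡ 2K₁₆) (trans (scale-products (+ 2) (+ 2) {λ l → 𝒵 𝟙E (L l)} {λ l → 𝒵 𝟙E (L l)} {λ l → eval γ (L-form l)} {λ l → eval γ (L-form l)} 2L 2L) ∑-L-form²))))
      enumerator-forms 4F = two-cancel (begin
        fromℤ (+ 2) * (fromℤ (+ 192) * p)                          ≈⟨ solve 1 (λ p → con (+ 2) :* (con (+ 192) :* p) := con (+ 3) :* (con (+ 8) :* con (+ 8) :* (con (+ 2) :* p))) refl p ⟩
        fromℤ (+ 3) * (fromℤ (+ 8) * fromℤ (+ 8) * (fromℤ (+ 2) * p)) ≈⟨ *-congˡ (trans (*-congˡ (2D {𝟙QQ} 𝟙Q 𝟙Q QQ-splits)) (scale-products (+ 8) (+ 8) {λ k → 𝒵 (H k) 𝟙Q} {λ k → 𝒵 (H k) 𝟙Q} {λ k → eval γ (Q-form k)} {λ k → eval γ (Q-form k)} 8Q 8Q)) ⟩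
        fromℤ (+ 3) * ∑ (List.allFin 4) (λ k → eval γ (Q-form k) * eval γ (Q-form k)) ≈⟨ ∑-Q-form² ⟩
        fromℤ (+ 2) * eval γ (form (basisForm 4F))                 ∎)
        where
        p : Carrier
        p = 𝒵 𝟙D 𝟙QQ
      enumerator-forms 5F = two-cancel (begin
        fromℤ (+ 2) * (fromℤ (+ 192) * p)                          ≈⟨ solve 1 (λ p → con (+ 2) :* (con (+ 192) :* p) := con (+ 12) :* (con (+ 8) :* con (+ 2) :* (con (+ 2) :* p))) refl p ⟩
        fromℤ (+ 12) * (fromℤ (+ 8) * fromℤ (+ 2) * (fromℤ (+ 2) * p)) ≈⟨ *-congˡ (trans (*-congˡ (2D {𝟙QK} 𝟙Q 𝟙K QK-splits)) (scale-products (+ 8) (+ 2) {λ k → 𝒵 (H k) 𝟙Q} {λ k → 𝒵 (H k) 𝟙K} {λ k → eval γ (Q-form k)} {λ k → eval γ (K-form k)} 8Q 2K)) ⟩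
        fromℤ (+ 12) * ∑ (List.allFin 4) (λ k → eval γ (Q-form k) * eval γ (K-form k)) ≈⟨ ∑-Q-K-form ⟩
        fromℤ (+ 2) * eval γ (form (basisForm 5F))                 ∎)
        where
        p : Carrier
        p = 𝒵 𝟙D 𝟙QK

      enumerators-basisExpr : ∀ k → fromℤ (+ lookup denominators k) * lookup enumerators k ≈ eval y (basisExpr k)
      enumerators-basisExpr k = trans (enumerator-forms k) (sym (basisExpr-form k))

-- Weight enumerators of the codes and matrices of the generators

module EnumeratorFormulas where

  open RingBasics
  open PolynomialRings
  open MatrixActions
  open CyclotomicNumbers
  open GeneratorMatrices
  open BlockCoordinates
  open ExponentOrbits
  open OrbitCertificate
  open OrbitSpanning
  open PairingForms
  open SignedPermutations
  open FormPolynomials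
  open PairFunctions
  open SumsOverWords
  open CodeTests using (indicator)

  open CodeIndicators using (𝟙; 𝟙-E₈; 𝟙-D₁₆; 𝟙-Q₈; 𝟙-K₈; 𝟙-⊕)
  open IndicatorK₁₆ using (𝟙-K₁₆)
  open WeightForms

  open Defs using (Word; words; LinearCode; codewords; exponents; E₈; Q₈; K₈; D₁₆; K₁₆; _⊕_)

  exponents-∷ : ∀ {n} i j (u : Word 2 n) v → exponents (i ∷ u) (j ∷ v) ≡ zipWith ℕ._+_ (replicate 6 0 Vec.[ letterClass i j ]≔ 1) (exponents u v)
  exponents-∷ 0F 0F u v = ≡.refl
  exponents-∷ 0F 1F u v = ≡.refl
  exponents-∷ 0F 2F u v = ≡.refl
  exponents-∷ 0F 3F u v = ≡.refl
  exponents-∷ 1F 0F u v = ≡.refl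
  exponents-∷ 1F 1F u v = ≡.refl
  exponents-∷ 1F 2F u v = ≡.refl
  exponents-∷ 1F 3F u v = ≡.refl

  module WeightEnumerators {r ℓ} (R : CommutativeRing r ℓ)
    (ζ half : CommutativeRing.Carrier R) (ζ⁴≈-1 : RingBasics.FourthPowerIs-1 R ζ) (half+half≈1 : RingBasics.IsHalf R half) where
    open CommutativeRing R hiding (zero)

    open Integers R using (fromℤ; fromℤ-1; fromℤ-neg)
    open CyclotomicEvaluation R ζ half ζ⁴≈-1 half+half≈1
    open Symmetry R ζ half ζ⁴≈-1 half+half≈1
    open BasisPolynomials R ζ half ζ⁴≈-1 half+half≈1 using (basisPolynomial; constant-fromℤ; •-eval; •-var; linear-row)
    open Defs.Polynomials R 6
    open Defs.Matrices R 6
    open PolynomialAlgebra R 6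
    open MatrixAction R 6
    open Algebra.Properties.Semiring.Exp semiring using (_^_)
    private
      module 𝓟 = CommutativeRing polynomialRing
      module I𝓟 = Integers polynomialRing
    open Evaluation polynomialRing
    open Summation polynomialRing
    open WordSums polynomialRing (λ i j → var (letterClass i j))

    opaque
      enumerator : ∀ {n} → LinearCode 2 n → LinearCode 4 n → Polynomial
      enumerator C D = List.cartesianProductWith (λ u v → 1# , exponents u v) (codewords C) (codewords D)

    private
      monomial : ∀ {n} → Word 2 n → Word 4 n → Polynomial
      monomial u v = (1# , exponents u v) ∷ []

      monomial-wordProduct : ∀ {n} (u : Word 2 n) v → monomial u v ≋ wordProduct u v
      monomial-wordProduct []      []      = 𝓟.refl
      monomial-wordProduct (i ∷ u) (j ∷ v) = 𝓟.trans
        (ext λ f → trans (⟪⟫-monomial f 1# (exponents (i ∷ u) (j ∷ v))) (trans (*-cong (sym (*-identityʳ 1#)) (reflexive (cong f (exponents-∷ i j u v))))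
          (sym (⟪⟫-monomial f (1# * 1#) (zipWith ℕ._+_ (unit (letterClass i j)) (exponents u v))))))
        (𝓟.*-congˡ {var (letterClass i j)} (monomial-wordProduct u v))

      terms-∑ : ∀ {t} {A : Set t} (g : A → Carrier × Vec ℕ 6) xs → List.map g xs ≋ ∑ xs (λ x → g x ∷ [])
      terms-∑ g []       = 𝓟.refl
      terms-∑ g (x ∷ xs) = 𝓟.+-congˡ {g x ∷ []} (terms-∑ g xs)

      cartesian-∑ : ∀ {s t} {A : Set s} {B : Set t} (g : A → B → Carrier × Vec ℕ 6) xs ys →
                    List.cartesianProductWith g xs ys ≋ ∑ xs (λ x → ∑ ys λ y → g x y ∷ [])
      cartesian-∑ g []       ys = 𝓟.refl
      cartesian-∑ g (x ∷ xs) ys = 𝓟.+-cong (terms-∑ (g x) ys) (cartesian-∑ g xs ys)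

      indicator-[] : ∀ {p} {P : Set p} (d : Dec P) q → [ does d ]· q ≋ I𝓟.fromℤ (indicator d) *ᴾ q
      indicator-[] (yes _) q = 𝓟.trans (𝓟.sym (𝓟.*-identityˡ q)) (𝓟.*-congʳ {q} (𝓟.sym I𝓟.fromℤ-1))
      indicator-[] (no _)  q = 𝓟.sym (𝓟.zeroˡ q)

      HasDegree-cartesian : ∀ {n} (us : List (Word 2 n)) vs → HasDegree n (List.cartesianProductWith (λ u v → 1# , exponents u v) us vs)
      HasDegree-cartesian []       vs = []
      HasDegree-cartesian (u ∷ us) vs = All.++⁺ (All.map⁺ (All.universal (sum-exponents u) vs)) (HasDegree-cartesian us vs)
        where
        sum-exponents : ∀ {n} (u : Word 2 n) v → Vec.sum (exponents u v) ≡ n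
        sum-exponents []      []      = ≡.refl
        sum-exponents (i ∷ u) (j ∷ v) = ≡.trans (cong Vec.sum (exponents-∷ i j u v))
          (≡.trans (sum-+ (unit (letterClass i j)) (exponents u v)) (cong₂ ℕ._+_ (sum-unit (letterClass i j)) (sum-exponents u v)))

    opaque
      unfolding 𝒵 enumerator

      enumerator-≡ : ∀ {n} (C : LinearCode 2 n) D → enumerator C D ≡ List.cartesianProductWith (λ u v → 1# , exponents u v) (codewords C) (codewords D)
      enumerator-≡ C D = ≡.refl

      HasDegree-enumerator : ∀ {n} (C : LinearCode 2 n) D → HasDegree n (enumerator C D)
      HasDegree-enumerator C D = HasDegree-cartesian (codewords C) (codewords D)

      -- Filtering by membership amounts to weighting all words by the indicator function.
      enumerator-𝒵 : ∀ {n} (C : LinearCode 2 n) D → enumerator C D ≋ 𝒵 (𝟙 C) (𝟙 D)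
      enumerator-𝒵 {n} C D = begin
        enumerator C D
          ≈⟨ cartesian-∑ (λ u v → 1# , exponents u v) (codewords C) (codewords D) ⟩
        ∑ (codewords C) (λ u → ∑ (codewords D) (monomial u))
          ≈⟨ ∑-filter (LinearCode.member? C) (words n) _ ⟩
        ∑ (words n) (λ u → [ does (LinearCode.member? C u) ]· ∑ (codewords D) (monomial u))
          ≈⟨ ∑-cong (words n) (λ u → 𝓟.trans (indicator-[] (LinearCode.member? C u) _) (𝓟.trans (𝓟.*-congˡ {I𝓟.fromℤ (𝟙 C u)} (𝓟.trans (∑-filter (LinearCode.member? D) (words n) (monomial u))
               (∑-cong (words n) λ v → 𝓟.trans (indicator-[] (LinearCode.member? D v) (monomial u v)) (𝓟.*-congˡ {I𝓟.fromℤ (𝟙 D v)} (monomial-wordProduct u v)))))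
               (𝓟.sym (∑-*ˡ (words n) (I𝓟.fromℤ (𝟙 C u)) (λ v → I𝓟.fromℤ (𝟙 D v) *ᴾ wordProduct u v))))) ⟩
        ∑ (words n) (λ u → ∑ (words n) λ v → I𝓟.fromℤ (𝟙 C u) *ᴾ (I𝓟.fromℤ (𝟙 D v) *ᴾ wordProduct u v)) ∎
        where open Relation.Binary.Reasoning.Setoid 𝓟.setoid

    Enumerator : Set _
    Enumerator = ∀ {n} → LinearCode 2 n → LinearCode 4 n → Polynomial

    -- Abstract in the enumerator and in the squaring, so that the list of the theorem is compared
    -- with `codeEnumerators` by congruence, with no enumerator expanded.
    sixCodes : Enumerator → (Polynomial → Polynomial) → Vec Polynomial 6
    sixCodes w square = square (w E₈ Q₈) ∷ square (w E₈ K₈) ∷ w (E₈ ⊕ E₈) (Q₈ ⊕ K₈) ∷ w (E₈ ⊕ E₈) K₁₆ ∷ w D₁₆ (Q₈ ⊕ Q₈) ∷ w D₁₆ (Q₈ ⊕ K₈) ∷ []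

    sixCodes-cong : ∀ {w w′ : Enumerator} {square square′} → (∀ {n} (C : LinearCode 2 n) D → w C D ≡ w′ C D) → (∀ p → square p ≡ square′ p) →
                    sixCodes w square ≡ sixCodes w′ square′
    sixCodes-cong {w} {w′} {square} {square′} h h′ =
      cong₂ _∷_ (squares E₈ Q₈) (cong₂ _∷_ (squares E₈ K₈) (cong₂ _∷_ (h (E₈ ⊕ E₈) (Q₈ ⊕ K₈)) (cong₂ _∷_ (h (E₈ ⊕ E₈) K₁₆)
        (cong₂ _∷_ (h D₁₆ (Q₈ ⊕ Q₈)) (cong₂ _∷_ (h D₁₆ (Q₈ ⊕ K₈)) ≡.refl)))))
      where
      squares : ∀ {n} (C : LinearCode 2 n) D → square (w C D) ≡ square′ (w′ C D)
      squares C D = ≡.trans (cong square (h C D)) (h′ (w′ C D))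

    codeEnumerators : Vec Polynomial 6
    codeEnumerators = sixCodes enumerator λ p → p *ᴾ p

    codeEnumerators-homogeneous : ∀ k → Homogeneous 16 (lookup codeEnumerators k)
    codeEnumerators-homogeneous 0F = HasDegree⇒Homogeneous (HasDegree-* (HasDegree-enumerator E₈ Q₈) (HasDegree-enumerator E₈ Q₈))
    codeEnumerators-homogeneous 1F = HasDegree⇒Homogeneous (HasDegree-* (HasDegree-enumerator E₈ K₈) (HasDegree-enumerator E₈ K₈))
    codeEnumerators-homogeneous 2F = HasDegree⇒Homogeneous (HasDegree-enumerator (E₈ ⊕ E₈) (Q₈ ⊕ K₈))
    codeEnumerators-homogeneous 3F = HasDegree⇒Homogeneous (HasDegree-enumerator (E₈ ⊕ E₈) K₁₆)
    codeEnumerators-homogeneous 4F = HasDegree⇒Homogeneous (HasDegree-enumerator D₁₆ (Q₈ ⊕ Q₈))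
    codeEnumerators-homogeneous 5F = HasDegree⇒Homogeneous (HasDegree-enumerator D₁₆ (Q₈ ⊕ K₈))

    private
      half+half≋1 : constant half +ᴾ constant half ≋ constant 1#
      half+half≋1 = 𝓟.trans (𝓟.sym (constant-+ half half)) (constant-cong half+half≈1)

    open WeightIdentities polynomialRing (constant half) half+half≋1 var

    private
      enumerators-𝒵 : ∀ k → lookup codeEnumerators k ≋ lookup (enumerators (𝟙 E₈) 𝟙-E₈ (𝟙 D₁₆) 𝟙-D₁₆ (𝟙 Q₈) 𝟙-Q₈ (𝟙 K₈) 𝟙-K₈ (𝟙 K₁₆) 𝟙-K₁₆
        (𝟙 (E₈ ⊕ E₈)) (𝟙-⊕ E₈ E₈) (𝟙 (Q₈ ⊕ Q₈)) (𝟙-⊕ Q₈ Q₈) (𝟙 (Q₈ ⊕ K₈)) (𝟙-⊕ Q₈ K₈)) k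
      enumerators-𝒵 0F = 𝓟.*-cong (enumerator-𝒵 E₈ Q₈) (enumerator-𝒵 E₈ Q₈)
      enumerators-𝒵 1F = 𝓟.*-cong (enumerator-𝒵 E₈ K₈) (enumerator-𝒵 E₈ K₈)
      enumerators-𝒵 2F = enumerator-𝒵 (E₈ ⊕ E₈) (Q₈ ⊕ K₈)
      enumerators-𝒵 3F = enumerator-𝒵 (E₈ ⊕ E₈) K₁₆
      enumerators-𝒵 4F = enumerator-𝒵 D₁₆ (Q₈ ⊕ Q₈)
      enumerators-𝒵 5F = enumerator-𝒵 D₁₆ (Q₈ ⊕ K₈)

      row-coordinate : ∀ i → eval var (rowExpr (lookup U-rows i) id) ≋ y i
      row-coordinate 0F = I𝓟.solve 6 (λ a b c d e f → toSolver (a ∷ b ∷ c ∷ d ∷ e ∷ f ∷ []) (rowExpr (lookup U-rows 0F) id) I𝓟.:= toSolver (a ∷ b ∷ c ∷ d ∷ e ∷ f ∷ []) (coordinate 0F)) 𝓟.refl (var 0F) (var 1F) (var 2F) (var 3F) (var 4F) (var 5F)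
      row-coordinate 1F = I𝓟.solve 6 (λ a b c d e f → toSolver (a ∷ b ∷ c ∷ d ∷ e ∷ f ∷ []) (rowExpr (lookup U-rows 1F) id) I𝓟.:= toSolver (a ∷ b ∷ c ∷ d ∷ e ∷ f ∷ []) (coordinate 1F)) 𝓟.refl (var 0F) (var 1F) (var 2F) (var 3F) (var 4F) (var 5F)
      row-coordinate 2F = I𝓟.solve 6 (λ a b c d e f → toSolver (a ∷ b ∷ c ∷ d ∷ e ∷ f ∷ []) (rowExpr (lookup U-rows 2F) id) I𝓟.:= toSolver (a ∷ b ∷ c ∷ d ∷ e ∷ f ∷ []) (coordinate 2F)) 𝓟.refl (var 0F) (var 1F) (var 2F) (var 3F) (var 4F) (var 5F)
      row-coordinate 3F = I𝓟.solve 6 (λ a b c d e f → toSolver (a ∷ b ∷ c ∷ d ∷ e ∷ f ∷ []) (rowExpr (lookup U-rows 3F) id) I𝓟.:= toSolver (a ∷ b ∷ c ∷ d ∷ e ∷ f ∷ []) (coordinate 3F)) 𝓟.refl (var 0F) (var 1F) (var 2F) (var 3F) (var 4F) (var 5F)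
      row-coordinate 4F = I𝓟.solve 6 (λ a b c d e f → toSolver (a ∷ b ∷ c ∷ d ∷ e ∷ f ∷ []) (rowExpr (lookup U-rows 4F) id) I𝓟.:= toSolver (a ∷ b ∷ c ∷ d ∷ e ∷ f ∷ []) (coordinate 4F)) 𝓟.refl (var 0F) (var 1F) (var 2F) (var 3F) (var 4F) (var 5F)
      row-coordinate 5F = I𝓟.solve 6 (λ a b c d e f → toSolver (a ∷ b ∷ c ∷ d ∷ e ∷ f ∷ []) (rowExpr (lookup U-rows 5F) id) I𝓟.:= toSolver (a ∷ b ∷ c ∷ d ∷ e ∷ f ∷ []) (coordinate 5F)) 𝓟.refl (var 0F) (var 1F) (var 2F) (var 3F) (var 4F) (var 5F)

      U•var : ∀ i → U • var i ≋ y i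
      U•var i = begin
        U • var i                                                              ≈⟨ •-var U i ⟩
        linear (λ j → ⟦ intᶜ 1ℤ ⊠ intᶜ (lookup (lookup U-rows i) j) ⟧)          ≈⟨ linear-row (intᶜ 1ℤ) (lookup U-rows i) ⟩
        constant ⟦ intᶜ 1ℤ ⟧ *ᴾ eval var (rowExpr (lookup U-rows i) id)         ≈⟨ 𝓟.*-congʳ (constant-cong (trans (⟦intᶜ⟧ 1ℤ) fromℤ-1)) ⟩
        constant 1# *ᴾ eval var (rowExpr (lookup U-rows i) id)                  ≈⟨ 𝓟.*-identityˡ _ ⟩
        eval var (rowExpr (lookup U-rows i) id)                                ≈⟨ row-coordinate i ⟩
        y i                                                                    ∎
        where open Relation.Binary.Reasoning.Setoid 𝓟.setoid

    -- `U •` evaluates a form at s, ..., E written in a, ..., f, and at these linear forms the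
    -- quadratic forms are the enumerators times `denominators`.
    codeEnumerators-formula : ∀ k → constant (fromℤ (+ lookup denominators k)) *ᴾ lookup codeEnumerators k ≋ U • basisPolynomial k
    codeEnumerators-formula k = begin
      constant (fromℤ (+ lookup denominators k)) *ᴾ lookup codeEnumerators k
        ≈⟨ 𝓟.*-cong (constant-fromℤ (+ lookup denominators k)) (enumerators-𝒵 k) ⟩
      I𝓟.fromℤ (+ lookup denominators k) *ᴾ lookup (enumerators (𝟙 E₈) 𝟙-E₈ (𝟙 D₁₆) 𝟙-D₁₆ (𝟙 Q₈) 𝟙-Q₈ (𝟙 K₈) 𝟙-K₈ (𝟙 K₁₆) 𝟙-K₁₆
        (𝟙 (E₈ ⊕ E₈)) (𝟙-⊕ E₈ E₈) (𝟙 (Q₈ ⊕ Q₈)) (𝟙-⊕ Q₈ Q₈) (𝟙 (Q₈ ⊕ K₈)) (𝟙-⊕ Q₈ K₈)) k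
        ≈⟨ enumerators-basisExpr (𝟙 E₈) 𝟙-E₈ (𝟙 D₁₆) 𝟙-D₁₆ (𝟙 Q₈) 𝟙-Q₈ (𝟙 K₈) 𝟙-K₈ (𝟙 K₁₆) 𝟙-K₁₆
             (𝟙 (E₈ ⊕ E₈)) (𝟙-⊕ E₈ E₈) (𝟙 (Q₈ ⊕ Q₈)) (𝟙-⊕ Q₈ Q₈) (𝟙 (Q₈ ⊕ K₈)) (𝟙-⊕ Q₈ K₈) k ⟩
      eval y (basisExpr k)
        ≈⟨ eval-cong U•var (basisExpr k) ⟨
      eval (λ i → U • var i) (basisExpr k)
        ≈⟨ •-eval U var (basisExpr k) ⟨
      U • basisPolynomial k ∎
      where open Relation.Binary.Reasoning.Setoid 𝓟.setoid

    module _ (ι : ℤ → Carrier) (ι≈fromℤ : ∀ k → ι k ≈ fromℤ k) (quarter : Carrier) (quarter≈ : quarter ≈ half * half) where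

      -- Spelled like the generators over ℂ, so that `Generators⊆` holds by reflexivity; `ι` and
      -- `quarter` stand for the rational constants there.
      generatorMatrix : Generator → Matrix
      generatorMatrix gX  = (ζ ^ 3 + ζ) * quarter ·ᴹ λ i j → ι (lookup (lookup X-rows i) j)
      generatorMatrix gP₁ = λ i j → ι (lookup (lookup P₁-rows i) j)
      generatorMatrix gP₂ = ζ ^ 2 ·ᴹ λ i j → ι (lookup (lookup P₂-rows i) j)
      generatorMatrix gE₁ = diagonal (lookup (1# ∷ ζ ∷ - 1# ∷ ζ ^ 2 ∷ - (ζ ^ 3) ∷ - (ζ ^ 2) ∷ []))
      generatorMatrix gE₂ = diagonal (lookup (1# ∷ ζ ∷ - 1# ∷ 1# ∷ ζ ∷ - 1# ∷ []))
      generatorMatrix gzI = ζ ·ᴹ I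

      private
        scaled-integer : ∀ {c} ĉ k → c ≈ ⟦ ĉ ⟧ → c * ι k ≈ ⟦ ĉ ⊠ intᶜ k ⟧
        scaled-integer ĉ k h = trans (*-cong h (trans (ι≈fromℤ k) (sym (⟦intᶜ⟧ k)))) (sym (⟦⟧-⊠ ĉ (intᶜ k)))

        ζ≈ : ζ ≈ ⟦ ζᶜ 1 ⟧
        ζ≈ = sym (trans (⟦ζᶜ⟧ 1) (*-identityʳ ζ))

        ζ^≈ : ∀ k → ζ ^ k ≈ ⟦ ζᶜ k ⟧
        ζ^≈ k = sym (⟦ζᶜ⟧ k)

        -ζ^≈ : ∀ k → - (ζ ^ k) ≈ ⟦ -ζᶜ k ⟧
        -ζ^≈ k = sym (trans (⟦⟧-⊠ (intᶜ -1ℤ) (ζᶜ k)) (trans (*-cong (trans (⟦intᶜ⟧ -1ℤ) (trans (fromℤ-neg 1ℤ) (-‿cong fromℤ-1))) (⟦ζᶜ⟧ k)) (-1*x≈-x (ζ ^ k))))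
          where open Algebra.Properties.Ring ring using (-1*x≈-x)

        half≈ : half ≈ ⟦ halfᶜ ⟧
        half≈ = sym (trans (*-cong (*-identityʳ half) (+-identityʳ-numerator)) (*-identityʳ half))
          where
          open Integers R using (solve; con; _:+_; _:*_; _:=_)
          +-identityʳ-numerator : numerator 1ℤ 0ℤ 0ℤ 0ℤ ≈ 1#
          +-identityʳ-numerator = trans (solve 1 (λ z → con 1ℤ :+ con 0ℤ :* z :+ con 0ℤ :* (z :* z) :+ con 0ℤ :* (z :* z :* z) := con 1ℤ) refl ζ) fromℤ-1

        diagonal≈ : ∀ {d} d̂ → (∀ i → d i ≈ ⟦ lookup d̂ i ⟧) → diagonal d ≈ᴹ ⟦ diagonalᶜ d̂ ⟧ᴹ
        diagonal≈ {d} d̂ h i j = entry (does (i Fin.≟ j))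
          where
          entry : ∀ b → (if b then d i else 0#) ≈ ⟦ (if b then lookup d̂ i else 0ᶜ) ⟧
          entry true  = h i
          entry false = sym ⟦⟧-0

      generatorMatrix≈ : ∀ g → generatorMatrix g ≈ᴹ ⟦ original g ⟧ᴹ
      generatorMatrix≈ gX  i j = scaled-integer ((ζᶜ 3 ⊞ ζᶜ 1) ⊠ (halfᶜ ⊠ halfᶜ)) (lookup (lookup X-rows i) j)
        (trans (*-cong (trans (+-cong (ζ^≈ 3) ζ≈) (sym (⟦⟧-⊞ (ζᶜ 3) (ζᶜ 1)))) (trans quarter≈ (trans (*-cong half≈ half≈) (sym (⟦⟧-⊠ halfᶜ halfᶜ)))))
          (sym (⟦⟧-⊠ (ζᶜ 3 ⊞ ζᶜ 1) (halfᶜ ⊠ halfᶜ))))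
      generatorMatrix≈ gP₁ i j = trans (sym (*-identityˡ _)) (scaled-integer (intᶜ 1ℤ) (lookup (lookup P₁-rows i) j) (ζ^≈ 0))
      generatorMatrix≈ gP₂ i j = scaled-integer (ζᶜ 2) (lookup (lookup P₂-rows i) j) (ζ^≈ 2)
      generatorMatrix≈ gE₁ = diagonal≈ (ζᶜ 0 ∷ ζᶜ 1 ∷ -ζᶜ 0 ∷ ζᶜ 2 ∷ -ζᶜ 3 ∷ -ζᶜ 2 ∷ [])
        λ { 0F → ζ^≈ 0 ; 1F → ζ≈ ; 2F → -ζ^≈ 0 ; 3F → ζ^≈ 2 ; 4F → -ζ^≈ 3 ; 5F → -ζ^≈ 2 }
      generatorMatrix≈ gE₂ = diagonal≈ (ζᶜ 0 ∷ ζᶜ 1 ∷ -ζᶜ 0 ∷ ζᶜ 0 ∷ ζᶜ 1 ∷ -ζᶜ 0 ∷ [])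
        λ { 0F → ζ^≈ 0 ; 1F → ζ≈ ; 2F → -ζ^≈ 0 ; 3F → ζ^≈ 0 ; 4F → ζ≈ ; 5F → -ζ^≈ 0 }
      generatorMatrix≈ gzI i j = trans (*-cong ζ≈ (diagonal≈ (replicate 6 (ζᶜ 0)) (λ i → trans (ζ^≈ 0) (reflexive (cong ⟦_⟧ (≡.sym (Vec.lookup-replicate i (ζᶜ 0)))))) i j))
        (sym (⟦⟧-⊠ (ζᶜ 1) (diagonalᶜ (replicate 6 (ζᶜ 0)) i j)))

-- The basis property over a general ring

module EnumeratorBasis where

  open RingBasics
  open PolynomialRings
  open MatrixActions
  open CyclotomicNumbers
  open GeneratorMatrices
  open BlockCoordinates
  open ExponentOrbits
  open OrbitCertificate
  open OrbitSpanning
  open PairingForms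
  open SignedPermutations
  open FormPolynomials
  open PairFunctions
  open SumsOverWords

  open BasisCriterion
  open EnumeratorFormulas
  open Defs using (LinearCode; codewords; exponents)

  module CodeBasis {r ℓ} (R : CommutativeRing r ℓ)
    (ζ half : CommutativeRing.Carrier R) (ζ⁴≈-1 : RingBasics.FourthPowerIs-1 R ζ) (half+half≈1 : RingBasics.IsHalf R half)
    (ι : ℤ → CommutativeRing.Carrier R) (ι≈fromℤ : ∀ k → CommutativeRing._≈_ R (ι k) (Integers.fromℤ R k))
    (quarter : CommutativeRing.Carrier R) (quarter≈ : CommutativeRing._≈_ R quarter (CommutativeRing._*_ R half half))
    (reciprocal : RingBasics.HasReciprocals R) where
    open CommutativeRing R hiding (zero)

    open CyclotomicEvaluation R ζ half ζ⁴≈-1 half+half≈1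
    open BasisPolynomials R ζ half ζ⁴≈-1 half+half≈1 using (basisPolynomial; basisPolynomial-fixed; coefficient-basisPolynomial)
    open BasisTheorem R ζ half ζ⁴≈-1 half+half≈1 reciprocal using (isBasis)
    open WeightEnumerators R ζ half ζ⁴≈-1 half+half≈1
    open Defs.Polynomials R 6
    open Defs.Matrices R 6

    codeBasis : ∀ {s} {S : Pred Matrix s} →
      (∀ A → S A → ∃ λ g → A ≡ generatorMatrix ι ι≈fromℤ quarter quarter≈ g) →
      (∀ g → S (generatorMatrix ι ι≈fromℤ quarter quarter≈ g)) →
      (w : Enumerator) (square : Polynomial → Polynomial) →
      (∀ {n} (C : LinearCode 2 n) D → w C D ≡ List.cartesianProductWith (λ u v → 1# , exponents u v) (codewords C) (codewords D)) →
      (∀ p → square p ≡ p *ᴾ p) →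
      IsBasis (λ q → InvariantRing ⟨ S ⟩ᴹ q × Homogeneous 16 q) (lookup (sixCodes w square))
    codeBasis {S = S} S⊆ ⊆S w square h h′ = subst (λ ps → IsBasis (λ q → InvariantRing ⟨ S ⟩ᴹ q × Homogeneous 16 q) (lookup ps))
      (≡.sym (sixCodes-cong {w} {enumerator} (λ C D → ≡.trans (h C D) (≡.sym (enumerator-≡ C D))) h′))
      (isBasis (λ A A∈ → approximate A (S⊆ A A∈)) (λ g → generatorMatrix ι ι≈fromℤ quarter quarter≈ g , ⊆S g , generatorMatrix≈ ι ι≈fromℤ quarter quarter≈ g)
        basisPolynomial basisPolynomial-fixed coefficient-basisPolynomial (lookup codeEnumerators) codeEnumerators-formula codeEnumerators-homogeneous)
      where
      approximate : ∀ A → (∃ λ g → A ≡ generatorMatrix ι ι≈fromℤ quarter quarter≈ g) → ∃ λ g → A ≈ᴹ ⟦ original g ⟧ᴹ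
      approximate _ (g , ≡.refl) = g , generatorMatrix≈ ι ι≈fromℤ quarter quarter≈ g

-- Specialisation to ℂ

open RingBasics
open EnumeratorFormulas
open GeneratorMatrices
open EnumeratorBasis
open Defs

private
  module ℝᶠ = CommutativeRing ℝ-commutativeRing
module ℂᶠ = CommutativeRing ℂ-commutativeRing
open Integers ℂ-commutativeRing using (fromℤ)

ℚ→ℂ-+ : ∀ p q → ℚ→ℂ (p ℚ.+ q) ≈ℂ ℚ→ℂ p +ℂ ℚ→ℂ q
ℚ→ℂ-+ p q = ≗⇒≈ _ _ (λ _ → ≡.refl) , ≗⇒≈ _ _ (λ _ → ≡.refl)

ℚ→ℂ-* : ∀ p q → ℚ→ℂ (p ℚ.* q) ≈ℂ ℚ→ℂ p *ℂ ℚ→ℂ q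
ℚ→ℂ-* p q = ≗⇒≈ _ _ (λ _ → ≡.sym (ℚ.+-identityʳ (p ℚ.* q)))
          , ≗⇒≈ _ _ (λ _ → ≡.sym (≡.cong₂ ℚ._+_ (ℚ.*-zeroʳ p) (ℚ.*-zeroˡ q)))

ℚ→ℂ-neg : ∀ p → ℚ→ℂ (ℚ.- p) ≈ℂ -ℂ ℚ→ℂ p
ℚ→ℂ-neg p = ≗⇒≈ _ _ (λ _ → ≡.refl) , ≗⇒≈ _ _ (λ _ → ≡.refl)

-- Reconciles the general argument, where an integer is a sum of ones, with the matrices over ℂ,
-- whose entries are rationals with denominator 1.
fromℕ≈ℚ→ℂ : ∀ n → fromℤ (+ n) ≈ℂ ℚ→ℂ (+ n / 1)
fromℕ≈ℚ→ℂ zero    = ℂᶠ.refl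
fromℕ≈ℚ→ℂ (suc n) = ℂᶠ.trans (ℂᶠ.+-congˡ (fromℕ≈ℚ→ℂ n))
  (ℂᶠ.trans (ℂᶠ.sym (ℚ→ℂ-+ 1ℚ (+ n / 1))) (ℂᶠ.reflexive (cong ℚ→ℂ (≡.sym suc/1))))
  where
  open ℚᵘ.≤-Reasoning
  suc/1 : + suc n / 1 ≡ 1ℚ ℚ.+ + n / 1
  suc/1 = ℚ.toℚᵘ-injective (begin-equality
    ℚ.toℚᵘ (+ suc n / 1)                    ≃⟨ ℚ.toℚᵘ-fromℚᵘ (ℚᵘ.mkℚᵘ (+ suc n) 0) ⟩
    ℚᵘ.mkℚᵘ (+ suc n) 0                     ≃⟨ ℚᵘ.*≡* (cong (λ t → (+ 1 ℤ.+ t) ℤ.* + 1) (≡.sym (ℤ.*-identityʳ (+ n)))) ⟩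
    ℚᵘ.1ℚᵘ ℚᵘ.+ ℚᵘ.mkℚᵘ (+ n) 0             ≃⟨ ℚᵘ.+-congʳ ℚᵘ.1ℚᵘ (ℚ.toℚᵘ-fromℚᵘ (ℚᵘ.mkℚᵘ (+ n) 0)) ⟨
    ℚ.toℚᵘ 1ℚ ℚᵘ.+ ℚ.toℚᵘ (+ n / 1)         ≃⟨ ℚ.toℚᵘ-homo-+ 1ℚ (+ n / 1) ⟨
    ℚ.toℚᵘ (1ℚ ℚ.+ + n / 1)                 ∎)

fromℤ≈ℚ→ℂ : ∀ k → fromℤ k ≈ℂ ℚ→ℂ (k / 1)
fromℤ≈ℚ→ℂ (+ n)    = fromℕ≈ℚ→ℂ n
fromℤ≈ℚ→ℂ -[1+ n ] = ℂᶠ.trans (ℂᶠ.-‿cong (fromℕ≈ℚ→ℂ (suc n))) (ℂᶠ.sym (ℚ→ℂ-neg (+ suc n / 1)))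

halfℂ : ℂ
halfℂ = ℚ→ℂ ½

half+half≈1 : halfℂ +ℂ halfℂ ≈ℂ 1ℂ
half+half≈1 = ℂᶠ.sym (ℚ→ℂ-+ ½ ½)

private
  z²≈i : z *ℂ z ≈ℂ (fromℚ 0ℚ +i fromℚ 1ℚ)
  z²≈i = ℝᶠ.-‿inverseʳ (w *ℝ w) , ℝᶠ.trans (ℝᶠ.+-cong w²≈½ w²≈½) (≗⇒≈ _ _ λ _ → ≡.refl)
    where
    open Integers ℝ-commutativeRing using (solve; _:*_; _:=_)
    w : ℝ
    w = fromℚ ½ *ℝ √2
    w²≈½ : w *ℝ w ≈ℝ fromℚ ½
    w²≈½ = ℝᶠ.trans (solve 2 (λ h s → h :* s :* (h :* s) := h :* h :* (s :* s)) ℝᶠ.refl (fromℚ ½) √2)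
      (ℝᶠ.trans (ℝᶠ.*-congˡ √2*√2≈2) (≗⇒≈ _ _ λ _ → ≡.refl))

z⁴≈-1 : z *ℂ z *ℂ (z *ℂ z) ≈ℂ -ℂ 1ℂ
z⁴≈-1 = ℂᶠ.trans (ℂᶠ.*-cong z²≈i z²≈i) (≗⇒≈ _ _ (λ _ → ≡.refl) , ≗⇒≈ _ _ (λ _ → ≡.refl))

reciprocal : ∀ n → ∃ λ x → x *ℂ fromℤ (+ suc n) ≈ℂ 1ℂ
reciprocal n = ℚ→ℂ (+ 1 / suc n) , ℂᶠ.trans (ℂᶠ.*-congˡ (fromℤ≈ℚ→ℂ (+ suc n)))
  (ℂᶠ.trans (ℂᶠ.sym (ℚ→ℂ-* (+ 1 / suc n) (+ suc n / 1))) (ℂᶠ.reflexive (cong ℚ→ℂ unit-fraction)))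
  where
  open ℚᵘ.≤-Reasoning
  unit-fraction : (+ 1 / suc n) ℚ.* (+ suc n / 1) ≡ 1ℚ
  unit-fraction = ℚ.toℚᵘ-injective (begin-equality
    ℚ.toℚᵘ ((+ 1 / suc n) ℚ.* (+ suc n / 1))             ≃⟨ ℚ.toℚᵘ-homo-* (+ 1 / suc n) (+ suc n / 1) ⟩
    ℚ.toℚᵘ (+ 1 / suc n) ℚᵘ.* ℚ.toℚᵘ (+ suc n / 1)       ≃⟨ ℚᵘ.*-cong (ℚ.toℚᵘ-fromℚᵘ (ℚᵘ.mkℚᵘ (+ 1) n)) (ℚ.toℚᵘ-fromℚᵘ (ℚᵘ.mkℚᵘ (+ suc n) 0)) ⟩
    ℚᵘ.mkℚᵘ (+ 1) n ℚᵘ.* ℚᵘ.mkℚᵘ (+ suc n) 0             ≃⟨ ℚᵘ.*≡* (ℤ.*-assoc (+ 1) (+ suc n) (+ 1)) ⟩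
    ℚᵘ.1ℚᵘ                                               ∎)

quarter≈ : ℚ→ℂ (+ 1 / 4) ≈ℂ halfℂ *ℂ halfℂ
quarter≈ = ℚ→ℂ-* ½ ½

integer : ℤ → ℂ
integer k = ℚ→ℂ (k / 1)

integer≈fromℤ : ∀ k → integer k ≈ℂ fromℤ k
integer≈fromℤ k = ℂᶠ.sym (fromℤ≈ℚ→ℂ k)

open CodeBasis ℂ-commutativeRing z halfℂ z⁴≈-1 half+half≈1 integer integer≈fromℤ (ℚ→ℂ (+ 1 / 4)) quarter≈ reciprocal using (codeBasis)
open WeightEnumerators ℂ-commutativeRing z halfℂ z⁴≈-1 half+half≈1 using (generatorMatrix)

Generators⊆ : ∀ A → Generators A → ∃ λ g → A ≡ generatorMatrix integer integer≈fromℤ (ℚ→ℂ (+ 1 / 4)) quarter≈ g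
Generators⊆ _ X∈  = gX  , ≡.refl
Generators⊆ _ P₁∈ = gP₁ , ≡.refl
Generators⊆ _ P₂∈ = gP₂ , ≡.refl
Generators⊆ _ E₁∈ = gE₁ , ≡.refl
Generators⊆ _ E₂∈ = gE₂ , ≡.refl
Generators⊆ _ zI∈ = gzI , ≡.refl

⊆Generators : ∀ g → Generators (generatorMatrix integer integer≈fromℤ (ℚ→ℂ (+ 1 / 4)) quarter≈ g)
⊆Generators gX  = X∈
⊆Generators gP₁ = P₁∈
⊆Generators gP₂ = P₂∈
⊆Generators gE₁ = E₁∈
⊆Generators gE₂ = E₂∈
⊆Generators gzI = zI∈

theorem3p3 : IsBasis (InvariantRing H ∩ Homogeneous 16)
    (lookup ( weightEnumerator E₈ Q₈ ²
    ∷ weightEnumerator E₈ K₈ ²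
    ∷ weightEnumerator (E₈ ⊕ E₈) (Q₈ ⊕ K₈)
    ∷ weightEnumerator (E₈ ⊕ E₈) K₁₆
    ∷ weightEnumerator D₁₆ (Q₈ ⊕ Q₈)
    ∷ weightEnumerator D₁₆ (Q₈ ⊕ K₈)
    ∷ []))
theorem3p3 = codeBasis Generators⊆ ⊆Generators weightEnumerator _² (λ C D → ≡.refl) (λ p → ≡.refl)
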